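{- Let $\beta\ge5$ and $\epsilon_1,\epsilon_2\in\{1,-1\}$. Let $\Gamma_3$ be the quotient of $[2^{\beta-1},2^\beta,2^{\beta-1}]^+$ by the relations $\sigma_2^{ -1}\sigma_1=\sigma_1^{ -1+2^{\beta-2}}\sigma_2^{ -3+\epsilon_12^{\beta-2}}$, $\sigma_2\sigma_1^{ -1}=\sigma_1^{1+2^{\beta-2}}\sigma_2^{3+\epsilon_12^{\beta-2}}$, $\sigma_3^{ -1}\sigma_2=\sigma_2^{3+\epsilon_22^{\beta-2}}\sigma_3^{1+2^{\beta-2}}$, $\sigma_3\sigma_2^{ -1}=\sigma_2^{ -3+\epsilon_22^{\beta-2}}\sigma_3^{ -1+2^{\beta-2}}$. Then $\Gamma_3$ is the automorphism group, with standard generators $\sigma_1,\sigma_2,\sigma_3$, of an atomic chiral $4$-polytope of type $\{2^{\beta-1},2^\beta,2^{\beta-1}\}$.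
   Context: $[p,q,r]^+=\langle\sigma_1,\sigma_2,\sigma_3\mid\sigma_1^p=\sigma_2^q=\sigma_3^r=(\sigma_1\sigma_2)^2=(\sigma_2\sigma_3)^2=(\sigma_1\sigma_2\sigma_3)^2=1\rangle$. Standard generators of a chiral polytope with base flag $\Phi$: $\Phi\sigma_i=\Phi^{i(i-1)}$, $\Phi^j$ the flag differing from $\Phi$ only in its $j$-face. Tight: type $\{p,q,r\}$ with exactly $2pqr$ flags. A tight chiral $4$-polytope is atomic if it does not properly cover any tight chiral polytope. -}

module Defs where

open import Level using (0ℓ)
open import Algebra.Bundles using (Group)
open import Algebra.Morphism.Structures using (module GroupMorphisms)
open import Data.Fin using (Fin; zero; suc; toℕ)
open import Data.Integer as ℤ using (ℤ; +_; -[1+_]; _◃_)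
open import Data.List using (List; length; map)
import Data.List.Membership.Setoid as Membership
import Data.List.Relation.Binary.Equality.Setoid as ListEquality
open import Data.List.Relation.Unary.All using (All)
open import Data.List.Relation.Unary.Linked using (Linked)
open import Data.Nat as ℕ using (ℕ; zero; suc)
open import Data.Product using (Σ-syntax; ∃; ∃-syntax; ∃₂; _×_; _,_; proj₁; proj₂)
open import Data.Sign using (Sign)
open import Data.Sum using (_⊎_)
open import Function.Base using (id; _∘_)
open import Function.Bundles using (Inverse; _⇔_)
open import Function.Definitions using (Surjective)
open import Relation.Binary.Bundles using (Poset; Setoid)
open import Relation.Binary.Core using (Rel)
import Relation.Binary.Construct.On as On
open import Relation.Binary.Construct.Closure.ReflexiveTransitive using (Star)
open import Relation.Binary.Construct.Union using (_∪_)
open import Relation.Binary.Definitions using (Minimum; Maximum)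
import Relation.Binary.Morphism.Construct.Composition as Compose
import Relation.Binary.Morphism.Construct.Identity as Identity
open import Relation.Binary.Morphism.Structures
  using (IsOrderHomomorphism; IsOrderIsomorphism)
import Relation.Binary.Properties.Poset as PosetProperties
open import Relation.Binary.PropositionalEquality as ≡ using (_≡_; _≢_)
open import Relation.Nullary using (¬_)

HasSize : Setoid 0ℓ 0ℓ → ℕ → Set
HasSize S n = Inverse S (≡.setoid (Fin n))

-- Ranks are shifted by one so that they are natural numbers: the least
-- face, of rank -1, has rank+1 equal to 0.
record RankedPoset : Set₁ where
  field
    poset : Poset 0ℓ 0ℓ 0ℓ

  open Poset poset public
    using (_≈_; _≤_; module Eq) renaming (Carrier to Face)
  open PosetProperties poset public using (_<_)

  field
    rank+1      : Face → ℕ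
    rank+1-cong : ∀ {F G} → F ≈ G → rank+1 F ≡ rank+1 G
    rank+1-mono : ∀ {F G} → F < G → rank+1 F ℕ.< rank+1 G

  open ListEquality Eq.setoid public using (_≋_; ≋-setoid)
  open Membership Eq.setoid public using (_∈_)

  -- A flag is a maximal chain.  Strict monotonicity of the rank and the
  -- bounds imposed below make every chain finite, so chains are
  -- represented by their lists of faces in increasing order.
  record Flag : Set where
    field
      faces   : List Face
      chain   : Linked _<_ faces
      maximal : ∀ F → All (λ G → F ≤ G ⊎ G ≤ F) faces → F ∈ faces

  open Flag public using (faces)

  flagSetoid : Setoid 0ℓ 0ℓ
  flagSetoid = On.setoid {B = Flag} ≋-setoid faces

  -- The two chains differ in their j-face and nowhere else.
  Adjacent : ℕ → List Face → List Face → Set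
  Adjacent j xs ys =
    ¬ (xs ≋ ys) × (∀ F → rank+1 F ≢ suc j → F ∈ xs ⇔ F ∈ ys)

  -- A sequence of flags from Φ to Ψ, successive ones being adjacent, in
  -- which every flag contains Φ ∩ Ψ.
  FlagConnected : Flag → Flag → Set
  FlagConnected Φ Ψ = ∃[ Λ ] Star Step Φ Λ × faces Λ ≋ faces Ψ
    where
    Step : Rel Flag 0ℓ
    Step Λ Λ′ = (∃[ j ] Adjacent j (faces Λ) (faces Λ′))
              × (∀ F → F ∈ faces Φ → F ∈ faces Ψ → F ∈ faces Λ′)

  -- The faces H with F < H < G and rank+1 H ≡ r.
  between : Face → Face → ℕ → Setoid 0ℓ 0ℓ
  between F G r = On.setoid {B = ∃[ H ] F < H × H < G × rank+1 H ≡ r}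
                            Eq.setoid proj₁

record Polytope (n : ℕ) : Set₁ where
  field
    ranked : RankedPoset

  open RankedPoset ranked public

  field
    ⊥F          : Face
    ⊥F-least    : Minimum _≤_ ⊥F
    ⊥F-rank     : rank+1 ⊥F ≡ 0
    ⊤F          : Face
    ⊤F-greatest : Maximum _≤_ ⊤F
    ⊤F-rank     : rank+1 ⊤F ≡ suc n
    flag-size   : ∀ (Φ : Flag) → length (faces Φ) ≡ 2 ℕ.+ n
    connected   : ∀ (Φ Ψ : Flag) → FlagConnected Φ Ψ
    diamond     : ∀ {F G} → F < G → rank+1 G ≡ 2 ℕ.+ rank+1 F →
                  HasSize (between F G (1 ℕ.+ rank+1 F)) 2

module _ {n : ℕ} (P Q : Polytope n) where
  private
    module P = Polytope P
    module Q = Polytope Q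

  IsIsomorphism : (P.Face → Q.Face) → Set
  IsIsomorphism = IsOrderIsomorphism P._≈_ Q._≈_ P._≤_ Q._≤_

  Isomorphic : Set
  Isomorphic = ∃ IsIsomorphism

  record IsCovering (γ : P.Face → Q.Face) : Set where
    field
      isOrderHomomorphism : IsOrderHomomorphism P._≈_ Q._≈_ P._≤_ Q._≤_ γ
      surjective          : Surjective P._≈_ Q._≈_ γ
      preserves-rank      : ∀ F → Q.rank+1 (γ F) ≡ P.rank+1 F
      preserves-adjacency : ∀ (Φ Ψ : P.Flag) j →
        P.Adjacent j (P.faces Φ) (P.faces Ψ) →
        Q.Adjacent j (map γ (P.faces Φ)) (map γ (P.faces Ψ))

  Covers : Set
  Covers = ∃ IsCovering

  ProperlyCovers : Set
  ProperlyCovers = Covers × ¬ Isomorphic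

module _ {n : ℕ} (P : Polytope n) where
  open Polytope P

  Automorphism : Set
  Automorphism = ∃ (IsIsomorphism P P)

  private
    _⁻¹ᵃ : Automorphism → Automorphism
    (f , iso) ⁻¹ᵃ = g , record
      { isOrderMonomorphism = record
        { isOrderHomomorphism = record
          { cong = λ {x} {y} x≈y →
              injective (Eq.trans (fg x) (Eq.trans x≈y (Eq.sym (fg y))))
          ; mono = λ {x} {y} x≤y →
              cancel (Poset.trans poset (Poset.reflexive poset (fg x))
                     (Poset.trans poset x≤y
                       (Poset.reflexive poset (Eq.sym (fg y)))))
          }
        ; injective = λ {x} {y} gx≈gy →
            Eq.trans (Eq.sym (fg x)) (Eq.trans (cong gx≈gy) (fg y))
        ; cancel = λ {x} {y} gx≤gy →
            Poset.trans poset (Poset.reflexive poset (Eq.sym (fg x)))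
              (Poset.trans poset (mono gx≤gy) (Poset.reflexive poset (fg y)))
        }
      ; surjective = λ y → f y , λ {z} z≈fy →
          injective (Eq.trans (fg z) z≈fy)
      }
      where
      open IsOrderIsomorphism iso
      g : Face → Face
      g y = proj₁ (surjective y)
      fg : ∀ y → f (g y) ≈ y
      fg y = proj₂ (surjective y) Eq.refl

  -- Automorphisms act on the right: α ∙ β is α followed by β.
  automorphismGroup : Group 0ℓ 0ℓ
  automorphismGroup = record
    { Carrier = Automorphism
    ; _≈_     = λ α β → ∀ F → proj₁ α F ≈ proj₁ β F
    ; _∙_     = λ α β → proj₁ β ∘ proj₁ α ,
                  Compose.isOrderIsomorphism Eq.trans (proj₂ α) (proj₂ β)
    ; ε       = id , Identity.isOrderIsomorphism _≈_ _≤_ Eq.refl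
    ; _⁻¹     = _⁻¹ᵃ
    ; isGroup = record
      { isMonoid = record
        { isSemigroup = record
          { isMagma = record
            { isEquivalence = record
              { refl  = λ _ → Eq.refl
              ; sym   = λ α≈β F → Eq.sym (α≈β F)
              ; trans = λ α≈β β≈γ F → Eq.trans (α≈β F) (β≈γ F)
              }
            ; ∙-cong = λ {α} {β} {γ} {δ} α≈β γ≈δ F →
                Eq.trans (IsOrderIsomorphism.cong (proj₂ γ) (α≈β F))
                         (γ≈δ (proj₁ β F))
            }
          ; assoc = λ _ _ _ _ → Eq.refl
          }
        ; identity = (λ _ _ → Eq.refl) , (λ _ _ → Eq.refl)
        }
      ; inverse = (λ α F → proj₂ (IsOrderIsomorphism.surjective (proj₂ α) F) Eq.refl)
                , (λ α F → IsOrderIsomorphism.injective (proj₂ α)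
                    (proj₂ (IsOrderIsomorphism.surjective (proj₂ α) (proj₁ α F)) Eq.refl))
      ; ⁻¹-cong = λ {α} {β} α≈β F →
          IsOrderIsomorphism.injective (proj₂ α)
            (Eq.trans (proj₂ (IsOrderIsomorphism.surjective (proj₂ α) F) Eq.refl)
            (Eq.trans (Eq.sym (proj₂ (IsOrderIsomorphism.surjective (proj₂ β) F) Eq.refl))
                      (Eq.sym (α≈β (proj₁ (IsOrderIsomorphism.surjective (proj₂ β) F))))))
      }
    }

  Sends : Automorphism → Flag → Flag → Set
  Sends α Φ Ψ = map (proj₁ α) (faces Φ) ≋ faces Ψ

  SameOrbit : Flag → Flag → Set
  SameOrbit Φ Ψ = ∃[ α ] Sends α Φ Ψ

  record Chiral : Set where
    field
      two-orbits        : ∃₂ λ Φ Ψ → ¬ SameOrbit Φ Ψ ×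
                          (∀ Λ → SameOrbit Φ Λ ⊎ SameOrbit Ψ Λ)
      adjacent-distinct : ∀ (Φ Ψ : Flag) j →
                          Adjacent j (faces Φ) (faces Ψ) → ¬ SameOrbit Φ Ψ

  -- Φ α = Φ^{i(i-1)} = (Φ^i)^{i-1}, for i ≥ 1.
  IsStandardRotation : Flag → ℕ → Automorphism → Set
  IsStandardRotation Φ i α = ∃₂ λ Λ Ψ →
    Adjacent i (faces Φ) (faces Λ) ×
    Adjacent (i ℕ.∸ 1) (faces Λ) (faces Ψ) ×
    Sends α Φ Ψ

  -- Every section G/F, with F an (i-2)-face and G an (i+1)-face, is a
  -- p-gon: it has p vertices, which are the (i-1)-faces between F and G.
  -- In terms of rank+1 these three ranks are i-1, i+2 and i; i ≥ 1.
  SectionsArePolygons : ℕ → ℕ → Set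
  SectionsArePolygons i p = ∀ {F G} → F < G →
    suc (rank+1 F) ≡ i → rank+1 G ≡ 2 ℕ.+ i → HasSize (between F G i) p

HasType : Polytope 4 → ℕ → ℕ → ℕ → Set
HasType P p q r = SectionsArePolygons P 1 p
                × SectionsArePolygons P 2 q
                × SectionsArePolygons P 3 r

Tight : Polytope 4 → Set
Tight P = ∃[ p ] ∃[ q ] ∃[ r ]
  HasType P p q r × HasSize (Polytope.flagSetoid P) (2 ℕ.* p ℕ.* q ℕ.* r)

record AtomicChiral (P : Polytope 4) : Set₁ where
  field
    tight  : Tight P
    chiral : Chiral P
    atomic : ∀ (Q : Polytope 4) → Tight Q → Chiral Q → ¬ ProperlyCovers P Q

infix  8 _⁻¹
infixr 8 _^_ _^ℕ_
infixl 7 _∙_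

data Word (X : Set) : Set where
  gen : X → Word X
  ε   : Word X
  _∙_ : Word X → Word X → Word X
  _⁻¹ : Word X → Word X

_^ℕ_ : {X : Set} → Word X → ℕ → Word X
w ^ℕ zero  = ε
w ^ℕ suc n = w ∙ w ^ℕ n

_^_ : {X : Set} → Word X → ℤ → Word X
w ^ (+ n)    = w ^ℕ n
w ^ -[1+ n ] = (w ^ℕ suc n) ⁻¹

-- Equality of words in the group ⟨ X ∣ R ⟩: the least congruence that
-- satisfies the group laws and contains R.
data Equal {X : Set} (R : Rel (Word X) 0ℓ) : Rel (Word X) 0ℓ where
  relation  : ∀ {u v} → R u v → Equal R u v
  refl      : ∀ {u} → Equal R u u
  sym       : ∀ {u v} → Equal R u v → Equal R v u
  trans     : ∀ {u v w} → Equal R u v → Equal R v w → Equal R u w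
  ∙-cong    : ∀ {u u′ v v′} → Equal R u u′ → Equal R v v′ →
              Equal R (u ∙ v) (u′ ∙ v′)
  ⁻¹-cong   : ∀ {u v} → Equal R u v → Equal R (u ⁻¹) (v ⁻¹)
  assoc     : ∀ u v w → Equal R ((u ∙ v) ∙ w) (u ∙ (v ∙ w))
  identityˡ : ∀ u → Equal R (ε ∙ u) u
  identityʳ : ∀ u → Equal R (u ∙ ε) u
  inverseˡ  : ∀ u → Equal R (u ⁻¹ ∙ u) ε
  inverseʳ  : ∀ u → Equal R (u ∙ u ⁻¹) ε

⟨_∣_⟩ : (X : Set) → Rel (Word X) 0ℓ → Group 0ℓ 0ℓ
⟨ X ∣ R ⟩ = record
  { Carrier = Word X
  ; _≈_     = Equal R
  ; _∙_     = _∙_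
  ; ε       = ε
  ; _⁻¹     = _⁻¹
  ; isGroup = record
    { isMonoid = record
      { isSemigroup = record
        { isMagma = record
          { isEquivalence = record { refl = refl ; sym = sym ; trans = trans }
          ; ∙-cong = ∙-cong
          }
        ; assoc = assoc
        }
      ; identity = identityˡ , identityʳ
      }
    ; inverse = inverseˡ , inverseʳ
    ; ⁻¹-cong = ⁻¹-cong
    }
  }

σ₁ σ₂ σ₃ : Word (Fin 3)
σ₁ = gen zero
σ₂ = gen (suc zero)
σ₃ = gen (suc (suc zero))

-- The defining relations of [p,q,r]⁺.
data Rotation (p q r : ℕ) : Rel (Word (Fin 3)) 0ℓ where
  σ₁^p    : Rotation p q r (σ₁ ^ (+ p)) ε
  σ₂^q    : Rotation p q r (σ₂ ^ (+ q)) ε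
  σ₃^r    : Rotation p q r (σ₃ ^ (+ r)) ε
  σ₁σ₂²   : Rotation p q r ((σ₁ ∙ σ₂) ^ (+ 2)) ε
  σ₂σ₃²   : Rotation p q r ((σ₂ ∙ σ₃) ^ (+ 2)) ε
  σ₁σ₂σ₃² : Rotation p q r ((σ₁ ∙ σ₂ ∙ σ₃) ^ (+ 2)) ε

-- The four additional relations of Γ₃, with m = 2^(β-2).
data Extra (m : ℕ) (ε₁ ε₂ : Sign) : Rel (Word (Fin 3)) 0ℓ where
  σ₂⁻¹σ₁ : Extra m ε₁ ε₂ (σ₂ ⁻¹ ∙ σ₁)
             (σ₁ ^ ((ℤ.- + 1) ℤ.+ + m) ∙ σ₂ ^ ((ℤ.- + 3) ℤ.+ (ε₁ ◃ m)))
  σ₂σ₁⁻¹ : Extra m ε₁ ε₂ (σ₂ ∙ σ₁ ⁻¹)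
             (σ₁ ^ (+ 1 ℤ.+ + m) ∙ σ₂ ^ (+ 3 ℤ.+ (ε₁ ◃ m)))
  σ₃⁻¹σ₂ : Extra m ε₁ ε₂ (σ₃ ⁻¹ ∙ σ₂)
             (σ₂ ^ (+ 3 ℤ.+ (ε₂ ◃ m)) ∙ σ₃ ^ (+ 1 ℤ.+ + m))
  σ₃σ₂⁻¹ : Extra m ε₁ ε₂ (σ₃ ∙ σ₂ ⁻¹)
             (σ₂ ^ ((ℤ.- + 3) ℤ.+ (ε₂ ◃ m)) ∙ σ₃ ^ ((ℤ.- + 1) ℤ.+ + m))

Γ₃ : ℕ → Sign → Sign → Group 0ℓ 0ℓ
Γ₃ β ε₁ ε₂ = ⟨ Fin 3 ∣ Rotation p q p ∪ Extra (2 ℕ.^ (β ℕ.∸ 2)) ε₁ ε₂ ⟩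
  where
  p = 2 ℕ.^ (β ℕ.∸ 1)
  q = 2 ℕ.^ β

-- Γ is the automorphism group of P, and s 0, s 1, s 2 are its standard
-- generators σ₁, σ₂, σ₃ with respect to some base flag Φ.
IsAutomorphismGroupOf : (Γ : Group 0ℓ 0ℓ) → (Fin 3 → Group.Carrier Γ) →
                        Polytope 4 → Set
IsAutomorphismGroupOf Γ s P =
  Σ[ Φ ∈ Polytope.Flag P ] Σ[ f ∈ (Group.Carrier Γ → Automorphism P) ]
    IsGroupIsomorphism f
    × (∀ k → IsStandardRotation P Φ (suc (toℕ k)) (f (s k)))
  where
  open GroupMorphisms (Group.rawGroup Γ)
                      (Group.rawGroup (automorphismGroup P))

{-# OPTIONS --safe #-}
-- With J = 2^(β-5), the polytope is built from integers modulo 16J: vertices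
-- and facets are residues, edges and 2-faces pairs of residues, and faces
-- whose ranks differ by at least 2 are always incident.  The generators act
-- by explicit polynomials that satisfy the relations of Γ₃.  Conversely the
-- relations give u = σ₁^(8J) commuting with σ₂², so every element is
-- σ₁ⁱσ₂ᵏσ₃ˡ, and the action on the flags is simply transitive on each of two
-- orbits.  A mirror automorphism would invert σ₁ and σ₂ and so turn one
-- relation into another up to z = σ₂^(16J), forcing z = 1, which is false.
--
-- Let Q be a tight chiral polytope covered by it.  By counting flags, a
-- relation between powers of different generators in Q splits into relations
-- between powers of single generators.  If z is trivial in Q, the mirror map
-- respects all relations of Q, which is then not chiral.  Otherwise all three
-- generators keep their orders, since these are powers of 2 and halving one of
-- them kills z, so the covering is an isomorphism.
module Submission where

-- The defining relations alone do not exclude a collapse of the group; that z is non-trivial, and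
-- that the generators have their full orders, is read off the explicit action. Every identity of
-- that action holds with J as an indeterminate and with each sign written as 1 + 2δ, so one
-- decision procedure for congruences modulo 16J checks them all. That J is a power of 2 enters
-- through `order-2^`. Only the action on 2-faces and facets is given by formulas: on edges and
-- vertices the same formulas are used with the two signs exchanged, through the duality sending σ₁,
-- σ₂, σ₃ to σ₃⁻¹, σ₂⁻¹, σ₁⁻¹. Polytopes are compared through their flags. A map of flags that
-- respects adjacency is determined by one value, and for polytopes in which non-consecutive ranks
-- are always incident it comes from a map of faces. Both the inverse of the covering and the mirror
-- automorphism of Q are built as such maps, prescribed on words of the group. The faces of Q need
-- not have decidable equality. As atomicity is a negation, decidability may be assumed after a
-- double negation.

-- A decision procedure for polynomial congruences modulo 16J.

module Modular where

  open import Data.Bool using (Bool; true; false; _∨_)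
  open import Data.Bool.Properties using () renaming (_≟_ to _≟ᵇ_)
  open import Data.Fin using (Fin)
  open import Data.Integer using (ℤ; +_; -[1+_]; _+_; _*_; -_; _-_; 0ℤ; 1ℤ)
  import Data.Integer.Properties as ℤ
  open import Data.Integer.Solver using (module +-*-Solver)
  open import Data.Integer.DivMod using (_/ℕ_; _%ℕ_; a≡a%ℕn+[a/ℕn]*n)
  open import Data.List using (List; []; _∷_; _++_)
  open import Data.Nat as ℕ using (ℕ; zero; suc)
  import Data.Nat.Properties as ℕ
  open import Data.Maybe using (Maybe; just; nothing)
  open import Data.Product using (∃; _×_; _,_; proj₁; proj₂)
  open import Data.Product.Properties using () renaming (≡-dec to ×-≡-dec)
  open import Data.Vec using (Vec; []; _∷_; lookup)
  open import Data.Vec.Properties using () renaming (≡-dec to Vec-≡-dec)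
  open import Relation.Binary.PropositionalEquality
  open import Relation.Nullary using (yes; no)

  triℕ : ℕ → ℕ
  triℕ zero    = 0
  triℕ (suc n) = n ℕ.+ triℕ n

  -- The binomial coefficient z(z - 1)/2, also for negative z. Powers of σ₁ act by expressions with
  -- this denominator, so integer polynomials alone would not suffice.
  tri : ℤ → ℤ
  tri (+ n)    = + triℕ n
  tri -[1+ n ] = + triℕ (suc (suc n))

  open +-*-Solver using (solve; _:+_; _:*_; _:-_; :-_; con; _:=_; _:^_)

  triℕ-spec : ∀ n → + 2 * + triℕ n ≡ + n * + n - + n
  triℕ-spec zero = refl
  triℕ-spec (suc n) = begin
    + 2 * + (n ℕ.+ triℕ n)                ≡⟨ cong (+ 2 *_) (ℤ.pos-+ n (triℕ n)) ⟩
    + 2 * (+ n + + triℕ n)                ≡⟨ ℤ.*-distribˡ-+ (+ 2) (+ n) (+ triℕ n) ⟩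
    + 2 * + n + + 2 * + triℕ n            ≡⟨ cong (_+_ (+ 2 * + n)) (triℕ-spec n) ⟩
    + 2 * + n + (+ n * + n - + n)         ≡⟨ solve 1 (λ x → con (+ 2) :* x :+ (x :* x :- x)
                                               := (con 1ℤ :+ x) :* (con 1ℤ :+ x) :- (con 1ℤ :+ x)) refl (+ n) ⟩
    (1ℤ + + n) * (1ℤ + + n) - (1ℤ + + n)  ∎
    where open ≡-Reasoning

  tri-spec : ∀ z → + 2 * tri z ≡ z * z - z
  tri-spec (+ n)    = triℕ-spec n
  tri-spec -[1+ n ] = begin
    + 2 * + triℕ (suc (suc n))
      ≡⟨ triℕ-spec (suc (suc n)) ⟩
    + suc (suc n) * + suc (suc n) - + suc (suc n)
      ≡⟨ cong (λ t → t * t - t) (ℤ.pos-+ 1 (suc n)) ⟩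
    (1ℤ + + suc n) * (1ℤ + + suc n) - (1ℤ + + suc n)
      ≡⟨ solve 1 (λ x → (con 1ℤ :+ x) :* (con 1ℤ :+ x) :- (con 1ℤ :+ x)
                 := (:- x) :* (:- x) :- (:- x)) refl (+ suc n) ⟩
    (- + suc n) * (- + suc n) - (- + suc n) ∎
    where open ≡-Reasoning

  tri-unique : ∀ z {t} → + 2 * t ≡ z * z - z → tri z ≡ t
  tri-unique z eq = ℤ.*-cancelˡ-≡ (+ 2) _ _ (trans (tri-spec z) (sym eq))

  data Expr (n : ℕ) : Set where
    con      : ℤ → Expr n
    𝕁        : Expr n
    var      : Fin n → Expr n
    _⊕_ _⊗_  : Expr n → Expr n → Expr n
    ⊝_       : Expr n → Expr n
    ⟨tri⟩    : Expr n → Expr n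

  infixl 6 _⊕_ _⊖_
  infixl 7 _⊗_
  infix  8 ⊝_

  _⊖_ : ∀ {n} → Expr n → Expr n → Expr n
  x ⊖ y = x ⊕ ⊝ y

  -- Monomials in variables x and their tri x: since x² = x + 2 tri x, the
  -- exponent of x is 0 or 1.
  Mono : ℕ → Set
  Mono n = Vec (Bool × ℕ) n

  Term : ℕ → Set
  Term n = ℤ × ℕ × Mono n

  Poly : ℕ → Set
  Poly n = List (Term n)

  infixl 6 _+ₚ_
  infixl 7 _*ₚ_

  insert : ∀ {n} → Term n → Poly n → Poly n
  insert t [] = t ∷ []
  insert (c , k) ((c′ , k′) ∷ p) with ×-≡-dec ℕ._≟_ (Vec-≡-dec (×-≡-dec _≟ᵇ_ ℕ._≟_)) k k′
  ... | yes _ = (c + c′ , k′) ∷ p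
  ... | no  _ = (c′ , k′) ∷ insert (c , k) p

  _+ₚ_ : ∀ {n} → Poly n → Poly n → Poly n
  []      +ₚ q = q
  (t ∷ p) +ₚ q = insert t (p +ₚ q)

  scale : ∀ {n} → ℤ → Poly n → Poly n
  scale a []            = []
  scale a ((c , k) ∷ p) = (a * c , k) ∷ scale a p

  consAll : ∀ {n} → ℤ → Bool × ℕ → List (ℤ × Mono n) → List (ℤ × Mono (suc n))
  consAll a f []            = []
  consAll a f ((c , m) ∷ l) = (a * c , f ∷ m) ∷ consAll a f l

  _*ₘ_ : ∀ {n} → Mono n → Mono n → List (ℤ × Mono n)
  [] *ₘ [] = (1ℤ , []) ∷ []
  ((true , f) ∷ m) *ₘ ((true , f′) ∷ m′) =
    consAll 1ℤ (true , f ℕ.+ f′) (m *ₘ m′) ++ consAll (+ 2) (false , suc (f ℕ.+ f′)) (m *ₘ m′)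
  ((b , f) ∷ m) *ₘ ((b′ , f′) ∷ m′) = consAll 1ℤ (b ∨ b′ , f ℕ.+ f′) (m *ₘ m′)

  addTerms : ∀ {n} → ℤ → ℕ → List (ℤ × Mono n) → Poly n → Poly n
  addTerms a e []            q = q
  addTerms a e ((c , m) ∷ l) q = insert (a * c , e , m) (addTerms a e l q)

  mulTerm : ∀ {n} → Term n → Poly n → Poly n → Poly n
  mulTerm t [] r = r
  mulTerm (c , e , m) ((c′ , e′ , m′) ∷ p) r =
    addTerms (c * c′) (e ℕ.+ e′) (m *ₘ m′) (mulTerm (c , e , m) p r)

  _*ₚ_ : ∀ {n} → Poly n → Poly n → Poly n
  []      *ₚ q = []
  (t ∷ p) *ₚ q = mulTerm t q (p *ₚ q)

  trivial : ∀ {n} → Mono n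
  trivial {zero}  = []
  trivial {suc n} = (false , 0) ∷ trivial

  single : ∀ {n} → Fin n → Mono n
  single Fin.zero    = (true , 0) ∷ trivial
  single (Fin.suc i) = (false , 0) ∷ single i

  quotient : (d : ℕ) → .{{ℕ.NonZero d}} → ℤ → Maybe ℤ
  quotient d c with c %ℕ d
  ... | zero  = just (c /ℕ d)
  ... | suc _ = nothing

  quotient-spec : ∀ d .{{_ : ℕ.NonZero d}} c {q} → quotient d c ≡ just q → c ≡ q * + d
  quotient-spec d c eq with c %ℕ d in r
  quotient-spec d c refl | zero = trans (a≡a%ℕn+[a/ℕn]*n c d)
    (trans (cong (λ t → + t + (c /ℕ d) * + d) r) (ℤ.+-identityˡ _))

  halve : ∀ {n} → Poly n → Maybe (Poly n)
  halve [] = just []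
  halve ((c , k) ∷ p) with quotient 2 c | halve p
  ... | just c′ | just p′ = just ((c′ , k) ∷ p′)
  ... | _       | _       = nothing

  -- Halves p² - p coefficient by coefficient, hence is partial. It succeeds as soon as every
  -- monomial of p that contains J or some tri x has an even coefficient, because the remaining
  -- monomials are idempotent modulo 2.
  triₚ : ∀ {n} → Poly n → Maybe (Poly n)
  triₚ p = halve (p *ₚ p +ₚ scale (- 1ℤ) p)

  normal : ∀ {n} → Expr n → Maybe (Poly n)
  normal (con c) = just ((c , 0 , trivial) ∷ [])
  normal 𝕁       = just ((1ℤ , 1 , trivial) ∷ [])
  normal (var i) = just ((1ℤ , 0 , single i) ∷ [])
  normal (a ⊕ b) with normal a | normal b
  ... | just p | just q = just (p +ₚ q)
  ... | _      | _      = nothing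
  normal (a ⊗ b) with normal a | normal b
  ... | just p | just q = just (p *ₚ q)
  ... | _      | _      = nothing
  normal (⊝ a) with normal a
  ... | just p = just (scale (- 1ℤ) p)
  ... | nothing = nothing
  normal (⟨tri⟩ a) with normal a
  ... | just p = triₚ p
  ... | nothing = nothing

  -- J is an indeterminate here: a term counts as a multiple of 16J if 16 divides its coefficient
  -- and J occurs in it. In particular the product of two terms with factor 4J disappears.
  vanishing : ∀ {n} → Poly n → Bool
  vanishing [] = true
  vanishing ((+ 0 , _) ∷ p) = vanishing p
  vanishing ((c , zero , _) ∷ p) = false
  vanishing ((c , suc e , _) ∷ p) with quotient 16 c
  ... | just _  = vanishing p
  ... | nothing = false

  congruent : ∀ {n} → Expr n → Expr n → Bool
  congruent a b with normal (a ⊖ b)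
  ... | just p  = vanishing p
  ... | nothing = false

  module Semantics (J : ℤ) where

    ⟦_⟧ : ∀ {n} → Expr n → Vec ℤ n → ℤ
    ⟦ con c ⟧   ρ = c
    ⟦ 𝕁 ⟧       ρ = J
    ⟦ var i ⟧   ρ = lookup ρ i
    ⟦ a ⊕ b ⟧   ρ = ⟦ a ⟧ ρ + ⟦ b ⟧ ρ
    ⟦ a ⊗ b ⟧   ρ = ⟦ a ⟧ ρ * ⟦ b ⟧ ρ
    ⟦ ⊝ a ⟧     ρ = - ⟦ a ⟧ ρ
    ⟦ ⟨tri⟩ a ⟧ ρ = tri (⟦ a ⟧ ρ)

    infix 4 _≈_

    -- With the quotient as a field, matching on `multiple q refl` turns a congruence into a
    -- substitution by b + q · 16J, so that well-definedness of an action becomes one more instance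
    -- of `mod!`.
    record _≈_ (a b : ℤ) : Set where
      constructor multiple
      field
        quot  : ℤ
        equal : a ≡ b + quot * (+ 16 * J)

    pow : ℤ → ℕ → ℤ
    pow x zero    = 1ℤ
    pow x (suc n) = x * pow x n

    pow-+ : ∀ x m n → pow x (m ℕ.+ n) ≡ pow x m * pow x n
    pow-+ x zero    n = sym (ℤ.*-identityˡ _)
    pow-+ x (suc m) n = trans (cong (x *_) (pow-+ x m n)) (sym (ℤ.*-assoc x _ _))

    factor : Bool → ℤ → ℤ
    factor true  x = x
    factor false x = 1ℤ

    ⟦_⟧ₘ : ∀ {n} → Mono n → Vec ℤ n → ℤ
    ⟦ [] ⟧ₘ          []      = 1ℤ
    ⟦ (b , f) ∷ m ⟧ₘ (x ∷ ρ) = factor b x * pow (tri x) f * ⟦ m ⟧ₘ ρ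

    ⟦_⟧ₜ : ∀ {n} → Term n → Vec ℤ n → ℤ
    ⟦ c , e , m ⟧ₜ ρ = c * (pow J e * ⟦ m ⟧ₘ ρ)

    ⟦_⟧ₚ : ∀ {n} → Poly n → Vec ℤ n → ℤ
    ⟦ [] ⟧ₚ    ρ = 0ℤ
    ⟦ t ∷ p ⟧ₚ ρ = ⟦ t ⟧ₜ ρ + ⟦ p ⟧ₚ ρ

    ⟦_⟧ₗ : ∀ {n} → List (ℤ × Mono n) → Vec ℤ n → ℤ
    ⟦ [] ⟧ₗ          ρ = 0ℤ
    ⟦ (c , m) ∷ l ⟧ₗ ρ = c * ⟦ m ⟧ₘ ρ + ⟦ l ⟧ₗ ρ

    module _ {n} (ρ : Vec ℤ n) where

      insert-sound : ∀ t (p : Poly n) → ⟦ insert t p ⟧ₚ ρ ≡ ⟦ t ⟧ₜ ρ + ⟦ p ⟧ₚ ρ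
      insert-sound t [] = refl
      insert-sound (c , k) ((c′ , k′) ∷ p) with ×-≡-dec ℕ._≟_ (Vec-≡-dec (×-≡-dec _≟ᵇ_ ℕ._≟_)) k k′
      ... | yes refl = solve 4 (λ c c′ k p → (c :+ c′) :* k :+ p := c :* k :+ (c′ :* k :+ p)) refl
        c c′ (pow J (proj₁ k) * ⟦ proj₂ k ⟧ₘ ρ) (⟦ p ⟧ₚ ρ)
      ... | no  _    = trans (cong (_+_ (⟦ c′ , k′ ⟧ₜ ρ)) (insert-sound (c , k) p))
        (solve 3 (λ a b c → a :+ (b :+ c) := b :+ (a :+ c)) refl (⟦ c′ , k′ ⟧ₜ ρ) (⟦ c , k ⟧ₜ ρ) (⟦ p ⟧ₚ ρ))

      +ₚ-sound : ∀ (p q : Poly n) → ⟦ p +ₚ q ⟧ₚ ρ ≡ ⟦ p ⟧ₚ ρ + ⟦ q ⟧ₚ ρ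
      +ₚ-sound []      q = sym (ℤ.+-identityˡ _)
      +ₚ-sound (t ∷ p) q = trans (insert-sound t (p +ₚ q))
        (trans (cong (_+_ (⟦ t ⟧ₜ ρ)) (+ₚ-sound p q)) (sym (ℤ.+-assoc (⟦ t ⟧ₜ ρ) (⟦ p ⟧ₚ ρ) (⟦ q ⟧ₚ ρ))))

      scale-sound : ∀ a (p : Poly n) → ⟦ scale a p ⟧ₚ ρ ≡ a * ⟦ p ⟧ₚ ρ
      scale-sound a []            = sym (ℤ.*-zeroʳ a)
      scale-sound a ((c , e , m) ∷ p) = trans (cong (_+_ (a * c * (pow J e * ⟦ m ⟧ₘ ρ))) (scale-sound a p))
        (solve 4 (λ a c k p → a :* c :* k :+ a :* p := a :* (c :* k :+ p)) refl
          a c (pow J e * ⟦ m ⟧ₘ ρ) (⟦ p ⟧ₚ ρ))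

      addTerms-sound : ∀ a e l (q : Poly n) →
        ⟦ addTerms a e l q ⟧ₚ ρ ≡ a * (pow J e * ⟦ l ⟧ₗ ρ) + ⟦ q ⟧ₚ ρ
      addTerms-sound a e [] q = solve 3 (λ a b q → q := a :* (b :* con 0ℤ) :+ q) refl a (pow J e) (⟦ q ⟧ₚ ρ)
      addTerms-sound a e ((c , m) ∷ l) q = trans (insert-sound (a * c , e , m) (addTerms a e l q))
        (trans (cong (_+_ (a * c * (pow J e * ⟦ m ⟧ₘ ρ))) (addTerms-sound a e l q))
          (solve 6 (λ a c j m l q → a :* c :* (j :* m) :+ (a :* (j :* l) :+ q)
                     := a :* (j :* (c :* m :+ l)) :+ q) refl
            a c (pow J e) (⟦ m ⟧ₘ ρ) (⟦ l ⟧ₗ ρ) (⟦ q ⟧ₚ ρ)))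

    ++-sound : ∀ {n} (ρ : Vec ℤ n) k l → ⟦ k ++ l ⟧ₗ ρ ≡ ⟦ k ⟧ₗ ρ + ⟦ l ⟧ₗ ρ
    ++-sound ρ []      l = sym (ℤ.+-identityˡ _)
    ++-sound ρ ((c , m) ∷ k) l = trans (cong (_+_ (c * ⟦ m ⟧ₘ ρ)) (++-sound ρ k l))
      (sym (ℤ.+-assoc (c * ⟦ m ⟧ₘ ρ) (⟦ k ⟧ₗ ρ) (⟦ l ⟧ₗ ρ)))

    consAll-sound : ∀ {n} x (ρ : Vec ℤ n) a b f l →
      ⟦ consAll a (b , f) l ⟧ₗ (x ∷ ρ) ≡ a * (factor b x * pow (tri x) f) * ⟦ l ⟧ₗ ρ
    consAll-sound x ρ a b f [] = sym (ℤ.*-zeroʳ (a * (factor b x * pow (tri x) f)))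
    consAll-sound x ρ a b f ((c , m) ∷ l) = trans
      (cong (_+_ (a * c * (factor b x * pow (tri x) f * ⟦ m ⟧ₘ ρ))) (consAll-sound x ρ a b f l))
      (solve 5 (λ a c f m l → a :* c :* (f :* m) :+ a :* f :* l := a :* f :* (c :* m :+ l)) refl
        a c (factor b x * pow (tri x) f) (⟦ m ⟧ₘ ρ) (⟦ l ⟧ₗ ρ))

    *ₘ-sound : ∀ {n} (ρ : Vec ℤ n) m m′ → ⟦ m *ₘ m′ ⟧ₗ ρ ≡ ⟦ m ⟧ₘ ρ * ⟦ m′ ⟧ₘ ρ
    *ₘ-sound [] [] [] = refl
    *ₘ-sound (x ∷ ρ) ((true , f) ∷ m) ((true , f′) ∷ m′) = trans
      (++-sound (x ∷ ρ) (consAll 1ℤ (true , f ℕ.+ f′) (m *ₘ m′)) (consAll (+ 2) (false , suc (f ℕ.+ f′)) (m *ₘ m′))) (trans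
      (cong₂ _+_ (consAll-sound x ρ 1ℤ true (f ℕ.+ f′) (m *ₘ m′))
                 (consAll-sound x ρ (+ 2) false (suc (f ℕ.+ f′)) (m *ₘ m′)))
      (trans (cong₂ (λ p s → 1ℤ * (x * p) * s + + 2 * (1ℤ * (tri x * p)) * s)
                    (pow-+ (tri x) f f′) (*ₘ-sound ρ m m′))
      (trans (solve 6 (λ x t p p′ s s′ →
                con 1ℤ :* (x :* (p :* p′)) :* (s :* s′) :+ con (+ 2) :* (con 1ℤ :* (t :* (p :* p′))) :* (s :* s′)
                := (x :+ con (+ 2) :* t) :* (p :* p′ :* (s :* s′))) refl
                x (tri x) (pow (tri x) f) (pow (tri x) f′) (⟦ m ⟧ₘ ρ) (⟦ m′ ⟧ₘ ρ))
      (trans (cong (λ t → (x + t) * (pow (tri x) f * pow (tri x) f′ * (⟦ m ⟧ₘ ρ * ⟦ m′ ⟧ₘ ρ))) (tri-spec x))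
        (solve 5 (λ x p p′ s s′ → (x :+ (x :* x :- x)) :* (p :* p′ :* (s :* s′))
                    := x :* p :* s :* (x :* p′ :* s′)) refl
                    x (pow (tri x) f) (pow (tri x) f′) (⟦ m ⟧ₘ ρ) (⟦ m′ ⟧ₘ ρ))))))
    *ₘ-sound (x ∷ ρ) ((true , f) ∷ m) ((false , f′) ∷ m′) = trans (consAll-sound x ρ 1ℤ true (f ℕ.+ f′) (m *ₘ m′))
      (trans (cong₂ (λ p s → 1ℤ * (x * p) * s) (pow-+ (tri x) f f′) (*ₘ-sound ρ m m′))
        (solve 5 (λ x p p′ s s′ → con 1ℤ :* (x :* (p :* p′)) :* (s :* s′) := x :* p :* s :* (con 1ℤ :* p′ :* s′)) refl
          x (pow (tri x) f) (pow (tri x) f′) (⟦ m ⟧ₘ ρ) (⟦ m′ ⟧ₘ ρ)))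
    *ₘ-sound (x ∷ ρ) ((false , f) ∷ m) ((b , f′) ∷ m′) = trans (consAll-sound x ρ 1ℤ b (f ℕ.+ f′) (m *ₘ m′))
      (trans (cong₂ (λ p s → 1ℤ * (factor b x * p) * s) (pow-+ (tri x) f f′) (*ₘ-sound ρ m m′))
        (solve 5 (λ x p p′ s s′ → con 1ℤ :* (x :* (p :* p′)) :* (s :* s′) := con 1ℤ :* p :* s :* (x :* p′ :* s′)) refl
          (factor b x) (pow (tri x) f) (pow (tri x) f′) (⟦ m ⟧ₘ ρ) (⟦ m′ ⟧ₘ ρ)))

    trivial-sound : ∀ {n} (ρ : Vec ℤ n) → ⟦ trivial ⟧ₘ ρ ≡ 1ℤ
    trivial-sound []      = refl
    trivial-sound (x ∷ ρ) = trans (ℤ.*-identityˡ _) (trivial-sound ρ)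

    single-sound : ∀ {n} (ρ : Vec ℤ n) i → ⟦ single i ⟧ₘ ρ ≡ lookup ρ i
    single-sound (x ∷ ρ) Fin.zero    = trans (cong (x * 1ℤ *_) (trivial-sound ρ)) (trans (ℤ.*-identityʳ _) (ℤ.*-identityʳ x))
    single-sound (x ∷ ρ) (Fin.suc i) = trans (ℤ.*-identityˡ _) (single-sound ρ i)

    module _ {n} (ρ : Vec ℤ n) where

      mulTerm-sound : ∀ t (p r : Poly n) → ⟦ mulTerm t p r ⟧ₚ ρ ≡ ⟦ t ⟧ₜ ρ * ⟦ p ⟧ₚ ρ + ⟦ r ⟧ₚ ρ
      mulTerm-sound t [] r = sym (trans (cong (λ s → s + ⟦ r ⟧ₚ ρ) (ℤ.*-zeroʳ (⟦ t ⟧ₜ ρ))) (ℤ.+-identityˡ (⟦ r ⟧ₚ ρ)))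
      mulTerm-sound (c , e , m) ((c′ , e′ , m′) ∷ p) r = trans
        (addTerms-sound ρ (c * c′) (e ℕ.+ e′) (m *ₘ m′) (mulTerm (c , e , m) p r))
        (trans (cong₂ _+_ (cong₂ (λ j s → c * c′ * (j * s)) (pow-+ J e e′) (*ₘ-sound ρ m m′))
                          (mulTerm-sound (c , e , m) p r))
          (solve 8 (λ c c′ j j′ m m′ p r → c :* c′ :* (j :* j′ :* (m :* m′)) :+ (c :* (j :* m) :* p :+ r)
                      := c :* (j :* m) :* (c′ :* (j′ :* m′) :+ p) :+ r) refl
            c c′ (pow J e) (pow J e′) (⟦ m ⟧ₘ ρ) (⟦ m′ ⟧ₘ ρ) (⟦ p ⟧ₚ ρ) (⟦ r ⟧ₚ ρ)))

      *ₚ-sound : ∀ (p q : Poly n) → ⟦ p *ₚ q ⟧ₚ ρ ≡ ⟦ p ⟧ₚ ρ * ⟦ q ⟧ₚ ρ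
      *ₚ-sound []      q = refl
      *ₚ-sound (t ∷ p) q = trans (mulTerm-sound t q (p *ₚ q))
        (trans (cong (_+_ (⟦ t ⟧ₜ ρ * ⟦ q ⟧ₚ ρ)) (*ₚ-sound p q)) (sym (ℤ.*-distribʳ-+ (⟦ q ⟧ₚ ρ) (⟦ t ⟧ₜ ρ) (⟦ p ⟧ₚ ρ))))

      halve-sound : ∀ (p : Poly n) {h} → halve p ≡ just h → ⟦ p ⟧ₚ ρ ≡ + 2 * ⟦ h ⟧ₚ ρ
      halve-sound [] refl = refl
      halve-sound ((c , e , m) ∷ p) eq with quotient 2 c in q | halve p in h
      halve-sound ((c , e , m) ∷ p) refl | just c′ | just p′ = trans
        (cong₂ (λ c p → c * (pow J e * ⟦ m ⟧ₘ ρ) + p) (quotient-spec 2 c q) (halve-sound p h))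
        (solve 3 (λ c k p → c :* con (+ 2) :* k :+ con (+ 2) :* p := con (+ 2) :* (c :* k :+ p)) refl
          c′ (pow J e * ⟦ m ⟧ₘ ρ) (⟦ p′ ⟧ₚ ρ))

      triₚ-sound : ∀ (p : Poly n) {h} → triₚ p ≡ just h → tri (⟦ p ⟧ₚ ρ) ≡ ⟦ h ⟧ₚ ρ
      triₚ-sound p eq = tri-unique (⟦ p ⟧ₚ ρ) (trans (sym (halve-sound (p *ₚ p +ₚ scale (- 1ℤ) p) eq))
        (trans (+ₚ-sound ρ (p *ₚ p) (scale (- 1ℤ) p)) (trans
          (cong₂ _+_ (*ₚ-sound p p) (scale-sound ρ (- 1ℤ) p))
          (solve 1 (λ p → p :* p :+ con (- 1ℤ) :* p := p :* p :- p) refl (⟦ p ⟧ₚ ρ)))))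

      normal-sound : ∀ (e : Expr n) {p} → normal e ≡ just p → ⟦ e ⟧ ρ ≡ ⟦ p ⟧ₚ ρ
      normal-sound (con c) refl = trans (sym (ℤ.*-identityʳ c)) (trans (cong (λ u → c * u) (sym (trans (ℤ.*-identityˡ _) (trivial-sound ρ)))) (sym (ℤ.+-identityʳ _)))
      normal-sound 𝕁       refl = trans (solve 1 (λ j → j := con 1ℤ :* (j :* con 1ℤ :* con 1ℤ) :+ con 0ℤ) refl J)
        (cong (λ u → 1ℤ * (J * 1ℤ * u) + 0ℤ) (sym (trivial-sound ρ)))
      normal-sound (var i) refl = trans (sym (single-sound ρ i))
        (solve 1 (λ s → s := con 1ℤ :* (con 1ℤ :* s) :+ con 0ℤ) refl (⟦ single i ⟧ₘ ρ))
      normal-sound (a ⊕ b) eq with normal a in na | normal b in nb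
      normal-sound (a ⊕ b) refl | just p | just q =
        trans (cong₂ _+_ (normal-sound a na) (normal-sound b nb)) (sym (+ₚ-sound ρ p q))
      normal-sound (a ⊗ b) eq with normal a in na | normal b in nb
      normal-sound (a ⊗ b) refl | just p | just q =
        trans (cong₂ _*_ (normal-sound a na) (normal-sound b nb)) (sym (*ₚ-sound p q))
      normal-sound (⊝ a) eq with normal a in na
      normal-sound (⊝ a) refl | just p =
        trans (cong -_ (normal-sound a na)) (trans (sym (ℤ.-1*i≡-i _)) (sym (scale-sound ρ (- 1ℤ) p)))
      normal-sound (⟨tri⟩ a) eq with normal a in na
      normal-sound (⟨tri⟩ a) eq | just p = trans (cong tri (normal-sound a na)) (triₚ-sound p eq)

      vanishing-sound : ∀ (p : Poly n) → vanishing p ≡ true → ∃ λ q → ⟦ p ⟧ₚ ρ ≡ q * (+ 16 * J)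
      vanishing-sound [] eq = 0ℤ , refl
      vanishing-sound ((+ 0 , k) ∷ p) eq with vanishing-sound p eq
      ... | q , eq′ = q , trans (ℤ.+-identityˡ _) eq′
      vanishing-sound ((+ suc c , suc e , m) ∷ p) eq with quotient 16 (+ suc c) in d
      ... | just c′ with vanishing-sound p eq
      ...   | q , eq′ = c′ * (pow J e * ⟦ m ⟧ₘ ρ) + q , trans
        (cong₂ (λ c p → c * (J * pow J e * ⟦ m ⟧ₘ ρ) + p) (quotient-spec 16 (+ suc c) d) eq′)
        (solve 5 (λ j c e m q → c :* con (+ 16) :* (j :* e :* m) :+ q :* (con (+ 16) :* j)
          := (c :* (e :* m) :+ q) :* (con (+ 16) :* j)) refl J c′ (pow J e) (⟦ m ⟧ₘ ρ) q)
      vanishing-sound ((-[1+ c ] , suc e , m) ∷ p) eq with quotient 16 -[1+ c ] in d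
      ... | just c′ with vanishing-sound p eq
      ...   | q , eq′ = c′ * (pow J e * ⟦ m ⟧ₘ ρ) + q , trans
        (cong₂ (λ c p → c * (J * pow J e * ⟦ m ⟧ₘ ρ) + p) (quotient-spec 16 -[1+ c ] d) eq′)
        (solve 5 (λ j c e m q → c :* con (+ 16) :* (j :* e :* m) :+ q :* (con (+ 16) :* j)
          := (c :* (e :* m) :+ q) :* (con (+ 16) :* j)) refl J c′ (pow J e) (⟦ m ⟧ₘ ρ) q)

    opaque
      -- The proof argument is `refl` wherever `congruent` computes to true on closed expressions.
      -- The lemma is opaque so that the quotients it produces are never unfolded.
      mod! : ∀ {n} (a b : Expr n) → congruent a b ≡ true → ∀ ρ → ⟦ a ⟧ ρ ≈ ⟦ b ⟧ ρ
      mod! a b eq ρ with normal (a ⊖ b) in nab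
      ... | just p with vanishing-sound ρ p eq
      ...   | q , eq′ = multiple q (trans
        (solve 2 (λ a b → a := b :+ (a :- b)) refl (⟦ a ⟧ ρ) (⟦ b ⟧ ρ))
        (cong (_+_ (⟦ b ⟧ ρ)) (trans (normal-sound ρ (a ⊖ b) nab) eq′)))

-- Free reduction of words and integer powers in a group.

module GroupKit where

  open import Algebra.Bundles using (Group)
  import Algebra.Properties.Group as GroupProperties
  open import Data.Bool using (Bool; true; false; not)
  open import Data.Fin using (Fin)
  import Data.Fin.Properties as Fin
  open import Data.Integer as ℤ using (ℤ; +_; -[1+_])
  import Data.Integer.Properties as ℤ
  open import Data.List using (List; []; _∷_)
  open import Data.Nat as ℕ using (ℕ; zero; suc)
  open import Data.Product using (_×_; _,_)
  open import Data.Vec as Vec using (Vec; lookup)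
  open import Level using (0ℓ)
  open import Relation.Binary.PropositionalEquality as ≡ using (_≡_)
  open import Relation.Nullary using (yes; no)
  open import Defs using (Word; gen; ε; _∙_; _⁻¹)

  Letters : ℕ → Set
  Letters n = List (Bool × Fin n)

  push : ∀ {n} → Bool × Fin n → Letters n → Letters n
  push l [] = l ∷ []
  push (b , i) ((c , k) ∷ l) with b | c | i Fin.≟ k
  ... | true  | false | yes _ = l
  ... | false | true  | yes _ = l
  ... | _     | _     | _     = (b , i) ∷ (c , k) ∷ l

  spell : ∀ {n} → Bool → Word (Fin n) → Letters n → Letters n
  spell b     (gen i) l = push (b , i) l
  spell b     ε       l = l
  spell true  (u ∙ v) l = spell true u (spell true v l)
  spell false (u ∙ v) l = spell false v (spell false u l)
  spell b     (u ⁻¹)  l = spell (not b) u l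

  reduced : ∀ {n} → Word (Fin n) → Letters n
  reduced w = spell true w []

  module Powers (G : Group 0ℓ 0ℓ) where

    open Group G renaming (Carrier to C; _∙_ to _·_; ε to e; _⁻¹ to inv)
    open GroupProperties G
    open import Relation.Binary.Reasoning.Setoid setoid

    ⟦_⟧ : ∀ {n} → Word (Fin n) → Vec C n → C
    ⟦ gen i ⟧ ρ = lookup ρ i
    ⟦ ε ⟧     ρ = e
    ⟦ u ∙ v ⟧ ρ = ⟦ u ⟧ ρ · ⟦ v ⟧ ρ
    ⟦ u ⁻¹ ⟧  ρ = inv (⟦ u ⟧ ρ)

    module _ {n} (ρ : Vec C n) where

      letter : Bool × Fin n → C
      letter (true  , i) = lookup ρ i
      letter (false , i) = inv (lookup ρ i)

      product : Letters n → C
      product []      = e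
      product (l ∷ w) = letter l · product w

      signed : Bool → Word (Fin n) → C
      signed true  w = ⟦ w ⟧ ρ
      signed false w = inv (⟦ w ⟧ ρ)

      push-sound : ∀ l w → product (push l w) ≈ letter l · product w
      push-sound l [] = refl
      push-sound (b , i) ((c , k) ∷ w) with b | c | i Fin.≟ k
      ... | true  | false | yes ≡.refl = sym (trans (sym (assoc _ _ _)) (trans (∙-congʳ (inverseʳ _)) (identityˡ _)))
      ... | false | true  | yes ≡.refl = sym (trans (sym (assoc _ _ _)) (trans (∙-congʳ (inverseˡ _)) (identityˡ _)))
      ... | true  | true  | yes _ = refl
      ... | true  | true  | no _  = refl
      ... | true  | false | no _  = refl
      ... | false | true  | no _  = refl
      ... | false | false | yes _ = refl
      ... | false | false | no _  = refl

      spell-sound : ∀ b w l → product (spell b w l) ≈ signed b w · product l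
      spell-sound true  (gen i) l = push-sound (true , i) l
      spell-sound false (gen i) l = push-sound (false , i) l
      spell-sound true  ε l = sym (identityˡ _)
      spell-sound false ε l = sym (trans (∙-congʳ ε⁻¹≈ε) (identityˡ _))
      spell-sound true  (u ∙ v) l = trans (spell-sound true u _)
        (trans (∙-congˡ (spell-sound true v l)) (sym (assoc _ _ _)))
      spell-sound false (u ∙ v) l = trans (spell-sound false v _)
        (trans (∙-congˡ (spell-sound false u l)) (trans (sym (assoc _ _ _)) (∙-congʳ (sym (⁻¹-anti-homo-∙ _ _)))))
      spell-sound true  (u ⁻¹) l = spell-sound false u l
      spell-sound false (u ⁻¹) l = trans (spell-sound true u l) (∙-congʳ (sym (⁻¹-involutive _)))

    -- Sides with the same freely reduced spelling are equal in every group. Calculations below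
    -- alternate such rearrangements with the insertion of one relation.
    group! : ∀ {n} (u v : Word (Fin n)) → reduced u ≡ reduced v → ∀ ρ → ⟦ u ⟧ ρ ≈ ⟦ v ⟧ ρ
    group! u v eq ρ = begin
      ⟦ u ⟧ ρ               ≈⟨ identityʳ _ ⟨
      ⟦ u ⟧ ρ · e           ≈⟨ spell-sound ρ true u [] ⟨
      product ρ (reduced u) ≡⟨ ≡.cong (product ρ) eq ⟩
      product ρ (reduced v) ≈⟨ spell-sound ρ true v [] ⟩
      ⟦ v ⟧ ρ · e           ≈⟨ identityʳ _ ⟩
      ⟦ v ⟧ ρ               ∎

    infixr 8 _^ⁿ_ _^ᶻ_ _^_

    _^ⁿ_ : C → ℕ → C
    x ^ⁿ zero  = e
    x ^ⁿ suc n = x · x ^ⁿ n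

    _^ᶻ_ : C → ℤ → C
    x ^ᶻ (+ n)    = x ^ⁿ n
    x ^ᶻ -[1+ n ] = inv (x ^ⁿ suc n)

    opaque
      _^_ : C → ℤ → C
      _^_ = _^ᶻ_

      ^≡^ᶻ : ∀ x z → x ^ z ≡ x ^ᶻ z
      ^≡^ᶻ x z = ≡.refl

      ^-0 : ∀ x → x ^ (+ 0) ≈ e
      ^-0 x = refl

      ^-1 : ∀ x → x ^ (+ 1) ≈ x
      ^-1 = identityʳ

      ^-2 : ∀ x → x ^ (+ 2) ≈ x · x
      ^-2 x = ∙-congˡ (identityʳ x)

    ^ⁿ-cong : ∀ {x y} n → x ≈ y → x ^ⁿ n ≈ y ^ⁿ n
    ^ⁿ-cong zero    eq = refl
    ^ⁿ-cong (suc n) eq = ∙-cong eq (^ⁿ-cong n eq)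

    opaque
      unfolding _^_

      ^-cong : ∀ {x y} z → x ≈ y → x ^ z ≈ y ^ z
      ^-cong (+ n)    eq = ^ⁿ-cong n eq
      ^-cong -[1+ n ] eq = ⁻¹-cong (^ⁿ-cong (suc n) eq)

    Commute : C → C → Set
    Commute x y = x · y ≈ y · x

    commute-inv : ∀ {x y} → Commute x y → Commute x (inv y)
    commute-inv {x} {y} c = begin
      x · inv y                   ≈⟨ group! (gen Fin.zero ∙ gen (Fin.suc Fin.zero) ⁻¹)
                                       (gen (Fin.suc Fin.zero) ⁻¹ ∙ (gen (Fin.suc Fin.zero) ∙ gen Fin.zero) ∙ gen (Fin.suc Fin.zero) ⁻¹)
                                       ≡.refl (x Vec.∷ y Vec.∷ Vec.[]) ⟩
      inv y · (y · x) · inv y     ≈⟨ ∙-congʳ (∙-congˡ (sym c)) ⟩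
      inv y · (x · y) · inv y     ≈⟨ group! (gen (Fin.suc Fin.zero) ⁻¹ ∙ (gen Fin.zero ∙ gen (Fin.suc Fin.zero)) ∙ gen (Fin.suc Fin.zero) ⁻¹)
                                       (gen (Fin.suc Fin.zero) ⁻¹ ∙ gen Fin.zero) ≡.refl (x Vec.∷ y Vec.∷ Vec.[]) ⟩
      inv y · x                   ∎

    commute-∙ : ∀ {x y z} → Commute x y → Commute x z → Commute x (y · z)
    commute-∙ {x} {y} {z} c d = trans (sym (assoc _ _ _)) (trans (∙-congʳ c)
      (trans (assoc _ _ _) (trans (∙-congˡ d) (sym (assoc _ _ _)))))

    commute-^ⁿ : ∀ {x y} n → Commute x y → Commute x (y ^ⁿ n)
    commute-^ⁿ zero    c = trans (identityʳ _) (sym (identityˡ _))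
    commute-^ⁿ (suc n) c = commute-∙ c (commute-^ⁿ n c)

    opaque
      unfolding _^_

      commute-^ : ∀ {x y} z → Commute x y → Commute x (y ^ z)
      commute-^ (+ n)    c = commute-^ⁿ n c
      commute-^ -[1+ n ] c = commute-inv (commute-^ⁿ (suc n) c)

    opaque
      unfolding _^_

      ^-suc : ∀ x z → x ^ (ℤ.suc z) ≈ x · x ^ z
      ^-suc x (+ n)          = refl
      ^-suc x -[1+ zero ]    = sym (trans (∙-congˡ (⁻¹-cong (identityʳ x))) (inverseʳ x))
      ^-suc x -[1+ suc n ]   = begin
        inv (x ^ⁿ suc n)                 ≈⟨ group! (gen (Fin.suc Fin.zero) ⁻¹)
                                              (gen Fin.zero ∙ (gen (Fin.suc Fin.zero) ∙ gen Fin.zero) ⁻¹)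
                                              ≡.refl (x Vec.∷ x ^ⁿ suc n Vec.∷ Vec.[]) ⟩
        x · inv (x ^ⁿ suc n · x)         ≈⟨ ∙-congˡ (⁻¹-cong (commute-^ⁿ (suc n) refl)) ⟨
        x · inv (x · x ^ⁿ suc n)         ∎

    ^-pred : ∀ x z → x ^ (ℤ.pred z) ≈ inv x · x ^ z
    ^-pred x z = begin
      x ^ ℤ.pred z                         ≈⟨ trans (sym (identityˡ _)) (trans (∙-congʳ (sym (inverseˡ x))) (assoc _ _ _)) ⟩
      inv x · (x · x ^ ℤ.pred z)           ≈⟨ ∙-congˡ (^-suc x (ℤ.pred z)) ⟨
      inv x · x ^ (ℤ.suc (ℤ.pred z))       ≡⟨ ≡.cong (λ t → inv x · x ^ t) (ℤ.suc-pred z) ⟩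
      inv x · x ^ z                        ∎

    opaque
      unfolding _^_

      -- The uniqueness of a homomorphism from ℤ with given value at 1. It yields the laws of
      -- exponents, and later identifies the explicit families of permutations with the powers of
      -- the generators.
      additive⇒power : (F : ℤ → C) → (∀ z → F (ℤ.suc z) ≈ F (+ 1) · F z) → F (+ 0) ≈ e →
                       ∀ z → F z ≈ F (+ 1) ^ z
      additive⇒power F step base (+ zero)  = base
      additive⇒power F step base (+ suc n) = trans (step (+ n)) (∙-congˡ (additive⇒power F step base (+ n)))
      additive⇒power F step base -[1+ n ]  = begin
        F -[1+ n ]                       ≈⟨ back -[1+ n ] ⟩
        inv (F (+ 1)) · F (ℤ.suc -[1+ n ])       ≈⟨ ∙-congˡ (earlier n) ⟩
        inv (F (+ 1)) · F (+ 1) ^ (ℤ.suc -[1+ n ]) ≈⟨ ^-pred (F (+ 1)) (ℤ.suc -[1+ n ]) ⟨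
        F (+ 1) ^ ℤ.pred (ℤ.suc -[1+ n ])          ≡⟨ ≡.cong (F (+ 1) ^_) (ℤ.pred-suc -[1+ n ]) ⟩
        F (+ 1) ^ -[1+ n ]               ∎
        where
        back : ∀ z → F z ≈ inv (F (+ 1)) · F (ℤ.suc z)
        back z = sym (trans (∙-congˡ (step z)) (trans (sym (assoc _ _ _)) (trans (∙-congʳ (inverseˡ _)) (identityˡ _))))
        earlier : ∀ n → F (ℤ.suc -[1+ n ]) ≈ F (+ 1) ^ (ℤ.suc -[1+ n ])
        earlier zero    = base
        earlier (suc n) = additive⇒power F step base -[1+ n ]

    ^-+ : ∀ x a b → x ^ (a ℤ.+ b) ≈ x ^ a · x ^ b
    ^-+ x a b = begin
      x ^ (a ℤ.+ b)                     ≈⟨ trans (sym (identityʳ _)) (trans (∙-congˡ (sym (inverseˡ (x ^ b)))) (sym (assoc _ _ _))) ⟩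
      x ^ (a ℤ.+ b) · inv (x ^ b) · x ^ b ≈⟨ ∙-congʳ (additive⇒power F step base a) ⟩
      F (+ 1) ^ a · x ^ b               ≈⟨ ∙-congʳ (^-cong a one) ⟩
      x ^ a · x ^ b                     ∎
      where
      F : ℤ → C
      F a = x ^ (a ℤ.+ b) · inv (x ^ b)
      one : F (+ 1) ≈ x
      one = trans (∙-congʳ (^-suc x b)) (trans (assoc _ _ _) (trans (∙-congˡ (inverseʳ _)) (identityʳ x)))
      step : ∀ z → F (ℤ.suc z) ≈ F (+ 1) · F z
      step z = begin
        x ^ (ℤ.suc z ℤ.+ b) · inv (x ^ b)   ≡⟨ ≡.cong (λ t → x ^ t · inv (x ^ b)) (ℤ.+-assoc (+ 1) z b) ⟩
        x ^ ℤ.suc (z ℤ.+ b) · inv (x ^ b)   ≈⟨ ∙-congʳ (^-suc x (z ℤ.+ b)) ⟩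
        x · x ^ (z ℤ.+ b) · inv (x ^ b)     ≈⟨ assoc _ _ _ ⟩
        x · F z                             ≈⟨ ∙-congʳ one ⟨
        F (+ 1) · F z                       ∎
      base : F (+ 0) ≈ e
      base = trans (∙-congʳ (reflexive (≡.cong (x ^_) (ℤ.+-identityˡ b)))) (inverseʳ _)

    ^-* : ∀ x a b → (x ^ a) ^ b ≈ x ^ (a ℤ.* b)
    ^-* x a b = sym (trans (additive⇒power F step base b) (^-cong b (reflexive (≡.cong (x ^_) (ℤ.*-identityʳ a)))))
      where
      F : ℤ → C
      F b = x ^ (a ℤ.* b)
      step : ∀ z → F (ℤ.suc z) ≈ F (+ 1) · F z
      step z = trans (reflexive (≡.cong (x ^_) (ℤ.*-distribˡ-+ a (+ 1) z))) (^-+ x (a ℤ.* + 1) (a ℤ.* z))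
      base : F (+ 0) ≈ e
      base = trans (reflexive (≡.cong (x ^_) (ℤ.*-zeroʳ a))) (^-0 x)

    ^-neg : ∀ x a → x ^ (ℤ.- a) ≈ inv (x ^ a)
    ^-neg x a = inverseʳ-unique _ _ (begin
      x ^ a · x ^ (ℤ.- a) ≈⟨ ^-+ x a (ℤ.- a) ⟨
      x ^ (a ℤ.+ ℤ.- a)   ≡⟨ ≡.cong (x ^_) (ℤ.+-inverseʳ a) ⟩
      x ^ (+ 0)           ≈⟨ ^-0 x ⟩
      e                   ∎)

    e^ⁿ : ∀ n → e ^ⁿ n ≈ e
    e^ⁿ zero    = refl
    e^ⁿ (suc n) = trans (identityˡ _) (e^ⁿ n)

    opaque
      unfolding _^_

      e^ : ∀ a → e ^ a ≈ e
      e^ (+ n)    = e^ⁿ n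
      e^ -[1+ n ] = trans (⁻¹-cong (e^ⁿ (suc n))) ε⁻¹≈ε

    ^-distrib : ∀ {x y} n → Commute x y → (x · y) ^ n ≈ x ^ n · y ^ n
    ^-distrib {x} {y} n c = sym (trans (additive⇒power F step base n) (^-cong n (∙-cong (^-1 x) (^-1 y))))
      where
      F : ℤ → C
      F n = x ^ n · y ^ n
      step : ∀ z → F (ℤ.suc z) ≈ F (+ 1) · F z
      step z = begin
        x ^ ℤ.suc z · y ^ ℤ.suc z     ≈⟨ ∙-cong (^-suc x z) (^-suc y z) ⟩
        x · x ^ z · (y · y ^ z)       ≈⟨ trans (assoc _ _ _) (∙-congˡ (sym (assoc _ _ _))) ⟩
        x · (x ^ z · y · y ^ z)       ≈⟨ ∙-congˡ (∙-congʳ (sym (commute-^ z (sym c)))) ⟩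
        x · (y · x ^ z · y ^ z)       ≈⟨ trans (∙-congˡ (assoc _ _ _)) (sym (assoc _ _ _)) ⟩
        x · y · F z                   ≈⟨ ∙-congʳ (∙-cong (^-1 x) (^-1 y)) ⟨
        F (+ 1) · F z                 ∎
      base : F (+ 0) ≈ e
      base = trans (∙-cong (^-0 x) (^-0 y)) (identityˡ e)

    conj : C → C → C
    conj g x = inv g · (x · g)

    conj-∙ : ∀ g x y → conj g (x · y) ≈ conj g x · conj g y
    conj-∙ g x y = group! (g′ ⁻¹ ∙ (x′ ∙ y′ ∙ g′)) (g′ ⁻¹ ∙ (x′ ∙ g′) ∙ (g′ ⁻¹ ∙ (y′ ∙ g′)))
      ≡.refl (g Vec.∷ x Vec.∷ y Vec.∷ Vec.[])
      where
      g′ x′ y′ : Word (Fin 3)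
      g′ = gen Fin.zero
      x′ = gen (Fin.suc Fin.zero)
      y′ = gen (Fin.suc (Fin.suc Fin.zero))

    conj-cong : ∀ g {x y} → x ≈ y → conj g x ≈ conj g y
    conj-cong g eq = ∙-congˡ (∙-congʳ eq)

    conj-e : ∀ g → conj g e ≈ e
    conj-e g = trans (∙-congˡ (identityˡ g)) (inverseˡ g)

    conj-^ : ∀ g x n → conj g (x ^ n) ≈ conj g x ^ n
    conj-^ g x n = trans (additive⇒power (λ n → conj g (x ^ n)) step (trans (conj-cong g (^-0 x)) (conj-e g)) n)
                         (^-cong n (conj-cong g (^-1 x)))
      where
      step : ∀ z → conj g (x ^ ℤ.suc z) ≈ conj g (x ^ (+ 1)) · conj g (x ^ z)
      step z = trans (conj-cong g (^-suc x z)) (trans (conj-∙ g x (x ^ z)) (∙-congʳ (conj-cong g (sym (^-1 x)))))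

-- Commuting a power of σ₂ past σ₁.

module Collect where

  open import Algebra.Bundles using (Group)
  open import Data.Fin using (Fin; zero; suc)
  open import Data.Integer as ℤ using (ℤ; +_; -[1+_])
  import Data.Integer.Properties as ℤ
  open import Data.Integer.Solver using (module +-*-Solver)
  open +-*-Solver using (solve; _:+_; _:*_; _:-_; :-_; con; _:=_)
  open import Data.Nat using (ℕ)
  import Data.Nat as ℕ
  open import Data.Product using (∃₂; _,_; ∃)
  open import Data.Vec using ([]; _∷_)
  open import Level using (0ℓ)
  open import Relation.Binary.PropositionalEquality as ≡ using (_≡_)
  open import Defs using (Word; gen; _∙_; _⁻¹)
  open GroupKit

  x₀ x₁ x₂ : Word (Fin 3)
  x₀ = gen zero
  x₁ = gen (suc zero)
  x₂ = gen (suc (suc zero))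

  data Parity : ℤ → Set where
    even : ∀ i → Parity (+ 2 ℤ.* i)
    odd  : ∀ i → Parity (+ 2 ℤ.* i ℤ.+ + 1)

  parity-suc : ∀ {z} → Parity z → Parity (ℤ.suc z)
  parity-suc (even i) = ≡.subst Parity (ℤ.+-comm (+ 2 ℤ.* i) (+ 1)) (odd i)
  parity-suc (odd i)  = ≡.subst Parity (solve 1 (λ i → con (+ 2) :* (i :+ con (+ 1))
    := con (+ 1) :+ (con (+ 2) :* i :+ con (+ 1))) ≡.refl i) (even (i ℤ.+ + 1))

  parity-neg : ∀ {z} → Parity z → Parity (ℤ.- z)
  parity-neg (even i) = ≡.subst Parity (solve 1 (λ i → con (+ 2) :* (:- i) := :- (con (+ 2) :* i)) ≡.refl i) (even (ℤ.- i))
  parity-neg (odd i)  = ≡.subst Parity (solve 1 (λ i → con (+ 2) :* (:- i :- con (+ 1)) :+ con (+ 1)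
    := :- (con (+ 2) :* i :+ con (+ 1))) ≡.refl i) (odd (ℤ.- i ℤ.- + 1))

  parity : ∀ n → Parity n
  parity (+ n)    = natural n
    where
    natural : ∀ n → Parity (+ n)
    natural ℕ.zero    = even (+ 0)
    natural (ℕ.suc n) = parity-suc (natural n)
  parity -[1+ n ] = parity-neg (parity (+ ℕ.suc n))

  module _ (G : Group 0ℓ 0ℓ) (J ε : ℤ) where

    open Group G using (Carrier; _≈_) renaming (_∙_ to _·_; ε to e; _⁻¹ to inv)
    open Powers G

    -- Only the relations between two neighbouring generators are assumed, so that the results apply
    -- both to σ₁, σ₂ and, by duality, to σ₃⁻¹, σ₂⁻¹.
    module TwoGenerators (a b : Carrier)
      (aᵖ : a ^ (+ 16 ℤ.* J) ≈ e) (b^q : b ^ (+ 32 ℤ.* J) ≈ e) (ab² : a · b · (a · b) ≈ e)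
      (b⁻¹a : inv b · a ≈ a ^ (-[1+ 0 ] ℤ.+ + 8 ℤ.* J) · b ^ (-[1+ 2 ] ℤ.+ ε ℤ.* (+ 8 ℤ.* J)))
      (ba⁻¹ : b · inv a ≈ a ^ (+ 1 ℤ.+ + 8 ℤ.* J) · b ^ (+ 3 ℤ.+ ε ℤ.* (+ 8 ℤ.* J)))
      where

      open Group G hiding (Carrier; _≈_; _∙_; ε; _⁻¹)
      open import Relation.Binary.Reasoning.Setoid setoid

      u s y : Carrier
      u = a ^ (+ 8 ℤ.* J)
      s = b ^ (+ 2)
      y = s · u

      ^-cong-≡ : ∀ x {m n} → m ≡ n → x ^ m ≈ x ^ n
      ^-cong-≡ x eq = reflexive (≡.cong (x ^_) eq)

      u² : u · u ≈ e
      u² = trans (sym (^-+ a (+ 8 ℤ.* J) (+ 8 ℤ.* J)))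
        (trans (^-cong-≡ a (solve 1 (λ j → con (+ 8) :* j :+ con (+ 8) :* j := con (+ 16) :* j) ≡.refl J)) aᵖ)

      inv-u : inv u ≈ u
      inv-u = begin
        inv u           ≈⟨ identityʳ _ ⟨
        inv u · e       ≈⟨ ∙-congˡ u² ⟨
        inv u · (u · u) ≈⟨ group! (x₀ ⁻¹ ∙ (x₀ ∙ x₀)) x₀ ≡.refl (u ∷ u ∷ u ∷ []) ⟩
        u               ∎

      sᴺ : ∀ n → s ^ (+ 16 ℤ.* J ℤ.* n) ≈ e
      sᴺ n = begin
        s ^ (+ 16 ℤ.* J ℤ.* n)               ≈⟨ ^-* b (+ 2) _ ⟩
        b ^ (+ 2 ℤ.* (+ 16 ℤ.* J ℤ.* n))     ≈⟨ ^-cong-≡ b (solve 2 (λ j n → con (+ 2) :* (con (+ 16) :* j :* n) := con (+ 32) :* j :* n) ≡.refl J n) ⟩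
        b ^ (+ 32 ℤ.* J ℤ.* n)               ≈⟨ ^-* b (+ 32 ℤ.* J) n ⟨
        (b ^ (+ 32 ℤ.* J)) ^ n               ≈⟨ ^-cong n b^q ⟩
        e ^ n                                ≈⟨ e^ n ⟩
        e                                    ∎

      s²≈bb : s ≈ b · b
      s²≈bb = ^-2 b

      b⁻¹a⁻¹ : inv b · inv a ≈ a · b
      b⁻¹a⁻¹ = begin
        inv b · inv a               ≈⟨ identityʳ _ ⟨
        inv b · inv a · e           ≈⟨ ∙-congˡ ab² ⟨
        inv b · inv a · (a · b · (a · b)) ≈⟨ group! (x₁ ⁻¹ ∙ x₀ ⁻¹ ∙ (x₀ ∙ x₁ ∙ (x₀ ∙ x₁))) (x₀ ∙ x₁) ≡.refl (a ∷ b ∷ b ∷ []) ⟩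
        a · b                       ∎

      ba : b · a ≈ inv a · inv b
      ba = begin
        b · a                       ≈⟨ identityˡ _ ⟨
        e · (b · a)                 ≈⟨ ∙-congʳ (trans (sym (inverseˡ _)) (∙-congˡ b⁻¹a⁻¹)) ⟩
        inv (inv b · inv a) · (a · b) · (b · a) ≈⟨ ∙-congʳ (∙-congʳ (⁻¹-cong b⁻¹a⁻¹)) ⟩
        inv (a · b) · (a · b) · (b · a) ≈⟨ ∙-congʳ (∙-congˡ b⁻¹a⁻¹) ⟨
        inv (a · b) · (inv b · inv a) · (b · a) ≈⟨ ∙-congʳ (∙-congʳ (⁻¹-cong b⁻¹a⁻¹)) ⟨
        inv (inv b · inv a) · (inv b · inv a) · (b · a) ≈⟨ trans (∙-congʳ (inverseˡ _)) (identityˡ _) ⟩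
        b · a                       ≈⟨ group! (x₁ ∙ x₀) (x₀ ⁻¹ ∙ ((x₀ ∙ x₁) ∙ (x₀ ∙ x₁)) ∙ x₁ ⁻¹) ≡.refl (a ∷ b ∷ b ∷ []) ⟩
        inv a · (a · b · (a · b)) · inv b ≈⟨ ∙-congʳ (∙-congˡ ab²) ⟩
        inv a · e · inv b           ≈⟨ ∙-congʳ (identityʳ _) ⟩
        inv a · inv b               ∎

      b-split : ∀ m n → b ^ (m ℤ.+ n) ≈ b ^ m · b ^ n
      b-split = ^-+ b

      s-power : ∀ n → s ^ n ≈ b ^ (+ 2 ℤ.* n)
      s-power = ^-* b (+ 2)

      -- Since (ab)² = 1, the product ba equals a⁻¹b⁻¹; hence a⁻¹b²a is a⁻¹(ba⁻¹)b⁻¹, and the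
      -- relation for ba⁻¹ applies.
      conj-s : conj a s ≈ u · s ^ (+ 1 ℤ.+ + 4 ℤ.* (ε ℤ.* J))
      conj-s = begin
        inv a · (s · a)                                 ≈⟨ group! (x₀ ⁻¹ ∙ (x₂ ∙ x₀)) (x₀ ⁻¹ ∙ (x₂ ∙ (x₀ ∙ x₁)) ∙ x₁ ⁻¹) ≡.refl (a ∷ b ∷ s ∷ []) ⟩
        inv a · (s · (a · b)) · inv b                   ≈⟨ ∙-congʳ (∙-congˡ (∙-cong s²≈bb (sym b⁻¹a⁻¹))) ⟩
        inv a · (b · b · (inv b · inv a)) · inv b       ≈⟨ ∙-congʳ (∙-congˡ (group! (x₁ ∙ x₁ ∙ (x₁ ⁻¹ ∙ x₀ ⁻¹)) (x₁ ∙ x₀ ⁻¹) ≡.refl (a ∷ b ∷ b ∷ []))) ⟩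
        inv a · (b · inv a) · inv b                     ≈⟨ ∙-congʳ (∙-congˡ ba⁻¹) ⟩
        inv a · (a ^ (+ 1 ℤ.+ + 8 ℤ.* J) · b ^ (+ 3 ℤ.+ ε ℤ.* (+ 8 ℤ.* J))) · inv b
          ≈⟨ ∙-congʳ (∙-congˡ (∙-cong (^-suc a (+ 8 ℤ.* J)) (trans (^-cong-≡ b (solve 2 (λ j e → con (+ 3) :+ e :* (con (+ 8) :* j)
               := con (+ 2) :* (con (+ 1) :+ con (+ 4) :* (e :* j)) :+ con (+ 1)) ≡.refl J ε)) (trans (b-split _ (+ 1)) (∙-cong (sym (s-power _)) (^-1 b)))))) ⟩
        inv a · (a · u · (s ^ (+ 1 ℤ.+ + 4 ℤ.* (ε ℤ.* J)) · b)) · inv b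
          ≈⟨ group! (y₀ ⁻¹ ∙ (y₀ ∙ y₂ ∙ (y₃ ∙ y₁)) ∙ y₁ ⁻¹) (y₂ ∙ y₃) ≡.refl (a ∷ b ∷ u ∷ s ^ (+ 1 ℤ.+ + 4 ℤ.* (ε ℤ.* J)) ∷ []) ⟩
        u · s ^ (+ 1 ℤ.+ + 4 ℤ.* (ε ℤ.* J))             ∎
        where
        y₀ y₁ y₂ y₃ : Word (Fin 4)
        y₀ = gen zero
        y₁ = gen (suc zero)
        y₂ = gen (suc (suc zero))
        y₃ = gen (suc (suc (suc zero)))

      -- The exponent is the inverse of 1 + 4εJ modulo 16J, so that t to the power 1 + 4εJ is s
      -- again.
      t : Carrier
      t = s ^ (+ 1 ℤ.- + 4 ℤ.* (ε ℤ.* J))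

      -- The relation for b⁻¹a gives a⁻¹u = b⁻¹a · b^(3 - 8εJ). Hence s a⁻¹ is ba · b^(3 - 8εJ) ·
      -- u⁻¹, and ba = a⁻¹b⁻¹ brings a⁻¹ to the front.
      sa⁻¹ : s · inv a ≈ inv a · (t · u)
      sa⁻¹ = begin
        s · inv a
          ≈⟨ group! (y₁ ∙ y₀ ⁻¹) (y₁ ∙ (y₀ ⁻¹ ∙ y₂ ∙ y₃ ⁻¹) ∙ (y₃ ∙ y₂ ⁻¹)) ≡.refl (a ∷ s ∷ u ∷ t′ ∷ []) ⟩
        s · (inv a · u · inv t′) · (t′ · inv u)
          ≈⟨ ∙-congʳ (∙-congˡ (∙-cong (sym (^-pred a (+ 8 ℤ.* J))) (sym (^-neg b _)))) ⟩
        s · (a ^ (-[1+ 0 ] ℤ.+ + 8 ℤ.* J) · b ^ (ℤ.- (+ 3 ℤ.- ε ℤ.* (+ 8 ℤ.* J)))) · (t′ · inv u)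
          ≈⟨ ∙-congʳ (∙-cong s²≈bb (∙-congˡ (^-cong-≡ b (solve 2 (λ j e → :- (con (+ 3) :- e :* (con (+ 8) :* j)) := con -[1+ 2 ] :+ e :* (con (+ 8) :* j)) ≡.refl J ε)))) ⟩
        b · b · (a ^ (-[1+ 0 ] ℤ.+ + 8 ℤ.* J) · b ^ (-[1+ 2 ] ℤ.+ ε ℤ.* (+ 8 ℤ.* J))) · (t′ · inv u)
          ≈⟨ ∙-cong (∙-congˡ b⁻¹a) refl ⟨
        b · b · (inv b · a) · (t′ · inv u)
          ≈⟨ ∙-congʳ (group! (x₁ ∙ x₁ ∙ (x₁ ⁻¹ ∙ x₀)) (x₁ ∙ x₀) ≡.refl (a ∷ b ∷ b ∷ [])) ⟩
        b · a · (t′ · inv u)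
          ≈⟨ ∙-cong ba (∙-cong (trans (^-cong-≡ b (solve 2 (λ j e → con (+ 3) :- e :* (con (+ 8) :* j)
                := con (+ 1) :+ con (+ 2) :* (con (+ 1) :- con (+ 4) :* (e :* j))) ≡.refl J ε))
                (trans (b-split (+ 1) _) (∙-cong (^-1 b) (sym (s-power _))))) inv-u) ⟩
        inv a · inv b · (b · t · u)
          ≈⟨ group! (y₀ ⁻¹ ∙ y₁ ⁻¹ ∙ (y₁ ∙ y₃ ∙ y₂)) (y₀ ⁻¹ ∙ (y₃ ∙ y₂)) ≡.refl (a ∷ b ∷ u ∷ t ∷ []) ⟩
        inv a · (t · u) ∎
        where
        y₀ y₁ y₂ y₃ : Word (Fin 4)
        y₀ = gen zero
        y₁ = gen (suc zero)
        y₂ = gen (suc (suc zero))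
        y₃ = gen (suc (suc (suc zero)))
        t′ : Carrier
        t′ = b ^ (+ 3 ℤ.- ε ℤ.* (+ 8 ℤ.* J))

      conj-u : conj a u ≈ u
      conj-u = trans (∙-congˡ (sym (commute-^ (+ 8 ℤ.* J) refl)))
        (group! (x₀ ⁻¹ ∙ (x₀ ∙ x₁)) x₁ ≡.refl (a ∷ u ∷ u ∷ []))

      conj-t : conj a t ≈ y
      conj-t = begin
        conj a t                  ≈⟨ group! x₀ (x₀ ∙ x₁ ∙ x₁ ⁻¹) ≡.refl (conj a t ∷ u ∷ u ∷ []) ⟩
        conj a t · u · inv u      ≈⟨ ∙-cong (∙-congˡ (sym conj-u)) inv-u ⟩
        conj a t · conj a u · u   ≈⟨ ∙-congʳ (conj-∙ a t u) ⟨
        conj a (t · u) · u        ≈⟨ ∙-congʳ (trans (sym (assoc _ _ _)) (∙-congʳ (sym sa⁻¹))) ⟩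
        s · inv a · a · u         ≈⟨ ∙-congʳ (trans (assoc _ _ _) (trans (∙-congˡ (inverseˡ a)) (identityʳ s))) ⟩
        s · u                     ∎

      -- The conjugate of s is evaluated in two ways: by `conj-s`, and by `conj-t` after writing s
      -- as t to the power 1 + 4εJ. Their comparison is what forces u and s to commute.
      y-power : y ^ (+ 1 ℤ.+ + 4 ℤ.* (ε ℤ.* J)) ≈ u · s ^ (+ 1 ℤ.+ + 4 ℤ.* (ε ℤ.* J))
      y-power = begin
        y ^ (+ 1 ℤ.+ + 4 ℤ.* (ε ℤ.* J))          ≈⟨ ^-cong _ conj-t ⟨
        conj a t ^ (+ 1 ℤ.+ + 4 ℤ.* (ε ℤ.* J))   ≈⟨ conj-^ a t _ ⟨
        conj a (t ^ (+ 1 ℤ.+ + 4 ℤ.* (ε ℤ.* J))) ≈⟨ conj-cong a (begin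
          t ^ (+ 1 ℤ.+ + 4 ℤ.* (ε ℤ.* J))        ≈⟨ ^-* s _ _ ⟩
          s ^ ((+ 1 ℤ.- + 4 ℤ.* (ε ℤ.* J)) ℤ.* (+ 1 ℤ.+ + 4 ℤ.* (ε ℤ.* J)))
            ≈⟨ ^-cong-≡ s (solve 2 (λ j e → (con (+ 1) :- con (+ 4) :* (e :* j)) :* (con (+ 1) :+ con (+ 4) :* (e :* j))
                 := con (+ 1) :+ con (+ 16) :* j :* (:- (e :* e :* j))) ≡.refl J ε) ⟩
          s ^ (+ 1 ℤ.+ + 16 ℤ.* J ℤ.* (ℤ.- (ε ℤ.* ε ℤ.* J))) ≈⟨ ^-suc s _ ⟩
          s · s ^ (+ 16 ℤ.* J ℤ.* (ℤ.- (ε ℤ.* ε ℤ.* J))) ≈⟨ trans (∙-congˡ (sᴺ _)) (identityʳ s) ⟩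
          s                                      ∎) ⟩
        conj a s                                 ≈⟨ conj-s ⟩
        u · s ^ (+ 1 ℤ.+ + 4 ℤ.* (ε ℤ.* J))      ∎

      yᴺ : ∀ n → y ^ (+ 16 ℤ.* J ℤ.* n) ≈ e
      yᴺ n = begin
        y ^ (+ 16 ℤ.* J ℤ.* n)         ≈⟨ ^-cong _ conj-t ⟨
        conj a t ^ (+ 16 ℤ.* J ℤ.* n)  ≈⟨ conj-^ a t _ ⟨
        conj a (t ^ (+ 16 ℤ.* J ℤ.* n)) ≈⟨ conj-cong a (trans (^-* s _ _) (trans (^-cong-≡ s
          (solve 3 (λ j e n → (con (+ 1) :- con (+ 4) :* (e :* j)) :* (con (+ 16) :* j :* n)
             := con (+ 16) :* j :* ((con (+ 1) :- con (+ 4) :* (e :* j)) :* n)) ≡.refl J ε n)) (sᴺ _))) ⟩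
        conj a e                       ≈⟨ conj-e a ⟩
        e                              ∎

      -- Multiplying `y-power` on the left by y = su makes the two factors u meet and cancel.
      even-powers : y ^ (+ 2 ℤ.+ + 4 ℤ.* (ε ℤ.* J)) ≈ s ^ (+ 2 ℤ.+ + 4 ℤ.* (ε ℤ.* J))
      even-powers = begin
        y ^ (+ 2 ℤ.+ + 4 ℤ.* (ε ℤ.* J))             ≈⟨ trans (^-cong-≡ y split) (^-suc y _) ⟩
        y · y ^ (+ 1 ℤ.+ + 4 ℤ.* (ε ℤ.* J))         ≈⟨ ∙-congˡ y-power ⟩
        s · u · (u · s ^ (+ 1 ℤ.+ + 4 ℤ.* (ε ℤ.* J))) ≈⟨ trans (assoc _ _ _) (∙-congˡ (trans (sym (assoc _ _ _)) (trans (∙-congʳ u²) (identityˡ _)))) ⟩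
        s · s ^ (+ 1 ℤ.+ + 4 ℤ.* (ε ℤ.* J))         ≈⟨ trans (^-cong-≡ s split) (^-suc s _) ⟨
        s ^ (+ 2 ℤ.+ + 4 ℤ.* (ε ℤ.* J))             ∎
        where
        split : + 2 ℤ.+ + 4 ℤ.* (ε ℤ.* J) ≡ ℤ.suc (+ 1 ℤ.+ + 4 ℤ.* (ε ℤ.* J))
        split = ℤ.+-assoc (+ 1) (+ 1) (+ 4 ℤ.* (ε ℤ.* J))

      -- 1 + 2εJ is invertible modulo 8J, with inverse (1 − 2εJ)(1 + 4ε²J²).
      squares : y ^ (+ 2) ≈ s ^ (+ 2)
      squares = trans (sym (root y yᴺ)) (trans (^-cong odd⁻¹ even-powers) (root s sᴺ))
        where
        odd⁻¹ : ℤ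
        odd⁻¹ = (+ 1 ℤ.- + 2 ℤ.* (ε ℤ.* J)) ℤ.* (+ 1 ℤ.+ + 4 ℤ.* (ε ℤ.* ε ℤ.* J ℤ.* J))
        root : ∀ x → (∀ n → x ^ (+ 16 ℤ.* J ℤ.* n) ≈ e) → (x ^ (+ 2 ℤ.+ + 4 ℤ.* (ε ℤ.* J))) ^ odd⁻¹ ≈ x ^ (+ 2)
        root x xᴺ = begin
          (x ^ (+ 2 ℤ.+ + 4 ℤ.* (ε ℤ.* J))) ^ odd⁻¹ ≈⟨ ^-* x _ _ ⟩
          x ^ ((+ 2 ℤ.+ + 4 ℤ.* (ε ℤ.* J)) ℤ.* odd⁻¹)
            ≈⟨ ^-cong-≡ x (solve 2 (λ j e → (con (+ 2) :+ con (+ 4) :* (e :* j)) :* ((con (+ 1) :- con (+ 2) :* (e :* j)) :* (con (+ 1) :+ con (+ 4) :* (e :* e :* j :* j)))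
                 := con (+ 2) :+ con (+ 16) :* j :* (:- (con (+ 2) :* e :* e :* e :* e :* j :* j :* j))) ≡.refl J ε) ⟩
          x ^ (+ 2 ℤ.+ + 16 ℤ.* J ℤ.* (ℤ.- (+ 2 ℤ.* ε ℤ.* ε ℤ.* ε ℤ.* ε ℤ.* J ℤ.* J ℤ.* J))) ≈⟨ trans (^-+ x (+ 2) _) (trans (∙-congˡ (xᴺ _)) (identityʳ _)) ⟩
          x ^ (+ 2) ∎

      -- From (su)² = s² follows usu = s, and u is an involution.
      u-s : Commute u s
      u-s = begin
        u · s                       ≈⟨ group! (x₁ ∙ x₀) (x₀ ⁻¹ ∙ (x₀ ∙ x₁ ∙ (x₀ ∙ x₁)) ∙ x₁ ⁻¹) ≡.refl (s ∷ u ∷ u ∷ []) ⟩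
        inv s · (y · y) · inv u     ≈⟨ ∙-cong (∙-congˡ (trans (sym (^-2 y)) (trans squares (^-2 s)))) inv-u ⟩
        inv s · (s · s) · u         ≈⟨ ∙-congʳ (group! (x₀ ⁻¹ ∙ (x₀ ∙ x₀)) x₀ ≡.refl (s ∷ s ∷ s ∷ [])) ⟩
        s · u                       ∎

      -- An even power of b passes a by `conj-s`. For an odd power, ba = a⁻¹b⁻¹ first leaves an even
      -- power to be moved past a⁻¹. As u and s commute, the i-th power of the conjugate of s splits
      -- into a power of a and a power of b.
      collect : ∀ n → ∃₂ λ i k → b ^ n · a ≈ a ^ i · b ^ k
      collect n with parity n
      ... | even i = + 1 ℤ.+ + 8 ℤ.* J ℤ.* i , + 2 ℤ.* (c ℤ.* i) , (begin
        b ^ (+ 2 ℤ.* i) · a                                        ≈⟨ ∙-congʳ (s-power i) ⟨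
        s ^ i · a                                                  ≈⟨ group! (x₁ ∙ x₀) (x₀ ∙ (x₀ ⁻¹ ∙ (x₁ ∙ x₀))) ≡.refl (a ∷ s ^ i ∷ a ∷ []) ⟩
        a · conj a (s ^ i)                                         ≈⟨ ∙-congˡ (trans (conj-^ a s i) (trans (^-cong i conj-s) (^-distrib i (commute-^ _ u-s)))) ⟩
        a · (u ^ i · (s ^ c) ^ i)                                  ≈⟨ trans (sym (assoc _ _ _)) (∙-cong (∙-cong (sym (^-1 a)) (^-* a _ i)) (trans (^-* s c i) (s-power _))) ⟩
        a ^ (+ 1) · a ^ (+ 8 ℤ.* J ℤ.* i) · b ^ (+ 2 ℤ.* (c ℤ.* i)) ≈⟨ ∙-congʳ (sym (^-+ a (+ 1) _)) ⟩
        a ^ (+ 1 ℤ.+ + 8 ℤ.* J ℤ.* i) · b ^ (+ 2 ℤ.* (c ℤ.* i))    ∎)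
        where
        c = + 1 ℤ.+ + 4 ℤ.* (ε ℤ.* J)
      ... | odd i = ℤ.pred (+ 8 ℤ.* J ℤ.* i) , + 2 ℤ.* (c ℤ.* i) ℤ.+ -[1+ 0 ] , (begin
        b ^ (+ 2 ℤ.* i ℤ.+ + 1) · a             ≈⟨ trans (∙-congʳ (trans (b-split _ (+ 1)) (∙-cong (sym (s-power i)) (^-1 b)))) (assoc _ _ _) ⟩
        s ^ i · (b · a)                         ≈⟨ ∙-congˡ ba ⟩
        s ^ i · (inv a · inv b)                 ≈⟨ group! (x₁ ∙ (x₀ ⁻¹ ∙ x₂)) (x₀ ⁻¹ ∙ ((x₀ ⁻¹) ⁻¹ ∙ (x₁ ∙ x₀ ⁻¹)) ∙ x₂) ≡.refl (a ∷ s ^ i ∷ inv b ∷ []) ⟩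
        inv a · conj (inv a) (s ^ i) · inv b    ≈⟨ ∙-congʳ (∙-congˡ (trans (conj-^ (inv a) s i) (^-cong i conj-inv))) ⟩
        inv a · (u · t) ^ i · inv b             ≈⟨ ∙-congʳ (∙-congˡ (^-distrib i (commute-^ _ u-s))) ⟩
        inv a · (u ^ i · t ^ i) · inv b         ≈⟨ trans (∙-congʳ (sym (assoc _ _ _))) (assoc _ _ _) ⟩
        inv a · u ^ i · (t ^ i · inv b)         ≈⟨ ∙-cong (trans (∙-congˡ (^-* a _ i)) (sym (^-pred a (+ 8 ℤ.* J ℤ.* i))))
                                                   (∙-cong (trans (^-* s _ i) (s-power _)) (trans (⁻¹-cong (sym (^-1 b))) (sym (^-neg b (+ 1))))) ⟩
        a ^ ℤ.pred (+ 8 ℤ.* J ℤ.* i) · (b ^ (+ 2 ℤ.* (c ℤ.* i)) · b ^ -[1+ 0 ]) ≈⟨ ∙-congˡ (^-+ b (+ 2 ℤ.* (c ℤ.* i)) -[1+ 0 ]) ⟨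
        a ^ ℤ.pred (+ 8 ℤ.* J ℤ.* i) · b ^ (+ 2 ℤ.* (c ℤ.* i) ℤ.+ -[1+ 0 ]) ∎)
        where
        c = + 1 ℤ.- + 4 ℤ.* (ε ℤ.* J)
        conj-inv : conj (inv a) s ≈ u · t
        conj-inv = trans (∙-congˡ sa⁻¹) (trans (group! (x₀ ⁻¹ ⁻¹ ∙ (x₀ ⁻¹ ∙ x₁)) x₁ ≡.refl (a ∷ t · u ∷ a ∷ [])) (sym (commute-^ _ u-s)))

      -- If σ₁ to the 8J is trivial then so is σ₂ to the 16J: raise
      -- σ₂⁻¹σ₁σ₂ = σ₁⁻¹sⁿ to the power 8J, where σ₁ acts on the powers of s
      -- by multiplication of exponents with k = 1 − 4εJ.
      module _ (u≈e : u ≈ e) where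
        private
          k M : ℤ
          k = + 1 ℤ.- + 4 ℤ.* (ε ℤ.* J)
          M = -[1+ 0 ] ℤ.+ + 4 ℤ.* (ε ℤ.* J)

          -- Here x is a power of a⁻¹ and r the same power of b⁻¹a⁻¹⁻¹b = b⁻¹ab. The exponents K and
          -- M matter only modulo 16J, the order of s dividing 16J.
          record Twisted (x r : Carrier) (K M : ℤ) : Set where
            field
              twist : ∀ n → s ^ n · x ≈ x · s ^ (K ℤ.* n)
              value : r ≈ x · s ^ M

          open Twisted

          twisted-square : ∀ {x r K M} → Twisted x r K M → Twisted (x · x) (r · r) (K ℤ.* K) (M ℤ.* (K ℤ.+ + 1))
          twisted-square {x} {r} {K} {M} t = record
            { twist = λ n → begin
                s ^ n · (x · x)                        ≈⟨ trans (sym (assoc _ _ _)) (∙-congʳ (twist t n)) ⟩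
                x · s ^ (K ℤ.* n) · x                  ≈⟨ trans (assoc _ _ _) (∙-congˡ (twist t (K ℤ.* n))) ⟩
                x · (x · s ^ (K ℤ.* (K ℤ.* n)))        ≈⟨ trans (sym (assoc _ _ _)) (∙-congˡ (^-cong-≡ s (≡.sym (ℤ.*-assoc K K n)))) ⟩
                x · x · s ^ (K ℤ.* K ℤ.* n)            ∎
            ; value = begin
                r · r                                  ≈⟨ ∙-cong (value t) (value t) ⟩
                x · s ^ M · (x · s ^ M)                ≈⟨ trans (assoc _ _ _) (∙-congˡ (trans (sym (assoc _ _ _)) (∙-congʳ (twist t M)))) ⟩
                x · (x · s ^ (K ℤ.* M) · s ^ M)        ≈⟨ trans (∙-congˡ (assoc _ _ _)) (sym (assoc _ _ _)) ⟩
                x · x · (s ^ (K ℤ.* M) · s ^ M)        ≈⟨ ∙-congˡ (trans (sym (^-+ s (K ℤ.* M) M))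
                                                            (^-cong-≡ s (solve 2 (λ k m → k :* m :+ m := m :* (k :+ con (+ 1))) ≡.refl K M))) ⟩
                x · x · s ^ (M ℤ.* (K ℤ.+ + 1))        ∎
            }

          r : Carrier
          r = conj b a

          first : Twisted (inv a) r k M
          first = record
            { twist = λ n → begin
                s ^ n · inv a                      ≈⟨ group! (x₁ ∙ x₀ ⁻¹) (x₀ ⁻¹ ∙ ((x₀ ⁻¹) ⁻¹ ∙ (x₁ ∙ x₀ ⁻¹))) ≡.refl (a ∷ s ^ n ∷ a ∷ []) ⟩
                inv a · conj (inv a) (s ^ n)       ≈⟨ ∙-congˡ (trans (conj-^ (inv a) s n) (^-cong n conj-inv)) ⟩
                inv a · (s ^ k) ^ n                ≈⟨ ∙-congˡ (^-* s k n) ⟩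
                inv a · s ^ (k ℤ.* n)              ∎
            ; value = begin
                inv b · (a · b)                    ≈⟨ trans (sym (assoc _ _ _)) (∙-congʳ b⁻¹a) ⟩
                a ^ (-[1+ 0 ] ℤ.+ + 8 ℤ.* J) · b ^ (-[1+ 2 ] ℤ.+ ε ℤ.* (+ 8 ℤ.* J)) · b
                  ≈⟨ trans (assoc _ _ _) (∙-cong (trans (^-pred a (+ 8 ℤ.* J)) (trans (∙-congˡ u≈e) (identityʳ _)))
                       (trans (∙-congˡ (sym (^-1 b))) (trans (sym (b-split (-[1+ 2 ] ℤ.+ ε ℤ.* (+ 8 ℤ.* J)) (+ 1)))
                         (trans (^-cong-≡ b (solve 2 (λ j e → con -[1+ 2 ] :+ e :* (con (+ 8) :* j) :+ con (+ 1) := con (+ 2) :* (con -[1+ 0 ] :+ con (+ 4) :* (e :* j))) ≡.refl J ε)) (sym (s-power M)))))) ⟩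
                inv a · s ^ M                      ∎
            }
            where
            conj-inv : conj (inv a) s ≈ s ^ k
            conj-inv = trans (∙-congˡ sa⁻¹) (trans (group! (x₀ ⁻¹ ⁻¹ ∙ (x₀ ⁻¹ ∙ (x₁ ∙ x₂))) (x₁ ∙ x₂) ≡.refl (a ∷ t ∷ u ∷ []))
              (trans (∙-congˡ u≈e) (identityʳ t)))

          reduce : ∀ {x r K M} K′ M′ p p′ → K ≡ K′ ℤ.+ + 16 ℤ.* J ℤ.* p → M ≡ M′ ℤ.+ + 16 ℤ.* J ℤ.* p′ → Twisted x r K M → Twisted x r K′ M′
          reduce {x} {r} {K} {M} K′ M′ p p′ K≡ M≡ t = record
            { twist = λ n → trans (twist t n) (∙-congˡ (trans (^-cong-≡ s (ℤ.*-comm K n)) (trans (^-cong-≡ s (≡.trans (≡.cong (n ℤ.*_) K≡)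
                (solve 4 (λ n k j p → n :* (k :+ con (+ 16) :* j :* p) := k :* n :+ con (+ 16) :* j :* (n :* p)) ≡.refl n K′ J p))) (periodic (K′ ℤ.* n) (n ℤ.* p)))))
            ; value = trans (value t) (∙-congˡ (trans (^-cong-≡ s M≡) (periodic M′ p′)))
            }
            where
            periodic : ∀ n p → s ^ (n ℤ.+ + 16 ℤ.* J ℤ.* p) ≈ s ^ n
            periodic n p = trans (^-+ s n _) (trans (∙-congˡ (sᴺ p)) (identityʳ _))

          -- Modulo 16J the multiplier k squares to 1 - 8εJ and then to 1, while M runs through -1 +
          -- 4εJ, -2 + 12εJ, -4 + 8εJ, -8. Three squarings thus remove every trace of ε.
          second = reduce (+ 1 ℤ.- + 8 ℤ.* (ε ℤ.* J)) (-[1+ 1 ] ℤ.+ + 12 ℤ.* (ε ℤ.* J)) (ε ℤ.* (ε ℤ.* J)) (ℤ.- (ε ℤ.* (ε ℤ.* J)))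
            (solve 2 (λ j ε → let k = con (+ 1) :- con (+ 4) :* (ε :* j) in
              k :* k := (con (+ 1) :- con (+ 8) :* (ε :* j)) :+ con (+ 16) :* j :* (ε :* (ε :* j))) ≡.refl J ε)
            (solve 2 (λ j ε → let k = con (+ 1) :- con (+ 4) :* (ε :* j) in
              (con -[1+ 0 ] :+ con (+ 4) :* (ε :* j)) :* (k :+ con (+ 1)) := (con -[1+ 1 ] :+ con (+ 12) :* (ε :* j)) :+ con (+ 16) :* j :* (:- (ε :* (ε :* j)))) ≡.refl J ε)
            (twisted-square first)

          fourth = reduce (+ 1) (-[1+ 3 ] ℤ.+ + 8 ℤ.* (ε ℤ.* J)) (+ 4 ℤ.* (ε ℤ.* (ε ℤ.* J)) ℤ.- ε) (+ 2 ℤ.* ε ℤ.- + 6 ℤ.* (ε ℤ.* (ε ℤ.* J)))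
            (solve 2 (λ j ε → let k = con (+ 1) :- con (+ 8) :* (ε :* j) in
              k :* k := con (+ 1) :+ con (+ 16) :* j :* (con (+ 4) :* (ε :* (ε :* j)) :- ε)) ≡.refl J ε)
            (solve 2 (λ j ε → let k = con (+ 1) :- con (+ 8) :* (ε :* j) in
              (con -[1+ 1 ] :+ con (+ 12) :* (ε :* j)) :* (k :+ con (+ 1)) := (con -[1+ 3 ] :+ con (+ 8) :* (ε :* j)) :+ con (+ 16) :* j :* (con (+ 2) :* ε :- con (+ 6) :* (ε :* (ε :* j)))) ≡.refl J ε)
            (twisted-square second)

          x8 : Carrier
          x8 = inv a · inv a · (inv a · inv a) · (inv a · inv a · (inv a · inv a))

          eighth : Twisted x8 (r · r · (r · r) · (r · r · (r · r))) (+ 1) -[1+ 7 ]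
          eighth = reduce (+ 1) -[1+ 7 ] (+ 0) ε
            (solve 1 (λ j → con (+ 1) :* con (+ 1) := con (+ 1) :+ con (+ 16) :* j :* con (+ 0)) ≡.refl J)
            (solve 2 (λ j ε → (con -[1+ 3 ] :+ con (+ 8) :* (ε :* j)) :* (con (+ 1) :+ con (+ 1)) := con -[1+ 7 ] :+ con (+ 16) :* j :* ε) ≡.refl J ε)
            (twisted-square fourth)

          power-8 : ∀ x → x · x · (x · x) · (x · x · (x · x)) ≈ x ^ (+ 8)
          power-8 x = begin
            x · x · (x · x) · (x · x · (x · x))       ≈⟨ ∙-cong (∙-cong (^-2 x) (^-2 x)) (∙-cong (^-2 x) (^-2 x)) ⟨
            x ^ (+ 2) · x ^ (+ 2) · (x ^ (+ 2) · x ^ (+ 2)) ≈⟨ ∙-cong (^-+ x (+ 2) (+ 2)) (^-+ x (+ 2) (+ 2)) ⟨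
            x ^ (+ 4) · x ^ (+ 4)                     ≈⟨ ^-+ x (+ 4) (+ 4) ⟨
            x ^ (+ 8)                                 ∎

          commute-8 : Commute x8 s
          commute-8 = sym (trans (∙-congʳ (sym (^-1 s))) (trans (twist eighth (+ 1)) (∙-congˡ (^-1 s))))

        degenerate : b ^ (+ 16 ℤ.* J) ≈ e
        degenerate = begin
          b ^ (+ 16 ℤ.* J)                            ≈⟨ ^-cong-≡ b (solve 1 (λ j → con (+ 16) :* j := con (+ 2) :* (con (+ 8) :* j)) ≡.refl J) ⟩
          b ^ (+ 2 ℤ.* (+ 8 ℤ.* J))                   ≈⟨ s-power (+ 8 ℤ.* J) ⟨
          s ^ (+ 8 ℤ.* J)                             ≈⟨ trans (sym (⁻¹-involutive _)) (trans (⁻¹-cong (trans (sym (^-neg s _)) trivial)) ε⁻¹≈ε) ⟩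
          e                                           ∎
          where
          open import Algebra.Properties.Group G using (⁻¹-involutive; ε⁻¹≈ε)
          -- The power r^(8J) is a conjugate of u and so trivial. It is also the product of the J-th
          -- powers of a⁻⁸ and s⁻⁸, and the first of these is u⁻¹.
          trivial : s ^ (ℤ.- (+ 8 ℤ.* J)) ≈ e
          trivial = begin
            s ^ (ℤ.- (+ 8 ℤ.* J))                     ≈⟨ ^-cong-≡ s (ℤ.neg-distribˡ-* (+ 8) J) ⟩
            s ^ (-[1+ 7 ] ℤ.* J)                      ≈⟨ ^-* s -[1+ 7 ] J ⟨
            (s ^ -[1+ 7 ]) ^ J                        ≈⟨ identityˡ _ ⟨
            e · (s ^ -[1+ 7 ]) ^ J                    ≈⟨ ∙-congʳ x8ᴶ ⟨
            x8 ^ J · (s ^ -[1+ 7 ]) ^ J               ≈⟨ ^-distrib J (commute-^ -[1+ 7 ] commute-8) ⟨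
            (x8 · s ^ -[1+ 7 ]) ^ J                   ≈⟨ ^-cong J (trans (sym (value eighth)) (power-8 r)) ⟩
            (r ^ (+ 8)) ^ J                           ≈⟨ ^-* r (+ 8) J ⟩
            r ^ (+ 8 ℤ.* J)                           ≈⟨ conj-^ b a (+ 8 ℤ.* J) ⟨
            conj b u                                  ≈⟨ trans (conj-cong b u≈e) (conj-e b) ⟩
            e                                         ∎
            where
            x8ᴶ : x8 ^ J ≈ e
            x8ᴶ = begin
              x8 ^ J                                  ≈⟨ ^-cong J (power-8 (inv a)) ⟩
              (inv a ^ (+ 8)) ^ J                     ≈⟨ ^-* (inv a) (+ 8) J ⟩
              inv a ^ (+ 8 ℤ.* J)                     ≈⟨ ^-cong (+ 8 ℤ.* J) (trans (⁻¹-cong (sym (^-1 a))) (sym (^-neg a (+ 1)))) ⟩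
              (a ^ -[1+ 0 ]) ^ (+ 8 ℤ.* J)            ≈⟨ ^-* a -[1+ 0 ] (+ 8 ℤ.* J) ⟩
              a ^ (-[1+ 0 ] ℤ.* (+ 8 ℤ.* J))          ≈⟨ ^-cong-≡ a (ℤ.*-comm -[1+ 0 ] (+ 8 ℤ.* J)) ⟩
              a ^ (+ 8 ℤ.* J ℤ.* -[1+ 0 ])            ≈⟨ ^-* a (+ 8 ℤ.* J) -[1+ 0 ] ⟨
              u ^ -[1+ 0 ]                            ≈⟨ trans (^-cong -[1+ 0 ] u≈e) (e^ -[1+ 0 ]) ⟩
              e                                       ∎

-- Consequences of the relations: mirror image, dual, normal form.

module Presentation where

  open import Algebra.Bundles using (Group)
  import Algebra.Properties.Group as GroupProperties
  open import Data.Fin using (zero; suc)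
  open import Data.Integer as ℤ using (ℤ; +_; -[1+_]; _◃_)
  import Data.Integer.Properties as ℤ
  open import Data.Integer.Solver using (module +-*-Solver)
  open +-*-Solver using (solve; _:+_; _:*_; _:-_; :-_; con; _:=_)
  open import Data.Nat as ℕ using (ℕ; zero; suc)
  open import Data.Product using (∃; ∃-syntax; ∃₂; _,_; _×_; proj₁; proj₂)
  open import Data.Sign using (Sign)
  open import Data.Vec using (Vec; []; _∷_)
  open import Level using (0ℓ)
  open import Relation.Binary.PropositionalEquality as ≡ using (_≡_)
  open import Defs hiding (_^_; refl; sym; trans; ∙-cong; ⁻¹-cong; assoc; identityˡ; identityʳ; inverseˡ; inverseʳ)
  open GroupKit
  open Collect

  unit : Sign → ℤ
  unit s = s ◃ 1

  ◃-unit : ∀ s n → s ◃ n ≡ unit s ℤ.* + n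
  ◃-unit Sign.+ n = ≡.trans (ℤ.+◃n≡+n n) (≡.sym (ℤ.*-identityˡ (+ n)))
  ◃-unit Sign.- n = ≡.trans (ℤ.-◃n≡-n n) (≡.sym (ℤ.-1*i≡-i (+ n)))

  -- The relations of Γ₃ with 2^(β-2) = 8J, imposed on three elements of an arbitrary group. The
  -- record is instantiated at Γ₃ itself, at the permutation groups of the model and at the
  -- automorphism group of a covered polytope.
  record Relations (G : Group 0ℓ 0ℓ) (J ε₁ ε₂ : ℤ) (a b c : Group.Carrier G) : Set where
    open Group G renaming (_∙_ to _·_; ε to e; _⁻¹ to inv)
    open Powers G
    field
      aᵖ   : a ^ (+ 16 ℤ.* J) ≈ e
      b^q  : b ^ (+ 32 ℤ.* J) ≈ e
      cᵖ   : c ^ (+ 16 ℤ.* J) ≈ e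
      ab²  : a · b · (a · b) ≈ e
      bc²  : b · c · (b · c) ≈ e
      abc² : a · b · c · (a · b · c) ≈ e
      b⁻¹a : inv b · a ≈ a ^ (-[1+ 0 ] ℤ.+ + 8 ℤ.* J) · b ^ (-[1+ 2 ] ℤ.+ ε₁ ℤ.* (+ 8 ℤ.* J))
      ba⁻¹ : b · inv a ≈ a ^ (+ 1 ℤ.+ + 8 ℤ.* J) · b ^ (+ 3 ℤ.+ ε₁ ℤ.* (+ 8 ℤ.* J))
      c⁻¹b : inv c · b ≈ b ^ (+ 3 ℤ.+ ε₂ ℤ.* (+ 8 ℤ.* J)) · c ^ (+ 1 ℤ.+ + 8 ℤ.* J)
      cb⁻¹ : c · inv b ≈ b ^ (-[1+ 2 ] ℤ.+ ε₂ ℤ.* (+ 8 ℤ.* J)) · c ^ (-[1+ 0 ] ℤ.+ + 8 ℤ.* J)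

  module Consequences {G : Group 0ℓ 0ℓ} {J ε₁ ε₂ : ℤ} {a b c : Group.Carrier G}
    (R : Relations G J ε₁ ε₂ a b c) where

    open Group G renaming (Carrier to C; _∙_ to _·_; ε to e; _⁻¹ to inv)
    open GroupProperties G
    open Powers G
    open Relations R
    open import Relation.Binary.Reasoning.Setoid setoid

    ^-≡ : ∀ x {m n} → m ≡ n → x ^ m ≈ x ^ n
    ^-≡ x eq = reflexive (≡.cong (x ^_) eq)

    inv-^ : ∀ x n → inv x ^ n ≈ x ^ (ℤ.- n)
    inv-^ x n = begin
      inv x ^ n              ≈⟨ ^-cong n (trans (⁻¹-cong (sym (^-1 x))) (sym (^-neg x (+ 1)))) ⟩
      (x ^ -[1+ 0 ]) ^ n     ≈⟨ ^-* x -[1+ 0 ] n ⟩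
      x ^ (-[1+ 0 ] ℤ.* n)   ≡⟨ ≡.cong (x ^_) (ℤ.-1*i≡-i n) ⟩
      x ^ (ℤ.- n)            ∎

    inv-e : ∀ {x} → x ≈ e → inv x ≈ e
    inv-e eq = trans (⁻¹-cong eq) ε⁻¹≈ε

    shift : ∀ x {n} → x ^ n ≈ e → ∀ m → x ^ (m ℤ.+ n) ≈ x ^ m
    shift x {n} xⁿ m = trans (^-+ x m n) (trans (∙-congˡ xⁿ) (identityʳ _))

    order : ∀ {x n} → x ^ n ≈ e → x ^ (ℤ.- n) ≈ e
    order xⁿ = trans (^-neg _ _) (inv-e xⁿ)

    cyclic² : ∀ {x y} → x · y · (x · y) ≈ e → y · x · (y · x) ≈ e
    cyclic² {x} {y} eq = begin
      y · x · (y · x)                     ≈⟨ group! (x₁ ∙ x₀ ∙ (x₁ ∙ x₀)) (x₀ ⁻¹ ∙ (x₀ ∙ x₁ ∙ (x₀ ∙ x₁)) ∙ x₀) ≡.refl (x ∷ y ∷ y ∷ []) ⟩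
      inv x · (x · y · (x · y)) · x       ≈⟨ ∙-congʳ (trans (∙-congˡ eq) (identityʳ _)) ⟩
      inv x · x                           ≈⟨ inverseˡ x ⟩
      e                                   ∎

    -- As t = t⁻¹, the element (x⁻¹t)² is the inverse of (tx)².
    involution-inverts : ∀ {x t} → t · t ≈ e → x · t · (x · t) ≈ e → inv x · t · (inv x · t) ≈ e
    involution-inverts {x} {t} t² xt² = begin
      inv x · t · (inv x · t)               ≈⟨ ∙-cong (∙-congˡ t⁻¹) (∙-congˡ t⁻¹) ⟩
      inv x · inv t · (inv x · inv t)       ≈⟨ group! (x₀ ⁻¹ ∙ x₁ ⁻¹ ∙ (x₀ ⁻¹ ∙ x₁ ⁻¹)) ((x₁ ∙ x₀ ∙ (x₁ ∙ x₀)) ⁻¹) ≡.refl (x ∷ t ∷ t ∷ []) ⟩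
      inv (t · x · (t · x))                 ≈⟨ inv-e (cyclic² xt²) ⟩
      e                                     ∎
      where
      t⁻¹ : t ≈ inv t
      t⁻¹ = inverseʳ-unique t t t²

    bc : b · c ≈ inv c · inv b
    bc = trans (inverseˡ-unique _ _ bc²) (⁻¹-anti-homo-∙ b c)
    c′ : b · b · c ≈ b · (inv c · inv b)
    c′ = trans (assoc b b c) (∙-congˡ bc)
    mirror-power : ∀ n → (b · b · c) ^ n ≈ b · (c ^ (ℤ.- n) · inv b)
    mirror-power n = begin
      (b · b · c) ^ n                  ≈⟨ ^-cong n (trans c′ (∙-congʳ (sym (⁻¹-involutive b)))) ⟩
      conj (inv b) (inv c) ^ n         ≈⟨ conj-^ (inv b) (inv c) n ⟨
      conj (inv b) (inv c ^ n)         ≈⟨ ∙-cong (⁻¹-involutive b) (∙-congʳ (inv-^ c n)) ⟩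
      b · (c ^ (ℤ.- n) · inv b)        ∎

    -- The mirror image with respect to the 1-adjacent flag.
    mirror : b ^ (+ 16 ℤ.* J) ≈ e → Relations G J ε₁ ε₂ (inv a) (inv b) (b · b · c)
    mirror z = record
      { aᵖ   = trans (inv-^ a _) (order aᵖ)
      ; b^q  = trans (inv-^ b _) (order b^q)
      ; cᵖ   = trans (mirror-power _) (trans (∙-congˡ (trans (∙-congʳ (order cᵖ)) (identityˡ _))) (inverseʳ b))
      ; ab²  = trans (group! (x₀ ⁻¹ ∙ x₁ ⁻¹ ∙ (x₀ ⁻¹ ∙ x₁ ⁻¹)) ((x₁ ∙ x₀ ∙ (x₁ ∙ x₀)) ⁻¹) ≡.refl (a ∷ b ∷ b ∷ []))
                 (inv-e (cyclic² ab²))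
      ; bc²  = trans (group! (x₀ ⁻¹ ∙ (x₀ ∙ x₀ ∙ x₁) ∙ (x₀ ⁻¹ ∙ (x₀ ∙ x₀ ∙ x₁))) (x₀ ∙ x₁ ∙ (x₀ ∙ x₁)) ≡.refl (b ∷ c ∷ c ∷ [])) bc²
      ; abc² = trans (group! (x₀ ⁻¹ ∙ x₁ ⁻¹ ∙ (x₁ ∙ x₁ ∙ x₂) ∙ (x₀ ⁻¹ ∙ x₁ ⁻¹ ∙ (x₁ ∙ x₁ ∙ x₂)))
                             (x₀ ⁻¹ ∙ (x₁ ∙ x₂) ∙ (x₀ ⁻¹ ∙ (x₁ ∙ x₂))) ≡.refl (a ∷ b ∷ c ∷ []))
                 (involution-inverts bc² (trans (∙-cong (sym (assoc a b c)) (sym (assoc a b c))) abc²))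
      -- Inverting a and b carries the relation for ba⁻¹ to this one up to the factor b^(16Jε), and
      -- conversely; the hypothesis removes that factor. The exponents of a differ by 16J only.
      ; b⁻¹a = trans (∙-congʳ (⁻¹-involutive b)) (trans ba⁻¹ (sym (∙-cong
                 (trans (inv-^ a _) (trans (sym (shift a aᵖ _)) (^-≡ a (solve 1 (λ j → :- (con -[1+ 0 ] :+ con (+ 8) :* j) :+ con (+ 16) :* j := con (+ 1) :+ con (+ 8) :* j) ≡.refl J))))
                 (trans (inv-^ b _) (trans (sym (shift b (zⁿ ε₁) _)) (^-≡ b (solve 2 (λ j s → :- (con -[1+ 2 ] :+ s :* (con (+ 8) :* j)) :+ con (+ 16) :* j :* s := con (+ 3) :+ s :* (con (+ 8) :* j)) ≡.refl J ε₁)))))))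
      ; ba⁻¹ = trans (∙-congˡ (⁻¹-involutive a)) (trans b⁻¹a (sym (∙-cong
                 (trans (inv-^ a _) (trans (sym (shift a aᵖ _)) (^-≡ a (solve 1 (λ j → :- (con (+ 1) :+ con (+ 8) :* j) :+ con (+ 16) :* j := con -[1+ 0 ] :+ con (+ 8) :* j) ≡.refl J))))
                 (trans (inv-^ b _) (trans (sym (shift b (zⁿ ε₁) _)) (^-≡ b (solve 2 (λ j s → :- (con (+ 3) :+ s :* (con (+ 8) :* j)) :+ con (+ 16) :* j :* s := con -[1+ 2 ] :+ s :* (con (+ 8) :* j)) ≡.refl J ε₁)))))))
      ; c⁻¹b = begin
          inv (b · b · c) · inv b                   ≈⟨ ∙-congʳ (trans (⁻¹-cong c′) (group! ((x₀ ∙ (x₁ ⁻¹ ∙ x₀ ⁻¹)) ⁻¹) (x₀ ∙ (x₁ ∙ x₀ ⁻¹)) ≡.refl (b ∷ c ∷ c ∷ []))) ⟩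
          b · (c · inv b) · inv b                   ≈⟨ ∙-congʳ (∙-congˡ cb⁻¹) ⟩
          b · (b ^ (-[1+ 2 ] ℤ.+ ε₂ ℤ.* (+ 8 ℤ.* J)) · c ^ (-[1+ 0 ] ℤ.+ + 8 ℤ.* J)) · inv b ≈⟨ through _ _ ⟩
          b ^ (-[1+ 2 ] ℤ.+ ε₂ ℤ.* (+ 8 ℤ.* J)) · (b · (c ^ (-[1+ 0 ] ℤ.+ + 8 ℤ.* J) · inv b)) ≈⟨ ∙-cong
            (trans (inv-^ b _) (trans (sym (shift b (zⁿ ε₂) _)) (^-≡ b (solve 2 (λ j s → :- (con (+ 3) :+ s :* (con (+ 8) :* j)) :+ con (+ 16) :* j :* s := con -[1+ 2 ] :+ s :* (con (+ 8) :* j)) ≡.refl J ε₂))))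
            (trans (mirror-power _) (∙-congˡ (∙-congʳ (trans (sym (shift c cᵖ _)) (^-≡ c (solve 1 (λ j → :- (con (+ 1) :+ con (+ 8) :* j) :+ con (+ 16) :* j := con -[1+ 0 ] :+ con (+ 8) :* j) ≡.refl J)))))) ⟨
          inv b ^ (+ 3 ℤ.+ ε₂ ℤ.* (+ 8 ℤ.* J)) · (b · b · c) ^ (+ 1 ℤ.+ + 8 ℤ.* J) ∎
      ; cb⁻¹ = begin
          b · b · c · inv (inv b)                   ≈⟨ ∙-cong c′ refl ⟩
          b · (inv c · inv b) · inv (inv b)         ≈⟨ group! (x₀ ∙ (x₁ ⁻¹ ∙ x₀ ⁻¹) ∙ x₀ ⁻¹ ⁻¹) (x₀ ∙ (x₁ ⁻¹ ∙ x₀) ∙ x₀ ⁻¹) ≡.refl (b ∷ c ∷ c ∷ []) ⟩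
          b · (inv c · b) · inv b                   ≈⟨ ∙-congʳ (∙-congˡ c⁻¹b) ⟩
          b · (b ^ (+ 3 ℤ.+ ε₂ ℤ.* (+ 8 ℤ.* J)) · c ^ (+ 1 ℤ.+ + 8 ℤ.* J)) · inv b ≈⟨ through _ _ ⟩
          b ^ (+ 3 ℤ.+ ε₂ ℤ.* (+ 8 ℤ.* J)) · (b · (c ^ (+ 1 ℤ.+ + 8 ℤ.* J) · inv b)) ≈⟨ ∙-cong
            (trans (inv-^ b _) (trans (sym (shift b (zⁿ ε₂) _)) (^-≡ b (solve 2 (λ j s → :- (con -[1+ 2 ] :+ s :* (con (+ 8) :* j)) :+ con (+ 16) :* j :* s := con (+ 3) :+ s :* (con (+ 8) :* j)) ≡.refl J ε₂))))
            (trans (mirror-power _) (∙-congˡ (∙-congʳ (trans (sym (shift c cᵖ _)) (^-≡ c (solve 1 (λ j → :- (con -[1+ 0 ] :+ con (+ 8) :* j) :+ con (+ 16) :* j := con (+ 1) :+ con (+ 8) :* j) ≡.refl J)))))) ⟨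
          inv b ^ (-[1+ 2 ] ℤ.+ ε₂ ℤ.* (+ 8 ℤ.* J)) · (b · b · c) ^ (-[1+ 0 ] ℤ.+ + 8 ℤ.* J) ∎
      }
      where
      zⁿ : ∀ n → b ^ (+ 16 ℤ.* J ℤ.* n) ≈ e
      zⁿ n = trans (sym (^-* b _ n)) (trans (^-cong n z) (e^ n))
      through : ∀ m n → b · (b ^ m · c ^ n) · inv b ≈ b ^ m · (b · (c ^ n · inv b))
      through m n = begin
        b · (b ^ m · c ^ n) · inv b      ≈⟨ trans (∙-congʳ (sym (assoc _ _ _))) (assoc _ _ _) ⟩
        b · b ^ m · (c ^ n · inv b)      ≈⟨ ∙-congʳ (commute-^ m refl) ⟩
        b ^ m · b · (c ^ n · inv b)      ≈⟨ assoc _ _ _ ⟩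
        b ^ m · (b · (c ^ n · inv b))    ∎

    -- Reversing the order of a polytope replaces its rotations by these. Each of the four extra
    -- relations is the inverse of one of the others, with the two signs exchanged.
    dual : Relations G J ε₂ ε₁ (inv c) (inv b) (inv a)
    dual = record
      { aᵖ   = trans (inv-^ c _) (order cᵖ)
      ; b^q  = trans (inv-^ b _) (order b^q)
      ; cᵖ   = trans (inv-^ a _) (order aᵖ)
      ; ab²  = reverse² bc²
      ; bc²  = reverse² ab²
      ; abc² = trans (group! (x₀ ⁻¹ ∙ x₁ ⁻¹ ∙ x₂ ⁻¹ ∙ (x₀ ⁻¹ ∙ x₁ ⁻¹ ∙ x₂ ⁻¹)) ((x₂ ∙ x₁ ∙ x₀ ∙ (x₂ ∙ x₁ ∙ x₀)) ⁻¹) ≡.refl (c ∷ b ∷ a ∷ [])) (inv-e abc²)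
      ; b⁻¹a = reverse cb⁻¹
      ; ba⁻¹ = reverse c⁻¹b
      ; c⁻¹b = reverse ba⁻¹
      ; cb⁻¹ = reverse b⁻¹a
      }
      where
      reverse² : ∀ {x y} → x · y · (x · y) ≈ e → inv y · inv x · (inv y · inv x) ≈ e
      reverse² {x} {y} eq = trans (group! (x₀ ⁻¹ ∙ x₁ ⁻¹ ∙ (x₀ ⁻¹ ∙ x₁ ⁻¹)) ((x₁ ∙ x₀ ∙ (x₁ ∙ x₀)) ⁻¹) ≡.refl (y ∷ x ∷ x ∷ [])) (inv-e eq)
      reverse : ∀ {x y u v m n} → x · y ≈ u ^ m · v ^ n → inv y · inv x ≈ inv v ^ n · inv u ^ m
      reverse {x} {y} {u} {v} {m} {n} eq = begin
        inv y · inv x               ≈⟨ ⁻¹-anti-homo-∙ x y ⟨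
        inv (x · y)                 ≈⟨ trans (⁻¹-cong eq) (⁻¹-anti-homo-∙ _ _) ⟩
        inv (v ^ n) · inv (u ^ m)   ≈⟨ ∙-cong (trans (inv-^ v n) (^-neg v n)) (trans (inv-^ u m) (^-neg u m)) ⟨
        inv v ^ n · inv u ^ m       ∎

  module Degenerate {G : Group 0ℓ 0ℓ} {J ε₁ ε₂ : ℤ} {a b c : Group.Carrier G} (R : Relations G J ε₁ ε₂ a b c) where

    open Group G renaming (Carrier to C; _∙_ to _·_; ε to e; _⁻¹ to inv)
    open Powers G
    open Relations R
    open Consequences R
    private
      module AB = TwoGenerators G J ε₁ a b aᵖ b^q ab² b⁻¹a ba⁻¹
      module R* = Relations dual
      module CB = TwoGenerators G J ε₂ (inv c) (inv b) R*.aᵖ R*.b^q R*.ab² R*.b⁻¹a R*.ba⁻¹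

    first-degenerate : a ^ (+ 8 ℤ.* J) ≈ e → b ^ (+ 16 ℤ.* J) ≈ e
    first-degenerate = AB.degenerate

    third-degenerate : c ^ (+ 8 ℤ.* J) ≈ e → b ^ (+ 16 ℤ.* J) ≈ e
    third-degenerate cᵐ = trans (sym (trans (⁻¹-cong (trans (inv-^ b _) (^-neg b _))) (⁻¹-involutive _)))
        (inv-e (CB.degenerate (trans (inv-^ c _) (order cᵐ))))
      where open GroupProperties G

  module NormalForm {G : Group 0ℓ 0ℓ} {J ε₁ ε₂ : ℤ} {a b c : Group.Carrier G} (R : Relations G J ε₁ ε₂ a b c)
    (p q : ℕ) (p-eq : + suc p ≡ + 16 ℤ.* J) (q-eq : + suc q ≡ + 32 ℤ.* J) where

    open Group G renaming (Carrier to C; _∙_ to _·_; ε to e; _⁻¹ to inv)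
    open GroupProperties G
    open Powers G
    open Relations R
    open Consequences R
    open import Relation.Binary.Reasoning.Setoid setoid
    private
      module AB = TwoGenerators G J ε₁ a b aᵖ b^q ab² b⁻¹a ba⁻¹
      module R* = Relations dual
      module CB = TwoGenerators G J ε₂ (inv c) (inv b) R*.aᵖ R*.b^q R*.ab² R*.b⁻¹a R*.ba⁻¹

    -- The exponent -(n + 1) is raised by the multiple (k + 1)(n + 1) of the order. It allows the
    -- generators to be moved one at a time, by induction on a natural number.
    natural-power : ∀ x k → x ^ (+ suc k) ≈ e → ∀ m → ∃[ n ] x ^ m ≈ x ^ (+ n)
    natural-power x k xᵏ (+ n)    = n , refl
    natural-power x k xᵏ -[1+ n ] = k ℕ.* suc n , (begin
      x ^ -[1+ n ]                                    ≈⟨ shift x (trans (sym (^-* x _ _)) (trans (^-cong (+ suc n) xᵏ) (e^ _))) -[1+ n ] ⟨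
      x ^ (-[1+ n ] ℤ.+ + suc k ℤ.* + suc n)          ≡⟨ ≡.cong (x ^_) (≡.trans (solve 2 (λ k n → :- n :+ (con (+ 1) :+ k) :* n := k :* n) ≡.refl (+ k) (+ suc n)) (≡.sym (ℤ.pos-* k (suc n)))) ⟩
      x ^ (+ (k ℕ.* suc n))                           ∎)

    -- The inverse of `collect` for the dual pair c⁻¹, b⁻¹.
    cb : ∀ n → ∃₂ λ i k → c · b ^ n ≈ b ^ i · c ^ k
    cb n with CB.collect n
    ... | i , k , eq = k , i , (begin
      c · b ^ n                           ≈⟨ ∙-cong (⁻¹-involutive c) (trans (⁻¹-cong (trans (inv-^ b n) (^-neg b n))) (⁻¹-involutive _)) ⟨
      inv (inv c) · inv (inv b ^ n)       ≈⟨ ⁻¹-anti-homo-∙ _ _ ⟨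
      inv (inv b ^ n · inv c)             ≈⟨ trans (⁻¹-cong eq) (⁻¹-anti-homo-∙ _ _) ⟩
      inv (inv b ^ k) · inv (inv c ^ i)   ≈⟨ ∙-cong (trans (⁻¹-cong (trans (inv-^ b k) (^-neg b k))) (⁻¹-involutive _)) (trans (⁻¹-cong (trans (inv-^ c i) (^-neg c i))) (⁻¹-involutive _)) ⟩
      b ^ k · c ^ i                       ∎)

    cⁿb : ∀ m n → ∃₂ λ i k → c ^ (+ m) · b ^ n ≈ b ^ i · c ^ k
    cⁿb zero    n = n , + 0 , trans (∙-congʳ (^-0 c)) (trans (identityˡ _) (sym (trans (∙-congˡ (^-0 c)) (identityʳ _))))
    cⁿb (suc m) n = step (cⁿb m n)
      where
      step : (∃₂ λ i k → c ^ (+ m) · b ^ n ≈ b ^ i · c ^ k) → ∃₂ λ i k → c ^ (+ suc m) · b ^ n ≈ b ^ i · c ^ k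
      step (i , k , eq) = let i′ , k′ , eq′ = cb i in i′ , k′ ℤ.+ k , (begin
        c ^ (+ suc m) · b ^ n        ≈⟨ trans (∙-congʳ (^-suc c (+ m))) (assoc _ _ _) ⟩
        c · (c ^ (+ m) · b ^ n)      ≈⟨ trans (∙-congˡ eq) (sym (assoc _ _ _)) ⟩
        c · b ^ i · c ^ k            ≈⟨ trans (∙-congʳ eq′) (assoc _ _ _) ⟩
        b ^ i′ · (c ^ k′ · c ^ k)    ≈⟨ ∙-congˡ (^-+ c k′ k) ⟨
        b ^ i′ · c ^ (k′ ℤ.+ k)      ∎)

    c^b : ∀ m n → ∃₂ λ i k → c ^ m · b ^ n ≈ b ^ i · c ^ k
    c^b m n = let m′ , eq = natural-power c p (trans (^-≡ c p-eq) cᵖ) m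
                  i , k , eq′ = cⁿb m′ n
              in i , k , trans (∙-congʳ eq) eq′

    Normal : C → Set
    Normal x = ∃₂ λ i k → ∃[ l ] x ≈ a ^ i · b ^ k · c ^ l

    normal-c : ∀ {x} → Normal x → Normal (x · c)
    normal-c {x} (i , k , l , eq) = i , k , l ℤ.+ + 1 , (begin
      x · c                                  ≈⟨ ∙-cong eq (sym (^-1 c)) ⟩
      a ^ i · b ^ k · c ^ l · c ^ (+ 1)      ≈⟨ trans (assoc _ _ _) (∙-congˡ (sym (^-+ c l (+ 1)))) ⟩
      a ^ i · b ^ k · c ^ (l ℤ.+ + 1)        ∎)

    normal-b : ∀ {x} → Normal x → Normal (x · b)
    normal-b {x} (i , k , l , eq) with c^b l (+ 1)
    ... | k′ , l′ , eq′ = i , k ℤ.+ k′ , l′ , (begin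
      x · b                                  ≈⟨ ∙-cong eq (sym (^-1 b)) ⟩
      a ^ i · b ^ k · c ^ l · b ^ (+ 1)      ≈⟨ trans (assoc _ _ _) (∙-congˡ eq′) ⟩
      a ^ i · b ^ k · (b ^ k′ · c ^ l′)      ≈⟨ trans (sym (assoc _ _ _)) (∙-congʳ (trans (assoc _ _ _) (∙-congˡ (sym (^-+ b k k′))))) ⟩
      a ^ i · b ^ (k ℤ.+ k′) · c ^ l′        ∎)

    -- Because (ab)² = (abc)² = 1, the involution ab inverts c.
    c^a : ∀ l → c ^ l · a ≈ a · (b · (c ^ (ℤ.- l) · b ^ -[1+ 0 ]))
    c^a l = begin
      c ^ l · a                              ≈⟨ group! (x₂ ∙ x₀) (x₀ ∙ x₁ ∙ ((x₀ ∙ x₁) ⁻¹ ∙ (x₂ ∙ (x₀ ∙ x₁))) ∙ x₁ ⁻¹) ≡.refl (a ∷ b ∷ c ^ l ∷ []) ⟩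
      a · b · conj (a · b) (c ^ l) · inv b   ≈⟨ ∙-cong (∙-congˡ (trans (conj-^ _ c l) (trans (^-cong l inverted) (inv-^ c l)))) (trans (⁻¹-cong (sym (^-1 b))) (sym (^-neg b (+ 1)))) ⟩
      a · b · c ^ (ℤ.- l) · b ^ -[1+ 0 ]     ≈⟨ trans (assoc _ _ _) (assoc _ _ _) ⟩
      a · (b · (c ^ (ℤ.- l) · b ^ -[1+ 0 ])) ∎
      where
      inverted : conj (a · b) c ≈ inv c
      inverted = begin
        inv (a · b) · (c · (a · b))          ≈⟨ ∙-congʳ (inverseˡ-unique _ _ ab²) ⟨
        a · b · (c · (a · b))                ≈⟨ group! (x₀ ∙ x₁ ∙ (x₂ ∙ (x₀ ∙ x₁))) (x₀ ∙ x₁ ∙ x₂ ∙ (x₀ ∙ x₁ ∙ x₂) ∙ x₂ ⁻¹) ≡.refl (a ∷ b ∷ c ∷ []) ⟩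
        a · b · c · (a · b · c) · inv c      ≈⟨ trans (∙-congʳ abc²) (identityˡ _) ⟩
        inv c                                ∎

    normal-a : ∀ {x} → Normal x → Normal (x · a)
    normal-a {x} (i , k , l , eq) with AB.collect k | c^b (ℤ.- l) -[1+ 0 ]
    ... | i′ , k′ , eq′ | k″ , l′ , eq″ = i ℤ.+ i′ , k′ ℤ.+ (+ 1 ℤ.+ k″) , l′ , (begin
      x · a                                              ≈⟨ trans (∙-congʳ eq) (assoc _ _ _) ⟩
      a ^ i · b ^ k · (c ^ l · a)                        ≈⟨ ∙-congˡ (trans (c^a l) (∙-congˡ (∙-congˡ eq″))) ⟩
      a ^ i · b ^ k · (a · (b · (b ^ k″ · c ^ l′)))      ≈⟨ trans (assoc _ _ _) (∙-congˡ (trans (sym (assoc _ _ _)) (∙-cong eq′ (trans (sym (assoc _ _ _)) (∙-congʳ (sym (^-suc b k″))))))) ⟩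
      a ^ i · (a ^ i′ · b ^ k′ · (b ^ (+ 1 ℤ.+ k″) · c ^ l′)) ≈⟨ ∙-congˡ (trans (assoc _ _ _) (∙-congˡ (trans (sym (assoc _ _ _)) (∙-congʳ (sym (^-+ b k′ _)))))) ⟩
      a ^ i · (a ^ i′ · (b ^ (k′ ℤ.+ (+ 1 ℤ.+ k″)) · c ^ l′)) ≈⟨ trans (sym (assoc _ _ _)) (∙-congʳ (sym (^-+ a i i′))) ⟩
      a ^ (i ℤ.+ i′) · (b ^ (k′ ℤ.+ (+ 1 ℤ.+ k″)) · c ^ l′) ≈⟨ assoc _ _ _ ⟨
      a ^ (i ℤ.+ i′) · b ^ (k′ ℤ.+ (+ 1 ℤ.+ k″)) · c ^ l′ ∎)

    normal-cong : ∀ {x y} → x ≈ y → Normal x → Normal y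
    normal-cong eq (i , k , l , eq′) = i , k , l , trans (sym eq) eq′

    normal-inv : ∀ g k → g ^ (+ suc k) ≈ e → (∀ {x} → Normal x → Normal (x · g)) → ∀ {x} → Normal x → Normal (x · inv g)
    normal-inv g k gᵏ step {x} nx with natural-power g k gᵏ -[1+ 0 ]
    ... | n , eq = normal-cong (∙-congˡ (trans (sym eq) (trans (^-neg g (+ 1)) (⁻¹-cong (^-1 g))))) (go n)
      where
      go : ∀ n → Normal (x · g ^ (+ n))
      go zero    = normal-cong (sym (trans (∙-congˡ (^-0 g)) (identityʳ x))) nx
      go (suc n) = normal-cong (trans (assoc _ _ _) (∙-congˡ (trans (sym (commute-^ (+ n) refl)) (sym (^-suc g (+ n)))))) (step (go n))

    generators : Vec C 3
    generators = a ∷ b ∷ c ∷ []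

    -- A word and its inverse are treated together, since the induction for an inverted word calls
    -- the other half.
    multiply : ∀ w {x} → Normal x → Normal (x · ⟦ w ⟧ generators) × Normal (x · inv (⟦ w ⟧ generators))
    multiply (gen zero) nx             = normal-a nx , normal-inv a p (trans (^-≡ a p-eq) aᵖ) normal-a nx
    multiply (gen (suc zero)) nx       = normal-b nx , normal-inv b q (trans (^-≡ b q-eq) b^q) normal-b nx
    multiply (gen (suc (suc zero))) nx = normal-c nx , normal-inv c p (trans (^-≡ c p-eq) cᵖ) normal-c nx
    multiply ε nx = normal-cong (sym (identityʳ _)) nx , normal-cong (sym (trans (∙-congˡ ε⁻¹≈ε) (identityʳ _))) nx
    multiply (u ∙ v) nx =
      normal-cong (assoc _ _ _) (proj₁ (multiply v (proj₁ (multiply u nx)))) ,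
      normal-cong (trans (assoc _ _ _) (∙-congˡ (sym (⁻¹-anti-homo-∙ _ _)))) (proj₂ (multiply u (proj₂ (multiply v nx))))
    multiply (u ⁻¹) nx with multiply u nx
    ... | p , q = q , normal-cong (∙-congˡ (sym (⁻¹-involutive _))) p

    normal : ∀ w → Normal (⟦ w ⟧ generators)
    normal w = normal-cong (identityˡ _) (proj₁ (multiply w (+ 0 , + 0 , + 0 ,
      sym (trans (∙-cong (∙-cong (^-0 a) (^-0 b)) (^-0 c)) (trans (identityʳ _) (identityʳ e))))))

-- Evaluation of words and the universal property of Γ₃.

module Universal where

  open import Algebra.Bundles using (Group)
  open import Data.Fin using (Fin; zero; suc)
  open import Data.Integer as ℤ using (ℤ; +_; -[1+_]; _◃_)
  open import Data.Nat as ℕ using (ℕ; zero; suc)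
  open import Data.Sign using (Sign)
  open import Data.Sum using (inj₁; inj₂)
  open import Data.Vec using (Vec; []; _∷_)
  open import Level using (0ℓ)
  open import Relation.Binary.Core using (Rel)
  open import Relation.Binary.Construct.Union using (_∪_)
  open import Relation.Binary.PropositionalEquality as ≡ using (_≡_)
  open import Defs using (Word; gen; ε; _∙_; _⁻¹; _^ℕ_; Equal; relation; ⟨_∣_⟩; σ₁; σ₂; σ₃; Rotation; Extra)
  open Rotation
  open Extra
  import Defs as D
  open GroupKit
  open Presentation

  module _ (G : Group 0ℓ 0ℓ) where
    open Group G renaming (Carrier to C; _∙_ to _·_; ε to e; _⁻¹ to inv)
    open Powers G

    eval-^ⁿ : ∀ {n} (ρ : Vec C n) w k → ⟦ w ^ℕ k ⟧ ρ ≡ ⟦ w ⟧ ρ ^ⁿ k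
    eval-^ⁿ ρ w zero    = ≡.refl
    eval-^ⁿ ρ w (suc k) = ≡.cong (⟦ w ⟧ ρ ·_) (eval-^ⁿ ρ w k)

    eval-^ : ∀ {n} (ρ : Vec C n) w z → ⟦ w D.^ z ⟧ ρ ≡ ⟦ w ⟧ ρ ^ z
    eval-^ ρ w z = ≡.trans (lemma z) (≡.sym (^≡^ᶻ (⟦ w ⟧ ρ) z))
      where
      lemma : ∀ z → ⟦ w D.^ z ⟧ ρ ≡ ⟦ w ⟧ ρ ^ᶻ z
      lemma (+ k)    = eval-^ⁿ ρ w k
      lemma -[1+ k ] = ≡.cong inv (eval-^ⁿ ρ w (suc k))

    eval-sound : ∀ {n} (ρ : Vec C n) {R : Rel (Word (Fin n)) 0ℓ} → (∀ {u v} → R u v → ⟦ u ⟧ ρ ≈ ⟦ v ⟧ ρ) →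
                 ∀ {u v} → Equal R u v → ⟦ u ⟧ ρ ≈ ⟦ v ⟧ ρ
    eval-sound ρ sound (relation r)     = sound r
    eval-sound ρ sound D.refl           = refl
    eval-sound ρ sound (D.sym p)        = sym (eval-sound ρ sound p)
    eval-sound ρ sound (D.trans p q)    = trans (eval-sound ρ sound p) (eval-sound ρ sound q)
    eval-sound ρ sound (D.∙-cong p q)   = ∙-cong (eval-sound ρ sound p) (eval-sound ρ sound q)
    eval-sound ρ sound (D.⁻¹-cong p)    = ⁻¹-cong (eval-sound ρ sound p)
    eval-sound ρ sound (D.assoc u v w)  = assoc _ _ _
    eval-sound ρ sound (D.identityˡ u)  = identityˡ _
    eval-sound ρ sound (D.identityʳ u)  = identityʳ _
    eval-sound ρ sound (D.inverseˡ u)   = inverseˡ _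
    eval-sound ρ sound (D.inverseʳ u)   = inverseʳ _

  module Γ (p q m : ℕ) (ε₁ ε₂ : Sign) (J : ℤ)
    (p-eq : + p ≡ + 16 ℤ.* J) (q-eq : + q ≡ + 32 ℤ.* J) (m-eq : + m ≡ + 8 ℤ.* J) where

    R : Rel (Word (Fin 3)) 0ℓ
    R = Rotation p q p ∪ Extra m ε₁ ε₂

    group : Group 0ℓ 0ℓ
    group = ⟨ Fin 3 ∣ R ⟩

    ◃m : ∀ s → s ◃ m ≡ unit s ℤ.* (+ 8 ℤ.* J)
    ◃m s = ≡.trans (◃-unit s m) (≡.cong (unit s ℤ.*_) m-eq)

    -- Von Dyck's theorem. Evaluation is by recursion on words, so compatibility with products and
    -- inverses is definitional and only the relations are left to check.
    universal : ∀ {G a b c} → Relations G J (unit ε₁) (unit ε₂) a b c → ∀ {u v} → Equal R u v →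
                Group._≈_ G (Powers.⟦_⟧ G u (a ∷ b ∷ c ∷ [])) (Powers.⟦_⟧ G v (a ∷ b ∷ c ∷ []))
    universal {G} {a} {b} {c} rel = eval-sound G ρ sound
      where
      open Group G renaming (Carrier to C; _∙_ to _·_; ε to e; _⁻¹ to inv)
      open Powers G
      open Relations rel
      ρ : Vec C 3
      ρ = a ∷ b ∷ c ∷ []
      power : ∀ w {z z′} → z ≡ z′ → ⟦ w D.^ z ⟧ ρ ≈ ⟦ w ⟧ ρ ^ z′
      power w ≡.refl = reflexive (eval-^ G ρ w _)
      square : ∀ x → ⟦ x D.^ (+ 2) ⟧ ρ ≈ ⟦ x ⟧ ρ · ⟦ x ⟧ ρ
      square x = ∙-congˡ (identityʳ _)
      sound : ∀ {u v} → R u v → ⟦ u ⟧ ρ ≈ ⟦ v ⟧ ρ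
      sound (inj₁ σ₁^p)    = trans (power σ₁ p-eq) aᵖ
      sound (inj₁ σ₂^q)    = trans (power σ₂ q-eq) b^q
      sound (inj₁ σ₃^r)    = trans (power σ₃ p-eq) cᵖ
      sound (inj₁ σ₁σ₂²)   = trans (square (σ₁ ∙ σ₂)) ab²
      sound (inj₁ σ₂σ₃²)   = trans (square (σ₂ ∙ σ₃)) bc²
      sound (inj₁ σ₁σ₂σ₃²) = trans (square (σ₁ ∙ σ₂ ∙ σ₃)) abc²
      sound (inj₂ σ₂⁻¹σ₁)  = trans b⁻¹a (sym (∙-cong (power σ₁ (≡.cong (ℤ._+_ -[1+ 0 ]) m-eq)) (power σ₂ (≡.cong (ℤ._+_ -[1+ 2 ]) (◃m ε₁)))))
      sound (inj₂ σ₂σ₁⁻¹)  = trans ba⁻¹ (sym (∙-cong (power σ₁ (≡.cong (ℤ._+_ (+ 1)) m-eq)) (power σ₂ (≡.cong (ℤ._+_ (+ 3)) (◃m ε₁)))))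
      sound (inj₂ σ₃⁻¹σ₂)  = trans c⁻¹b (sym (∙-cong (power σ₂ (≡.cong (ℤ._+_ (+ 3)) (◃m ε₂))) (power σ₃ (≡.cong (ℤ._+_ (+ 1)) m-eq))))
      sound (inj₂ σ₃σ₂⁻¹)  = trans cb⁻¹ (sym (∙-cong (power σ₂ (≡.cong (ℤ._+_ -[1+ 2 ]) (◃m ε₂))) (power σ₃ (≡.cong (ℤ._+_ -[1+ 0 ]) m-eq))))

    open Powers group using (_^_; _^ⁿ_; _^ᶻ_; ^≡^ᶻ)

    word-^ : ∀ w z → w D.^ z ≡ w ^ z
    word-^ w z = ≡.trans (lemma z) (≡.sym (^≡^ᶻ w z))
      where
      natural : ∀ k → w ^ℕ k ≡ w ^ⁿ k
      natural zero    = ≡.refl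
      natural (suc k) = ≡.cong (w ∙_) (natural k)
      lemma : ∀ z → w D.^ z ≡ w ^ᶻ z
      lemma (+ k)    = natural k
      lemma -[1+ k ] = ≡.cong _⁻¹ (natural (suc k))

    relations : Relations group J (unit ε₁) (unit ε₂) σ₁ σ₂ σ₃
    relations = record
      { aᵖ   = trans (sym (power σ₁ p-eq)) (relation (inj₁ σ₁^p))
      ; b^q  = trans (sym (power σ₂ q-eq)) (relation (inj₁ σ₂^q))
      ; cᵖ   = trans (sym (power σ₃ p-eq)) (relation (inj₁ σ₃^r))
      ; ab²  = trans (sym (square (σ₁ ∙ σ₂))) (relation (inj₁ σ₁σ₂²))
      ; bc²  = trans (sym (square (σ₂ ∙ σ₃))) (relation (inj₁ σ₂σ₃²))
      ; abc² = trans (sym (square (σ₁ ∙ σ₂ ∙ σ₃))) (relation (inj₁ σ₁σ₂σ₃²))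
      ; b⁻¹a = trans (relation (inj₂ σ₂⁻¹σ₁)) (∙-cong (power σ₁ (≡.cong (ℤ._+_ -[1+ 0 ]) m-eq)) (power σ₂ (≡.cong (ℤ._+_ -[1+ 2 ]) (◃m ε₁))))
      ; ba⁻¹ = trans (relation (inj₂ σ₂σ₁⁻¹)) (∙-cong (power σ₁ (≡.cong (ℤ._+_ (+ 1)) m-eq)) (power σ₂ (≡.cong (ℤ._+_ (+ 3)) (◃m ε₁))))
      ; c⁻¹b = trans (relation (inj₂ σ₃⁻¹σ₂)) (∙-cong (power σ₂ (≡.cong (ℤ._+_ (+ 3)) (◃m ε₂))) (power σ₃ (≡.cong (ℤ._+_ (+ 1)) m-eq)))
      ; cb⁻¹ = trans (relation (inj₂ σ₃σ₂⁻¹)) (∙-cong (power σ₂ (≡.cong (ℤ._+_ -[1+ 2 ]) (◃m ε₂))) (power σ₃ (≡.cong (ℤ._+_ -[1+ 0 ]) m-eq)))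
      }
      where
      open Group group using (sym; trans; ∙-cong; ∙-congˡ; identityʳ; reflexive)
      power : ∀ w {z z′} → z ≡ z′ → Equal R (w D.^ z) (w ^ z′)
      power w ≡.refl = reflexive (word-^ w _)
      square : ∀ x → Equal R (x D.^ (+ 2)) (x ∙ x)
      square x = ∙-congˡ (identityʳ x)

    open Powers group using (⟦_⟧)

    eval-self : ∀ w → ⟦ w ⟧ (σ₁ ∷ σ₂ ∷ σ₃ ∷ []) ≡ w
    eval-self (gen zero)             = ≡.refl
    eval-self (gen (suc zero))       = ≡.refl
    eval-self (gen (suc (suc zero))) = ≡.refl
    eval-self ε                      = ≡.refl
    eval-self (u ∙ v)                = ≡.cong₂ _∙_ (eval-self u) (eval-self v)
    eval-self (u ⁻¹)                 = ≡.cong _⁻¹ (eval-self u)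

-- Permutation groups, and the polynomial action on 2-faces.

module Half where

  open import Algebra.Bundles using (Group)
  open import Data.Bool using (true)
  open import Data.Fin.Patterns
  open import Data.Integer as ℤ using (ℤ; +_; -[1+_])
  import Data.Integer.Properties as ℤ
  open import Data.Integer.Solver using (module +-*-Solver)
  open import Data.Product using (_×_; _,_; proj₂)
  open import Data.Product.Relation.Binary.Pointwise.NonDependent using (×-setoid)
  open import Data.Vec using (Vec; []; _∷_)
  open import Level using (0ℓ)
  open import Relation.Binary.Bundles using (Setoid)
  open import Relation.Binary.PropositionalEquality as ≡ using (_≡_)
  open GroupKit
  open Modular

  module _ (S : Setoid 0ℓ 0ℓ) where
    open Setoid S

    record Permutation : Set where
      no-eta-equality
      field
        to      : Carrier → Carrier
        from    : Carrier → Carrier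
        to-cong : ∀ {x y} → x ≈ y → to x ≈ to y
        from-cong : ∀ {x y} → x ≈ y → from x ≈ from y
        to-from : ∀ x → to (from x) ≈ x
        from-to : ∀ x → from (to x) ≈ x

      to-injective : ∀ {x y} → to x ≈ to y → x ≈ y
      to-injective {x} {y} eq = trans (sym (from-to x)) (trans (from-cong eq) (from-to y))

    open Permutation

    record Agree (f g : Permutation) : Set where
      constructor agree
      field at : ∀ x → to f x ≈ to g x

    open Agree

    -- Permutations act on the right.
    permutations : Group 0ℓ 0ℓ
    permutations = record
      { Carrier = Permutation
      ; _≈_ = Agree
      ; _∙_ = λ f g → record
          { to        = λ x → to g (to f x)
          ; from      = λ x → from f (from g x)
          ; to-cong   = λ eq → to-cong g (to-cong f eq)
          ; from-cong = λ eq → from-cong f (from-cong g eq)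
          ; to-from   = λ x → trans (to-cong g (to-from f _)) (to-from g x)
          ; from-to   = λ x → trans (from-cong f (from-to g _)) (from-to f x)
          }
      ; ε = record { to = λ x → x ; from = λ x → x ; to-cong = λ eq → eq ; from-cong = λ eq → eq
                   ; to-from = λ _ → refl ; from-to = λ _ → refl }
      ; _⁻¹ = λ f → record { to = from f ; from = to f ; to-cong = from-cong f ; from-cong = to-cong f
                           ; to-from = from-to f ; from-to = to-from f }
      ; isGroup = record
        { isMonoid = record
          { isSemigroup = record
            { isMagma = record
              { isEquivalence = record
                { refl = agree λ _ → refl ; sym = λ p → agree λ x → sym (at p x)
                ; trans = λ p q → agree λ x → trans (at p x) (at q x) }
              ; ∙-cong = λ {f} {g} {h} {k} p q → agree λ x → trans (to-cong h (at p x)) (at q (to g x))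
              }
            ; assoc = λ _ _ _ → agree λ _ → refl
            }
          ; identity = (λ _ → agree λ _ → refl) , (λ _ → agree λ _ → refl)
          }
        ; inverse = (λ f → agree (to-from f)) , (λ f → agree (from-to f))
        ; ⁻¹-cong = λ {f} {g} p → agree λ x → trans (sym (from-cong f (to-from g x)))
            (trans (from-cong f (sym (at p (from g x)))) (from-to f (from g x)))
        }
      }

  infix 9 κ_

  κ_ : ∀ {n} → Expr n → Expr n
  κ e = con (+ 4) ⊗ 𝕁 ⊗ e

  μ : ∀ {n} → Expr n
  μ = con (+ 8) ⊗ 𝕁

  -- In the form 1 + 2δ the parity of a sign is visible to the decision procedure, which can then
  -- replace 8Jε by 8J.
  sign : ∀ {n} → Expr n → Expr n
  sign δ = con (+ 1) ⊕ con (+ 2) ⊗ δ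

  -- The coordinates of (w , z)σ₁ⁿ, of (w , z)σ₂²ⁿ and of (w , z)σ₂, as
  -- polynomials in the signs and in w and z.
  module Formulas {n} (ε₁ ε₂ : Expr n) where

    -- Modulo 4J these are affine maps: σ₁ⁿ is (w + nz , z), σ₂²ⁿ is (w + n , z), and σ₂ is (w - z ,
    -- -z - 1). The terms with factor 4J or 8J are corrections under which the relations hold modulo
    -- 16J.
    rot-w rot-z sq-w sq-z : Expr n → Expr n → Expr n → Expr n
    rot-w n w z = w ⊕ n ⊗ z ⊕ κ ε₁ ⊗ (n ⊗ w ⊕ ⟨tri⟩ n ⊗ z) ⊕ κ ε₂ ⊗ n ⊗ ⟨tri⟩ z ⊕ μ ⊗ ⟨tri⟩ n ⊗ ⟨tri⟩ z
    rot-z n w z = z ⊕ μ ⊗ n ⊗ ⟨tri⟩ z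
    sq-w n w z  = w ⊕ n ⊕ κ ε₂ ⊗ n ⊗ z
    sq-z n w z  = z ⊕ μ ⊗ n ⊗ z

    turn-w turn-z : Expr n → Expr n → Expr n
    turn-w w z = w ⊖ z ⊕ κ ε₂ ⊗ (⟨tri⟩ z ⊕ z ⊖ w)
    turn-z w z = ⊝ z ⊖ con (+ 1) ⊕ μ ⊗ (⟨tri⟩ z ⊕ w ⊖ z)

    -- Powers of σ₁ and of σ₂² act on a facet as on the second coordinate of a 2-face. The formula
    -- for σ₂ differs because σ₂ exchanges the roles of the two facets of a 2-face.
    facet-rot facet-sq : Expr n → Expr n → Expr n
    facet-rot n z = z ⊕ μ ⊗ n ⊗ ⟨tri⟩ z
    facet-sq n z  = z ⊕ μ ⊗ n ⊗ z

    facet-turn : Expr n → Expr n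
    facet-turn z = ⊝ z ⊕ μ ⊗ ⟨tri⟩ z

  module Congruence (J : ℤ) where
    open Semantics J

    ≈-refl : ∀ {a} → a ≈ a
    ≈-refl {a} = multiple (+ 0) (≡.sym (ℤ.+-identityʳ a))

    ≈-reflexive : ∀ {a b} → a ≡ b → a ≈ b
    ≈-reflexive ≡.refl = ≈-refl

    opaque
      ≈-sym : ∀ {a b} → a ≈ b → b ≈ a
      ≈-sym {a} {b} (multiple q eq) = multiple (ℤ.- q) (≡.sym (≡.trans (≡.cong (λ t → t ℤ.+ ℤ.- q ℤ.* (+ 16 ℤ.* J)) eq)
        (solve 3 (λ b q n → b :+ q :* n :+ :- q :* n := b) ≡.refl b q (+ 16 ℤ.* J))))
        where open +-*-Solver

      ≈-trans : ∀ {a b c} → a ≈ b → b ≈ c → a ≈ c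
      ≈-trans {a} {b} {c} (multiple q eq) (multiple r eq′) = multiple (q ℤ.+ r) (≡.trans eq (≡.trans (≡.cong (λ t → t ℤ.+ q ℤ.* (+ 16 ℤ.* J)) eq′)
        (solve 4 (λ c q r n → c :+ r :* n :+ q :* n := c :+ (q :+ r) :* n) ≡.refl c q r (+ 16 ℤ.* J))))
        where open +-*-Solver

    ℤ/N : Setoid 0ℓ 0ℓ
    ℤ/N = record { Carrier = ℤ ; _≈_ = _≈_ ; isEquivalence = record
      { refl = ≈-refl ; sym = ≈-sym ; trans = ≈-trans } }

    ℤ/N² : Setoid 0ℓ 0ℓ
    ℤ/N² = ×-setoid ℤ/N ℤ/N

  -- The action on 2-faces (w , z) and facets z.
  module Upper (J δ₁ δ₂ : ℤ) where
    open Semantics J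
    open Congruence J
    open Setoid ℤ/N² using () renaming (_≈_ to _≋_; trans to ≋-trans; sym to ≋-sym; refl to ≋-refl)

    private
      V = Expr 6
      e₁ e₂ l m w z : V
      e₁ = sign (var 0F)
      e₂ = sign (var 1F)
      l = var 2F
      m = var 3F
      w = var 4F
      z = var 5F
      open Formulas e₁ e₂

      env : ℤ → ℤ → ℤ → ℤ → Vec ℤ 6
      env l m w z = δ₁ ∷ δ₂ ∷ l ∷ m ∷ w ∷ z ∷ []

      both! : (a b c d : V) → congruent a c ≡ true → congruent b d ≡ true → ∀ ρ → (⟦ a ⟧ ρ , ⟦ b ⟧ ρ) ≋ (⟦ c ⟧ ρ , ⟦ d ⟧ ρ)
      both! a b c d p q ρ = mod! a c p ρ , mod! b d q ρ

    rot sq : ℤ → ℤ × ℤ → ℤ × ℤ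
    rot n (w′ , z′) = ⟦ rot-w l w z ⟧ (env n n w′ z′) , ⟦ rot-z l w z ⟧ (env n n w′ z′)
    sq n (w′ , z′) = ⟦ sq-w l w z ⟧ (env n n w′ z′) , ⟦ sq-z l w z ⟧ (env n n w′ z′)

    turn : ℤ × ℤ → ℤ × ℤ
    turn (w′ , z′) = ⟦ turn-w w z ⟧ (env w′ z′ w′ z′) , ⟦ turn-z w z ⟧ (env w′ z′ w′ z′)

    up : ℤ → ℤ × ℤ → ℤ × ℤ
    up n (w , z) = w , z ℤ.+ n

    w+ z+ : V
    w+ = w ⊕ l ⊗ (con (+ 16) ⊗ 𝕁)
    z+ = z ⊕ m ⊗ (con (+ 16) ⊗ 𝕁)

    opaque
      rot-cong : ∀ n {x y} → x ≋ y → rot n x ≋ rot n y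
      rot-cong n {_} {w′ , z′} (multiple q ≡.refl , multiple r ≡.refl) =
         mod! (F.rot-w N (W ⊕ Q ⊗ (con (+ 16) ⊗ 𝕁)) (Z ⊕ R ⊗ (con (+ 16) ⊗ 𝕁))) (F.rot-w N W Z) ≡.refl ρ ,
         mod! (F.rot-z N (W ⊕ Q ⊗ (con (+ 16) ⊗ 𝕁)) (Z ⊕ R ⊗ (con (+ 16) ⊗ 𝕁))) (F.rot-z N W Z) ≡.refl ρ
        where
        N W Z Q R : Expr 7
        N = var 2F
        Q = var 3F
        R = var 4F
        W = var 5F
        Z = var 6F
        module F = Formulas (sign (var 0F)) (sign (var 1F))
        ρ : Vec ℤ 7
        ρ = δ₁ ∷ δ₂ ∷ n ∷ q ∷ r ∷ w′ ∷ z′ ∷ []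

      rot-+ : ∀ k n x → rot k (rot n x) ≋ rot (k ℤ.+ n) x
      rot-+ k n (w′ , z′) = both! (rot-w l (rot-w m w z) (rot-z m w z)) (rot-z l (rot-w m w z) (rot-z m w z))
        (rot-w (l ⊕ m) w z) (rot-z (l ⊕ m) w z) ≡.refl ≡.refl (env k n w′ z′)

      rot-0 : ∀ x → rot (+ 0) x ≋ x
      rot-0 (w′ , z′) = both! (rot-w (con (+ 0)) w z) (rot-z (con (+ 0)) w z) w z ≡.refl ≡.refl (env w′ z′ w′ z′)

      sq-cong : ∀ n {x y} → x ≋ y → sq n x ≋ sq n y
      sq-cong n {_} {w′ , z′} (multiple q ≡.refl , multiple r ≡.refl) =
         mod! (F.sq-w N (W ⊕ Q ⊗ (con (+ 16) ⊗ 𝕁)) (Z ⊕ R ⊗ (con (+ 16) ⊗ 𝕁))) (F.sq-w N W Z) ≡.refl ρ ,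
         mod! (F.sq-z N (W ⊕ Q ⊗ (con (+ 16) ⊗ 𝕁)) (Z ⊕ R ⊗ (con (+ 16) ⊗ 𝕁))) (F.sq-z N W Z) ≡.refl ρ
        where
        N W Z Q R : Expr 7
        N = var 2F
        Q = var 3F
        R = var 4F
        W = var 5F
        Z = var 6F
        module F = Formulas (sign (var 0F)) (sign (var 1F))
        ρ : Vec ℤ 7
        ρ = δ₁ ∷ δ₂ ∷ n ∷ q ∷ r ∷ w′ ∷ z′ ∷ []

      sq-+ : ∀ k n x → sq k (sq n x) ≋ sq (k ℤ.+ n) x
      sq-+ k n (w′ , z′) = both! (sq-w l (sq-w m w z) (sq-z m w z)) (sq-z l (sq-w m w z) (sq-z m w z))
        (sq-w (l ⊕ m) w z) (sq-z (l ⊕ m) w z) ≡.refl ≡.refl (env k n w′ z′)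

      sq-0 : ∀ x → sq (+ 0) x ≋ x
      sq-0 (w′ , z′) = both! (sq-w (con (+ 0)) w z) (sq-z (con (+ 0)) w z) w z ≡.refl ≡.refl (env w′ z′ w′ z′)

      turn-cong : ∀ {x y} → x ≋ y → turn x ≋ turn y
      turn-cong {_} {w′ , z′} (multiple q ≡.refl , multiple r ≡.refl) =
        both! (turn-w w+ z+) (turn-z w+ z+) (turn-w w z) (turn-z w z) ≡.refl ≡.refl (env q r w′ z′)

      -- Under σ₂ᵏ the sign of z alternates with k, so there is no single polynomial for all powers.
      -- They are split into a power of σ₂² and at most one further turn.
      turn² : ∀ x → turn (turn x) ≋ sq (+ 1) x
      turn² (w′ , z′) = both! (turn-w (turn-w w z) (turn-z w z)) (turn-z (turn-w w z) (turn-z w z))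
        (sq-w (con (+ 1)) w z) (sq-z (con (+ 1)) w z) ≡.refl ≡.refl (env w′ z′ w′ z′)

      turn-sq : ∀ n x → turn (sq n x) ≋ sq n (turn x)
      turn-sq n (w′ , z′) = both! (turn-w (sq-w l w z) (sq-z l w z)) (turn-z (sq-w l w z) (sq-z l w z))
        (sq-w l (turn-w w z) (turn-z w z)) (sq-z l (turn-w w z) (turn-z w z)) ≡.refl ≡.refl (env n n w′ z′)

    rot-base : ∀ n → rot n (+ 0 , + 0) ≋ (+ 0 , + 0)
    rot-base n = both! (rot-w l o o) (rot-z l o o) o o ≡.refl ≡.refl (env n n n n)
      where
      o : V
      o = con (+ 0)

    turn-base : turn (+ 0 , + 0) ≋ (+ 0 , -[1+ 0 ])
    turn-base = both! (turn-w o o) (turn-z o o) o (con -[1+ 0 ]) ≡.refl ≡.refl (env (+ 0) (+ 0) (+ 0) (+ 0))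
      where
      o : V
      o = con (+ 0)

    turn-back : sq -[1+ 0 ] (turn (+ 0 , -[1+ 0 ])) ≋ (+ 0 , + 0)
    turn-back = both! (sq-w i (turn-w o i) (turn-z o i)) (sq-z i (turn-w o i) (turn-z o i)) o o ≡.refl ≡.refl (env (+ 0) (+ 0) (+ 0) (+ 0))
      where
      o i : V
      o = con (+ 0)
      i = con -[1+ 0 ]

    sq-base : ∀ n → sq n (+ 0 , + 0) ≋ (n , + 0)
    sq-base n = both! (sq-w l (con (+ 0)) (con (+ 0))) (sq-z l (con (+ 0)) (con (+ 0))) l (con (+ 0)) ≡.refl ≡.refl (env n n n n)

    turn-sq-base : ∀ n → proj₂ (turn (sq n (+ 0 , + 0))) ≈ -[1+ 0 ] ℤ.+ + 8 ℤ.* J ℤ.* n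
    turn-sq-base n = mod! (turn-z (sq-w l o o) (sq-z l o o)) (con -[1+ 0 ] ⊕ con (+ 8) ⊗ 𝕁 ⊗ l) ≡.refl (env n n n n)
      where
      o : V
      o = con (+ 0)

    FacePerm : Group 0ℓ 0ℓ
    FacePerm = permutations ℤ/N²

    opaque
      inverse-law : ∀ (F : ℤ → ℤ × ℤ → ℤ × ℤ) → (∀ k n x → F k (F n x) ≋ F (k ℤ.+ n) x) → (∀ x → F (+ 0) x ≋ x) →
                    ∀ k n → k ℤ.+ n ≡ + 0 → ∀ x → F k (F n x) ≋ x
      inverse-law F +-law 0-law k n eq x = ≋-trans (+-law k n x)
        (≡.subst (λ t → F t x ≋ x) (≡.sym eq) (0-law x))

    opaque
      up-cong : ∀ n {x y} → x ≋ y → up n x ≋ up n y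
      up-cong n {_ , z} {_ , z′} (p , multiple r eq) = p , multiple r
        (≡.trans (≡.cong (λ t → t ℤ.+ n) eq) (solve 3 (λ z q n → z :+ q :+ n := z :+ n :+ q) ≡.refl z′ (r ℤ.* (+ 16 ℤ.* J)) n))
        where open +-*-Solver
      up-+ : ∀ k n x → up k (up n x) ≋ up (k ℤ.+ n) x
      up-+ k n (w , z) = ≈-refl , ≈-reflexive (≡.trans (ℤ.+-assoc z n k) (≡.cong (ℤ._+_ z) (ℤ.+-comm n k)))
      up-0 : ∀ x → up (+ 0) x ≋ x
      up-0 (w , z) = ≈-refl , ≈-reflexive (ℤ.+-identityʳ z)

    rotₚ sqₚ upₚ : ℤ → Permutation ℤ/N²
    rotₚ n = record { to = rot n ; from = rot (ℤ.- n) ; to-cong = rot-cong n ; from-cong = rot-cong (ℤ.- n)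
      ; to-from = inverse-law rot rot-+ rot-0 n (ℤ.- n) (ℤ.+-inverseʳ n)
      ; from-to = inverse-law rot rot-+ rot-0 (ℤ.- n) n (ℤ.+-inverseˡ n) }
    sqₚ n = record { to = sq n ; from = sq (ℤ.- n) ; to-cong = sq-cong n ; from-cong = sq-cong (ℤ.- n)
      ; to-from = inverse-law sq sq-+ sq-0 n (ℤ.- n) (ℤ.+-inverseʳ n)
      ; from-to = inverse-law sq sq-+ sq-0 (ℤ.- n) n (ℤ.+-inverseˡ n) }
    upₚ n = record { to = up n ; from = up (ℤ.- n) ; to-cong = up-cong n ; from-cong = up-cong (ℤ.- n)
      ; to-from = inverse-law up up-+ up-0 n (ℤ.- n) (ℤ.+-inverseʳ n)
      ; from-to = inverse-law up up-+ up-0 (ℤ.- n) n (ℤ.+-inverseˡ n) }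

    opaque
      turn-inverseˡ : ∀ x → sq -[1+ 0 ] (turn (turn x)) ≋ x
      turn-inverseˡ x = ≋-trans (sq-cong -[1+ 0 ] (turn² x)) (inverse-law sq sq-+ sq-0 -[1+ 0 ] (+ 1) ≡.refl x)

      turn-inverseʳ : ∀ x → turn (sq -[1+ 0 ] (turn x)) ≋ x
      turn-inverseʳ x = ≋-trans (turn-sq -[1+ 0 ] (turn x)) (turn-inverseˡ x)

    turnₚ : Permutation ℤ/N²
    turnₚ = record
      { to        = turn
      ; from      = λ x → sq -[1+ 0 ] (turn x)
      ; to-cong   = turn-cong
      ; from-cong = λ eq → sq-cong -[1+ 0 ] (turn-cong eq)
      ; to-from   = turn-inverseʳ
      ; from-to   = turn-inverseˡ
      }

    open Powers FacePerm
    open Group FacePerm using () renaming (_≈_ to _≐_; trans to ≐-trans; sym to ≐-sym; ∙-cong to ≐-cong; _∙_ to _·_; _⁻¹ to inv; ε to e)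

    rot-power : ∀ n → rotₚ n ≐ rotₚ (+ 1) ^ n
    rot-power = additive⇒power rotₚ (λ z → agree λ x → ≋-sym (≋-trans (rot-+ z (+ 1) x)
      (≡.subst (λ t → rot t x ≋ rot (ℤ.suc z) x) (ℤ.+-comm (+ 1) z) ≋-refl))) (agree rot-0)

    sq-power : ∀ n → sqₚ n ≐ sqₚ (+ 1) ^ n
    sq-power = additive⇒power sqₚ (λ z → agree λ x → ≋-sym (≋-trans (sq-+ z (+ 1) x)
      (≡.subst (λ t → sq t x ≋ sq (ℤ.suc z) x) (ℤ.+-comm (+ 1) z) ≋-refl))) (agree sq-0)

    up-power : ∀ n → upₚ n ≐ upₚ (+ 1) ^ n
    up-power = additive⇒power upₚ (λ z → agree λ x → ≈-refl , ≈-reflexive (≡.sym (ℤ.+-assoc (proj₂ x) (+ 1) z)))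
      (agree λ x → ≈-refl , ≈-reflexive (ℤ.+-identityʳ (proj₂ x)))

    turn-even : ∀ n → sqₚ n ≐ turnₚ ^ (+ 2 ℤ.* n)
    turn-even n = ≐-trans (sq-power n) (≐-trans (^-cong n (≐-trans (agree λ x → ≋-sym (turn² x)) (≐-sym (^-2 turnₚ)))) (^-* turnₚ (+ 2) n))

    turn-odd : ∀ n → sqₚ n · turnₚ ≐ turnₚ ^ (+ 2 ℤ.* n ℤ.+ + 1)
    turn-odd n = ≐-trans (≐-cong (turn-even n) (≐-sym (^-1 turnₚ))) (≐-sym (^-+ turnₚ (+ 2 ℤ.* n) (+ 1)))

-- The action on 2-faces satisfies the relations.

module HalfRelations where

  open import Algebra.Bundles using (Group)
  open import Data.Bool using (true)
  open import Data.Fin.Patterns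
  open import Data.Integer as ℤ using (ℤ; +_; -[1+_])
  import Data.Integer.Properties as ℤ
  open import Data.Integer.Solver using (module +-*-Solver)
  open import Data.Product using (_×_; _,_; proj₁; proj₂)
  open import Data.Vec using ([]; _∷_)
  open import Relation.Binary.Bundles using (Setoid)
  open import Relation.Binary.PropositionalEquality as ≡ using (_≡_)
  open GroupKit
  open Presentation using (Relations)
  open Modular
  open Half

  module FaceRelations (J δ₁ δ₂ : ℤ) where
    open Semantics J
    open Congruence J
    open Upper J δ₁ δ₂
    open Setoid ℤ/N² using () renaming (_≈_ to _≋_; trans to ≋-trans; sym to ≋-sym; refl to ≋-refl)
    open Powers FacePerm hiding (⟦_⟧)
    open Group FacePerm using () renaming (_≈_ to _≐_; trans to ≐-trans; sym to ≐-sym; ∙-cong to ≐-cong; ∙-congˡ to ≐-congˡ; reflexive to ≐-reflexive; _∙_ to _·_; _⁻¹ to inv; ε to e)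

    s₁ s₂ : ℤ
    s₁ = + 1 ℤ.+ + 2 ℤ.* δ₁
    s₂ = + 1 ℤ.+ + 2 ℤ.* δ₂

    private
      V = Expr 4
      d₁ d₂ w z : V
      d₁ = var 0F
      d₂ = var 1F
      w = var 2F
      z = var 3F
      open Formulas (sign d₁) (sign d₂)

      both! : (a b c d : V) → congruent a c ≡ true → congruent b d ≡ true →
              ∀ w z → let ρ = δ₁ ∷ δ₂ ∷ w ∷ z ∷ [] in (⟦ a ⟧ ρ , ⟦ b ⟧ ρ) ≋ (⟦ c ⟧ ρ , ⟦ d ⟧ ρ)
      both! a b c d p q w z = mod! a c p (δ₁ ∷ δ₂ ∷ w ∷ z ∷ []) , mod! b d q (δ₁ ∷ δ₂ ∷ w ∷ z ∷ [])

      Pair = V × V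

      rotᵉ sqᵉ : V → Pair → Pair
      rotᵉ n (w , z) = rot-w n w z , rot-z n w z
      sqᵉ n (w , z) = sq-w n w z , sq-z n w z
      turnᵉ : Pair → Pair
      turnᵉ (w , z) = turn-w w z , turn-z w z
      upᵉ : V → Pair → Pair
      upᵉ n (w , z) = w , z ⊕ n

      equal! : (x y : Pair) → congruent (proj₁ x) (proj₁ y) ≡ true → congruent (proj₂ x) (proj₂ y) ≡ true →
               ∀ w z → let ρ = δ₁ ∷ δ₂ ∷ w ∷ z ∷ [] in (⟦ proj₁ x ⟧ ρ , ⟦ proj₂ x ⟧ ρ) ≋ (⟦ proj₁ y ⟧ ρ , ⟦ proj₂ y ⟧ ρ)
      equal! (a , b) (c , d) = both! a b c d

      one m′ : V
      one = con (+ 1)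
      m′ = con (+ 8) ⊗ 𝕁

      -- Closed forms modulo 16J of σ₁σ₂, σ₂σ₃ and σ₁σ₂σ₃. That F is an involution is checked as F =
      -- τ and Fτ = 1, which keeps the polynomials smaller than composing F with itself.
      τ₁₂ τ₂₃ ω : Pair → Pair
      τ₁₂ (w , z) = w ⊕ μ ⊗ (d₁ ⊕ d₂) ⊗ w , ⊝ z ⊖ one ⊕ μ ⊗ w
      τ₂₃ (w , z) = w ⊖ z ⊕ κ (sign d₂) ⊗ (⟨tri⟩ z ⊕ z ⊖ w) , ⊝ z ⊕ μ ⊗ (⟨tri⟩ z ⊕ w ⊖ z)
      ω (w , z) = w ⊕ μ ⊗ (d₁ ⊕ d₂) ⊗ w , ⊝ z ⊕ μ ⊗ w

      involution : ∀ (F : ℤ × ℤ → ℤ × ℤ) → (∀ {x y} → x ≋ y → F x ≋ F y) → (T : ℤ × ℤ → ℤ × ℤ) →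
                   (∀ x → F x ≋ T x) → (∀ x → F (T x) ≋ x) → ∀ x → F (F x) ≋ x
      involution F F-cong T p q x = ≋-trans (F-cong (p x)) (q x)

      exponent : ∀ x {k n} → k ≡ n → x ^ k ≐ x ^ n
      exponent x eq = ≐-reflexive (≡.cong (x ^_) eq)

      turn-exponent : ∀ n k → + 2 ℤ.* n ℤ.+ + 1 ≡ k → sqₚ n · turnₚ ≐ turnₚ ^ k
      turn-exponent n k eq = ≐-trans (turn-odd n) (exponent turnₚ eq)

      open +-*-Solver using (solve; _:+_; _:*_; _:=_) renaming (con to :con)

      odd-2 odd+1 : ∀ s → _
      odd-2 s = turn-exponent (-[1+ 1 ] ℤ.+ + 4 ℤ.* J ℤ.* s) (-[1+ 2 ] ℤ.+ s ℤ.* (+ 8 ℤ.* J))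
        (solve 2 (λ j s → :con (+ 2) :* (:con -[1+ 1 ] :+ :con (+ 4) :* j :* s) :+ :con (+ 1) := :con -[1+ 2 ] :+ s :* (:con (+ 8) :* j)) ≡.refl J s)
      odd+1 s = turn-exponent (+ 1 ℤ.+ + 4 ℤ.* J ℤ.* s) (+ 3 ℤ.+ s ℤ.* (+ 8 ℤ.* J))
        (solve 2 (λ j s → :con (+ 2) :* (:con (+ 1) :+ :con (+ 4) :* j :* s) :+ :con (+ 1) := :con (+ 3) :+ s :* (:con (+ 8) :* j)) ≡.refl J s)

      4J : V → V
      4J d = con (+ 4) ⊗ 𝕁 ⊗ sign d

    relations : Relations FacePerm J s₁ s₂ (rotₚ (+ 1)) turnₚ (upₚ (+ 1))
    relations = record
      { aᵖ   = ≐-trans (≐-sym (rot-power (+ 16 ℤ.* J))) (agree λ (w′ , z′) →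
                 equal! (rotᵉ (con (+ 16) ⊗ 𝕁) (w , z)) (w , z) ≡.refl ≡.refl w′ z′)
      ; b^q  = ≐-trans (exponent turnₚ (solve 1 (λ j → :con (+ 32) :* j := :con (+ 2) :* (:con (+ 16) :* j)) ≡.refl J))
                 (≐-trans (≐-sym (turn-even (+ 16 ℤ.* J))) (agree λ (w′ , z′) →
                   equal! (sqᵉ (con (+ 16) ⊗ 𝕁) (w , z)) (w , z) ≡.refl ≡.refl w′ z′))
      ; cᵖ   = ≐-trans (≐-sym (up-power (+ 16 ℤ.* J))) (agree λ (w′ , z′) →
                 equal! (upᵉ (con (+ 16) ⊗ 𝕁) (w , z)) (w , z) ≡.refl ≡.refl w′ z′)
      ; ab²  = agree (involution (λ x → turn (rot (+ 1) x)) (λ eq → turn-cong (rot-cong (+ 1) eq)) _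
                 (λ (w′ , z′) → equal! (turnᵉ (rotᵉ one (w , z))) (τ₁₂ (w , z)) ≡.refl ≡.refl w′ z′)
                 (λ (w′ , z′) → equal! (turnᵉ (rotᵉ one (τ₁₂ (w , z)))) (w , z) ≡.refl ≡.refl w′ z′))
      ; bc²  = agree (involution (λ x → up (+ 1) (turn x)) (λ eq → Permutation.to-cong (upₚ (+ 1)) (turn-cong eq)) _
                 (λ (w′ , z′) → equal! (upᵉ one (turnᵉ (w , z))) (τ₂₃ (w , z)) ≡.refl ≡.refl w′ z′)
                 (λ (w′ , z′) → equal! (upᵉ one (turnᵉ (τ₂₃ (w , z)))) (w , z) ≡.refl ≡.refl w′ z′))
      ; abc² = agree (involution (λ x → up (+ 1) (turn (rot (+ 1) x))) (λ eq → Permutation.to-cong (upₚ (+ 1)) (turn-cong (rot-cong (+ 1) eq))) _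
                 (λ (w′ , z′) → equal! (upᵉ one (turnᵉ (rotᵉ one (w , z)))) (ω (w , z)) ≡.refl ≡.refl w′ z′)
                 (λ (w′ , z′) → equal! (upᵉ one (turnᵉ (rotᵉ one (ω (w , z))))) (w , z) ≡.refl ≡.refl w′ z′))
      -- Products act from left to right, so the first factor is innermost. The exponent -3 + 8Jε of
      -- σ₂ is split as σ₂² to the power -2 + 4Jε, followed by one σ₂.
      ; b⁻¹a = ≐-trans (agree λ (w′ , z′) → equal! (rotᵉ one (sqᵉ (con -[1+ 0 ]) (turnᵉ (w , z))))
                 (turnᵉ (sqᵉ (con -[1+ 1 ] ⊕ 4J d₁) (rotᵉ (con -[1+ 0 ] ⊕ m′) (w , z)))) ≡.refl ≡.refl w′ z′)
                 (≐-cong (rot-power (-[1+ 0 ] ℤ.+ + 8 ℤ.* J)) (odd-2 s₁))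
      ; ba⁻¹ = ≐-trans (agree λ (w′ , z′) → equal! (rotᵉ (con -[1+ 0 ]) (turnᵉ (w , z)))
                 (turnᵉ (sqᵉ (one ⊕ 4J d₁) (rotᵉ (one ⊕ m′) (w , z)))) ≡.refl ≡.refl w′ z′)
                 (≐-cong (rot-power (+ 1 ℤ.+ + 8 ℤ.* J)) (odd+1 s₁))
      ; c⁻¹b = ≐-trans (agree λ (w′ , z′) → equal! (turnᵉ (upᵉ (con -[1+ 0 ]) (w , z)))
                 (upᵉ (one ⊕ m′) (turnᵉ (sqᵉ (one ⊕ 4J d₂) (w , z)))) ≡.refl ≡.refl w′ z′)
                 (≐-cong (odd+1 s₂) (up-power (+ 1 ℤ.+ + 8 ℤ.* J)))
      ; cb⁻¹ = ≐-trans (agree λ (w′ , z′) → equal! (sqᵉ (con -[1+ 0 ]) (turnᵉ (upᵉ one (w , z))))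
                 (upᵉ (con -[1+ 0 ] ⊕ m′) (turnᵉ (sqᵉ (con -[1+ 1 ] ⊕ 4J d₂) (w , z)))) ≡.refl ≡.refl w′ z′)
                 (≐-cong (odd-2 s₂) (up-power (-[1+ 0 ] ℤ.+ + 8 ℤ.* J)))
      }

-- The action on facets.

module Facets where

  open import Algebra.Bundles using (Group)
  open import Data.Bool using (true)
  open import Data.Fin.Patterns
  open import Data.Integer as ℤ using (ℤ; +_; -[1+_])
  import Data.Integer.Properties as ℤ
  open import Data.Integer.Solver using (module +-*-Solver)
  open import Data.Vec using (Vec; []; _∷_)
  open import Relation.Binary.PropositionalEquality as ≡ using (_≡_)
  open GroupKit
  open Presentation using (Relations)
  open Modular
  open Half

  module FacetAction (J δ₁ δ₂ : ℤ) where
    open Semantics J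
    open Congruence J

    private
      V = Expr 4
      e l m z : V
      e = sign (var 0F)
      l = var 2F
      m = var 3F
      z = var 1F
      open Formulas e e

      env : ℤ → ℤ → ℤ → Vec ℤ 4
      env l m z = δ₁ ∷ z ∷ l ∷ m ∷ []

    frot fsq fup : ℤ → ℤ → ℤ
    frot n z′ = ⟦ facet-rot l z ⟧ (env n n z′)
    fsq n z′ = ⟦ facet-sq l z ⟧ (env n n z′)
    fup n z′ = z′ ℤ.+ n

    fturn : ℤ → ℤ
    fturn z′ = ⟦ facet-turn z ⟧ (env z′ z′ z′)

    opaque
      frot-cong : ∀ n {x y} → x ≈ y → frot n x ≈ frot n y
      frot-cong n {_} {z′} (multiple q ≡.refl) =
        mod! (facet-rot l (z ⊕ m ⊗ (con (+ 16) ⊗ 𝕁))) (facet-rot l z) ≡.refl (env n q z′)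

      fsq-cong : ∀ n {x y} → x ≈ y → fsq n x ≈ fsq n y
      fsq-cong n {_} {z′} (multiple q ≡.refl) =
        mod! (facet-sq l (z ⊕ m ⊗ (con (+ 16) ⊗ 𝕁))) (facet-sq l z) ≡.refl (env n q z′)

      fturn-cong : ∀ {x y} → x ≈ y → fturn x ≈ fturn y
      fturn-cong {_} {z′} (multiple q ≡.refl) =
        mod! (facet-turn (z ⊕ m ⊗ (con (+ 16) ⊗ 𝕁))) (facet-turn z) ≡.refl (env q q z′)

      fup-cong : ∀ n {x y} → x ≈ y → fup n x ≈ fup n y
      fup-cong n {_} {z′} (multiple q ≡.refl) =
        mod! (z ⊕ m ⊗ (con (+ 16) ⊗ 𝕁) ⊕ l) (z ⊕ l) ≡.refl (env n q z′)

      frot-+ : ∀ k n x → frot k (frot n x) ≈ frot (k ℤ.+ n) x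
      frot-+ k n z′ = mod! (facet-rot l (facet-rot m z)) (facet-rot (l ⊕ m) z) ≡.refl (env k n z′)

      fsq-+ : ∀ k n x → fsq k (fsq n x) ≈ fsq (k ℤ.+ n) x
      fsq-+ k n z′ = mod! (facet-sq l (facet-sq m z)) (facet-sq (l ⊕ m) z) ≡.refl (env k n z′)

      fup-+ : ∀ k n x → fup k (fup n x) ≈ fup (k ℤ.+ n) x
      fup-+ k n z′ = mod! (z ⊕ m ⊕ l) (z ⊕ (l ⊕ m)) ≡.refl (env k n z′)

      frot-0 : ∀ x → frot (+ 0) x ≈ x
      frot-0 z′ = mod! (facet-rot (con (+ 0)) z) z ≡.refl (env z′ z′ z′)

      fsq-0 : ∀ x → fsq (+ 0) x ≈ x
      fsq-0 z′ = mod! (facet-sq (con (+ 0)) z) z ≡.refl (env z′ z′ z′)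

      fup-0 : ∀ x → fup (+ 0) x ≈ x
      fup-0 z′ = mod! (z ⊕ con (+ 0)) z ≡.refl (env z′ z′ z′)

      fturn² : ∀ x → fturn (fturn x) ≈ fsq (+ 1) x
      fturn² z′ = mod! (facet-turn (facet-turn z)) (facet-sq (con (+ 1)) z) ≡.refl (env z′ z′ z′)

      fturn-sq : ∀ n x → fturn (fsq n x) ≈ fsq n (fturn x)
      fturn-sq n z′ = mod! (facet-turn (facet-sq l z)) (facet-sq l (facet-turn z)) ≡.refl (env n n z′)

      finverse : ∀ (F : ℤ → ℤ → ℤ) → (∀ k n x → F k (F n x) ≈ F (k ℤ.+ n) x) → (∀ x → F (+ 0) x ≈ x) →
                 ∀ k n → k ℤ.+ n ≡ + 0 → ∀ x → F k (F n x) ≈ x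
      finverse F +-law 0-law k n eq x = ≈-trans (+-law k n x)
        (≡.subst (λ t → F t x ≈ x) (≡.sym eq) (0-law x))

      fturn-inverseˡ : ∀ x → fsq -[1+ 0 ] (fturn (fturn x)) ≈ x
      fturn-inverseˡ x = ≈-trans (fsq-cong -[1+ 0 ] (fturn² x)) (finverse fsq fsq-+ fsq-0 -[1+ 0 ] (+ 1) ≡.refl x)

      fturn-inverseʳ : ∀ x → fturn (fsq -[1+ 0 ] (fturn x)) ≈ x
      fturn-inverseʳ x = ≈-trans (fturn-sq -[1+ 0 ] (fturn x)) (fturn-inverseˡ x)

    frot-base : ∀ n → frot n (+ 0) ≈ + 0
    frot-base n = mod! (facet-rot l (con (+ 0))) (con (+ 0)) ≡.refl (env n n n)

    fsq-base : ∀ n → fsq n (+ 0) ≈ + 0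
    fsq-base n = mod! (facet-sq l (con (+ 0))) (con (+ 0)) ≡.refl (env n n n)

    fturn-base : fturn (+ 0) ≈ + 0
    fturn-base = mod! (facet-turn (con (+ 0))) (con (+ 0)) ≡.refl (env (+ 0) (+ 0) (+ 0))

    FacetPerm : Group _ _
    FacetPerm = permutations ℤ/N

    private
      cyclic : (F : ℤ → ℤ → ℤ) → (∀ n {x y} → x ≈ y → F n x ≈ F n y) →
               (∀ k n x → F k (F n x) ≈ F (k ℤ.+ n) x) → (∀ x → F (+ 0) x ≈ x) → ℤ → Permutation ℤ/N
      cyclic F F-cong +-law 0-law n = record { to = F n ; from = F (ℤ.- n) ; to-cong = F-cong n ; from-cong = F-cong (ℤ.- n)
        ; to-from = finverse F +-law 0-law n (ℤ.- n) (ℤ.+-inverseʳ n)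
        ; from-to = finverse F +-law 0-law (ℤ.- n) n (ℤ.+-inverseˡ n) }

    frotₚ fsqₚ fupₚ : ℤ → Permutation ℤ/N
    frotₚ = cyclic frot frot-cong frot-+ frot-0
    fsqₚ = cyclic fsq fsq-cong fsq-+ fsq-0
    fupₚ = cyclic fup fup-cong fup-+ fup-0

    fturnₚ : Permutation ℤ/N
    fturnₚ = record
      { to = fturn ; from = λ x → fsq -[1+ 0 ] (fturn x) ; to-cong = fturn-cong
      ; from-cong = λ eq → fsq-cong -[1+ 0 ] (fturn-cong eq) ; to-from = fturn-inverseʳ ; from-to = fturn-inverseˡ }

    open Powers FacetPerm hiding (⟦_⟧)
    open Group FacetPerm using () renaming (_≈_ to _≐_; trans to ≐-trans; sym to ≐-sym; ∙-cong to ≐-cong; reflexive to ≐-reflexive; _∙_ to _·_; _⁻¹ to inv)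

    private
      power : (F : ℤ → ℤ → ℤ) (F-cong : ∀ n {x y} → x ≈ y → F n x ≈ F n y)
              (+-law : ∀ k n x → F k (F n x) ≈ F (k ℤ.+ n) x) (0-law : ∀ x → F (+ 0) x ≈ x) →
              ∀ n → cyclic F F-cong +-law 0-law n ≐ cyclic F F-cong +-law 0-law (+ 1) ^ n
      power F F-cong +-law 0-law = additive⇒power (cyclic F F-cong +-law 0-law)
        (λ z → agree λ x → ≈-sym (≈-trans (+-law z (+ 1) x) (≡.subst (λ t → F t x ≈ F (ℤ.suc z) x) (ℤ.+-comm (+ 1) z) ≈-refl)))
        (agree 0-law)

      exponent : ∀ x {k n} → k ≡ n → x ^ k ≐ x ^ n
      exponent x eq = ≐-reflexive (≡.cong (x ^_) eq)

      turn-even : ∀ n → fsqₚ n ≐ fturnₚ ^ (+ 2 ℤ.* n)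
      turn-even n = ≐-trans (power fsq fsq-cong fsq-+ fsq-0 n)
        (≐-trans (^-cong n (≐-trans (agree λ x → ≈-sym (fturn² x)) (≐-sym (^-2 fturnₚ)))) (^-* fturnₚ (+ 2) n))

      turn-exponent : ∀ n k → + 2 ℤ.* n ℤ.+ + 1 ≡ k → fsqₚ n · fturnₚ ≐ fturnₚ ^ k
      turn-exponent n k eq = ≐-trans (≐-cong (turn-even n) (≐-sym (^-1 fturnₚ)))
        (≐-trans (≐-sym (^-+ fturnₚ (+ 2 ℤ.* n) (+ 1))) (exponent fturnₚ eq))

      open +-*-Solver using (solve; _:+_; _:*_; _:=_) renaming (con to :con)

      odd-2 : ∀ s → fsqₚ (-[1+ 1 ] ℤ.+ + 4 ℤ.* J ℤ.* s) · fturnₚ ≐ fturnₚ ^ (-[1+ 2 ] ℤ.+ s ℤ.* (+ 8 ℤ.* J))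
      odd-2 s = turn-exponent (-[1+ 1 ] ℤ.+ + 4 ℤ.* J ℤ.* s) (-[1+ 2 ] ℤ.+ s ℤ.* (+ 8 ℤ.* J))
        (solve 2 (λ j s → :con (+ 2) :* (:con -[1+ 1 ] :+ :con (+ 4) :* j :* s) :+ :con (+ 1) := :con -[1+ 2 ] :+ s :* (:con (+ 8) :* j)) ≡.refl J s)

      odd+1 : ∀ s → fsqₚ (+ 1 ℤ.+ + 4 ℤ.* J ℤ.* s) · fturnₚ ≐ fturnₚ ^ (+ 3 ℤ.+ s ℤ.* (+ 8 ℤ.* J))
      odd+1 s = turn-exponent (+ 1 ℤ.+ + 4 ℤ.* J ℤ.* s) (+ 3 ℤ.+ s ℤ.* (+ 8 ℤ.* J))
        (solve 2 (λ j s → :con (+ 2) :* (:con (+ 1) :+ :con (+ 4) :* j :* s) :+ :con (+ 1) := :con (+ 3) :+ s :* (:con (+ 8) :* j)) ≡.refl J s)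

      one : V
      one = con (+ 1)
      4J : V
      4J = con (+ 4) ⊗ 𝕁 ⊗ sign (var 0F)

      equal! : (x y : V) → congruent x y ≡ true → ∀ z → ⟦ x ⟧ (env z z z) ≈ ⟦ y ⟧ (env z z z)
      equal! x y p z = mod! x y p (env z z z)

      -- The facet formulas contain no sign, so for the relations between σ₂ and σ₃ the slot of δ₁
      -- is filled with δ₂.
      reparametrise : ∀ δ → (x y : V) → congruent x y ≡ true → ∀ z →
        ⟦ x ⟧ (δ ∷ z ∷ z ∷ z ∷ []) ≈ ⟦ y ⟧ (δ ∷ z ∷ z ∷ z ∷ [])
      reparametrise δ x y p z = mod! x y p (δ ∷ z ∷ z ∷ z ∷ [])

    rot^ : ∀ n → frotₚ n ≐ frotₚ (+ 1) ^ n
    rot^ = power frot frot-cong frot-+ frot-0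

    up^ : ∀ n → fupₚ n ≐ fupₚ (+ 1) ^ n
    up^ = power fup fup-cong fup-+ fup-0

    facet-relations : Relations FacetPerm J (+ 1 ℤ.+ + 2 ℤ.* δ₁) (+ 1 ℤ.+ + 2 ℤ.* δ₂) (frotₚ (+ 1)) fturnₚ (fupₚ (+ 1))
    facet-relations = record
      { aᵖ   = ≐-trans (≐-sym (rot^ (+ 16 ℤ.* J))) (agree (equal! (facet-rot (con (+ 16) ⊗ 𝕁) z) z ≡.refl))
      ; b^q  = ≐-trans (exponent fturnₚ (solve 1 (λ j → :con (+ 32) :* j := :con (+ 2) :* (:con (+ 16) :* j)) ≡.refl J))
                 (≐-trans (≐-sym (turn-even (+ 16 ℤ.* J))) (agree (equal! (facet-sq (con (+ 16) ⊗ 𝕁) z) z ≡.refl)))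
      ; cᵖ   = ≐-trans (≐-sym (up^ (+ 16 ℤ.* J))) (agree (equal! (z ⊕ con (+ 16) ⊗ 𝕁) z ≡.refl))
      ; ab²  = agree (equal! (facet-turn (facet-rot one (facet-turn (facet-rot one z)))) z ≡.refl)
      ; bc²  = agree (equal! (facet-turn (facet-turn z ⊕ one) ⊕ one) z ≡.refl)
      ; abc² = agree (equal! (facet-turn (facet-rot one (facet-turn (facet-rot one z) ⊕ one)) ⊕ one) z ≡.refl)
      ; b⁻¹a = ≐-trans (agree (equal! (facet-rot one (facet-sq (con -[1+ 0 ]) (facet-turn z)))
                 (facet-turn (facet-sq (con -[1+ 1 ] ⊕ 4J) (facet-rot (con -[1+ 0 ] ⊕ con (+ 8) ⊗ 𝕁) z))) ≡.refl))
                 (≐-cong (rot^ (-[1+ 0 ] ℤ.+ + 8 ℤ.* J)) (odd-2 (+ 1 ℤ.+ + 2 ℤ.* δ₁)))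
      ; ba⁻¹ = ≐-trans (agree (equal! (facet-rot (con -[1+ 0 ]) (facet-turn z))
                 (facet-turn (facet-sq (one ⊕ 4J) (facet-rot (one ⊕ con (+ 8) ⊗ 𝕁) z))) ≡.refl))
                 (≐-cong (rot^ (+ 1 ℤ.+ + 8 ℤ.* J)) (odd+1 (+ 1 ℤ.+ + 2 ℤ.* δ₁)))
      ; c⁻¹b = ≐-trans (agree (reparametrise δ₂ (facet-turn (z ⊕ con -[1+ 0 ]))
                 (facet-turn (facet-sq (one ⊕ 4J) z) ⊕ (one ⊕ con (+ 8) ⊗ 𝕁)) ≡.refl))
                 (≐-cong (odd+1 (+ 1 ℤ.+ + 2 ℤ.* δ₂)) (up^ (+ 1 ℤ.+ + 8 ℤ.* J)))
      ; cb⁻¹ = ≐-trans (agree (reparametrise δ₂ (facet-sq (con -[1+ 0 ]) (facet-turn (z ⊕ one)))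
                 (facet-turn (facet-sq (con -[1+ 1 ] ⊕ 4J) z) ⊕ (con -[1+ 0 ] ⊕ con (+ 8) ⊗ 𝕁)) ≡.refl))
                 (≐-cong (odd-2 (+ 1 ℤ.+ + 2 ℤ.* δ₂)) (up^ (-[1+ 0 ] ℤ.+ + 8 ℤ.* J)))
      }

-- Incidence of vertices, edges, 2-faces and facets, and its invariance.

module Incidence where

  open import Algebra.Bundles using (Group)
  open import Data.Fin.Patterns
  open import Data.Integer as ℤ using (ℤ; +_; -[1+_])
  import Data.Integer.Properties as ℤ
  open import Data.Integer.Solver using (module +-*-Solver)
  open import Data.Nat using (zero; suc)
  open import Data.Product using (_×_; _,_; proj₂)
  open import Data.Vec using (Vec; []; _∷_)
  open import Level using (0ℓ)
  open import Relation.Binary.Bundles using (Setoid)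
  open import Relation.Binary.PropositionalEquality as ≡ using (_≡_; _≢_)
  open import Relation.Nullary using (¬_)
  open Modular
  open Half
  open Facets

  module _ {A B : Setoid 0ℓ 0ℓ} (_~_ : Setoid.Carrier A → Setoid.Carrier B → Set) where
    private
      module A = Setoid A
      module B = Setoid B

    record Preserves (f : Permutation A) (g : Permutation B) : Set where
      constructor preserves
      field
        forth : ∀ {x y} → x ~ y → Permutation.to f x ~ Permutation.to g y
        back  : ∀ {x y} → Permutation.to f x ~ Permutation.to g y → x ~ y

    open Preserves
    open Permutation

    preserves-∙ : ∀ {f f′ g g′} → Preserves f g → Preserves f′ g′ →
      Preserves (Group._∙_ (permutations A) f f′) (Group._∙_ (permutations B) g g′)
    preserves-∙ p q = preserves (λ r → forth q (forth p r)) (λ r → back p (back q r))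

    preserves-ε : Preserves (Group.ε (permutations A)) (Group.ε (permutations B))
    preserves-ε = preserves (λ r → r) (λ r → r)

    module _ (resp : ∀ {x x′ y y′} → x A.≈ x′ → y B.≈ y′ → x ~ y → x′ ~ y′) where

      preserves-⁻¹ : ∀ {f g} → Preserves f g → Preserves (Group._⁻¹ (permutations A) f) (Group._⁻¹ (permutations B) g)
      preserves-⁻¹ {f} {g} p = preserves
        (λ r → back p (resp (A.sym (to-from f _)) (B.sym (to-from g _)) r))
        (λ r → resp (to-from f _) (to-from g _) (forth p r))

  -- The two facets of a 2-face, and the two vertices of an edge.
  module Ends (J : ℤ) where
    open Semantics J
    open Congruence J
    open Setoid ℤ/N² using () renaming (_≈_ to _≋_)

    private
      headᵉ : ∀ {n} → Expr n → Expr n → Expr n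
      headᵉ w z = z ⊕ con (+ 1) ⊕ μ ⊗ w

    tail head : ℤ × ℤ → ℤ
    tail (_ , z) = z
    head (w , z) = ⟦ headᵉ (var 0F) (var 1F) ⟧ (w ∷ z ∷ [])

    data _∋_ (f : ℤ × ℤ) (c : ℤ) : Set where
      at-tail : c ≈ tail f → f ∋ c
      at-head : c ≈ head f → f ∋ c

    head-cong : ∀ {f g} → f ≋ g → head f ≈ head g
    head-cong {_} {w , z} (multiple q ≡.refl , multiple r ≡.refl) =
      mod! {4} (headᵉ (var 0F ⊕ var 2F ⊗ (con (+ 16) ⊗ 𝕁)) (var 1F ⊕ var 3F ⊗ (con (+ 16) ⊗ 𝕁)))
           (headᵉ (var 0F) (var 1F)) ≡.refl (w ∷ z ∷ q ∷ r ∷ [])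

    ∋-resp : ∀ {f g c d} → f ≋ g → c ≈ d → f ∋ c → g ∋ d
    ∋-resp f≋g c≈d (at-tail p) = at-tail (≈-trans (≈-sym c≈d) (≈-trans p (proj₂ f≋g)))
    ∋-resp f≋g c≈d (at-head p) = at-head (≈-trans (≈-sym c≈d) (≈-trans p (head-cong f≋g)))

    -- The two differ by an odd number, and the modulus 16J is even.
    tail≉head : ∀ f → ¬ (tail f ≈ head f)
    tail≉head (w , z) (multiple q eq) = odd≢even a (begin
      + 1                                                                        ≡⟨ solve 4 (λ z w j q → :con (+ 1) :=
        z :+ :con (+ 1) :+ :con (+ 8) :* j :* w :+ q :* (:con (+ 16) :* j) :- z :+ :con (+ 2) :* (:- (:con (+ 4) :* j :* w :+ q :* (:con (+ 8) :* j)))) ≡.refl z w J q ⟩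
      head (w , z) ℤ.+ q ℤ.* (+ 16 ℤ.* J) ℤ.- z ℤ.+ + 2 ℤ.* (ℤ.- a)              ≡⟨ ≡.cong (λ t → t ℤ.- z ℤ.+ + 2 ℤ.* (ℤ.- a)) eq ⟨
      z ℤ.- z ℤ.+ + 2 ℤ.* (ℤ.- a)                                                ≡⟨ solve 2 (λ z a → z :- z :+ :con (+ 2) :* (:- a) := :con (+ 2) :* (:- a)) ≡.refl z a ⟩
      + 2 ℤ.* (ℤ.- a)                                                            ∎)
      where
      open ≡.≡-Reasoning
      open +-*-Solver using (solve; _:+_; _:*_; _:-_; :-_; _:=_) renaming (con to :con)
      a : ℤ
      a = + 4 ℤ.* J ℤ.* w ℤ.+ q ℤ.* (+ 8 ℤ.* J)
      odd≢even : ∀ a → + 1 ≢ + 2 ℤ.* (ℤ.- a)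
      odd≢even a eq with ℤ.- a | eq
      ... | + zero        | ()
      ... | + suc zero    | ()
      ... | + suc (suc n) | ()
      ... | -[1+ n ]      | ()

  module Relation (J δ₁ δ₂ : ℤ) where
    open Semantics J
    open Congruence J
    open Ends J
    open Setoid ℤ/N² using () renaming (_≈_ to _≋_; trans to ≋-trans; sym to ≋-sym; refl to ≋-refl)

    private
      V = Expr 6
      d₁ d₂ w x y z : V
      d₁ = var 0F
      d₂ = var 1F
      w = var 2F
      z = var 3F
      y = var 4F
      x = var 5F
      16J : V
      16J = con (+ 16) ⊗ 𝕁
      open Formulas (sign d₁) (sign d₂)
      module F′ = Formulas (sign d₂) (sign d₁)
      env : ℤ → ℤ → ℤ → ℤ → Vec ℤ 6
      env w z y x = δ₁ ∷ δ₂ ∷ w ∷ z ∷ y ∷ x ∷ []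

      headᵉ : V → V → V
      headᵉ w z = z ⊕ con (+ 1) ⊕ μ ⊗ w

      -- Modulo 4J this is y + w + xz, which is unchanged when the shear of σ₁-type on one side is
      -- traded for the translation of σ₃-type on the other. The corrections extend this to modulus
      -- 16J up to unit factors. As y occurs once, with coefficient 1, a 2-face and a tail determine
      -- an edge.
      E : V → V → V → V → V
      E y x w z = y ⊕ w ⊕ x ⊗ z ⊖ κ (sign d₂) ⊗ (w ⊗ z ⊕ x ⊗ z ⊕ x ⊗ ⟨tri⟩ z)
        ⊕ κ (sign d₁) ⊗ (x ⊗ w ⊕ z ⊗ ⟨tri⟩ x) ⊖ μ ⊗ ⟨tri⟩ x ⊗ ⟨tri⟩ z

    -- Incidence of the edge (y , x) and the 2-face (w , z).
    defect : ℤ × ℤ → ℤ × ℤ → ℤ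
    defect (y′ , x′) (w′ , z′) = ⟦ E y x w z ⟧ (env w′ z′ y′ x′)

    record _∼_ (e f : ℤ × ℤ) : Set where
      constructor incident
      field vanishes : defect e f ≈ + 0

    private
      scaled : ∀ {a b} (u : V) ρ → a ≈ b ℤ.* ⟦ u ⟧ ρ → b ≈ + 0 → a ≈ + 0
      scaled {a} {b} u ρ eq (multiple q ≡.refl) = ≈-trans eq (mod! {3} ((con (+ 0) ⊕ var 0F ⊗ (con (+ 16) ⊗ 𝕁)) ⊗ var 1F) (con (+ 0)) ≡.refl (q ∷ ⟦ u ⟧ ρ ∷ q ∷ []))

      equal : ∀ {a b} → a ≈ b → b ≈ + 0 → a ≈ + 0
      equal p q = ≈-trans p q

    defect-cong : ∀ {e e′ f f′} → e ≋ e′ → f ≋ f′ → defect e f ≈ defect e′ f′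
    defect-cong {_} {y′ , x′} {_} {w′ , z′} (multiple q ≡.refl , multiple r ≡.refl) (multiple s ≡.refl , multiple t ≡.refl) =
      mod! (E₁ (y₁ ⊕ q₁ ⊗ (con (+ 16) ⊗ 𝕁)) (x₁ ⊕ r₁ ⊗ (con (+ 16) ⊗ 𝕁)) (w₁ ⊕ s₁ ⊗ (con (+ 16) ⊗ 𝕁)) (z₁ ⊕ t₁ ⊗ (con (+ 16) ⊗ 𝕁)))
           (E₁ y₁ x₁ w₁ z₁) ≡.refl (δ₁ ∷ δ₂ ∷ w′ ∷ z′ ∷ y′ ∷ x′ ∷ q ∷ r ∷ s ∷ t ∷ [])
      where
      w₁ z₁ y₁ x₁ q₁ r₁ s₁ t₁ : Expr 10
      w₁ = var 2F
      z₁ = var 3F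
      y₁ = var 4F
      x₁ = var 5F
      q₁ = var 6F
      r₁ = var 7F
      s₁ = var 8F
      t₁ = var 9F
      E₁ : Expr 10 → Expr 10 → Expr 10 → Expr 10 → Expr 10
      E₁ y x w z = y ⊕ w ⊕ x ⊗ z ⊖ κ (sign (var 1F)) ⊗ (w ⊗ z ⊕ x ⊗ z ⊕ x ⊗ ⟨tri⟩ z)
        ⊕ κ (sign (var 0F)) ⊗ (x ⊗ w ⊕ z ⊗ ⟨tri⟩ x) ⊖ μ ⊗ ⟨tri⟩ x ⊗ ⟨tri⟩ z

    ∼-resp : ∀ {e e′ f f′} → e ≋ e′ → f ≋ f′ → e ∼ f → e′ ∼ f′
    ∼-resp p q (incident v) = incident (≈-trans (≈-sym (defect-cong p q)) v)

    module U = Upper J δ₁ δ₂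
    module C = FacetAction J δ₁ δ₂
    module L = Upper J δ₂ δ₁

    ∋-rot : Preserves _∋_ (U.rotₚ (+ 1)) (C.frotₚ (+ 1))
    ∋-rot = preserves forth back
      where
      heads : ∀ f → C.frot (+ 1) (head f) ≈ head (U.rot (+ 1) f)
      heads (w′ , z′) = mod! (facet-rot (con (+ 1)) (headᵉ w z)) (headᵉ (rot-w (con (+ 1)) w z) (rot-z (con (+ 1)) w z)) ≡.refl (env w′ z′ w′ z′)
      forth : ∀ {f c} → f ∋ c → U.rot (+ 1) f ∋ C.frot (+ 1) c
      forth (at-tail p) = at-tail (C.frot-cong (+ 1) p)
      forth {f} (at-head p) = at-head (≈-trans (C.frot-cong (+ 1) p) (heads f))
      back : ∀ {f c} → U.rot (+ 1) f ∋ C.frot (+ 1) c → f ∋ c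
      back (at-tail p) = at-tail (Permutation.to-injective (C.frotₚ (+ 1)) p)
      back {f} (at-head p) = at-head (Permutation.to-injective (C.frotₚ (+ 1)) (≈-trans p (≈-sym (heads f))))

    ∋-turn : Preserves _∋_ U.turnₚ C.fturnₚ
    ∋-turn = preserves forth back
      where
      tails : ∀ f → C.fturn (tail f) ≈ head (U.turn f)
      tails (w′ , z′) = mod! (facet-turn z) (headᵉ (turn-w w z) (turn-z w z)) ≡.refl (env w′ z′ w′ z′)
      heads : ∀ f → C.fturn (head f) ≈ tail (U.turn f)
      heads (w′ , z′) = mod! (facet-turn (headᵉ w z)) (turn-z w z) ≡.refl (env w′ z′ w′ z′)
      forth : ∀ {f c} → f ∋ c → U.turn f ∋ C.fturn c
      forth {f} (at-tail p) = at-head (≈-trans (C.fturn-cong p) (tails f))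
      forth {f} (at-head p) = at-tail (≈-trans (C.fturn-cong p) (heads f))
      back : ∀ {f c} → U.turn f ∋ C.fturn c → f ∋ c
      back {f} (at-tail p) = at-head (Permutation.to-injective C.fturnₚ (≈-trans p (≈-sym (heads f))))
      back {f} (at-head p) = at-tail (Permutation.to-injective C.fturnₚ (≈-trans p (≈-sym (tails f))))

    ∋-up : Preserves _∋_ (U.upₚ (+ 1)) (C.fupₚ (+ 1))
    ∋-up = preserves forth back
      where
      heads : ∀ f → C.fup (+ 1) (head f) ≈ head (U.up (+ 1) f)
      heads (w′ , z′) = mod! (headᵉ w z ⊕ con (+ 1)) (headᵉ w (z ⊕ con (+ 1))) ≡.refl (env w′ z′ w′ z′)
      forth : ∀ {f c} → f ∋ c → U.up (+ 1) f ∋ C.fup (+ 1) c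
      forth (at-tail p) = at-tail (C.fup-cong (+ 1) p)
      forth {f} (at-head p) = at-head (≈-trans (C.fup-cong (+ 1) p) (heads f))
      back : ∀ {f c} → U.up (+ 1) f ∋ C.fup (+ 1) c → f ∋ c
      back (at-tail p) = at-tail (Permutation.to-injective (C.fupₚ (+ 1)) p)
      back {f} (at-head p) = at-head (Permutation.to-injective (C.fupₚ (+ 1)) (≈-trans p (≈-sym (heads f))))

    module _ where
      private
        -- Moving a generator from the 2-face to the edge multiplies the defect by u, and moving it
        -- back by v. The two are inverse modulo 16J because 4J · 4J vanishes, so either defect is
        -- zero with the other.
        u₃ u₂ v₃ v₂ : V
        u₃ = con (+ 1) ⊕ κ (sign d₂)
        v₃ = con (+ 1) ⊖ κ (sign d₂)
        u₂ = con (+ 1) ⊕ κ (con (+ 2) ⊗ z ⊖ con (+ 1) ⊕ con (+ 2) ⊗ d₁)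
        v₂ = con (+ 1) ⊖ κ (con (+ 2) ⊗ z ⊖ con (+ 1) ⊕ con (+ 2) ⊗ d₁)

      rot-up : ∀ {e f} → e ∼ U.up (+ 1) f → L.rot (+ 1) e ∼ f
      rot-up {y′ , x′} {w′ , z′} (incident v) = incident (scaled u₃ (env w′ z′ y′ x′)
        (mod! (E (F′.rot-w (con (+ 1)) y x) (F′.rot-z (con (+ 1)) y x) w z) (E y x w (z ⊕ con (+ 1)) ⊗ u₃) ≡.refl (env w′ z′ y′ x′)) v)

      up-rot : ∀ {e f} → L.rot (+ 1) e ∼ f → e ∼ U.up (+ 1) f
      up-rot {y′ , x′} {w′ , z′} (incident v) = incident (scaled v₃ (env w′ z′ y′ x′)
        (mod! (E y x w (z ⊕ con (+ 1))) (E (F′.rot-w (con (+ 1)) y x) (F′.rot-z (con (+ 1)) y x) w z ⊗ v₃) ≡.refl (env w′ z′ y′ x′)) v)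

      turn-turn : ∀ {e f} → e ∼ U.turn f → L.turn e ∼ f
      turn-turn {y′ , x′} {w′ , z′} (incident v) = incident (scaled u₂ (env w′ z′ y′ x′)
        (mod! (E (F′.turn-w y x) (F′.turn-z y x) w z) (E y x (turn-w w z) (turn-z w z) ⊗ u₂) ≡.refl (env w′ z′ y′ x′)) v)

      turn-turn⁻ : ∀ {e f} → L.turn e ∼ f → e ∼ U.turn f
      turn-turn⁻ {y′ , x′} {w′ , z′} (incident v) = incident (scaled v₂ (env w′ z′ y′ x′)
        (mod! (E y x (turn-w w z) (turn-z w z)) (E (F′.turn-w y x) (F′.turn-z y x) w z ⊗ v₂) ≡.refl (env w′ z′ y′ x′)) v)

    private
      rest : V → V → V → V
      rest x w z = w ⊕ x ⊗ z ⊖ κ (sign d₂) ⊗ (w ⊗ z ⊕ x ⊗ z ⊕ x ⊗ ⟨tri⟩ z)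
        ⊕ κ (sign d₁) ⊗ (x ⊗ w ⊕ z ⊗ ⟨tri⟩ x) ⊖ μ ⊗ ⟨tri⟩ x ⊗ ⟨tri⟩ z

    -- The tail of the edge of f with head x.
    prior : ℤ × ℤ → ℤ → ℤ
    prior (w′ , z′) x′ = ⟦ x ⊖ con (+ 1) ⊖ μ ⊗ (w ⊕ (x ⊖ con (+ 1)) ⊗ z) ⟧ (env w′ z′ x′ x′)

    -- The edge of the 2-face f with tail x, and the one with head x.
    outgoing incoming : ℤ × ℤ → ℤ → ℤ × ℤ
    outgoing (w′ , z′) x′ = ⟦ ⊝ rest x w z ⟧ (env w′ z′ x′ x′) , x′
    incoming f x = outgoing f (prior f x)

    outgoing-∼ : ∀ f x → outgoing f x ∼ f
    outgoing-∼ (w′ , z′) x′ = incident (mod! (E (⊝ rest x w z) x w z) (con (+ 0)) ≡.refl (env w′ z′ x′ x′))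

    outgoing-unique : ∀ {e f} → e ∼ f → e ≋ outgoing f (tail e)
    outgoing-unique {y′ , x′} {w′ , z′} (incident v) = ≈-trans (≈-trans
        (mod! y (E y x w z ⊕ ⊝ rest x w z) ≡.refl (env w′ z′ y′ x′)) (shift v))
        (mod! (⊝ rest x w z) (⊝ rest x w z) ≡.refl (env w′ z′ x′ x′)) , ≈-refl
      where
      shift : ∀ {a b} → a ≈ + 0 → a ℤ.+ b ≈ b
      shift {_} {b} (multiple q ≡.refl) = mod! {2} (con (+ 0) ⊕ var 0F ⊗ (con (+ 16) ⊗ 𝕁) ⊕ var 1F) (var 1F) ≡.refl (q ∷ b ∷ [])

    outgoing-cong : ∀ f {x x′} → x ≈ x′ → outgoing f x ≋ outgoing f x′
    outgoing-cong (w′ , z′) {_} {x′} (multiple q ≡.refl) =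
      mod! (⊝ rest (x ⊕ y ⊗ 16J) w z) (⊝ rest x w z) ≡.refl (env w′ z′ q x′) , multiple q ≡.refl

    base-∼ : ∀ x → (+ 0 , x) ∼ (+ 0 , + 0)
    base-∼ x′ = incident (mod! (E (con (+ 0)) x (con (+ 0)) (con (+ 0))) (con (+ 0)) ≡.refl (env x′ x′ x′ x′))

    incoming-∼ : ∀ f x → incoming f x ∼ f
    incoming-∼ f x = outgoing-∼ f _

    head-incoming : ∀ f x → x ≈ head (incoming f x)
    head-incoming (w′ , z′) x′ = mod! x (t ⊕ con (+ 1) ⊕ μ ⊗ ⊝ rest t w z) ≡.refl (env w′ z′ x′ x′)
      where
      t : V
      t = x ⊖ con (+ 1) ⊖ μ ⊗ (w ⊕ (x ⊖ con (+ 1)) ⊗ z)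

    prior-cong : ∀ f {x x′} → x ≈ x′ → prior f x ≈ prior f x′
    prior-cong (w′ , z′) {_} {x′} (multiple q ≡.refl) =
      mod! (X ⊖ con (+ 1) ⊖ μ ⊗ (w ⊕ (X ⊖ con (+ 1)) ⊗ z)) (x ⊖ con (+ 1) ⊖ μ ⊗ (w ⊕ (x ⊖ con (+ 1)) ⊗ z)) ≡.refl (env w′ z′ q x′)
      where
      X : V
      X = x ⊕ y ⊗ 16J

    prior-head : ∀ f t → prior f (head (outgoing f t)) ≈ t
    prior-head (w′ , z′) t = mod! (X ⊖ con (+ 1) ⊖ μ ⊗ (w ⊕ (X ⊖ con (+ 1)) ⊗ z)) x ≡.refl (env w′ z′ t t)
      where
      X : V
      X = x ⊕ con (+ 1) ⊕ μ ⊗ (⊝ rest x w z)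

    incoming-unique : ∀ {e f x} → e ∼ f → x ≈ head e → e ≋ incoming f x
    incoming-unique {e} {f} e∼f p = ≋-trans (outgoing-unique e∼f) (outgoing-cong f (≈-sym
      (≈-trans (prior-cong f (≈-trans p (head-cong (outgoing-unique e∼f)))) (prior-head f (tail e)))))

    -- The n-th vertex after x along the 2-face f, in closed form.
    private
      P : V → V → V → V → V
      P n x w z = x ⊕ n ⊕ μ ⊗ (n ⊗ (w ⊕ x ⊗ z) ⊕ ⟨tri⟩ n ⊗ z)
      D : V → V → V → V → V
      D x x′ w z = x′ ⊖ x ⊖ μ ⊗ ((x′ ⊖ x) ⊗ (w ⊕ x ⊗ z) ⊕ ⟨tri⟩ (x′ ⊖ x) ⊗ z)

    advance : ℤ × ℤ → ℤ → ℤ → ℤ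
    advance (w′ , z′) n x′ = ⟦ P y x w z ⟧ (env w′ z′ n x′)

    distance : ℤ × ℤ → ℤ → ℤ → ℤ
    distance (w′ , z′) x′ x″ = ⟦ D y x w z ⟧ (env w′ z′ x′ x″)

    advance-0 : ∀ f x → advance f (+ 0) x ≈ x
    advance-0 (w′ , z′) x′ = mod! (P (con (+ 0)) x w z) x ≡.refl (env w′ z′ x′ x′)

    advance-suc : ∀ f n x → head (outgoing f (advance f n x)) ≈ advance f (ℤ.suc n) x
    advance-suc (w′ , z′) n x′ = mod! (P y x w z ⊕ con (+ 1) ⊕ μ ⊗ ⊝ rest (P y x w z) w z) (P (con (+ 1) ⊕ y) x w z) ≡.refl (env w′ z′ n x′)

    advance-cong : ∀ f {n n′} x → n ≈ n′ → advance f n x ≈ advance f n′ x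
    advance-cong (w′ , z′) {_} {n} x′ (multiple q ≡.refl) =
      mod! {7} (P′ (var 4F ⊕ var 6F ⊗ (con (+ 16) ⊗ 𝕁))) (P′ (var 4F)) ≡.refl (δ₁ ∷ δ₂ ∷ w′ ∷ z′ ∷ n ∷ x′ ∷ q ∷ [])
      where
      P′ : Expr 7 → Expr 7
      P′ n = var 5F ⊕ n ⊕ μ ⊗ (n ⊗ (var 2F ⊕ var 5F ⊗ var 3F) ⊕ ⟨tri⟩ n ⊗ var 3F)

    -- The boundary of a 2-face is therefore a single cycle through all vertices, which makes the
    -- section below a 2-face connected.
    advance-distance : ∀ f x x′ → advance f (distance f x x′) x ≈ x′
    advance-distance (w′ , z′) x′ x″ = mod! (P (D y x w z) y w z) x ≡.refl (env w′ z′ x′ x″)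

    -- The edges and 2-faces around the vertex x in the facet c, in cyclic
    -- order; the 2-face after the edge (y , x) is spoke y.
    module Spokes (x′ c : ℤ) where
      private
        S : V → V
        S y = ⊝ (y ⊕ x ⊗ z ⊖ κ (sign d₁) ⊗ (y ⊗ x ⊕ z ⊗ x ⊕ z ⊗ ⟨tri⟩ x)
          ⊕ κ (sign d₂) ⊗ (z ⊗ y ⊕ x ⊗ ⟨tri⟩ z) ⊖ μ ⊗ ⟨tri⟩ z ⊗ ⟨tri⟩ x)
        ρ : ℤ → Vec ℤ 6
        ρ y = env y c y x′
        -- Closed solutions of the linear incidence equations. In the 2-face after (y , x) the other
        -- edge at the vertex is `back`; the other 2-face of the facet at that edge is `opposite`;
        -- its other edge at the vertex leaves it again and is `next`.
        back-y back-x opposite-w opposite-z turned : V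
        back-y = y ⊕ z ⊕ con (+ 12) ⊗ 𝕁 ⊗ y ⊕ con (+ 4) ⊗ 𝕁 ⊗ ⟨tri⟩ z ⊕ μ ⊗ (⟨tri⟩ z ⊗ x ⊕ z ⊗ y ⊕ d₂ ⊗ ⟨tri⟩ z ⊕ d₂ ⊗ z ⊕ d₁ ⊗ y ⊕ d₁ ⊗ z)
        back-x = x ⊖ con (+ 1) ⊕ μ ⊗ (y ⊕ z)
        opposite-w = ⊝ con (+ 1) ⊖ y ⊕ x ⊖ z ⊗ x ⊕ con (+ 4) ⊗ 𝕁 ⊗ (con (+ 1) ⊕ y ⊕ ⟨tri⟩ x ⊕ con (+ 3) ⊗ x ⊕ con (+ 3) ⊗ x ⊗ y
          ⊕ con (+ 3) ⊗ ⟨tri⟩ z ⊗ x ⊕ con (+ 3) ⊗ z ⊗ y ⊕ con (+ 3) ⊗ z ⊗ ⟨tri⟩ x)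
          ⊕ μ ⊗ (⟨tri⟩ z ⊗ ⟨tri⟩ x ⊕ d₂ ⊗ (con (+ 1) ⊕ y ⊕ x ⊕ ⟨tri⟩ z ⊗ x ⊕ z ⊗ y ⊕ z ⊗ x) ⊕ d₁ ⊗ (⟨tri⟩ x ⊕ x ⊗ y ⊕ z ⊗ ⟨tri⟩ x ⊕ z ⊗ x))
        opposite-z = z ⊖ con (+ 1) ⊕ μ ⊗ (con (+ 1) ⊕ y ⊕ x ⊕ z ⊗ x)
        turned = y ⊕ con (+ 1) ⊖ κ (sign d₂) ⊗ z

      spoke back opposite : ℤ → ℤ × ℤ
      spoke y′ = ⟦ S y ⟧ (ρ y′) , c
      back y′ = ⟦ back-y ⟧ (ρ y′) , ⟦ back-x ⟧ (ρ y′)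
      opposite y′ = ⟦ opposite-w ⟧ (ρ y′) , ⟦ opposite-z ⟧ (ρ y′)

      turned-by : ℤ → ℤ → ℤ
      turned-by n y′ = ⟦ y ⊕ w ⊗ (con (+ 1) ⊖ κ (sign d₂) ⊗ z) ⟧ (env n c y′ x′)

      angle : ℤ → ℤ → ℤ
      angle y′ y″ = ⟦ (w ⊖ y) ⊗ (con (+ 1) ⊕ κ (sign d₂) ⊗ z) ⟧ (env y″ c y′ x′)

      next : ℤ → ℤ
      next y′ = ⟦ turned ⟧ (ρ y′)

      edge-spoke : ∀ y → (y , x′) ∼ spoke y
      edge-spoke y′ = incident (mod! (E y x (S y) z) (con (+ 0)) ≡.refl (ρ y′))

      back-spoke : ∀ y → back y ∼ spoke y
      back-spoke y′ = incident (mod! (E back-y back-x (S y) z) (con (+ 0)) ≡.refl (ρ y′))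

      back-opposite : ∀ y → back y ∼ opposite y
      back-opposite y′ = incident (mod! (E back-y back-x opposite-w opposite-z) (con (+ 0)) ≡.refl (ρ y′))

      next-opposite : ∀ y → (next y , x′) ∼ opposite y
      next-opposite y′ = incident (mod! (E turned x opposite-w opposite-z) (con (+ 0)) ≡.refl (ρ y′))

      back∋ : ∀ y → x′ ≈ head (back y)
      back∋ y′ = mod! x (back-x ⊕ con (+ 1) ⊕ μ ⊗ back-y) ≡.refl (ρ y′)

      opposite∋ : ∀ y → c ≈ head (opposite y)
      opposite∋ y′ = mod! z (opposite-z ⊕ con (+ 1) ⊕ μ ⊗ opposite-w) ≡.refl (ρ y′)

      next-turned : ∀ n y → next (turned-by n y) ≈ turned-by (ℤ.suc n) y
      next-turned n y′ = mod! (y ⊕ w ⊗ (con (+ 1) ⊖ κ (sign d₂) ⊗ z) ⊕ con (+ 1) ⊖ κ (sign d₂) ⊗ z)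
        (y ⊕ (con (+ 1) ⊕ w) ⊗ (con (+ 1) ⊖ κ (sign d₂) ⊗ z)) ≡.refl (env n c y′ x′)

      turned-0 : ∀ y → turned-by (+ 0) y ≈ y
      turned-0 y′ = mod! (y ⊕ con (+ 0) ⊗ (con (+ 1) ⊖ κ (sign d₂) ⊗ z)) y ≡.refl (ρ y′)

      turned-cong : ∀ {n n′} y → n ≈ n′ → turned-by n y ≈ turned-by n′ y
      turned-cong {_} {n} y′ (multiple q ≡.refl) = mod! {5} (var 2F ⊕ (var 3F ⊕ var 4F ⊗ (con (+ 16) ⊗ 𝕁)) ⊗ u) (var 2F ⊕ var 3F ⊗ u)
        ≡.refl (δ₂ ∷ c ∷ y′ ∷ n ∷ q ∷ [])
        where
        u : Expr 5
        u = con (+ 1) ⊖ κ (sign (var 0F)) ⊗ var 1F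

      -- One turn adds the unit 1 - 4Jε₂c, whose inverse is 1 + 4Jε₂c; repeated turning hence
      -- reaches every edge leaving the vertex.
      turned-angle : ∀ y y′ → turned-by (angle y y′) y ≈ y′
      turned-angle y′ y″ = mod! (y ⊕ ((w ⊖ y) ⊗ (con (+ 1) ⊕ κ (sign d₂) ⊗ z)) ⊗ (con (+ 1) ⊖ κ (sign d₂) ⊗ z)) w ≡.refl (env y″ c y′ x′)

  -- The defects computed from the two sides differ by the factor `ratio`. This is the duality that
  -- transfers statements about edges of a 2-face to 2-faces at an edge.
  ∼-swap : ∀ {J δ₁ δ₂ e f} → Relation._∼_ J δ₁ δ₂ e f → Relation._∼_ J δ₂ δ₁ f e
  ∼-swap {J} {δ₁} {δ₂} {y , x} {w , z} (Relation.incident v) = Relation.incident (vanish v)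
    where
    open Semantics J
    open Congruence J
    d₁ d₂ w′ z′ y′ x′ : Expr 6
    d₁ = var 0F
    d₂ = var 1F
    w′ = var 2F
    z′ = var 3F
    y′ = var 4F
    x′ = var 5F
    E : Expr 6 → Expr 6 → Expr 6 → Expr 6 → Expr 6 → Expr 6 → Expr 6
    E d₁ d₂ y x w z = y ⊕ w ⊕ x ⊗ z ⊖ κ (sign d₂) ⊗ (w ⊗ z ⊕ x ⊗ z ⊕ x ⊗ ⟨tri⟩ z)
      ⊕ κ (sign d₁) ⊗ (x ⊗ w ⊕ z ⊗ ⟨tri⟩ x) ⊖ μ ⊗ ⟨tri⟩ x ⊗ ⟨tri⟩ z
    ratio : Expr 6
    ratio = con (+ 1) ⊖ κ (sign d₁ ⊗ x′ ⊖ sign d₂ ⊗ z′)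
    vanish : Relation.defect J δ₁ δ₂ (y , x) (w , z) ≈ + 0 → Relation.defect J δ₂ δ₁ (w , z) (y , x) ≈ + 0
    vanish (multiple q eq) = ≈-trans (mod! (E d₂ d₁ w′ z′ y′ x′) (E d₁ d₂ y′ x′ w′ z′ ⊗ ratio) ≡.refl (δ₁ ∷ δ₂ ∷ w ∷ z ∷ y ∷ x ∷ []))
      (≡.subst (λ t → t ℤ.* ⟦ ratio ⟧ (δ₁ ∷ δ₂ ∷ w ∷ z ∷ y ∷ x ∷ []) ≈ + 0) (≡.sym eq)
        (mod! {2} ((con (+ 0) ⊕ var 0F ⊗ (con (+ 16) ⊗ 𝕁)) ⊗ var 1F) (con (+ 0)) ≡.refl (q ∷ ⟦ ratio ⟧ (δ₁ ∷ δ₂ ∷ w ∷ z ∷ y ∷ x ∷ []) ∷ [])))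

-- Finite setoids and the residues modulo 16J.

module Finite where

  open import Data.Empty using (⊥-elim)
  open import Data.Fin as Fin using (Fin; zero; suc; toℕ; fromℕ<)
  open import Data.Fin.Patterns
  import Data.Fin.Properties as Fin
  open import Data.Integer as ℤ using (ℤ; +_; -[1+_])
  import Data.Integer.Properties as ℤ
  open import Data.Integer.DivMod using (_/ℕ_; _%ℕ_; a≡a%ℕn+[a/ℕn]*n; n%ℕd<d)
  open import Data.Integer.Solver using (module +-*-Solver)
  open import Data.Nat as ℕ using (ℕ; zero; suc; NonZero)
  import Data.Nat.Properties as ℕ
  open import Data.Product using (_×_; _,_; proj₁; proj₂)
  open import Data.Product.Relation.Binary.Pointwise.NonDependent using (×-setoid)
  open import Data.Sum using (_⊎_; inj₁; inj₂)
  open import Function.Bundles using (Inverse)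
  open import Level using (0ℓ)
  open import Relation.Binary.Bundles using (Setoid)
  open import Relation.Binary.Definitions using (Decidable)
  open import Relation.Binary.PropositionalEquality as ≡ using (_≡_)
  open import Relation.Nullary using (¬_; Dec; yes; no; contradiction)
  open import Defs using (HasSize)
  open Modular
  open Half using (module Congruence)

  module _ {S : Setoid 0ℓ 0ℓ} where
    open Setoid S

    hasSize : ∀ {n} (to : Carrier → Fin n) (from : Fin n → Carrier) → (∀ {x y} → x ≈ y → to x ≡ to y) →
              (∀ i → to (from i) ≡ i) → (∀ x → from (to x) ≈ x) → HasSize S n
    hasSize to from to-cong to-from from-to = record
      { to = to ; from = from ; to-cong = to-cong ; from-cong = λ { ≡.refl → refl }
      ; inverse = (λ {i} {x} eq → ≡.trans (to-cong eq) (to-from i))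
                , (λ {x} {i} eq → trans (reflexive (≡.cong from eq)) (from-to x))
      }

    module Size {n} (size : HasSize S n) where
      open Inverse size public

      to-injective : ∀ {x y} → to x ≡ to y → x ≈ y
      to-injective {x} {y} eq = trans (sym (strictlyInverseʳ x)) (trans (reflexive (≡.cong from eq)) (strictlyInverseʳ y))

      decidable : Decidable _≈_
      decidable x y with to x Fin.≟ to y
      ... | yes eq = yes (to-injective eq)
      ... | no ne  = no λ eq → ne (to-cong eq)

    two : ∀ a b → ¬ (a ≈ b) → (∀ x → x ≈ a ⊎ x ≈ b) → HasSize S 2
    two a b a≉b split = hasSize (λ x → index (split x)) element
      (λ {x} {y} eq → index-cong (split x) (split y) eq) index-element (λ x → element-index (split x))
      where
      index : ∀ {x} → x ≈ a ⊎ x ≈ b → Fin 2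
      index (inj₁ _) = 0F
      index (inj₂ _) = 1F
      element : Fin 2 → Carrier
      element 0F = a
      element 1F = b
      index-cong : ∀ {x y} (p : x ≈ a ⊎ x ≈ b) (q : y ≈ a ⊎ y ≈ b) → x ≈ y → index p ≡ index q
      index-cong (inj₁ p) (inj₁ q) eq = ≡.refl
      index-cong (inj₂ p) (inj₂ q) eq = ≡.refl
      index-cong (inj₁ p) (inj₂ q) eq = contradiction (trans (sym p) (trans eq q)) a≉b
      index-cong (inj₂ p) (inj₁ q) eq = contradiction (trans (sym q) (trans (sym eq) p)) a≉b
      index-element : ∀ i → index (split (element i)) ≡ i
      index-element 0F with split a
      ... | inj₁ _ = ≡.refl
      ... | inj₂ p = contradiction p a≉b
      index-element 1F with split b
      ... | inj₁ p = contradiction (sym p) a≉b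
      ... | inj₂ _ = ≡.refl
      element-index : ∀ {x} (p : x ≈ a ⊎ x ≈ b) → element (index p) ≈ x
      element-index (inj₁ p) = sym p
      element-index (inj₂ p) = sym p

  module _ {R S : Setoid 0ℓ 0ℓ} where
    private
      module R = Setoid R
      module S = Setoid S

    transport-size : ∀ {n} (f : R.Carrier → S.Carrier) (g : S.Carrier → R.Carrier) →
      (∀ {x y} → x R.≈ y → f x S.≈ f y) → (∀ {x y} → x S.≈ y → g x R.≈ g y) →
      (∀ y → f (g y) S.≈ y) → (∀ x → g (f x) R.≈ x) → HasSize S n → HasSize R n
    transport-size f g f-cong g-cong fg gf size = hasSize (λ x → to (f x)) (λ i → g (from i))
      (λ eq → to-cong (f-cong eq)) (λ i → ≡.trans (to-cong (fg (from i))) (strictlyInverseˡ i))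
      (λ x → R.trans (g-cong (strictlyInverseʳ (f x))) (gf x))
      where open Inverse size

    ×-size : ∀ {m n} → HasSize R m → HasSize S n → HasSize (×-setoid R S) (m ℕ.* n)
    ×-size {m} {n} r s = hasSize
      (λ (x , y) → Fin.combine (R′.to x) (S′.to y))
      (λ i → R′.from (proj₁ (Fin.remQuot {m} n i)) , S′.from (proj₂ (Fin.remQuot {m} n i)))
      (λ (p , q) → ≡.cong₂ Fin.combine (R′.to-cong p) (S′.to-cong q))
      (λ i → ≡.trans (≡.cong₂ Fin.combine (R′.strictlyInverseˡ _) (S′.strictlyInverseˡ _)) (Fin.combine-remQuot {m} n i))
      (λ (x , y) → R.trans (R.reflexive (≡.cong (λ t → R′.from (proj₁ t)) (Fin.remQuot-combine (R′.to x) (S′.to y)))) (R′.strictlyInverseʳ x)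
                 , S.trans (S.reflexive (≡.cong (λ t → S′.from (proj₂ t)) (Fin.remQuot-combine (R′.to x) (S′.to y)))) (S′.strictlyInverseʳ y))
      where
      module R′ = Inverse r
      module S′ = Inverse s

  module Residues (N : ℕ) (J : ℤ) .{{_ : NonZero N}} (N-eq : + N ≡ + 16 ℤ.* J) where
    open Semantics J
    open Congruence J

    remainder : ℤ → Fin N
    remainder z = fromℕ< (n%ℕd<d z N)

    private
      unique : ∀ q {r r′} → r ℕ.< N → r′ ℕ.< N → + r ≡ + r′ ℤ.+ q ℤ.* + N → r ≡ r′
      unique (+ zero) r<N r′<N eq = ℤ.+-injective (≡.trans eq (ℤ.+-identityʳ _))
      unique (+ suc k) {r} {r′} r<N r′<N eq = ⊥-elim (ℕ.<⇒≱ r<N (≡.subst (N ℕ.≤_)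
        (≡.sym (ℤ.+-injective (≡.trans eq (≡.trans (≡.cong (λ t → + r′ ℤ.+ t) (≡.sym (ℤ.pos-* (suc k) N))) (≡.sym (ℤ.pos-+ r′ (suc k ℕ.* N)))))))
        (ℕ.≤-trans (ℕ.m≤m+n N (k ℕ.* N)) (ℕ.m≤n+m (suc k ℕ.* N) r′))))
      unique -[1+ k ] {r} {r′} r<N r′<N eq = ≡.sym (unique (+ suc k) r′<N r<N (begin
        + r′                                            ≡⟨ solve 2 (λ r n → r := r :- n :+ n) ≡.refl (+ r′) (+ suc k ℤ.* + N) ⟩
        + r′ ℤ.- + suc k ℤ.* + N ℤ.+ + suc k ℤ.* + N    ≡⟨ ≡.cong (λ t → + r′ ℤ.+ t ℤ.+ + suc k ℤ.* + N) (ℤ.neg-distribˡ-* (+ suc k) (+ N)) ⟩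
        + r′ ℤ.+ -[1+ k ] ℤ.* + N ℤ.+ + suc k ℤ.* + N   ≡⟨ ≡.cong (λ t → t ℤ.+ + suc k ℤ.* + N) eq ⟨
        + r ℤ.+ + suc k ℤ.* + N                         ∎))
        where
        open ≡.≡-Reasoning
        open +-*-Solver using (solve; _:+_; _:-_; _:=_)

    remainder-spec : ∀ z → z ≈ + toℕ (remainder z)
    remainder-spec z = multiple (z /ℕ N) (≡.trans (a≡a%ℕn+[a/ℕn]*n z N)
      (≡.cong₂ (λ r n → + r ℤ.+ (z /ℕ N) ℤ.* n) (≡.sym (Fin.toℕ-fromℕ< (n%ℕd<d z N))) N-eq))

    small-unique : ∀ {r r′} → r ℕ.< N → r′ ℕ.< N → + r ≈ + r′ → r ≡ r′
    small-unique {r} {r′} p q (multiple k eq) = unique k p q (≡.trans eq (≡.cong (λ n → + r′ ℤ.+ k ℤ.* n) (≡.sym N-eq)))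

    ℤ/N-size : HasSize ℤ/N N
    ℤ/N-size = hasSize remainder (λ i → + toℕ i)
      (λ {x} {y} eq → Fin.toℕ-injective (small-unique (Fin.toℕ<n (remainder x)) (Fin.toℕ<n (remainder y))
        (≈-trans (≈-sym (remainder-spec x)) (≈-trans eq (remainder-spec y)))))
      (λ i → Fin.toℕ-injective (small-unique (Fin.toℕ<n _) (Fin.toℕ<n i) (≈-sym (remainder-spec (+ toℕ i)))))
      (λ z → ≈-sym (remainder-spec z))

    infix 4 _≈?_
    _≈?_ : Decidable _≈_
    _≈?_ = Size.decidable ℤ/N-size

-- The face poset of the model and the diamond condition.

module Model where

  open import Data.Fin using (zero; suc)
  open import Data.Integer as ℤ using (ℤ; +_)
  import Data.Integer.Properties as ℤ
  open import Data.List using (List; []; _∷_)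
  open import Data.List.Relation.Binary.Pointwise using ([]; _∷_)
  open import Data.List.Relation.Unary.All as All using (All; []; _∷_)
  open import Data.List.Relation.Unary.Any using (Any; here; there)
  open import Data.List.Relation.Unary.Linked using (Linked; []; _∷_)
  open import Data.Nat as ℕ using (ℕ; zero; suc; s≤s; z≤n; NonZero)
  import Data.Nat.Properties as ℕ
  open import Data.Product using (Σ-syntax; ∃; ∃-syntax; _×_; _,_; proj₁; proj₂)
  open import Data.Sum using (_⊎_; inj₁; inj₂)
  open import Relation.Binary.Bundles using (Poset; Setoid)
  open import Relation.Binary.Definitions using (Decidable)
  open import Relation.Binary.PropositionalEquality as ≡ using (_≡_; _≢_)
  open import Relation.Nullary using (¬_; Dec; yes; no; contradiction)
  open import Defs using (RankedPoset; HasSize)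
  open Modular
  open Half
  open Incidence
  open Finite

  module Faces (N : ℕ) (J : ℤ) .{{N≢0 : NonZero N}} (N-eq : + N ≡ + 16 ℤ.* J) (δ₁ δ₂ : ℤ) where
    open Semantics J
    open Congruence J
    open Ends J
    open Residues N J N-eq
    module U = Relation J δ₁ δ₂
    module L = Relation J δ₂ δ₁
    open U using (_∼_)
    open Setoid ℤ/N² using () renaming (_≈_ to _≋_; trans to ≋-trans; sym to ≋-sym; refl to ≋-refl)

    -- Vertices are integers mod 16J, an edge (y , x) joins x to x + 1 + 8Jy,
    -- a 2-face (w , z) lies in the facets z and z + 1 + 8Jw.
    data Face : Set where
      bottom : Face
      vertex : ℤ → Face
      edge   : ℤ × ℤ → Face
      face   : ℤ × ℤ → Face
      facet  : ℤ → Face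
      top    : Face

    rank : Face → ℕ
    rank bottom     = 0
    rank (vertex _) = 1
    rank (edge _)   = 2
    rank (face _)   = 3
    rank (facet _)  = 4
    rank top        = 5

    infix 4 _≈ᶠ_ _⋖_ _≤ᶠ_

    data _≈ᶠ_ : Face → Face → Set where
      bottom : bottom ≈ᶠ bottom
      vertex : ∀ {x y} → x ≈ y → vertex x ≈ᶠ vertex y
      edge   : ∀ {x y} → x ≋ y → edge x ≈ᶠ edge y
      face   : ∀ {x y} → x ≋ y → face x ≈ᶠ face y
      facet  : ∀ {x y} → x ≈ y → facet x ≈ᶠ facet y
      top    : top ≈ᶠ top

    data _⋖_ : Face → Face → Set where
      bottom⋖vertex : ∀ {x} → bottom ⋖ vertex x
      vertex⋖edge   : ∀ {x e} → e ∋ x → vertex x ⋖ edge e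
      edge⋖face     : ∀ {e f} → e ∼ f → edge e ⋖ face f
      face⋖facet    : ∀ {f c} → f ∋ c → face f ⋖ facet c
      facet⋖top     : ∀ {c} → facet c ⋖ top

    -- The polytope is flat: faces whose ranks differ by 2 or more are incident.
    data _≤ᶠ_ (F G : Face) : Set where
      equal : F ≈ᶠ G → F ≤ᶠ G
      cover : F ⋖ G → F ≤ᶠ G
      far   : 2 ℕ.+ rank F ℕ.≤ rank G → F ≤ᶠ G

    ≈ᶠ-refl : ∀ {F} → F ≈ᶠ F
    ≈ᶠ-refl {bottom}   = bottom
    ≈ᶠ-refl {vertex _} = vertex ≈-refl
    ≈ᶠ-refl {edge _}   = edge ≋-refl
    ≈ᶠ-refl {face _}   = face ≋-refl
    ≈ᶠ-refl {facet _}  = facet ≈-refl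
    ≈ᶠ-refl {top}      = top

    ≈ᶠ-sym : ∀ {F G} → F ≈ᶠ G → G ≈ᶠ F
    ≈ᶠ-sym bottom     = bottom
    ≈ᶠ-sym (vertex p) = vertex (≈-sym p)
    ≈ᶠ-sym (edge p)   = edge (≋-sym p)
    ≈ᶠ-sym (face p)   = face (≋-sym p)
    ≈ᶠ-sym (facet p)  = facet (≈-sym p)
    ≈ᶠ-sym top        = top

    ≈ᶠ-trans : ∀ {F G H} → F ≈ᶠ G → G ≈ᶠ H → F ≈ᶠ H
    ≈ᶠ-trans bottom     bottom     = bottom
    ≈ᶠ-trans (vertex p) (vertex q) = vertex (≈-trans p q)
    ≈ᶠ-trans (edge p)   (edge q)   = edge (≋-trans p q)
    ≈ᶠ-trans (face p)   (face q)   = face (≋-trans p q)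
    ≈ᶠ-trans (facet p)  (facet q)  = facet (≈-trans p q)
    ≈ᶠ-trans top        top        = top

    _≋?_ : Decidable _≋_
    (a , b) ≋? (c , d) with a ≈? c | b ≈? d
    ... | yes p | yes q = yes (p , q)
    ... | no ¬p | _     = no λ eq → ¬p (proj₁ eq)
    ... | _     | no ¬q = no λ eq → ¬q (proj₂ eq)

    _≟ᶠ_ : Decidable _≈ᶠ_
    bottom   ≟ᶠ bottom = yes bottom
    vertex x ≟ᶠ vertex y with x ≈? y
    ... | yes p = yes (vertex p)
    ... | no ¬p = no λ { (vertex p) → ¬p p }
    edge x ≟ᶠ edge y with x ≋? y
    ... | yes p = yes (edge p)
    ... | no ¬p = no λ { (edge p) → ¬p p }
    face x ≟ᶠ face y with x ≋? y
    ... | yes p = yes (face p)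
    ... | no ¬p = no λ { (face p) → ¬p p }
    facet x ≟ᶠ facet y with x ≈? y
    ... | yes p = yes (facet p)
    ... | no ¬p = no λ { (facet p) → ¬p p }
    top ≟ᶠ top = yes top
    bottom ≟ᶠ vertex _ = no λ ()
    bottom ≟ᶠ edge _ = no λ ()
    bottom ≟ᶠ face _ = no λ ()
    bottom ≟ᶠ facet _ = no λ ()
    bottom ≟ᶠ top = no λ ()
    vertex _ ≟ᶠ bottom = no λ ()
    vertex _ ≟ᶠ edge _ = no λ ()
    vertex _ ≟ᶠ face _ = no λ ()
    vertex _ ≟ᶠ facet _ = no λ ()
    vertex _ ≟ᶠ top = no λ ()
    edge _ ≟ᶠ bottom = no λ ()
    edge _ ≟ᶠ vertex _ = no λ ()
    edge _ ≟ᶠ face _ = no λ ()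
    edge _ ≟ᶠ facet _ = no λ ()
    edge _ ≟ᶠ top = no λ ()
    face _ ≟ᶠ bottom = no λ ()
    face _ ≟ᶠ vertex _ = no λ ()
    face _ ≟ᶠ edge _ = no λ ()
    face _ ≟ᶠ facet _ = no λ ()
    face _ ≟ᶠ top = no λ ()
    facet _ ≟ᶠ bottom = no λ ()
    facet _ ≟ᶠ vertex _ = no λ ()
    facet _ ≟ᶠ edge _ = no λ ()
    facet _ ≟ᶠ face _ = no λ ()
    facet _ ≟ᶠ top = no λ ()
    top ≟ᶠ bottom = no λ ()
    top ≟ᶠ vertex _ = no λ ()
    top ≟ᶠ edge _ = no λ ()
    top ≟ᶠ face _ = no λ ()
    top ≟ᶠ facet _ = no λ ()

    rank-cong : ∀ {F G} → F ≈ᶠ G → rank F ≡ rank G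
    rank-cong bottom     = ≡.refl
    rank-cong (vertex _) = ≡.refl
    rank-cong (edge _)   = ≡.refl
    rank-cong (face _)   = ≡.refl
    rank-cong (facet _)  = ≡.refl
    rank-cong top        = ≡.refl

    ⋖-rank : ∀ {F G} → F ⋖ G → rank G ≡ suc (rank F)
    ⋖-rank bottom⋖vertex   = ≡.refl
    ⋖-rank (vertex⋖edge _) = ≡.refl
    ⋖-rank (edge⋖face _)   = ≡.refl
    ⋖-rank (face⋖facet _)  = ≡.refl
    ⋖-rank facet⋖top       = ≡.refl

    ⋖-resp : ∀ {F F′ G G′} → F ≈ᶠ F′ → G ≈ᶠ G′ → F ⋖ G → F′ ⋖ G′
    ⋖-resp bottom     (vertex _) bottom⋖vertex   = bottom⋖vertex
    ⋖-resp (vertex p) (edge q)   (vertex⋖edge r) = vertex⋖edge (∋-resp q p r)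
    ⋖-resp (edge p)   (face q)   (edge⋖face r)   = edge⋖face (U.∼-resp p q r)
    ⋖-resp (face p)   (facet q)  (face⋖facet r)  = face⋖facet (∋-resp p q r)
    ⋖-resp (facet _)  top        facet⋖top       = facet⋖top

    ≤ᶠ-rank : ∀ {F G} → F ≤ᶠ G → F ≈ᶠ G ⊎ rank F ℕ.< rank G
    ≤ᶠ-rank (equal p) = inj₁ p
    ≤ᶠ-rank (cover p) = inj₂ (ℕ.≤-reflexive (≡.sym (⋖-rank p)))
    ≤ᶠ-rank (far p)   = inj₂ (ℕ.≤-trans (ℕ.n≤1+n _) p)

    ≤ᶠ-antisym : ∀ {F G} → F ≤ᶠ G → G ≤ᶠ F → F ≈ᶠ G
    ≤ᶠ-antisym p q with ≤ᶠ-rank p | ≤ᶠ-rank q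
    ... | inj₁ eq | _       = eq
    ... | inj₂ _  | inj₁ eq = ≈ᶠ-sym eq
    ... | inj₂ a  | inj₂ b  = contradiction a (ℕ.<-asym b)

    ≤ᶠ-trans : ∀ {F G H} → F ≤ᶠ G → G ≤ᶠ H → F ≤ᶠ H
    ≤ᶠ-trans (equal p) (equal q) = equal (≈ᶠ-trans p q)
    ≤ᶠ-trans (equal p) (cover q) = cover (⋖-resp (≈ᶠ-sym p) ≈ᶠ-refl q)
    ≤ᶠ-trans (equal p) (far q)   = far (ℕ.≤-trans (ℕ.≤-reflexive (≡.cong (2 ℕ.+_) (rank-cong p))) q)
    ≤ᶠ-trans (cover p) (equal q) = cover (⋖-resp ≈ᶠ-refl q p)
    ≤ᶠ-trans (far p)   (equal q) = far (ℕ.≤-trans p (ℕ.≤-reflexive (rank-cong q)))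
    ≤ᶠ-trans (cover p) (cover q) = far (ℕ.≤-reflexive (≡.trans (≡.cong suc (≡.sym (⋖-rank p))) (≡.sym (⋖-rank q))))
    ≤ᶠ-trans (cover p) (far q)   = far (ℕ.≤-trans (ℕ.≤-reflexive (≡.cong suc (≡.sym (⋖-rank p)))) (ℕ.≤-trans (ℕ.n≤1+n _) q))
    ≤ᶠ-trans (far p)   (cover q) = far (ℕ.≤-trans p (ℕ.≤-trans (ℕ.n≤1+n _) (ℕ.≤-reflexive (≡.sym (⋖-rank q)))))
    ≤ᶠ-trans (far p)   (far q)   = far (ℕ.≤-trans p (ℕ.≤-trans (ℕ.n≤1+n _) (ℕ.≤-trans (ℕ.n≤1+n _) q)))

    ranked : RankedPoset
    ranked = record
      { poset = record
        { Carrier = Face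
        ; _≈_ = _≈ᶠ_
        ; _≤_ = _≤ᶠ_
        ; isPartialOrder = record
          { isPreorder = record
            { isEquivalence = record { refl = ≈ᶠ-refl ; sym = ≈ᶠ-sym ; trans = ≈ᶠ-trans }
            ; reflexive = equal
            ; trans = ≤ᶠ-trans
            }
          ; antisym = ≤ᶠ-antisym
          }
        }
      ; rank+1 = rank
      ; rank+1-cong = rank-cong
      ; rank+1-mono = λ (p , ne) → less (≤ᶠ-rank p) ne
      }
      where
      less : ∀ {F G} → F ≈ᶠ G ⊎ rank F ℕ.< rank G → ¬ (F ≈ᶠ G) → rank F ℕ.< rank G
      less (inj₁ eq) ne = contradiction eq ne
      less (inj₂ lt) ne = lt

    open RankedPoset ranked using (_<_; between)

    ⋖⇒< : ∀ {F G} → F ⋖ G → F < G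
    ⋖⇒< p = cover p , λ eq → ℕ.<-irrefl (rank-cong eq) (ℕ.≤-reflexive (≡.sym (⋖-rank p)))

    <⇒⋖ : ∀ {F G} → F < G → rank G ≡ suc (rank F) → F ⋖ G
    <⇒⋖ (equal p , ne) eq = contradiction p ne
    <⇒⋖ (cover p , ne) eq = p
    <⇒⋖ (far p , ne)   eq = contradiction (ℕ.≤-trans p (ℕ.≤-reflexive eq)) (ℕ.<-irrefl ≡.refl)

    far⇒< : ∀ {F G} → 2 ℕ.+ rank F ℕ.≤ rank G → F < G
    far⇒< p = far p , λ eq → ℕ.<-irrefl (rank-cong eq) (ℕ.≤-trans (ℕ.n≤1+n _) p)

    record Diamond (F G : Face) : Set where
      field
        first second : Face
        first-low    : F ⋖ first
        first-high   : first ⋖ G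
        second-low   : F ⋖ second
        second-high  : second ⋖ G
        distinct     : ¬ (first ≈ᶠ second)
        exhaust      : ∀ {H} → F ⋖ H → H ⋖ G → H ≈ᶠ first ⊎ H ≈ᶠ second

    -- At the two ends of the rank range the two faces are a tail and a head. In the middle they are
    -- the solutions of the incidence equation with prescribed tail or prescribed head; for an edge
    -- in a facet it is solved by the dual formulas.
    diamond-at : ∀ F G → rank G ≡ 2 ℕ.+ rank F → Diamond F G
    diamond-at bottom (edge e) ≡.refl = record
      { first = vertex (tail e) ; second = vertex (head e) ; first-low = bottom⋖vertex ; second-low = bottom⋖vertex
      ; first-high = vertex⋖edge (at-tail ≈-refl) ; second-high = vertex⋖edge (at-head ≈-refl)
      ; distinct = λ { (vertex p) → tail≉head e p }
      ; exhaust = λ { bottom⋖vertex (vertex⋖edge (at-tail p)) → inj₁ (vertex p)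
                    ; bottom⋖vertex (vertex⋖edge (at-head p)) → inj₂ (vertex p) }
      }
    diamond-at (vertex x) (face f) ≡.refl = record
      { first = edge (U.outgoing f x) ; second = edge (U.incoming f x)
      ; first-low = vertex⋖edge (at-tail ≈-refl) ; first-high = edge⋖face (U.outgoing-∼ f x)
      ; second-low = vertex⋖edge (at-head (U.head-incoming f x)) ; second-high = edge⋖face (U.incoming-∼ f x)
      ; distinct = λ { (edge p) → tail≉head (U.incoming f x) (≈-trans (≈-sym (proj₂ p)) (U.head-incoming f x)) }
      ; exhaust = λ { (vertex⋖edge (at-tail p)) (edge⋖face q) →
                        inj₁ (edge (≋-trans (U.outgoing-unique q) (U.outgoing-cong f (≈-sym p))))
                    ; (vertex⋖edge (at-head p)) (edge⋖face q) → inj₂ (edge (U.incoming-unique q p)) }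
      }
    diamond-at (edge e) (facet c) ≡.refl = record
      { first = face (L.outgoing e c) ; second = face (L.incoming e c)
      ; first-low = edge⋖face (∼-swap (L.outgoing-∼ e c)) ; first-high = face⋖facet (at-tail ≈-refl)
      ; second-low = edge⋖face (∼-swap (L.incoming-∼ e c)) ; second-high = face⋖facet (at-head (L.head-incoming e c))
      ; distinct = λ { (face p) → tail≉head (L.incoming e c) (≈-trans (≈-sym (proj₂ p)) (L.head-incoming e c)) }
      ; exhaust = λ { (edge⋖face q) (face⋖facet (at-tail p)) →
                        inj₁ (face (≋-trans (L.outgoing-unique (∼-swap q)) (L.outgoing-cong e (≈-sym p))))
                    ; (edge⋖face q) (face⋖facet (at-head p)) → inj₂ (face (L.incoming-unique (∼-swap q) p)) }
      }
    diamond-at (face f) top ≡.refl = record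
      { first = facet (tail f) ; second = facet (head f) ; first-high = facet⋖top ; second-high = facet⋖top
      ; first-low = face⋖facet (at-tail ≈-refl) ; second-low = face⋖facet (at-head ≈-refl)
      ; distinct = λ { (facet p) → tail≉head f p }
      ; exhaust = λ { (face⋖facet (at-tail p)) facet⋖top → inj₁ (facet p)
                    ; (face⋖facet (at-head p)) facet⋖top → inj₂ (facet p) }
      }

    diamond : ∀ {F G} → F < G → rank G ≡ 2 ℕ.+ rank F → HasSize (between F G (1 ℕ.+ rank F)) 2
    diamond {F} {G} _ eq = two (wrap first first-low first-high) (wrap second second-low second-high) distinct
      λ (H , F<H , H<G , rk) → exhaust (<⇒⋖ F<H rk) (<⇒⋖ H<G (≡.trans eq (≡.cong suc (≡.sym rk))))
      where
      open Diamond (diamond-at F G eq)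
      wrap : ∀ H → F ⋖ H → H ⋖ G → ∃[ H ] F < H × H < G × rank H ≡ 1 ℕ.+ rank F
      wrap H p q = H , ⋖⇒< p , ⋖⇒< q , ⋖-rank p

    above : ∀ F → rank F ≢ 5 → ∃[ G ] F ⋖ G
    above bottom     _ = vertex (+ 0) , bottom⋖vertex
    above (vertex x) _ = edge (+ 0 , x) , vertex⋖edge (at-tail ≈-refl)
    above (edge e)   _ = face (L.outgoing e (+ 0)) , edge⋖face (∼-swap (L.outgoing-∼ e (+ 0)))
    above (face f)   _ = facet (tail f) , face⋖facet (at-tail ≈-refl)
    above (facet c)  _ = top , facet⋖top
    above top        ne = contradiction ≡.refl ne

    rank≤5 : ∀ F → rank F ℕ.≤ 5
    rank≤5 bottom     = z≤n
    rank≤5 (vertex _) = s≤s z≤n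
    rank≤5 (edge _)   = s≤s (s≤s z≤n)
    rank≤5 (face _)   = s≤s (s≤s (s≤s z≤n))
    rank≤5 (facet _)  = s≤s (s≤s (s≤s (s≤s z≤n)))
    rank≤5 top        = ℕ.≤-refl

    infixr 5 _∷_

    -- A saturated chain up to the top. Every chain embeds in one, and a maximal chain then
    -- coincides with one; this is how a flag, given merely as a list, is found to have six faces.
    data Up : Face → Set where
      end : Up top
      _∷_ : ∀ {F G} → F ⋖ G → Up G → Up F

    upper : ∀ {F} → Up F → List Face
    upper end             = top ∷ []
    upper (_∷_ {F} _ up)  = F ∷ upper up

    record Through (F : Face) (l : List Face) : Set where
      constructor through
      field
        up      : Up F
        contain : All (λ G → Any (G ≈ᶠ_) (upper up)) l

    start : ∀ {F} (up : Up F) → Any (F ≈ᶠ_) (upper up)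
    start end      = here ≈ᶠ-refl
    start (_ ∷ _)  = here ≈ᶠ-refl

    weaken : ∀ {F G l} (p : F ⋖ G) → Through G l → Through F l
    weaken p (through up contain) = through (p ∷ up) (All.map there contain)

    -- The number n counts the ranks missing between F and G. One missing rank is filled by the
    -- diamond condition. If more are missing, any face covering F still lies at least two ranks
    -- below G, hence below G.
    connect : ∀ n {F G l} → rank G ≡ n ℕ.+ suc (rank F) → F < G → Through G l → Through F l
    connect zero eq F<G t = weaken (<⇒⋖ F<G eq) t
    connect (suc zero) {F} {G} eq F<G t = let open Diamond (diamond-at F G eq) in weaken first-low (weaken first-high t)
    connect (suc (suc n)) {F} {G} eq F<G t =
      let H , F⋖H = above F (ℕ.<⇒≢ (ℕ.≤-trans (RankedPoset.rank+1-mono ranked F<G) (rank≤5 G)))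
          eq′ = ≡.trans eq (≡.trans (≡.cong suc (≡.sym (ℕ.+-suc n (suc (rank F))))) (≡.cong (λ t → suc (n ℕ.+ suc t)) (≡.sym (⋖-rank F⋖H))))
      in weaken F⋖H (connect (suc n) eq′
           (far⇒< (ℕ.≤-trans (ℕ.m≤n+m (2 ℕ.+ rank H) n) (ℕ.≤-reflexive (≡.trans (ℕ.+-suc n (suc (rank H))) (≡.sym eq′))))) t)

    connect< : ∀ {F G l} → F < G → Through G l → Through F l
    connect< {F} {G} F<G t with ℕ.m≤n⇒∃[o]m+o≡n (RankedPoset.rank+1-mono ranked F<G)
    ... | n , eq = connect n (≡.trans (≡.sym eq) (ℕ.+-comm (suc (rank F)) n)) F<G t

    insert-start : ∀ {F l} → Through F l → Through F (F ∷ l)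
    insert-start (through up contain) = through up (start up ∷ contain)

    to-top : ∀ F → Through F []
    to-top top        = through end []
    to-top bottom     = connect< {bottom} (far⇒< (s≤s (s≤s z≤n))) (through end [])
    to-top (vertex x) = connect< {vertex x} (far⇒< (s≤s (s≤s (s≤s z≤n)))) (through end [])
    to-top (edge e)   = connect< {edge e} (far⇒< (s≤s (s≤s (s≤s (s≤s z≤n))))) (through end [])
    to-top (face f)   = connect< {face f} (far⇒< ℕ.≤-refl) (through end [])
    to-top (facet c)  = connect< (⋖⇒< facet⋖top) (through end [])

    extend : ∀ F l → Linked _<_ (F ∷ l) → Through F (F ∷ l)
    extend F []      _         = insert-start (to-top F)
    extend F (G ∷ l) (p ∷ lk)  = insert-start (connect< p (extend G l lk))

-- Flags of a 4-polytope, flag maps, and rotations of a chiral polytope.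

module General where

  open import Algebra.Bundles using (Group)
  open import Data.Empty using (⊥; ⊥-elim)
  open import Data.Fin using (Fin; zero; suc; toℕ; inject₁; fromℕ<)
  open import Data.Fin.Patterns
  import Data.Fin.Properties as Fin
  open import Data.List using (List; []; _∷_; length; map; tabulate)
  open import Data.List.Properties using (map-tabulate)
  import Data.List.Relation.Binary.Pointwise as Pointwise
  open import Data.List.Relation.Unary.All as All using (All; []; _∷_)
  import Data.List.Relation.Unary.All.Properties as All
  open import Data.List.Relation.Unary.Any using (Any; here; there)
  import Data.List.Relation.Unary.Any.Properties as Any
  open import Data.List.Relation.Unary.Linked using (Linked; []; [-]; _∷_)
  open import Data.Nat as ℕ using (ℕ; zero; suc; s≤s; z≤n)
  import Data.Nat.Properties as ℕ
  open import Data.Product using (Σ-syntax; ∃; ∃-syntax; ∃₂; _×_; _,_; proj₁; proj₂)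
  open import Data.Sum using (_⊎_; inj₁; inj₂)
  open import Function.Bundles using (Inverse; mk⇔; module Equivalence)
  open import Relation.Binary.Bundles using (Poset)
  open import Relation.Binary.Construct.Closure.ReflexiveTransitive using (Star; _◅_) renaming (ε to stop)
  open import Relation.Binary.Definitions using (Decidable)
  open import Relation.Binary.Morphism.Structures using (IsOrderIsomorphism)
  open import Relation.Binary.PropositionalEquality as ≡ using (_≡_; _≢_)
  open import Relation.Nullary using (¬_; Dec; yes; no; contradiction)
  open import Defs using (RankedPoset; Polytope; IsIsomorphism; Automorphism; automorphismGroup; Sends; Chiral; SameOrbit)

  -- The position, in a flag, of its face of rank j.
  position : Fin 4 → Fin 6
  position j = suc (inject₁ j)

  ranks : (r : Fin 6 → ℕ) → (∀ (i : Fin 5) → r (inject₁ i) ℕ.< r (suc i)) → r 5F ℕ.≤ 5 → ∀ i → r i ≡ toℕ i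
  ranks r up top i = ℕ.≤-antisym (upper i) (lower i)
    where
    lower₁ : 1 ℕ.≤ r 1F
    lower₁ = ℕ.≤-trans (s≤s z≤n) (up 0F)
    lower₂ : 2 ℕ.≤ r 2F
    lower₂ = ℕ.≤-trans (s≤s lower₁) (up 1F)
    lower₃ : 3 ℕ.≤ r 3F
    lower₃ = ℕ.≤-trans (s≤s lower₂) (up 2F)
    lower₄ : 4 ℕ.≤ r 4F
    lower₄ = ℕ.≤-trans (s≤s lower₃) (up 3F)
    lower : ∀ i → toℕ i ℕ.≤ r i
    lower 0F = z≤n
    lower 1F = lower₁
    lower 2F = lower₂
    lower 3F = lower₃
    lower 4F = lower₄
    lower 5F = ℕ.≤-trans (s≤s lower₄) (up 4F)
    upper₄ : r 4F ℕ.≤ 4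
    upper₄ = ℕ.≤-pred (ℕ.≤-trans (up 4F) top)
    upper₃ : r 3F ℕ.≤ 3
    upper₃ = ℕ.≤-pred (ℕ.≤-trans (up 3F) upper₄)
    upper₂ : r 2F ℕ.≤ 2
    upper₂ = ℕ.≤-pred (ℕ.≤-trans (up 2F) upper₃)
    upper₁ : r 1F ℕ.≤ 1
    upper₁ = ℕ.≤-pred (ℕ.≤-trans (up 1F) upper₂)
    upper : ∀ i → r i ℕ.≤ toℕ i
    upper 0F = ℕ.≤-pred (ℕ.≤-trans (up 0F) upper₁)
    upper 1F = upper₁
    upper 2F = upper₂
    upper 3F = upper₃
    upper 4F = upper₄
    upper 5F = top

  third-equal : ∀ {a b c : Fin 2} → a ≢ b → a ≢ c → b ≡ c
  third-equal {0F} {0F} p q = contradiction ≡.refl p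
  third-equal {0F} {1F} {0F} p q = contradiction ≡.refl q
  third-equal {0F} {1F} {1F} p q = ≡.refl
  third-equal {1F} {1F} p q = contradiction ≡.refl p
  third-equal {1F} {0F} {1F} p q = contradiction ≡.refl q
  third-equal {1F} {0F} {0F} p q = ≡.refl

  module RankedChains (R : RankedPoset) where
    open RankedPoset R

    ≤-reflexive : ∀ {F G} → F ≈ G → F ≤ G
    ≤-reflexive = Poset.reflexive poset

    ≤-trans : ∀ {F G H} → F ≤ G → G ≤ H → F ≤ H
    ≤-trans = Poset.trans poset

    -- A flag indexed by rank, so that its j-face sits at a known position. Lists of faces appear
    -- only where the definitions of the statement demand them.
    record Chain : Set where
      field
        at      : Fin 6 → Face
        rank-at : ∀ i → rank+1 (at i) ≡ toℕ i
        ascend  : ∀ (i : Fin 5) → at (inject₁ i) ≤ at (suc i)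

    open Chain public

    infix 4 _≈ᶜ_

    record _≈ᶜ_ (x y : Chain) : Set where
      constructor agree
      field _on_ : ∀ i → at x i ≈ at y i

    open _≈ᶜ_ public using (_on_)

    ≈ᶜ-refl : ∀ {x} → x ≈ᶜ x
    ≈ᶜ-refl = agree λ _ → Eq.refl

    ≈ᶜ-sym : ∀ {x y} → x ≈ᶜ y → y ≈ᶜ x
    ≈ᶜ-sym p = agree λ i → Eq.sym (p on i)

    ≈ᶜ-trans : ∀ {x y z} → x ≈ᶜ y → y ≈ᶜ z → x ≈ᶜ z
    ≈ᶜ-trans p q = agree λ i → Eq.trans (p on i) (q on i)

    record Adj (j : Fin 4) (x y : Chain) : Set where
      constructor adj
      field
        differ : ¬ (at x (position j) ≈ at y (position j))
        same   : ∀ i → i ≢ position j → at x i ≈ at y i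

    open Adj public

    adj-sym : ∀ {j x y} → Adj j x y → Adj j y x
    adj-sym a = adj (λ eq → differ a (Eq.sym eq)) (λ i ne → Eq.sym (same a i ne))

    adj-cong : ∀ {j x x′ y y′} → x ≈ᶜ x′ → y ≈ᶜ y′ → Adj j x y → Adj j x′ y′
    adj-cong p q a = adj (λ eq → differ a (Eq.trans (p on _) (Eq.trans eq (Eq.sym (q on _)))))
      (λ i ne → Eq.trans (Eq.sym (p on i)) (Eq.trans (same a i ne) (q on i)))

    list : Chain → List Face
    list x = tabulate (at x)

    ≤∧rank<⇒< : ∀ {F G} → F ≤ G → rank+1 F ℕ.< rank+1 G → F < G
    ≤∧rank<⇒< p lt = p , λ eq → ℕ.<-irrefl (rank+1-cong eq) lt

    ascend-rank : ∀ x (i : Fin 5) → rank+1 (at x (inject₁ i)) ℕ.< rank+1 (at x (suc i))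
    ascend-rank x i = ≡.subst₂ ℕ._<_ (≡.sym (≡.trans (rank-at x (inject₁ i)) (Fin.toℕ-inject₁ i)))
      (≡.sym (rank-at x (suc i))) (ℕ.n<1+n (toℕ i))

    strict : ∀ x (i : Fin 5) → at x (inject₁ i) < at x (suc i)
    strict x i = ≤∧rank<⇒< (ascend x i) (ascend-rank x i)

    at-mono : ∀ x {i k} → toℕ i ℕ.≤ toℕ k → at x i ≤ at x k
    at-mono x {i} {k} p with ℕ.m≤n⇒∃[o]m+o≡n p
    ... | o , eq = go o i k eq
      where
      go : ∀ o i k → toℕ i ℕ.+ o ≡ toℕ k → at x i ≤ at x k
      go zero    i k eq = ≤-reflexive (Eq.reflexive (≡.cong (at x) (Fin.toℕ-injective (≡.trans (≡.sym (ℕ.+-identityʳ _)) eq))))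
      go (suc o) i zero eq = contradiction (≡.trans (≡.sym (ℕ.+-suc (toℕ i) o)) eq) λ ()
      go (suc o) i (suc k) eq = ≤-trans (go o i (inject₁ k)
        (≡.trans (ℕ.suc-injective (≡.trans (≡.sym (ℕ.+-suc (toℕ i) o)) eq)) (≡.sym (Fin.toℕ-inject₁ k)))) (ascend x k)

    chain : (∀ F → rank+1 F ℕ.≤ 5) → (f : Fin 6 → Face) → (∀ (i : Fin 5) → f (inject₁ i) < f (suc i)) → Chain
    chain rank≤5 f up = record
      { at      = f
      ; rank-at = ranks (λ i → rank+1 (f i)) (λ i → rank+1-mono (up i)) (rank≤5 (f 5F))
      ; ascend  = λ i → proj₁ (up i)
      }

    linked : ∀ x → Linked _<_ (list x)
    linked x = strict x 0F ∷ strict x 1F ∷ strict x 2F ∷ strict x 3F ∷ strict x 4F ∷ [-]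

    chain-of-list : (∀ F → rank+1 F ℕ.≤ 5) → (l : List Face) → length l ≡ 6 → Linked _<_ l → Σ[ x ∈ Chain ] l ≡ list x
    chain-of-list rank≤5 (a ∷ b ∷ c ∷ d ∷ e ∷ f ∷ []) ≡.refl (ab ∷ bc ∷ cd ∷ de ∷ ef ∷ [-]) = chain rank≤5 sequence up , ≡.refl
      where
      sequence : Fin 6 → Face
      sequence 0F = a
      sequence 1F = b
      sequence 2F = c
      sequence 3F = d
      sequence 4F = e
      sequence 5F = f
      up : ∀ (i : Fin 5) → sequence (inject₁ i) < sequence (suc i)
      up 0F = ab
      up 1F = bc
      up 2F = cd
      up 3F = de
      up 4F = ef

    ∈-list : ∀ x {F} i → F ≈ at x i → F ∈ list x
    ∈-list x i eq = Any.tabulate⁺ {f = at x} i eq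

    list-∈ : ∀ x {F} → F ∈ list x → ∃[ i ] F ≈ at x i
    list-∈ x = Any.tabulate⁻ {f = at x}

    list-∈-rank : ∀ x {F} i → rank+1 F ≡ toℕ i → F ∈ list x → F ≈ at x i
    list-∈-rank x {F} i eq F∈ with list-∈ x F∈
    ... | k , F≈ with Fin.toℕ-injective {i = i} {j = k} (≡.trans (≡.sym eq) (≡.trans (rank+1-cong F≈) (rank-at x k)))
    ...   | ≡.refl = F≈

    ≋⇒≈ᶜ : ∀ {x y} → list x ≋ list y → x ≈ᶜ y
    ≋⇒≈ᶜ p = agree (Pointwise.tabulate⁻ p)

    ≈ᶜ⇒≋ : ∀ {x y} → x ≈ᶜ y → list x ≋ list y
    ≈ᶜ⇒≋ p = Pointwise.tabulate⁺ (p on_)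

    fromAdj : ∀ {j x y} → Adj j x y → Adjacent (toℕ j) (list x) (list y)
    fromAdj {j} {x} {y} a = (λ p → differ a (≋⇒≈ᶜ {x} {y} p on position j)) , λ F ne → mk⇔ (move x y (same a) F ne)
        (move y x (λ i i≢ → Eq.sym (same a i i≢)) F ne)
      where
      move : ∀ x y → (∀ i → i ≢ position j → at x i ≈ at y i) → ∀ F → rank+1 F ≢ suc (toℕ j) → F ∈ list x → F ∈ list y
      move x y eqs F ne F∈ with list-∈ x F∈
      ... | i , F≈ = ∈-list y i (Eq.trans F≈ (eqs i λ { ≡.refl → ne
        (≡.trans (rank+1-cong F≈) (≡.trans (rank-at x (position j)) (≡.cong suc (Fin.toℕ-inject₁ j)))) }))

    private
      below-tail : ∀ {F l} → Linked _<_ (F ∷ l) → All (λ G → rank+1 F ℕ.< rank+1 G) l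
      below-tail [-]       = []
      below-tail (p ∷ lk)  = rank+1-mono p ∷ All.map (ℕ.<-trans (rank+1-mono p)) (below-tail lk)

      rank-∈ : ∀ {F H l} → All (λ G → rank+1 F ℕ.< rank+1 G) l → H ∈ l → rank+1 F ℕ.< rank+1 H
      rank-∈ (p ∷ ps) (here eq) = ℕ.<-≤-trans p (ℕ.≤-reflexive (≡.sym (rank+1-cong eq)))
      rank-∈ (p ∷ ps) (there q) = rank-∈ ps q

      linked-tail : ∀ {F l} → Linked _<_ (F ∷ l) → Linked _<_ l
      linked-tail [-]      = []
      linked-tail (_ ∷ lk) = lk

    -- Each head is the strict minimum of its list in rank, so the heads agree and can be removed
    -- from both sides.
    same-members : ∀ {k l} → Linked _<_ k → Linked _<_ l → (∀ F → F ∈ k → F ∈ l) → (∀ F → F ∈ l → F ∈ k) → k ≋ l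
    same-members {[]} {[]} _ _ _ _ = Pointwise.[]
    same-members {[]} {G ∷ l} _ _ _ g with g G (here Eq.refl)
    ... | ()
    same-members {F ∷ k} {[]} _ _ f _ with f F (here Eq.refl)
    ... | ()
    same-members {F ∷ k} {G ∷ l} p q f g = F≈G (f F (here Eq.refl)) (g G (here Eq.refl)) Pointwise.∷
      same-members (linked-tail p) (linked-tail q)
        (λ H H∈ → drop (below-tail p) (F≈G (f F (here Eq.refl)) (g G (here Eq.refl))) (f H (there H∈)) H∈)
        (λ H H∈ → drop (below-tail q) (Eq.sym (F≈G (f F (here Eq.refl)) (g G (here Eq.refl)))) (g H (there H∈)) H∈)
      where
      F≈G : F ∈ (G ∷ l) → G ∈ (F ∷ k) → F ≈ G
      F≈G (here eq) _          = eq
      F≈G (there a) (here eq)  = Eq.sym eq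
      F≈G (there a) (there b)  = contradiction (rank-∈ (below-tail p) b) (ℕ.<-asym (rank-∈ (below-tail q) a))
      drop : ∀ {F G H k l} → All (λ H → rank+1 F ℕ.< rank+1 H) k → F ≈ G → H ∈ (G ∷ l) → H ∈ k → H ∈ l
      drop below eq (there a) _ = a
      drop below eq (here e) H∈ = contradiction (rank-∈ below H∈)
        (ℕ.<-irrefl (rank+1-cong (Eq.trans eq (Eq.sym e))))

    -- The faces of x below position i and those of y above it.
    splice : ∀ x y (i : Fin 5) → at x (inject₁ i) ≤ at y (suc i) →
             Σ[ z ∈ Chain ] at z (inject₁ i) ≡ at x (inject₁ i) × at z (suc i) ≡ at y (suc i)
    splice x y i le = record
      { at = λ k → pick k (below? k)
      ; rank-at = λ k → pick-rank k (below? k)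
      ; ascend = λ k → pick-ascend k (below? (inject₁ k)) (below? (suc k))
      } , pick-low (below? (inject₁ i)) , pick-high (below? (suc i))
      where
      Below : Fin 6 → Set
      Below k = toℕ k ℕ.≤ toℕ i
      below? : ∀ k → Dec (Below k)
      below? k = toℕ k ℕ.≤? toℕ i
      pick : ∀ k → Dec (Below k) → Face
      pick k (yes _) = at x k
      pick k (no _)  = at y k
      pick-rank : ∀ k d → rank+1 (pick k d) ≡ toℕ k
      pick-rank k (yes _) = rank-at x k
      pick-rank k (no _)  = rank-at y k
      pick-ascend : ∀ k d d′ → pick (inject₁ k) d ≤ pick (suc k) d′
      pick-ascend k (yes _) (yes _) = ascend x k
      pick-ascend k (no _)  (no _)  = ascend y k
      pick-ascend k (no ¬p) (yes p) = contradiction (ℕ.≤-trans (ℕ.≤-trans (ℕ.≤-reflexive (Fin.toℕ-inject₁ k)) (ℕ.n≤1+n _)) p) ¬p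
      pick-ascend k (yes p) (no ¬p) = ≡.subst (λ k → at x (inject₁ k) ≤ at y (suc k)) (Fin.toℕ-injective
        (ℕ.≤-antisym (ℕ.≤-pred (ℕ.≰⇒> ¬p)) (≡.subst (ℕ._≤ toℕ i) (Fin.toℕ-inject₁ k) p))) le
      pick-low : ∀ d → pick (inject₁ i) d ≡ at x (inject₁ i)
      pick-low (yes _) = ≡.refl
      pick-low (no ¬p) = contradiction (ℕ.≤-reflexive (Fin.toℕ-inject₁ i)) ¬p
      pick-high : ∀ d → pick (suc i) d ≡ at y (suc i)
      pick-high (yes p) = contradiction p ℕ.1+n≰n
      pick-high (no _)  = ≡.refl

    -- The endpoints x and y are fixed while a runs along the path, since every intermediate flag
    -- has to contain the faces common to x and y.
    data Path (x y : Chain) (a : Chain) : Set where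
      done : a ≈ᶜ y → Path x y a
      step : ∀ {b} j → Adj j a b → (∀ i → at x i ≈ at y i → at x i ≈ at b i) → Path x y b → Path x y a

    data Walk (K : Fin 4 → Set) (a y : Chain) : Set where
      arrived : a ≈ᶜ y → Walk K a y
      walk    : ∀ {b} j → K j → Adj j a b → Walk K b y → Walk K a y

    walk-from : ∀ {K a a′ y} → a ≈ᶜ a′ → Walk K a y → Walk K a′ y
    walk-from eq (arrived e)      = arrived (≈ᶜ-trans (≈ᶜ-sym eq) e)
    walk-from eq (walk j k s w)   = walk j k (adj-cong eq ≈ᶜ-refl s) w

    walk-trans : ∀ {K x y z} → Walk K x y → Walk K y z → Walk K x z
    walk-trans (arrived e)    w′ = walk-from (≈ᶜ-sym e) w′
    walk-trans (walk j k s w) w′ = walk j k s (walk-trans w w′)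

    walk-sym : ∀ {K x y} → Walk K x y → Walk K y x
    walk-sym (arrived e)    = arrived (≈ᶜ-sym e)
    walk-sym (walk j k s w) = walk-trans (walk-sym w) (walk j k (adj-sym s) (arrived ≈ᶜ-refl))

    -- If only ranks at which x and y differ are ever changed, the common faces survive. Strong
    -- connectedness is thus reduced to control over the ranks of the steps.
    walk-path : ∀ {x y} → Walk (λ j → ¬ (at x (position j) ≈ at y (position j))) x y →
                Path x y x
    walk-path {x} {y} w = go w λ _ _ → Eq.refl
      where
      Kept : Chain → Set
      Kept a = ∀ i → at x i ≈ at y i → at x i ≈ at a i
      go : ∀ {a} → Walk (λ j → ¬ (at x (position j) ≈ at y (position j))) a y → Kept a → Path x y a
      go (arrived e)    kept = done e
      go (walk {b} j k s w) kept = step j s kept′ (go w kept′)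
        where
        kept′ : Kept b
        kept′ i eq = Eq.trans (kept i eq) (same s i λ { ≡.refl → k eq })

  module Chains (P : Polytope 4) where
    open Polytope P
    open RankedChains ranked public hiding (chain; chain-of-list)

    rank≤5 : ∀ F → rank+1 F ℕ.≤ 5
    rank≤5 F with rank+1 F ℕ.≤? 5
    ... | yes p = p
    ... | no ¬p = contradiction (ℕ.<⇒≤ (≡.subst (rank+1 F ℕ.<_) ⊤F-rank
            (rank+1-mono (⊤F-greatest F , λ eq → ¬p (ℕ.≤-reflexive (≡.trans (rank+1-cong eq) ⊤F-rank)))))) ¬p

    -- A face of top rank cannot lie strictly below the greatest face. Equality of faces not being
    -- decidable in general, this gives a double negation only.
    top-stable : ∀ {F} → rank+1 F ≡ 5 → ¬ ¬ (F ≈ ⊤F)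
    top-stable {F} eq ¬p = ℕ.<-irrefl (≡.trans eq (≡.sym ⊤F-rank)) (rank+1-mono (⊤F-greatest F , ¬p))

    chain : (f : Fin 6 → Face) → (∀ (i : Fin 5) → f (inject₁ i) < f (suc i)) → Chain
    chain = RankedChains.chain ranked rank≤5

    chain-of-list : (l : List Face) → length l ≡ 6 → Linked _<_ l → Σ[ x ∈ Chain ] l ≡ list x
    chain-of-list = RankedChains.chain-of-list ranked rank≤5

    toChain : Flag → Chain
    toChain Φ = proj₁ (chain-of-list (faces Φ) (flag-size Φ) (Flag.chain Φ))

    toChain-list : ∀ Φ → faces Φ ≡ list (toChain Φ)
    toChain-list Φ = proj₂ (chain-of-list (faces Φ) (flag-size Φ) (Flag.chain Φ))

    toAdj : ∀ {n} x y → Adjacent n (list x) (list y) → Σ[ j ∈ Fin 4 ] toℕ j ≡ n × Adj j x y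
    toAdj {n} x y (ne , eqv) with n ℕ.<? 4
    ... | yes n<4 = j , Fin.toℕ-fromℕ< n<4 , adj
      (λ eq → ne (≈ᶜ⇒≋ {x} {y} (agree λ i → everywhere eq i (i Fin.≟ position j)))) others
      where
      j = fromℕ< n<4
      rank-j : toℕ (position j) ≡ suc n
      rank-j = ≡.cong suc (≡.trans (Fin.toℕ-inject₁ j) (Fin.toℕ-fromℕ< n<4))
      others : ∀ i → i ≢ position j → at x i ≈ at y i
      others i i≢ = list-∈-rank y i (rank-at x i) (Equivalence.to (eqv (at x i) (λ eq → i≢
        (Fin.toℕ-injective (≡.trans (≡.sym (rank-at x i)) (≡.trans eq (≡.sym rank-j)))))) (∈-list x i Eq.refl))
      everywhere : at x (position j) ≈ at y (position j) → ∀ i → Dec (i ≡ position j) → at x i ≈ at y i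
      everywhere eq i (yes ≡.refl) = eq
      everywhere eq i (no i≢)      = others i i≢
    -- An adjacency of rank 4 or more leaves all faces of smaller rank alone, and the greatest face
    -- cannot change either; so the two flags would be equal.
    ... | no n≮4 = ⊥-elim (top-stable (rank-at x 5F) λ p → top-stable (rank-at y 5F) λ q →
        ne (≈ᶜ⇒≋ {x} {y} (agree λ i → everywhere (Eq.trans p (Eq.sym q)) i (i Fin.≟ 5F))))
      where
      everywhere : at x 5F ≈ at y 5F → ∀ i → Dec (i ≡ 5F) → at x i ≈ at y i
      everywhere eq i (yes ≡.refl) = eq
      everywhere eq i (no i≢) = list-∈-rank y i (rank-at x i) (Equivalence.to (eqv (at x i) (λ eq → n≮4
        (ℕ.≤-pred (ℕ.≤-trans (ℕ.≤-reflexive (≡.cong suc (≡.trans (≡.sym eq) (rank-at x i))))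
          (ℕ.≤∧≢⇒< (ℕ.≤-pred (Fin.toℕ<n i)) λ e → i≢ (Fin.toℕ-injective e)))))) (∈-list x i Eq.refl))

    -- The faces available at this position form a two-element set by the diamond condition, and
    -- both candidates differ from the face of x.
    adj-unique : ∀ {j x y y′} → Adj j x y → Adj j x y′ → y ≈ᶜ y′
    adj-unique {j} {x} {y} {y′} a b = agree λ i → everywhere i (i Fin.≟ position j)
      where
      low mid high : Fin 6
      low  = inject₁ (inject₁ j)
      mid  = position j
      high = suc (suc j)
      rank-low : rank+1 (at x low) ≡ toℕ j
      rank-low = ≡.trans (rank-at x low) (≡.trans (Fin.toℕ-inject₁ (inject₁ j)) (Fin.toℕ-inject₁ j))
      rank-mid : ∀ y → rank+1 (at y mid) ≡ suc (rank+1 (at x low))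
      rank-mid y = ≡.trans (rank-at y mid) (≡.cong suc (≡.trans (Fin.toℕ-inject₁ j) (≡.sym rank-low)))
      rank-high : rank+1 (at x high) ≡ 2 ℕ.+ rank+1 (at x low)
      rank-high = ≡.trans (rank-at x high) (≡.cong (2 ℕ.+_) (≡.sym rank-low))
      low≢ : low ≢ mid
      low≢ eq = ℕ.<-irrefl (≡.trans (≡.sym (≡.trans (Fin.toℕ-inject₁ (inject₁ j)) (Fin.toℕ-inject₁ j)))
        (≡.trans (≡.cong toℕ eq) (≡.cong suc (Fin.toℕ-inject₁ j)))) (ℕ.n<1+n (toℕ j))
      high≢ : high ≢ mid
      high≢ eq = ℕ.<-irrefl (≡.trans (≡.sym (≡.cong suc (Fin.toℕ-inject₁ j))) (≡.cong toℕ (≡.sym eq))) (ℕ.n<1+n (suc (toℕ j)))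
      low<high : at x low < at x high
      low<high = ≤∧rank<⇒< (≤-trans (ascend x (inject₁ j)) (ascend x (suc j)))
        (≡.subst (rank+1 (at x low) ℕ.<_) (≡.sym rank-high) (ℕ.m≤n+m (suc (rank+1 (at x low))) 1))
      open Inverse (diamond low<high rank-high)
      between-them : ∀ y → at x low ≈ at y low → at x high ≈ at y high →
        ∃[ H ] at x low < H × H < at x high × rank+1 H ≡ 1 ℕ.+ rank+1 (at x low)
      between-them y p q = at y mid
        , ≤∧rank<⇒< (≤-trans (≤-reflexive p) (ascend y (inject₁ j))) (ℕ.≤-reflexive (≡.sym (rank-mid y)))
        , ≤∧rank<⇒< (≤-trans (ascend y (suc j)) (≤-reflexive (Eq.sym q)))
            (ℕ.≤-reflexive (≡.trans (≡.cong suc (rank-mid y)) (≡.sym rank-high)))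
        , rank-mid y
      hx = between-them x Eq.refl Eq.refl
      hy = between-them y (same a low low≢) (same a high high≢)
      hy′ = between-them y′ (same b low low≢) (same b high high≢)
      injective : ∀ h h′ → to h ≡ to h′ → proj₁ h ≈ proj₁ h′
      injective h h′ eq = Eq.trans (Eq.sym (strictlyInverseʳ h))
        (Eq.trans (Eq.reflexive (≡.cong (λ t → proj₁ (from t)) eq)) (strictlyInverseʳ h′))
      everywhere : ∀ i → Dec (i ≡ mid) → at y i ≈ at y′ i
      everywhere i (yes ≡.refl) = injective hy hy′ (third-equal
        (λ eq → differ a (injective hx hy eq)) (λ eq → differ b (injective hx hy′ eq)))
      everywhere i (no i≢) = Eq.trans (Eq.sym (same a i i≢)) (same b i i≢)

    -- Maximality of a flag asks for membership of any comparable face; with decidable equality such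
    -- a face is recognised by its rank.
    module Decided (_≟_ : Decidable _≈_) where

      toFlag : Chain → Flag
      toFlag x = record { faces = list x ; chain = linked x ; maximal = maximal }
        where
        maximal : ∀ F → All (λ G → F ≤ G ⊎ G ≤ F) (list x) → F ∈ list x
        maximal F comparable = ∈-list x i F≈
          where
          i = fromℕ< (s≤s (rank≤5 F))
          rank-F : rank+1 F ≡ rank+1 (at x i)
          rank-F = ≡.trans (≡.sym (Fin.toℕ-fromℕ< (s≤s (rank≤5 F)))) (≡.sym (rank-at x i))
          F≈ : F ≈ at x i
          F≈ with F ≟ at x i | All.tabulate⁻ {f = at x} comparable i
          ... | yes p | _      = p
          ... | no ¬p | inj₁ q = contradiction (rank+1-mono (q , ¬p)) (ℕ.<-irrefl rank-F)
          ... | no ¬p | inj₂ q = contradiction (rank+1-mono (q , λ eq → ¬p (Eq.sym eq))) (ℕ.<-irrefl (≡.sym rank-F))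

      toChain-toFlag : ∀ x → toChain (toFlag x) ≈ᶜ x
      toChain-toFlag x = ≋⇒≈ᶜ {toChain (toFlag x)} {x} (≡.subst (_≋ list x) (toChain-list (toFlag x)) (≈ᶜ⇒≋ {x} {x} ≈ᶜ-refl))

      path : ∀ x y → Path x y x
      path x y with connected (toFlag x) (toFlag y)
      ... | Λ , star , end = go (toFlag x) Λ star x ≡.refl end
        where
        Step : Flag → Flag → Set
        Step Λ Λ′ = (∃[ j ] Adjacent j (faces Λ) (faces Λ′)) × (∀ F → F ∈ list x → F ∈ list y → F ∈ faces Λ′)
        go : ∀ Φ Λ → Star Step Φ Λ → ∀ a → faces Φ ≡ list a → faces Λ ≋ list y → Path x y a
        go Φ .Φ stop a eq end = done (≋⇒≈ᶜ {a} {y} (≡.subst (_≋ list y) eq end))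
        go Φ Λ (_◅_ {j = Φ′} ((n , adjacent) , keeps) rest) a eq end
          with toAdj a (toChain Φ′) (≡.subst₂ (Adjacent n) eq (toChain-list Φ′) adjacent)
        ... | j , _ , a-adj = step j a-adj
          (λ i p → list-∈-rank (toChain Φ′) i (rank-at x i) (≡.subst (at x i ∈_) (toChain-list Φ′)
            (keeps (at x i) (∈-list x i Eq.refl) (∈-list y i p))))
          (go Φ′ Λ rest (toChain Φ′) (toChain-list Φ′) end)

  -- Automorphisms and coverings both act on flags in this way. Working with flags allows a map to
  -- be prescribed on one orbit of words and recovered as a map of faces afterwards.
  record FlagMap (P Q : Polytope 4) : Set where
    private
      module P = Chains P
      module Q = Chains Q
    field
      on       : P.Chain → Q.Chain
      on-cong  : ∀ {x y} → x P.≈ᶜ y → on x Q.≈ᶜ on y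
      on-adj   : ∀ {j x y} → P.Adj j x y → Q.Adj j (on x) (on y)

  module _ {P Q : Polytope 4} (_≟_ : Decidable (Polytope._≈_ P)) where
    private
      module P where
        open Polytope P public
        open Chains P public
        open Decided _≟_ public
      module Q where
        open Polytope Q public
        open Chains Q public
    open FlagMap

    agreement : (m n : FlagMap P Q) → ∀ {x} → on m x Q.≈ᶜ on n x → ∀ y → on m y Q.≈ᶜ on n y
    agreement m n {x} start y = go (P.path x y) start
      where
      go : ∀ {a} → P.Path x y a → on m a Q.≈ᶜ on n a → on m y Q.≈ᶜ on n y
      go (P.done eq) p = Q.≈ᶜ-trans (Q.≈ᶜ-sym (on-cong m eq)) (Q.≈ᶜ-trans p (on-cong n eq))
      go (P.step j a _ rest) p = go rest (Q.adj-unique (on-adj m a) (Q.adj-cong (Q.≈ᶜ-sym p) Q.≈ᶜ-refl (on-adj n a)))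

    -- A path from x to y that keeps their common i-face contains no adjacency of that rank, and its
    -- image then keeps its i-face as well.
    shared : (m : FlagMap P Q) → ∀ x y i → P.at x i P.≈ P.at y i → Q.at (on m x) i Q.≈ Q.at (on m y) i
    shared m x y i eq = go (P.path x y) P.Eq.refl Q.Eq.refl
      where
      go : ∀ {a} → P.Path x y a → P.at x i P.≈ P.at a i → Q.at (on m x) i Q.≈ Q.at (on m a) i →
           Q.at (on m x) i Q.≈ Q.at (on m y) i
      go (P.done e) p q = Q.Eq.trans q (on-cong m e Q.on i)
      go (P.step j a keep rest) p q = go rest (keep i eq) (Q.Eq.trans q (Q.same (on-adj m a) i
        λ { ≡.refl → P.differ a (P.Eq.trans (P.Eq.sym p) (keep i eq)) }))

  -- Only faces of consecutive ranks have non-trivial incidence.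
  record Flat (P : Polytope 4) : Set where
    open Polytope P
    open Chains P
    field
      through : ∀ F → ∃₂ λ (x : Chain) (i : Fin 6) → at x i ≈ F
      far     : ∀ {F G} → 2 ℕ.+ rank+1 F ℕ.≤ rank+1 G → F ≤ G

  module Induced {P Q : Polytope 4} (_≟_ : Decidable (Polytope._≈_ P)) (P-flat : Flat P) (Q-flat : Flat Q) (m : FlagMap P Q) where
    private
      module P where
        open Polytope P public
        open Chains P public
        open Decided _≟_ public
      module Q where
        open Polytope Q public
        open Chains Q public
    open FlagMap m
    open Flat P-flat using (through)

    induced : P.Face → Q.Face
    induced F = let x , i , _ = through F in Q.at (on x) i

    induced-at : ∀ x i {F} → P.at x i P.≈ F → induced F Q.≈ Q.at (on x) i
    induced-at x i {F} eq = let x′ , k , eq′ = through F in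
      go x′ k (P.Eq.trans eq′ (P.Eq.sym eq))
      where
      go : ∀ x′ k → P.at x′ k P.≈ P.at x i → Q.at (on x′) k Q.≈ Q.at (on x) i
      go x′ k eq with Fin.toℕ-injective {i = k} {j = i}
                        (≡.trans (≡.sym (P.rank-at x′ k)) (≡.trans (P.rank+1-cong eq) (P.rank-at x i)))
      ... | ≡.refl = shared _≟_ m x′ x k eq

    induced-cong : ∀ {F G} → F P.≈ G → induced F Q.≈ induced G
    induced-cong {F} {G} eq = let x , i , at≈ = through G in
      Q.Eq.trans (induced-at x i (P.Eq.trans at≈ (P.Eq.sym eq))) (Q.Eq.sym (induced-at x i at≈))

    induced-rank : ∀ F → Q.rank+1 (induced F) ≡ P.rank+1 F
    induced-rank F = let x , i , at≈ = through F in
      ≡.trans (Q.rank-at (on x) i) (≡.trans (≡.sym (P.rank-at x i)) (P.rank+1-cong at≈))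

    -- Incident faces of consecutive ranks lie on a common flag, obtained by splicing a flag through
    -- each. For larger gaps incidence in the target is automatic.
    induced-mono : ∀ {F G} → F P.≤ G → induced F Q.≤ induced G
    induced-mono {F} {G} F≤G = compare (F ≟ G)
      where
      consecutive : P.rank+1 G ≡ suc (P.rank+1 F) → induced F Q.≤ induced G
      consecutive eq = let x , i , p = through F ; y , k , q = through G in go x i p y k q
        (≡.trans (≡.trans (≡.sym (P.rank-at y k)) (P.rank+1-cong q))
          (≡.trans eq (≡.cong suc (≡.trans (≡.sym (P.rank+1-cong p)) (P.rank-at x i)))))
        where
        go : ∀ x i → P.at x i P.≈ F → ∀ y k → P.at y k P.≈ G → toℕ k ≡ suc (toℕ i) → induced F Q.≤ induced G
        go x i p y zero    q ()
        go x i p y (suc l) q k≡ with Fin.toℕ-injective {i = i} {j = inject₁ l} (≡.trans (≡.sym (ℕ.suc-injective k≡)) (≡.sym (Fin.toℕ-inject₁ l)))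
        ... | ≡.refl = let z , zx , zy = P.splice x y l (P.≤-trans (P.≤-reflexive p) (P.≤-trans F≤G (P.≤-reflexive (P.Eq.sym q)))) in
          Q.≤-trans (Q.≤-reflexive (induced-at z (inject₁ l) (P.Eq.trans (P.Eq.reflexive zx) p)))
          (Q.≤-trans (Q.ascend (on z) l) (Q.≤-reflexive (Q.Eq.sym (induced-at z (suc l) (P.Eq.trans (P.Eq.reflexive zy) q)))))
      compare : Dec (F P.≈ G) → induced F Q.≤ induced G
      compare (yes eq) = Q.≤-reflexive (induced-cong eq)
      compare (no ne) with suc (P.rank+1 F) ℕ.≟ P.rank+1 G
      ... | yes eq = consecutive (≡.sym eq)
      ... | no ne′ = Flat.far Q-flat (≡.subst₂ (λ m n → 2 ℕ.+ m ℕ.≤ n) (≡.sym (induced-rank F)) (≡.sym (induced-rank G))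
            (ℕ.≤∧≢⇒< (P.rank+1-mono (F≤G , ne)) ne′))

  module InducedIsomorphism {P Q : Polytope 4} (_≟ᴾ_ : Decidable (Polytope._≈_ P)) (_≟ꟴ_ : Decidable (Polytope._≈_ Q))
    (P-flat : Flat P) (Q-flat : Flat Q) (m : FlagMap P Q) (n : FlagMap Q P)
    (nm : ∀ x → Chains._≈ᶜ_ P (FlagMap.on n (FlagMap.on m x)) x)
    (mn : ∀ y → Chains._≈ᶜ_ Q (FlagMap.on m (FlagMap.on n y)) y) where
    private
      module P = Polytope P
      module Q = Polytope Q
      module PC = Chains P
      module QC = Chains Q
      module M = Induced _≟ᴾ_ P-flat Q-flat m
      module N = Induced _≟ꟴ_ Q-flat P-flat n
    open FlagMap

    inverseˡ : ∀ F → N.induced (M.induced F) P.≈ F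
    inverseˡ F = let x , i , eq = Flat.through P-flat F in
      P.Eq.trans (N.induced-at (on m x) i Q.Eq.refl) (P.Eq.trans (nm x PC.on i) eq)

    inverseʳ : ∀ F → M.induced (N.induced F) Q.≈ F
    inverseʳ F = let y , i , eq = Flat.through Q-flat F in
      Q.Eq.trans (M.induced-at (on n y) i P.Eq.refl) (Q.Eq.trans (mn y QC.on i) eq)

    isIsomorphism : IsIsomorphism P Q M.induced
    isIsomorphism = record
      { isOrderMonomorphism = record
        { isOrderHomomorphism = record { cong = M.induced-cong ; mono = M.induced-mono }
        ; injective = λ {F} {G} eq → P.Eq.trans (P.Eq.sym (inverseˡ F)) (P.Eq.trans (N.induced-cong eq) (inverseˡ G))
        ; cancel = λ {F} {G} le → PC.≤-trans (PC.≤-reflexive (P.Eq.sym (inverseˡ F)))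
            (PC.≤-trans (N.induced-mono le) (PC.≤-reflexive (inverseˡ G)))
        }
      ; surjective = λ F → N.induced F , λ eq → Q.Eq.trans (M.induced-cong eq) (inverseʳ F)
      }

  module Automorphisms (P : Polytope 4) where
    open Polytope P
    open Chains P

    move : Automorphism P → Chain → Chain
    move (f , iso) x = chain (λ i → f (at x i)) λ i →
      mono (ascend x i) , λ eq → proj₂ (strict x i) (injective eq)
      where open IsOrderIsomorphism iso

    moving : Automorphism P → FlagMap P P
    moving α@(f , iso) = record
      { on      = move α
      ; on-cong = λ p → agree λ i → cong (p on i)
      ; on-adj  = λ a → adj (λ eq → differ a (injective eq)) (λ i ne → cong (same a i ne))
      }
      where open IsOrderIsomorphism iso

    sends⇒ : ∀ {α Φ Ψ} → Sends P α Φ Ψ → move α (toChain Φ) ≈ᶜ toChain Ψ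
    sends⇒ {α} {Φ} {Ψ} p = ≋⇒≈ᶜ {move α (toChain Φ)} {toChain Ψ} (≡.subst₂ _≋_ (≡.trans (≡.cong (map (proj₁ α)) (toChain-list Φ))
      (map-tabulate (at (toChain Φ)) (proj₁ α))) (toChain-list Ψ) p)

    ⇒sends : ∀ {α Φ Ψ} → move α (toChain Φ) ≈ᶜ toChain Ψ → Sends P α Φ Ψ
    ⇒sends {α} {Φ} {Ψ} p = ≡.subst₂ _≋_ (≡.sym (≡.trans (≡.cong (map (proj₁ α)) (toChain-list Φ))
      (map-tabulate (at (toChain Φ)) (proj₁ α)))) (≡.sym (toChain-list Ψ)) (≈ᶜ⇒≋ p)

  module Rotations (P : Polytope 4) (_≟_ : Decidable (Polytope._≈_ P)) (P-chiral : Chiral P) where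
    open Polytope P
    open Chains P
    open Decided _≟_
    open Automorphisms P
    open Chiral P-chiral
    private module Aut = Group (automorphismGroup P)

    move-cong : ∀ α {x y} → x ≈ᶜ y → move α x ≈ᶜ move α y
    move-cong α = FlagMap.on-cong (moving α)

    apart : ∀ {j x y} → Adj j x y → ∀ α → ¬ (move α x ≈ᶜ y)
    apart {j} {x} {y} s α p = adjacent-distinct (toFlag x) (toFlag y) (toℕ j) (fromAdj {j} {x} {y} s)
      (α , ⇒sends {α} {toFlag x} {toFlag y} (≈ᶜ-trans (move-cong α (toChain-toFlag x)) (≈ᶜ-trans p (≈ᶜ-sym (toChain-toFlag y)))))

    private
      same-orbit : ∀ {Θ x z} → SameOrbit P Θ (toFlag x) → SameOrbit P Θ (toFlag z) → ∃[ α ] move α x ≈ᶜ z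
      same-orbit {Θ} {x} {z} (α , p) (β , q) = α Aut.⁻¹ Aut.∙ β ,
        ≈ᶜ-trans (move-cong (α Aut.⁻¹ Aut.∙ β) (≈ᶜ-trans (≈ᶜ-sym (toChain-toFlag x)) (≈ᶜ-sym (sends⇒ {α} {Θ} {toFlag x} p))))
        (≈ᶜ-trans {y = move β (toChain Θ)} (agree λ i → IsOrderIsomorphism.cong (proj₂ β) (Aut.inverseʳ α (at (toChain Θ) i)))
        (≈ᶜ-trans (sends⇒ {β} {Θ} {toFlag z} q) (toChain-toFlag z)))

    -- There are two orbits and adjacent flags lie in different ones, so x and z, both adjacent to
    -- y, share an orbit.
    rotation : ∀ {j k x y z} → Adj j x y → Adj k y z → ∃[ α ] move α x ≈ᶜ z
    rotation {x = x} {y} {z} s t = let _ , _ , _ , side = two-orbits in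
      go {proj₁ two-orbits} {proj₁ (proj₂ two-orbits)} (side (toFlag x)) (side (toFlag y)) (side (toFlag z))
      where
      clash : ∀ Θ {j x y} {A : Set} → Adj j x y → SameOrbit P Θ (toFlag x) → SameOrbit P Θ (toFlag y) → A
      clash Θ {x = x} {y} s p q = let α , r = same-orbit {Θ} {x} {y} p q in ⊥-elim (apart s α r)
      go : ∀ {Θ Θ′} → SameOrbit P Θ (toFlag x) ⊎ SameOrbit P Θ′ (toFlag x) → SameOrbit P Θ (toFlag y) ⊎ SameOrbit P Θ′ (toFlag y) →
           SameOrbit P Θ (toFlag z) ⊎ SameOrbit P Θ′ (toFlag z) → ∃[ α ] move α x ≈ᶜ z
      go {Θ} (inj₁ p) _        (inj₁ r) = same-orbit {Θ} {x} {z} p r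
      go {Θ′ = Θ} (inj₂ p) _   (inj₂ r) = same-orbit {Θ} {x} {z} p r
      go {Θ} (inj₁ p) (inj₁ q) _        = clash Θ s p q
      go {Θ′ = Θ} (inj₂ p) (inj₂ q) _   = clash Θ s p q
      go {Θ′ = Θ} (inj₁ _) (inj₂ q) (inj₂ r) = clash Θ t q r
      go {Θ} (inj₂ _) (inj₁ q) (inj₁ r) = clash Θ t q r

-- Bounds on the orders of rotations of a chiral polytope.

module Periods where

  open import Algebra.Bundles using (Group)
  open import Data.Empty using (⊥; ⊥-elim)
  open import Data.Fin as Fin using (Fin; zero; suc; toℕ; inject₁)
  import Data.Fin.Properties as Fin
  open import Data.Integer using (+_)
  open import Data.Nat as ℕ using (ℕ; zero; suc; s≤s)
  import Data.Nat.Properties as ℕ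
  open import Data.Product using (Σ-syntax; ∃; ∃-syntax; ∃₂; _×_; _,_; proj₁; proj₂)
  open import Function.Bundles using (Inverse)
  open import Relation.Binary.Definitions using (Decidable)
  open import Relation.Binary.Morphism.Structures using (IsOrderIsomorphism)
  open import Relation.Binary.PropositionalEquality as ≡ using (_≡_; _≢_)
  open import Relation.Nullary using (Dec; yes; no)
  open import Defs using (Polytope; Automorphism; automorphismGroup; Chiral; SectionsArePolygons)
  open GroupKit
  open General

  module Rigidity (P : Polytope 4) (_≟_ : Decidable (Polytope._≈_ P))
    (through : ∀ F → ∃₂ λ (x : Chains.Chain P) (i : Fin 6) → Polytope._≈_ P (Chains.at {P} x i) F) where
    open Polytope P
    open Chains P
    open Automorphisms P

    determined : (α β : Automorphism P) → ∀ {x} → move α x ≈ᶜ move β x → ∀ F → proj₁ α F ≈ proj₁ β F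
    determined α β {x₀} eq F =
      let x , i , at≈ = through F in
      Eq.trans (IsOrderIsomorphism.cong (proj₂ α) (Eq.sym at≈))
        (Eq.trans (agreement _≟_ (moving α) (moving β) {x₀} eq x on i) (IsOrderIsomorphism.cong (proj₂ β) at≈))

    -- Of α only the following is known: it fixes every face of x outside two consecutive ranks. The
    -- size p of the polygonal section then bounds its order.
    module Period (P-chiral : Chiral P) (k : Fin 3) (x : Chain) (α : Automorphism P)
      (fixed : ∀ i → i ≢ position (inject₁ k) → i ≢ position (suc k) → proj₁ α (at x i) ≈ at x i)
      {p : ℕ} (polygons : SectionsArePolygons P (suc (toℕ k)) p) where

      open Group (automorphismGroup P) using () renaming (_≈_ to _≈ᵃ_; ε to e; _∙_ to _·_)
      open Powers (automorphismGroup P)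
      open Rotations P _≟_ P-chiral
      private
        low vary high : Fin 6
        low  = inject₁ (inject₁ (inject₁ k))
        vary = position (inject₁ k)
        high = suc (suc (suc k))

        fixed-power : ∀ n i → i ≢ position (inject₁ k) → i ≢ position (suc k) → proj₁ (α ^ (+ n)) (at x i) ≈ at x i
        fixed-power n i ne ne′ = ≡.subst (λ β → proj₁ β (at x i) ≈ at x i) (≡.sym (^≡^ᶻ α (+ n))) (natural n)
          where
          natural : ∀ n → proj₁ (α ^ⁿ n) (at x i) ≈ at x i
          natural zero    = Eq.refl
          natural (suc n) = Eq.trans (IsOrderIsomorphism.cong (proj₂ (α ^ⁿ n)) (fixed i ne ne′)) (natural n)

        toℕ-low : toℕ low ≡ toℕ k
        toℕ-low = ≡.trans (Fin.toℕ-inject₁ _) (≡.trans (Fin.toℕ-inject₁ _) (Fin.toℕ-inject₁ k))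
        toℕ-vary : toℕ vary ≡ suc (toℕ k)
        toℕ-vary = ≡.cong suc (≡.trans (Fin.toℕ-inject₁ _) (Fin.toℕ-inject₁ k))
        toℕ-other : toℕ (position (suc k)) ≡ 2 ℕ.+ toℕ k
        toℕ-other = ≡.cong (2 ℕ.+_) (Fin.toℕ-inject₁ k)

        unequal : ∀ {i j : Fin 6} {m n} → toℕ i ≡ m → toℕ j ≡ n → m ≢ n → i ≢ j
        unequal p q m≢n eq = m≢n (≡.trans (≡.sym p) (≡.trans (≡.cong toℕ eq) q))

        _^ᶜ_ : Automorphism P → ℕ → Chain
        α ^ᶜ n = move (α ^ (+ n)) x

        low≈ : ∀ n → at (α ^ᶜ n) low ≈ at x low
        low≈ n = fixed-power n low (unequal toℕ-low toℕ-vary (ℕ.m≢1+n+m _ {0})) (unequal toℕ-low toℕ-other (ℕ.m≢1+n+m _ {1}))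

        high≈ : ∀ n → at (α ^ᶜ n) high ≈ at x high
        high≈ n = fixed-power n high (unequal ≡.refl toℕ-vary (λ eq → ℕ.m≢1+n+m _ {1} (≡.sym eq))) (unequal ≡.refl toℕ-other (λ eq → ℕ.m≢1+n+m _ {0} (≡.sym eq)))

        below : ∀ y → at x low ≈ at y low → at x low < at y vary
        below y p = ≤∧rank<⇒< (≤-trans (≤-reflexive p) (ascend y (inject₁ (inject₁ k))))
          (≡.subst₂ ℕ._<_ (≡.sym (≡.trans (rank-at x low) toℕ-low)) (≡.sym (≡.trans (rank-at y vary) toℕ-vary)) (ℕ.n<1+n _))

        above : ∀ y → at y high ≈ at x high → at y vary < at x high
        above y p = ≤∧rank<⇒< (≤-trans (ascend y (suc (inject₁ k))) (≤-trans (ascend y (suc (suc k))) (≤-reflexive p)))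
          (≡.subst₂ ℕ._<_ (≡.sym (≡.trans (rank-at y vary) toℕ-vary)) (≡.sym (rank-at x high)) (ℕ.m≤n+m _ 1))

        low<high : at x low < at x high
        low<high = ≤∧rank<⇒< (≤-trans (proj₁ (below x Eq.refl)) (proj₁ (above x Eq.refl)))
          (≡.subst₂ ℕ._<_ (≡.sym (≡.trans (rank-at x low) toℕ-low)) (≡.sym (rank-at x high)) (ℕ.m≤n+m _ 2))

        open Inverse (polygons low<high (≡.cong suc (≡.trans (rank-at x low) toℕ-low)) (rank-at x high)) using (to; from; strictlyInverseʳ)

        varying : ∀ n → ∃[ H ] at x low < H × H < at x high × rank+1 H ≡ suc (toℕ k)
        varying n = at (α ^ᶜ n) vary , below (α ^ᶜ n) (Eq.sym (low≈ n)) , above (α ^ᶜ n) (high≈ n)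
          , ≡.trans (rank-at (α ^ᶜ n) vary) toℕ-vary

        injective : ∀ h h′ → to h ≡ to h′ → proj₁ h ≈ proj₁ h′
        injective h h′ eq = Eq.trans (Eq.sym (strictlyInverseʳ h))
          (Eq.trans (Eq.reflexive (≡.cong (λ t → proj₁ (from t)) eq)) (strictlyInverseʳ h′))

        returns : ∀ d i → proj₁ (α ^ (+ i)) (at x vary) ≈ proj₁ (α ^ (+ (d ℕ.+ i))) (at x vary) → at (α ^ᶜ d) vary ≈ at x vary
        returns d i eq = IsOrderIsomorphism.injective (proj₂ (α ^ (+ i)))
          (Eq.trans (Eq.sym (^-+ α (+ d) (+ i) (at x vary))) (Eq.sym eq))

        trivial : ∀ d → at (α ^ᶜ d) vary ≈ at x vary → α ^ (+ d) ≈ᵃ e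
        trivial d eq with at (α ^ᶜ d) (position (suc k)) ≟ at x (position (suc k))
        ... | yes eq′ = determined (α ^ (+ d)) e {x} (agree λ i → everywhere i (i Fin.≟ vary) (i Fin.≟ position (suc k)))
          where
          everywhere : ∀ i → Dec (i ≡ vary) → Dec (i ≡ position (suc k)) → at (α ^ᶜ d) i ≈ at x i
          everywhere i (yes ≡.refl) _            = eq
          everywhere i (no _)       (yes ≡.refl) = eq′
          everywhere i (no ne)      (no ne′)     = fixed-power d i ne ne′
        -- Otherwise the power of α would take x to an adjacent flag, which chirality forbids.
        ... | no ne = ⊥-elim (apart {suc k} {x} {α ^ᶜ d} (adj (λ p → ne (Eq.sym p)) (λ i i≢ → Eq.sym (others i i≢ (i Fin.≟ vary)))) (α ^ (+ d)) ≈ᶜ-refl)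
          where
          others : ∀ i → i ≢ position (suc k) → Dec (i ≡ vary) → at (α ^ᶜ d) i ≈ at x i
          others i i≢ (yes ≡.refl) = eq
          others i i≢ (no ne)      = fixed-power d i ne i≢

      -- The powers of α with exponents 0 to p move one face within a section of p faces, so two of
      -- the images coincide. The power by the difference of the exponents fixes that face and is
      -- trivial by `trivial`.
      period : ∃[ d ] d ℕ.< p × α ^ (+ suc d) ≈ᵃ e
      period with Fin.pigeonhole (ℕ.n<1+n p) (λ i → to (varying (toℕ i)))
      ... | i , j , i<j , eq with ℕ.m≤n⇒∃[o]m+o≡n i<j
      ... | d , j≡ = d , ℕ.≤-pred (ℕ.≤-trans (s≤s (ℕ.≤-trans (ℕ.m≤n+m (suc d) (toℕ i)) (ℕ.≤-reflexive (≡.trans (ℕ.+-suc (toℕ i) d) j≡)))) (Fin.toℕ<n j))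
        , trivial (suc d) (returns (suc d) (toℕ i) (≡.subst (λ n → proj₁ (α ^ (+ toℕ i)) (at x vary) ≈ proj₁ (α ^ (+ n)) (at x vary))
            (≡.trans (≡.sym j≡) (≡.cong suc (ℕ.+-comm (toℕ i) d))) (injective (varying (toℕ i)) (varying (toℕ j)) eq)))

-- Flags of the model as tuples, and walks inside its sections.

module Flags where

  open import Data.Fin as Fin using (Fin; zero; suc; toℕ; inject₁)
  open import Data.Fin.Patterns
  import Data.Fin.Properties as Fin
  open import Data.Integer as ℤ using (ℤ; +_)
  open import Data.List using (List; []; _∷_; length; tabulate)
  import Data.List.Membership.Setoid.Properties as Membership
  open import Data.List.Relation.Binary.Pointwise as Pointwise using (Pointwise; []; _∷_)
  open import Data.List.Relation.Unary.All as All using (All; []; _∷_)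
  import Data.List.Relation.Unary.All.Properties as All
  open import Data.List.Relation.Unary.Any as Any using (Any; here; there)
  open import Data.List.Relation.Unary.Linked using (Linked; []; _∷_)
  open import Data.Nat as ℕ using (ℕ; zero; suc; s≤s; z≤n; NonZero)
  import Data.Nat.Properties as ℕ
  open import Data.Product using (Σ-syntax; ∃; ∃-syntax; _×_; _,_; proj₁; proj₂)
  open import Data.Sum using (_⊎_; inj₁; inj₂)
  open import Data.Unit using (tt)
  open import Relation.Binary.Bundles using (Setoid)
  open import Relation.Binary.PropositionalEquality as ≡ using (_≡_; _≢_)
  open import Relation.Nullary using (¬_; yes; no; contradiction)
  open import Defs using (RankedPoset)
  open Modular
  open Half
  open Incidence
  open Finite
  open Model
  open General

  module Construction (N : ℕ) (J : ℤ) .{{N≢0 : NonZero N}} (N-eq : + N ≡ + 16 ℤ.* J) (δ₁ δ₂ : ℤ) where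
    open Semantics J
    open Congruence J
    open Ends J
    open Residues N J N-eq
    open Faces N J N-eq δ₁ δ₂
    open U using (_∼_)
    open RankedPoset ranked using (_<_; _≋_; _∈_; Flag; faces; Adjacent; FlagConnected; module Eq)
    open RankedChains ranked
    open Setoid ℤ/N² using () renaming (_≈_ to _≈²_; trans to ≈²-trans; sym to ≈²-sym; refl to ≈²-refl)

    record Tuple : Set where
      constructor tuple
      field
        {v}   : ℤ
        {e f} : ℤ × ℤ
        {c}   : ℤ
        e∋v   : e ∋ v
        e∼f   : e ∼ f
        f∋c   : f ∋ c

    ⟨_⟩ : Tuple → Chain
    ⟨ tuple {v} {e} {f} {c} e∋v e∼f f∋c ⟩ = record { at = at′ ; rank-at = ranks′ ; ascend = ascend′ }
      where
      at′ : Fin 6 → Face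
      at′ 0F = bottom
      at′ 1F = vertex v
      at′ 2F = edge e
      at′ 3F = face f
      at′ 4F = facet c
      at′ 5F = top
      ranks′ : ∀ i → rank (at′ i) ≡ toℕ i
      ranks′ 0F = ≡.refl
      ranks′ 1F = ≡.refl
      ranks′ 2F = ≡.refl
      ranks′ 3F = ≡.refl
      ranks′ 4F = ≡.refl
      ranks′ 5F = ≡.refl
      ascend′ : ∀ (i : Fin 5) → at′ (inject₁ i) ≤ᶠ at′ (suc i)
      ascend′ 0F = cover bottom⋖vertex
      ascend′ 1F = cover (vertex⋖edge e∋v)
      ascend′ 2F = cover (edge⋖face e∼f)
      ascend′ 3F = cover (face⋖facet f∋c)
      ascend′ 4F = cover facet⋖top

    saturated : (up : Up bottom) → Σ[ t ∈ Tuple ] upper up ≡ list ⟨ t ⟩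
    saturated (bottom⋖vertex ∷ vertex⋖edge p ∷ edge⋖face q ∷ face⋖facet r ∷ facet⋖top ∷ end) = tuple p q r , ≡.refl

    -- The flag is contained in a saturated chain, all of whose faces are comparable with those of
    -- the flag; by maximality they belong to it.
    flag-tuple : (Φ : Flag) → Σ[ t ∈ Tuple ] faces Φ ≋ list ⟨ t ⟩
    flag-tuple Φ = t , same-members (Flag.chain Φ) (linked ⟨ t ⟩) inside λ F F∈ →
        Flag.maximal Φ F (All.tabulate λ {G} G∈ → comparable F∈ (inside G (Membership.∈-resp-≈ Eq.setoid Eq.refl (to-∈ G∈))))
      where
      from-bottom : (l : List Face) → Linked _<_ l → Through bottom l
      from-bottom [] _ = to-top bottom
      from-bottom (F ∷ l) lk with bottom ≟ᶠ F | extend F l lk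
      ... | yes bottom | t = t
      ... | no ne      | t = connect< (equal-or-above F ne) t
        where
        equal-or-above : ∀ F → ¬ (bottom ≈ᶠ F) → bottom < F
        equal-or-above bottom     ne = contradiction bottom ne
        equal-or-above (vertex _) ne = cover bottom⋖vertex , ne
        equal-or-above (edge _)   ne = far (s≤s (s≤s z≤n)) , ne
        equal-or-above (face _)   ne = far (s≤s (s≤s z≤n)) , ne
        equal-or-above (facet _)  ne = far (s≤s (s≤s z≤n)) , ne
        equal-or-above top        ne = far (s≤s (s≤s z≤n)) , ne
      all = from-bottom (faces Φ) (Flag.chain Φ)
      t = proj₁ (saturated (Through.up all))
      contained : All (λ G → G ∈ list ⟨ t ⟩) (faces Φ)
      contained = ≡.subst (λ l → All (λ G → G ∈ l) (faces Φ)) (proj₂ (saturated (Through.up all))) (Through.contain all)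
      inside : ∀ F → F ∈ faces Φ → F ∈ list ⟨ t ⟩
      inside F F∈ = look contained F∈
        where
        look : ∀ {l} → All (λ G → G ∈ list ⟨ t ⟩) l → F ∈ l → F ∈ list ⟨ t ⟩
        look (p ∷ ps) (here eq) = Membership.∈-resp-≈ Eq.setoid (Eq.sym eq) p
        look (p ∷ ps) (there q) = look ps q
      to-∈ : ∀ {G l} → Any (G ≡_) l → G ∈ l
      to-∈ = Any.map λ { ≡.refl → Eq.refl }
      comparable : ∀ {F G} → F ∈ list ⟨ t ⟩ → G ∈ list ⟨ t ⟩ → F ≤ᶠ G ⊎ G ≤ᶠ F
      comparable F∈ G∈ with list-∈ ⟨ t ⟩ F∈ | list-∈ ⟨ t ⟩ G∈
      ... | i , p | k , q with ℕ.≤-total (toℕ i) (toℕ k)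
      ...   | inj₁ i≤k = inj₁ (≤ᶠ-trans (equal p) (≤ᶠ-trans (at-mono ⟨ t ⟩ i≤k) (equal (Eq.sym q))))
      ...   | inj₂ k≤i = inj₂ (≤ᶠ-trans (equal q) (≤ᶠ-trans (at-mono ⟨ t ⟩ k≤i) (equal (Eq.sym p))))

    flag-length : (Φ : Flag) → length (faces Φ) ≡ 6
    flag-length Φ = Pointwise.Pointwise-length (proj₂ (flag-tuple Φ))

    chain-tuple : (x : Chain) → Σ[ t ∈ Tuple ] x ≈ᶜ ⟨ t ⟩
    chain-tuple x = find (at x 0F) (at x 1F) (at x 2F) (at x 3F) (at x 4F) (at x 5F)
      (rank-at x 0F) (rank-at x 1F) (rank-at x 2F) (rank-at x 3F) (rank-at x 4F) (rank-at x 5F)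
      (ascend x 1F) (ascend x 2F) (ascend x 3F) ≡.refl ≡.refl ≡.refl ≡.refl ≡.refl ≡.refl
      where
      find : ∀ A B C D E F → rank A ≡ 0 → rank B ≡ 1 → rank C ≡ 2 → rank D ≡ 3 → rank E ≡ 4 → rank F ≡ 5 →
             B ≤ᶠ C → C ≤ᶠ D → D ≤ᶠ E → at x 0F ≡ A → at x 1F ≡ B → at x 2F ≡ C → at x 3F ≡ D → at x 4F ≡ E → at x 5F ≡ F →
             Σ[ t ∈ Tuple ] x ≈ᶜ ⟨ t ⟩
      find bottom (vertex v) (edge e) (face f) (facet c) top _ _ _ _ _ _ p q r a₀ a₁ a₂ a₃ a₄ a₅
        with <⇒⋖ (p , λ ()) ≡.refl | <⇒⋖ (q , λ ()) ≡.refl | <⇒⋖ (r , λ ()) ≡.refl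
      ... | vertex⋖edge p′ | edge⋖face q′ | face⋖facet r′ = tuple p′ q′ r′ , agree λ
        { 0F → Eq.reflexive a₀ ; 1F → Eq.reflexive a₁ ; 2F → Eq.reflexive a₂
        ; 3F → Eq.reflexive a₃ ; 4F → Eq.reflexive a₄ ; 5F → Eq.reflexive a₅ }

    module _ where
      open Tuple

      entries : ∀ {t t′} → v t ≈ v t′ → e t ≈² e t′ → f t ≈² f t′ → c t ≈ c t′ → ⟨ t ⟩ ≈ᶜ ⟨ t′ ⟩
      entries p q r s = agree λ
        { 0F → bottom ; 1F → vertex p ; 2F → edge q ; 3F → face r ; 4F → facet s ; 5F → top }

      module _ {K : Fin 4 → Set} where

        -- If the vertices agree the walk is empty, so that every recorded step is a genuine
        -- adjacency. The three variants below serve the other ranks.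
        step₀ : ∀ {t t′} → K 0F → e t ≈² e t′ → f t ≈² f t′ → c t ≈ c t′ → Walk K ⟨ t ⟩ ⟨ t′ ⟩
        step₀ {t} {t′} k q r s with v t ≈? v t′
        ... | yes p = arrived (entries p q r s)
        ... | no ¬p = walk 0F k (adj (λ { (vertex p) → ¬p p }) λ
          { 0F _ → bottom ; 1F ne → contradiction ≡.refl ne ; 2F _ → edge q ; 3F _ → face r ; 4F _ → facet s ; 5F _ → top })
          (arrived ≈ᶜ-refl)

        step₁ : ∀ {t t′} → K 1F → v t ≈ v t′ → f t ≈² f t′ → c t ≈ c t′ → Walk K ⟨ t ⟩ ⟨ t′ ⟩
        step₁ {t} {t′} k p r s with e t ≋? e t′
        ... | yes q = arrived (entries p q r s)
        ... | no ¬q = walk 1F k (adj (λ { (edge q) → ¬q q }) λ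
          { 0F _ → bottom ; 1F _ → vertex p ; 2F ne → contradiction ≡.refl ne ; 3F _ → face r ; 4F _ → facet s ; 5F _ → top })
          (arrived ≈ᶜ-refl)

        step₂ : ∀ {t t′} → K 2F → v t ≈ v t′ → e t ≈² e t′ → c t ≈ c t′ → Walk K ⟨ t ⟩ ⟨ t′ ⟩
        step₂ {t} {t′} k p q s with f t ≋? f t′
        ... | yes r = arrived (entries p q r s)
        ... | no ¬r = walk 2F k (adj (λ { (face r) → ¬r r }) λ
          { 0F _ → bottom ; 1F _ → vertex p ; 2F _ → edge q ; 3F ne → contradiction ≡.refl ne ; 4F _ → facet s ; 5F _ → top })
          (arrived ≈ᶜ-refl)

        step₃ : ∀ {t t′} → K 3F → v t ≈ v t′ → e t ≈² e t′ → f t ≈² f t′ → Walk K ⟨ t ⟩ ⟨ t′ ⟩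
        step₃ {t} {t′} k p q r with c t ≈? c t′
        ... | yes s = arrived (entries p q r s)
        ... | no ¬s = walk 3F k (adj (λ { (facet s) → ¬s s }) λ
          { 0F _ → bottom ; 1F _ → vertex p ; 2F _ → edge q ; 3F _ → face r ; 4F ne → contradiction ≡.refl ne ; 5F _ → top })
          (arrived ≈ᶜ-refl)

        -- Advancing n by one takes two steps: to the head of the current edge, then to the next
        -- edge of the 2-face at that vertex.
        around-face : ∀ {x f c} → K 0F → K 1F → (f∋c : f ∋ c) → ∀ n →
          Walk K ⟨ tuple {x} (at-tail ≈-refl) (U.outgoing-∼ f x) f∋c ⟩
                 ⟨ tuple (at-tail ≈-refl) (U.outgoing-∼ f (U.advance f (+ n) x)) f∋c ⟩
        around-face {x} {f} {c} k₀ k₁ f∋c zero = arrived (entries (≈-sym (U.advance-0 f x)) (U.outgoing-cong f (≈-sym (U.advance-0 f x))) ≈²-refl ≈-refl)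
        around-face {x} {f} {c} k₀ k₁ f∋c (suc n) = walk-trans (around-face k₀ k₁ f∋c n)
          (walk-trans (step₀ {t′ = tuple (at-head ≈-refl) (U.outgoing-∼ f (U.advance f (+ n) x)) f∋c} k₀ ≈²-refl ≈²-refl ≈-refl)
                      (step₁ k₁ (U.advance-suc f (+ n) x) ≈²-refl ≈-refl))

        around-edge : ∀ {x e c} → K 2F → K 3F → (e∋x : e ∋ x) → ∀ n →
          Walk K ⟨ tuple {c = c} e∋x (∼-swap (L.outgoing-∼ e c)) (at-tail ≈-refl) ⟩
                 ⟨ tuple e∋x (∼-swap (L.outgoing-∼ e (L.advance e (+ n) c))) (at-tail ≈-refl) ⟩
        around-edge {x} {e} {c} k₂ k₃ e∋x zero = arrived (entries ≈-refl ≈²-refl (L.outgoing-cong e (≈-sym (L.advance-0 e c))) (≈-sym (L.advance-0 e c)))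
        around-edge {x} {e} {c} k₂ k₃ e∋x (suc n) = walk-trans (around-edge k₂ k₃ e∋x n)
          (walk-trans (step₃ {t′ = tuple e∋x (∼-swap (L.outgoing-∼ e (L.advance e (+ n) c))) (at-head ≈-refl)} k₃ ≈-refl ≈²-refl ≈²-refl)
                      (step₂ k₂ ≈-refl ≈²-refl (L.advance-suc e (+ n) c)))

        module _ {x c : ℤ} (k₁ : K 1F) (k₂ : K 2F) where
          open U.Spokes x c

          spoke-tuple : ℤ → Tuple
          spoke-tuple y = tuple {x} {y , x} {spoke y} {c} (at-tail ≈-refl) (edge-spoke y) (at-tail ≈-refl)

          spoke-cong : ∀ {y y′} → y ≈ y′ → ⟨ spoke-tuple y ⟩ ≈ᶜ ⟨ spoke-tuple y′ ⟩
          spoke-cong {y} {y′} eq = entries ≈-refl (eq , ≈-refl) (same-spoke (L.outgoing-unique (∼-swap (edge-spoke y′)))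
              (L.outgoing-unique (∼-swap (U.∼-resp (eq , ≈-refl) ≈²-refl (edge-spoke y))))) ≈-refl
            where
            same-spoke : ∀ {g h k} → g ≈² k → h ≈² k → h ≈² g
            same-spoke p q = ≈²-trans q (≈²-sym p)

          -- Advancing n by one takes four steps, alternating edges and 2-faces: to the arriving
          -- edge `back`, to the 2-face `opposite`, to the edge `next`, and to its own spoke.
          around-vertex : ∀ y n → Walk K ⟨ spoke-tuple y ⟩ ⟨ spoke-tuple (turned-by (+ n) y) ⟩
          around-vertex y zero    = arrived (spoke-cong (≈-sym (turned-0 y)))
          around-vertex y (suc n) = walk-trans (around-vertex y n)
            (walk-trans (step₁ {t′ = tuple {x} {c = c} (at-head (back∋ y′)) (back-spoke y′) (at-tail ≈-refl)} k₁ ≈-refl ≈²-refl ≈-refl)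
            (walk-trans (step₂ {t′ = tuple {x} {c = c} (at-head (back∋ y′)) (back-opposite y′) (at-head (opposite∋ y′))} k₂ ≈-refl ≈²-refl ≈-refl)
            (walk-trans (step₁ {t′ = tuple {x} {c = c} (at-tail ≈-refl) (next-opposite y′) (at-head (opposite∋ y′))} k₁ ≈-refl ≈²-refl ≈-refl)
            (walk-trans (step₂ {t′ = spoke-tuple (next y′)} k₂ ≈-refl ≈²-refl ≈-refl)
                        (arrived (spoke-cong (next-turned (+ n) y)))))))
            where y′ = turned-by (+ n) y

        residue : ℤ → ℕ
        residue z = toℕ (remainder z)

        face-section : ∀ t t′ → f t ≈² f t′ → c t ≈ c t′ → (¬ (v t ≈ v t′) → K 0F) → (¬ (e t ≈² e t′) → K 1F) → Walk K ⟨ t ⟩ ⟨ t′ ⟩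
        face-section t t′ r s k₀ k₁ with v t ≈? v t′ | e t ≋? e t′
        ... | yes p | yes q = arrived (entries p q r s)
        ... | yes p | no ¬q = step₁ (k₁ ¬q) p r s
        ... | no ¬p | yes q = step₀ (k₀ ¬p) q r s
        ... | no ¬p | no ¬q = walk-trans (normalise t ≈²-refl ≈-refl)
            (walk-trans (around-face (k₀ ¬p) (k₁ ¬q) (f∋c t) (residue d))
            (walk-trans (arrived (entries reach (U.outgoing-cong (f t) reach) ≈²-refl ≈-refl)) (walk-sym (normalise t′ (≈²-sym r) (≈-sym s)))))
          where
          x x′ d : ℤ
          x = tail (e t)
          x′ = tail (e t′)
          d = U.distance (f t) x x′
          reach : U.advance (f t) (+ residue d) x ≈ x′
          reach = ≈-trans (U.advance-cong (f t) x (≈-sym (remainder-spec d))) (U.advance-distance (f t) x x′)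
          normalise : ∀ t″ → f t″ ≈² f t → c t″ ≈ c t → Walk K ⟨ t″ ⟩ ⟨ tuple {tail (e t″)} (at-tail ≈-refl) (U.outgoing-∼ (f t) (tail (e t″))) (f∋c t) ⟩
          normalise t″ r s = step₀ (k₀ ¬p) (U.outgoing-unique (U.∼-resp ≈²-refl r (e∼f t″))) r s

        edge-section : ∀ t t′ → v t ≈ v t′ → e t ≈² e t′ → (¬ (f t ≈² f t′) → K 2F) → (¬ (c t ≈ c t′) → K 3F) → Walk K ⟨ t ⟩ ⟨ t′ ⟩
        edge-section t t′ p q k₂ k₃ with f t ≋? f t′ | c t ≈? c t′
        ... | yes r | yes s = arrived (entries p q r s)
        ... | yes r | no ¬s = step₃ (k₃ ¬s) p q r
        ... | no ¬r | yes s = step₂ (k₂ ¬r) p q s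
        ... | no ¬r | no ¬s = walk-trans (normalise t ≈-refl ≈²-refl)
            (walk-trans (around-edge (k₂ ¬r) (k₃ ¬s) (e∋v t) (residue d))
            (walk-trans (arrived (entries ≈-refl ≈²-refl (L.outgoing-cong (e t) reach) reach)) (walk-sym (normalise t′ (≈-sym p) (≈²-sym q)))))
          where
          x x′ d : ℤ
          x = tail (f t)
          x′ = tail (f t′)
          d = L.distance (e t) x x′
          reach : L.advance (e t) (+ residue d) x ≈ x′
          reach = ≈-trans (L.advance-cong (e t) x (≈-sym (remainder-spec d))) (L.advance-distance (e t) x x′)
          normalise : ∀ t″ → v t″ ≈ v t → e t″ ≈² e t → Walk K ⟨ t″ ⟩ ⟨ tuple {c = tail (f t″)} (e∋v t) (∼-swap (L.outgoing-∼ (e t) (tail (f t″)))) (at-tail ≈-refl) ⟩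
          normalise t″ p q = step₃ (k₃ ¬s) p q (L.outgoing-unique (∼-swap (U.∼-resp q ≈²-refl (e∼f t″))))

        -- When both entries differ, the two flags are brought to the form of a spoke, in which the
        -- facet is the tail of the 2-face and the vertex the tail of the edge. Two spokes are
        -- joined by turning about the vertex.
        vertex-section : ∀ t t′ → v t ≈ v t′ → c t ≈ c t′ → (¬ (e t ≈² e t′) → K 1F) → (¬ (f t ≈² f t′) → K 2F) → Walk K ⟨ t ⟩ ⟨ t′ ⟩
        vertex-section t t′ p s k₁ k₂ with e t ≋? e t′ | f t ≋? f t′
        ... | yes q | yes r = arrived (entries p q r s)
        ... | yes q | no ¬r = step₂ (k₂ ¬r) p q s
        ... | no ¬q | yes r = step₁ (k₁ ¬q) p r s
        ... | no ¬q | no ¬r = walk-trans (proj₂ (normalise t ≈-refl ≈-refl))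
            (walk-trans (around-vertex (k₁ ¬q) (k₂ ¬r) y (residue d))
            (walk-trans (arrived (spoke-cong (k₁ ¬q) (k₂ ¬r) reach)) (walk-sym (proj₂ (normalise t′ (≈-sym p) (≈-sym s))))))
          where
          x c′ : ℤ
          x = v t
          c′ = c t
          open U.Spokes x c′
          outward : ∀ t″ → v t″ ≈ x → c t″ ≈ c′ → f t″ ∋ c′ → ∃[ t‴ ] Walk K ⟨ t″ ⟩ ⟨ t‴ ⟩ × tail (f t‴) ≈ c′ × v t‴ ≈ x × c t‴ ≈ c′
          outward t″ p s (at-tail q) = t″ , arrived ≈ᶜ-refl , ≈-sym q , p , s
          outward t″ p s (at-head q) = tuple {v t″} {e t″} {c = c′} (e∋v t″) (∼-swap (L.outgoing-∼ (e t″) c′)) (at-tail ≈-refl)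
            , step₂ (k₂ ¬r) ≈-refl ≈²-refl s , ≈-refl , p , ≈-refl
          onward : ∀ t″ → v t″ ≈ x → c t″ ≈ c′ → tail (f t″) ≈ c′ → x ≈ tail (e t″) →
                   ∃[ y ] Walk K ⟨ t″ ⟩ ⟨ spoke-tuple (k₁ ¬q) (k₂ ¬r) y ⟩
          onward t″ p s q a = proj₁ (e t″) , arrived (entries p (≈-refl , ≈-sym a)
            (≈²-trans (L.outgoing-unique (∼-swap (U.∼-resp (≈-refl , ≈-sym a) ≈²-refl (e∼f t″))))
            (≈²-trans (L.outgoing-cong (proj₁ (e t″) , x) q) (≈²-sym (L.outgoing-unique (∼-swap (edge-spoke (proj₁ (e t″)))))))) s)
          inward : ∀ t″ → v t″ ≈ x → c t″ ≈ c′ → tail (f t″) ≈ c′ → e t″ ∋ x →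
                   ∃[ y ] Walk K ⟨ t″ ⟩ ⟨ spoke-tuple (k₁ ¬q) (k₂ ¬r) y ⟩
          inward t″ p s q (at-tail a) = onward t″ p s q a
          inward t″ p s q (at-head a) = let y , w = onward t‴ ≈-refl s q ≈-refl in
            y , walk-trans (step₁ {t′ = t‴} (k₁ ¬q) p ≈²-refl ≈-refl) w
            where
            t‴ : Tuple
            t‴ = tuple {x} (at-tail ≈-refl) (U.outgoing-∼ (f t″) x) (f∋c t″)
          normalise : ∀ t″ → v t″ ≈ x → c t″ ≈ c′ → ∃[ y ] Walk K ⟨ t″ ⟩ ⟨ spoke-tuple (k₁ ¬q) (k₂ ¬r) y ⟩
          normalise t″ p s =
            let t‴ , w , q , p′ , s′ = outward t″ p s (∋-resp ≈²-refl s (f∋c t″))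
                y , w′ = inward t‴ p′ s′ q (∋-resp ≈²-refl p′ (e∋v t‴))
            in y , walk-trans w w′
          y y′ d : ℤ
          y = proj₁ (normalise t ≈-refl ≈-refl)
          y′ = proj₁ (normalise t′ (≈-sym p) (≈-sym s))
          d = angle y y′
          reach : turned-by (+ residue d) y ≈ y′
          reach = ≈-trans (turned-cong y (≈-sym (remainder-spec d))) (turned-angle y y′)

-- Connectedness, type and number of flags of the model.

module Tight where

  open import Data.Fin as Fin using (Fin; toℕ; fromℕ<)
  open import Data.Fin.Patterns
  import Data.Fin.Properties as Fin
  open import Data.Integer as ℤ using (ℤ; +_)
  open import Data.List using ([]; _∷_; length; tabulate)
  open import Data.List.Relation.Unary.All as All using (All; []; _∷_)
  import Data.List.Relation.Unary.All.Properties as All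
  open import Data.Nat as ℕ using (ℕ; s≤s; z≤n; NonZero)
  import Data.Nat.Properties as ℕ
  open import Data.Product using (Σ-syntax; ∃; ∃-syntax; _×_; _,_; proj₁; proj₂)
  open import Data.Product.Relation.Binary.Pointwise.NonDependent using (×-setoid)
  open import Data.Sum using (_⊎_; inj₁; inj₂)
  open import Data.Vec using () renaming (_∷_ to _∷ᵥ_; [] to []ᵥ)
  open import Level using (0ℓ)
  open import Relation.Binary.Bundles using (Setoid)
  open import Relation.Binary.Construct.Closure.ReflexiveTransitive using (Star; _◅_) renaming (ε to stop)
  open import Relation.Binary.PropositionalEquality as ≡ using (_≡_; _≢_)
  open import Relation.Nullary using (¬_; Dec; yes; no; contradiction)
  open import Defs using (RankedPoset; Polytope; HasSize; HasType; SectionsArePolygons)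
  open Modular
  open Half
  open Incidence
  open Finite
  open Model
  open General
  open Flags

  module TightPolytope (N : ℕ) (J : ℤ) .{{N≢0 : NonZero N}} (N-eq : + N ≡ + 16 ℤ.* J) (δ₁ δ₂ : ℤ) where
    open Semantics J
    open Congruence J
    open Ends J
    open Residues N J N-eq
    open Faces N J N-eq δ₁ δ₂ public
    open Construction N J N-eq δ₁ δ₂ public
    open U using (_∼_)
    open RankedPoset ranked using (_<_; _≋_; _∈_; Flag; faces; Adjacent; FlagConnected; between; flagSetoid; ≋-setoid; module Eq)
    open RankedChains ranked
    open Tuple
    open Setoid ℤ/N² using () renaming (_≈_ to _≈²_; trans to ≈²-trans; sym to ≈²-sym; refl to ≈²-refl)

    _∋?_ : ∀ e x → Dec (e ∋ x)
    e ∋? x with x ≈? tail e | x ≈? head e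
    ... | yes p | _     = yes (at-tail p)
    ... | _     | yes q = yes (at-head q)
    ... | no ¬p | no ¬q = no λ { (at-tail p) → ¬p p ; (at-head q) → ¬q q }

    _∼?_ : ∀ e f → Dec (e ∼ f)
    e ∼? f with U.defect e f ≈? + 0
    ... | yes p = yes (U.incident p)
    ... | no ¬p = no λ { (U.incident p) → ¬p p }

    module _ {K : Fin 4 → Set} (t t′ : Tuple) (k₀ : ¬ (v t ≈ v t′) → K 0F) (k₁ : ¬ (e t ≈² e t′) → K 1F)
      (k₂ : ¬ (f t ≈² f t′) → K 2F) (k₃ : ¬ (c t ≈ c t′) → K 3F) where

      private
        -- The 2-face of t′ is preferred. It is not incident with the edge of t only if the two
        -- 2-faces differ, and then steps of rank 2 are permitted.
        via-face : Dec (e t ∼ f t′) → ∃[ g ] e t ∼ g × g ∋ c t′ × (¬ (f t ≈² g) → K 2F) × (¬ (g ≈² f t′) → K 2F)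
        via-face (yes p) = f t′ , p , f∋c t′ , k₂ , λ ne → contradiction ≈²-refl ne
        via-face (no ¬p) = L.outgoing (e t) (c t′) , ∼-swap (L.outgoing-∼ (e t) (c t′)) , at-tail ≈-refl , (λ _ → k) , λ _ → k
          where k = k₂ λ eq → ¬p (U.∼-resp ≈²-refl eq (e∼f t))

        via-edge : Dec (e t′ ∋ v t) → ∃[ g ] g ∋ v t × g ∼ f t′ × (¬ (e t ≈² g) → K 1F) × (¬ (g ≈² e t′) → K 1F)
        via-edge (yes p) = e t′ , p , e∼f t′ , k₁ , λ ne → contradiction ≈²-refl ne
        via-edge (no ¬p) = U.outgoing (f t′) (v t) , at-tail ≈-refl , U.outgoing-∼ (f t′) (v t) , (λ _ → k) , λ _ → k
          where k = k₁ λ eq → ¬p (∋-resp eq ≈-refl (e∋v t))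

      -- The facet is corrected first with vertex and edge held fixed, then the 2-face with vertex
      -- and facet held fixed, and last the vertex and edge. The intermediate 2-face g and edge h
      -- exist because a tail can be prescribed.
      connecting-walk : Walk K ⟨ t ⟩ ⟨ t′ ⟩
      connecting-walk =
        let g , e∼g , g∋c , k₂₁ , k₂₂ = via-face (e t ∼? f t′)
            h , h∋v , h∼f , k₁₁ , k₁₂ = via-edge (e t′ ∋? v t)
            t₁ = tuple (e∋v t) e∼g g∋c
            t₂ = tuple h∋v h∼f (f∋c t′)
        in walk-trans (edge-section t t₁ ≈-refl ≈²-refl k₂₁ k₃)
             (walk-trans (vertex-section t₁ t₂ ≈-refl ≈-refl k₁₁ k₂₂) (face-section t₂ t′ ≈²-refl ≈-refl k₀ k₁₂))

    flag-of : Chain → Flag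
    flag-of x = record { faces = list x ; chain = linked x ; maximal = maximal }
      where
      maximal : ∀ F → All (λ G → F ≤ᶠ G ⊎ G ≤ᶠ F) (list x) → F ∈ list x
      maximal F comparable = ∈-list x i (here (All.tabulate⁻ {f = at x} comparable i))
        where
        i = fromℕ< (s≤s (rank≤5 F))
        rank-F : rank F ≡ rank (at x i)
        rank-F = ≡.trans (≡.sym (Fin.toℕ-fromℕ< (s≤s (rank≤5 F)))) (≡.sym (rank-at x i))
        here : F ≤ᶠ at x i ⊎ at x i ≤ᶠ F → F ≈ᶠ at x i
        here (inj₁ p) with ≤ᶠ-rank p
        ... | inj₁ eq = eq
        ... | inj₂ lt = contradiction lt (ℕ.<-irrefl rank-F)
        here (inj₂ p) with ≤ᶠ-rank p
        ... | inj₁ eq = ≈ᶠ-sym eq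
        ... | inj₂ lt = contradiction lt (ℕ.<-irrefl (≡.sym rank-F))

    connecting-path : ∀ x y → Path x y x
    connecting-path x y =
      let t , x≈ = chain-tuple x
          t′ , y≈ = chain-tuple y
          apart : ∀ i → ¬ (at ⟨ t ⟩ i ≈ᶠ at ⟨ t′ ⟩ i) → ¬ (at x i ≈ᶠ at y i)
          apart i ne eq = ne (≈ᶠ-trans (≈ᶠ-sym (x≈ on i)) (≈ᶠ-trans eq (y≈ on i)))
      in walk-path (walk-trans (walk-from (≈ᶜ-sym x≈) (connecting-walk t t′
           (λ ne → apart 1F λ { (vertex p) → ne p }) (λ ne → apart 2F λ { (edge p) → ne p })
           (λ ne → apart 3F λ { (face p) → ne p }) (λ ne → apart 4F λ { (facet p) → ne p }))) (arrived (≈ᶜ-sym y≈)))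

    connected : ∀ Φ Ψ → FlagConnected Φ Ψ
    connected Φ Ψ = let Λ , star , last = go (connecting-path x y) Φ x-eq in Λ , star , ≡.subst (faces Λ ≋_) (≡.sym y-eq) last
      where
      chain-of : (Φ : Flag) → Σ[ x ∈ Chain ] faces Φ ≡ list x
      chain-of Φ = chain-of-list rank≤5 (faces Φ) (flag-length Φ) (Flag.chain Φ)
      x = proj₁ (chain-of Φ)
      y = proj₁ (chain-of Ψ)
      x-eq : faces Φ ≡ list x
      x-eq = proj₂ (chain-of Φ)
      y-eq : faces Ψ ≡ list y
      y-eq = proj₂ (chain-of Ψ)
      Step : Flag → Flag → Set
      Step Λ Λ′ = (∃[ j ] Adjacent j (faces Λ) (faces Λ′)) × (∀ F → F ∈ faces Φ → F ∈ faces Ψ → F ∈ faces Λ′)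
      go : ∀ {a} → Path x y a → (Λ : Flag) → faces Λ ≡ list a → ∃[ Λ′ ] Star Step Λ Λ′ × faces Λ′ ≋ list y
      go {a} (done eq) Λ Λ-eq = Λ , stop , ≡.subst (_≋ list y) (≡.sym Λ-eq) (≈ᶜ⇒≋ eq)
      go {a} (step {b} j s keep rest) Λ Λ-eq =
        let Λ′ , star , last = go rest (flag-of b) ≡.refl in
        Λ′ , ((toℕ j , ≡.subst (λ l → Adjacent (toℕ j) l (list b)) (≡.sym Λ-eq) (fromAdj {j} {a} {b} s)) , kept) ◅ star , last
        where
        kept : ∀ F → F ∈ faces Φ → F ∈ faces Ψ → F ∈ list b
        kept F F∈Φ F∈Ψ with list-∈ x (≡.subst (F ∈_) x-eq F∈Φ)
        ... | i , F≈x = ∈-list b i (≈ᶠ-trans F≈x (keep i (≈ᶠ-trans (≈ᶠ-sym F≈x)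
              (list-∈-rank y i (≡.trans (rank-cong F≈x) (rank-at x i)) (≡.subst (F ∈_) y-eq F∈Ψ)))))

    polytope : Polytope 4
    polytope = record
      { ranked = ranked
      ; ⊥F = bottom
      ; ⊥F-least = least
      ; ⊥F-rank = ≡.refl
      ; ⊤F = top
      ; ⊤F-greatest = greatest
      ; ⊤F-rank = ≡.refl
      ; flag-size = flag-length
      ; connected = connected
      ; diamond = diamond
      }
      where
      least : ∀ F → bottom ≤ᶠ F
      least bottom     = equal bottom
      least (vertex _) = cover bottom⋖vertex
      least (edge _)   = far ℕ.≤-refl
      least (face _)   = far (s≤s (s≤s z≤n))
      least (facet _)  = far (s≤s (s≤s z≤n))
      least top        = far (s≤s (s≤s z≤n))
      greatest : ∀ F → F ≤ᶠ top
      greatest bottom     = far (s≤s (s≤s z≤n))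
      greatest (vertex _) = far (s≤s (s≤s (s≤s z≤n)))
      greatest (edge _)   = far (s≤s (s≤s (s≤s (s≤s z≤n))))
      greatest (face _)   = far ℕ.≤-refl
      greatest (facet _)  = cover facet⋖top
      greatest top        = equal top

    module _ (x : ℤ) where
      arriving : ℤ → ℤ × ℤ
      arriving y = y , x ℤ.- + 1 ℤ.- + 8 ℤ.* J ℤ.* y

      head-arriving : ∀ y → x ≈ head (arriving y)
      head-arriving y = mod! {2} (var 0F) (var 0F ⊖ con (+ 1) ⊖ con (+ 8) ⊗ 𝕁 ⊗ var 1F ⊕ con (+ 1) ⊕ con (+ 8) ⊗ 𝕁 ⊗ var 1F) ≡.refl (x ∷ᵥ y ∷ᵥ []ᵥ)

      arriving-unique : ∀ {e} → x ≈ head e → e ≈² arriving (proj₁ e)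
      arriving-unique {y , t} (multiple q ≡.refl) = ≈-refl , mod! {3} (var 0F) (X ⊖ con (+ 1) ⊖ con (+ 8) ⊗ 𝕁 ⊗ var 1F) ≡.refl (t ∷ᵥ y ∷ᵥ q ∷ᵥ []ᵥ)
        where
        X : Expr 3
        X = var 0F ⊕ con (+ 1) ⊕ con (+ 8) ⊗ 𝕁 ⊗ var 1F ⊕ var 2F ⊗ (con (+ 16) ⊗ 𝕁)

      arriving-cong : ∀ {y y′} → y ≈ y′ → arriving y ≈² arriving y′
      arriving-cong {_} {y} (multiple q ≡.refl) = multiple q ≡.refl ,
        mod! {3} (var 0F ⊖ con (+ 1) ⊖ con (+ 8) ⊗ 𝕁 ⊗ (var 1F ⊕ var 2F ⊗ (con (+ 16) ⊗ 𝕁))) (var 0F ⊖ con (+ 1) ⊖ con (+ 8) ⊗ 𝕁 ⊗ var 1F) ≡.refl (x ∷ᵥ y ∷ᵥ q ∷ᵥ []ᵥ)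

    Bit : Setoid 0ℓ 0ℓ
    Bit = ≡.setoid (Fin 2)

    Bit-size : HasSize Bit 2
    Bit-size = hasSize (λ i → i) (λ i → i) (λ eq → eq) (λ _ → ≡.refl) (λ _ → ≡.refl)

    side : ∀ {e x} → e ∋ x → Fin 2
    side (at-tail _) = 0F
    side (at-head _) = 1F

    side-cong : ∀ {e e′ x x′} → e ≈² e′ → x ≈ x′ → (p : e ∋ x) (q : e′ ∋ x′) → side p ≡ side q
    side-cong _ _ (at-tail _) (at-tail _) = ≡.refl
    side-cong _ _ (at-head _) (at-head _) = ≡.refl
    side-cong {e} {e′} s r (at-tail p) (at-head q) = contradiction
      (≈-trans (≈-sym (≈-trans (≈-sym r) (≈-trans p (proj₂ s)))) q) (tail≉head e′)
    side-cong {e} {e′} s r (at-head p) (at-tail q) = contradiction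
      (≈-trans (≈-sym (≈-trans r (≈-trans q (≈-sym (proj₂ s))))) p) (tail≉head e)

    end-at : Fin 2 → ℤ × ℤ → ℤ
    end-at 0F e = tail e
    end-at 1F e = head e

    end-∋ : ∀ s e → e ∋ end-at s e
    end-∋ 0F e = at-tail ≈-refl
    end-∋ 1F e = at-head ≈-refl

    side-end : ∀ s e {x} (p : e ∋ x) → x ≈ end-at s e → side p ≡ s
    side-end s e p eq = ≡.trans (side-cong ≈²-refl eq p (end-∋ s e)) (lemma s)
      where
      lemma : ∀ s → side (end-∋ s e) ≡ s
      lemma 0F = ≡.refl
      lemma 1F = ≡.refl

    end-side : ∀ {e x} (p : e ∋ x) → end-at (side p) e ≈ x
    end-side (at-tail p) = ≈-sym p
    end-side (at-head p) = ≈-sym p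

    end-cong : ∀ s {e e′} → e ≈² e′ → end-at s e ≈ end-at s e′
    end-cong 0F eq = proj₂ eq
    end-cong 1F eq = head-cong eq

    hasType : HasType polytope N (2 ℕ.* N) N
    hasType = vertices , edges , faces′
      where
      vertices : SectionsArePolygons polytope 1 N
      vertices {bottom} {face g} _ _ _ = transport-size {S = ℤ/N} coordinate (λ x → vertex x , ⋖⇒< bottom⋖vertex , far⇒< ℕ.≤-refl , ≡.refl)
        coordinate-cong vertex (λ _ → ≈-refl) back ℤ/N-size
        where
        coordinate : (∃[ H ] bottom < H × H < face g × rank H ≡ 1) → ℤ
        coordinate (vertex x , _) = x
        coordinate (bottom , _ , _ , ())
        coordinate-cong : ∀ {H H′} → proj₁ H ≈ᶠ proj₁ H′ → coordinate H ≈ coordinate H′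
        coordinate-cong {vertex _ , _} {vertex _ , _} (vertex p) = p
        coordinate-cong {bottom , _ , _ , ()} {bottom , _}
        back : ∀ H → vertex (coordinate H) ≈ᶠ proj₁ H
        back (vertex x , _) = ≈ᶠ-refl
        back (bottom , _ , _ , ())
      -- The section at a vertex has N edges leaving it and N arriving, distinguished by a bit;
      -- either kind is coordinatised by the first entry of the edge.
      edges : SectionsArePolygons polytope 2 (2 ℕ.* N)
      edges {vertex x} {facet g} _ _ _ = transport-size {S = ×-setoid Bit ℤ/N} coordinate
        (λ (s , y) → edge (which s y) , ⋖⇒< (vertex⋖edge (which-∋ s y)) , far⇒< ℕ.≤-refl , ≡.refl)
        (λ {H} {H′} → coordinate-cong {H} {H′}) (λ { {s , y} (≡.refl , eq) → edge (which-cong s eq) })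
        (λ (s , y) → side-which s y _ , ≈-refl′ s) back (×-size Bit-size ℤ/N-size)
        where
        which : Fin 2 → ℤ → ℤ × ℤ
        which 0F y = y , x
        which 1F y = arriving x y
        which-∋ : ∀ s y → which s y ∋ x
        which-∋ 0F y = at-tail ≈-refl
        which-∋ 1F y = at-head (head-arriving x y)
        which-cong : ∀ s {y y′} → y ≈ y′ → which s y ≈² which s y′
        which-cong 0F eq = eq , ≈-refl
        which-cong 1F eq = arriving-cong x eq
        at-x : ∀ {H} → vertex x < H → rank H ≡ 2 → ∃[ e ] H ≡ edge e × e ∋ x
        at-x {edge e} p eq with <⇒⋖ p eq
        ... | vertex⋖edge e∋x = e , ≡.refl , e∋x
        coordinate : (∃[ H ] vertex x < H × H < facet g × rank H ≡ 2) → Fin 2 × ℤ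
        coordinate (H , p , _ , eq) = let e , _ , e∋x = at-x p eq in side e∋x , proj₁ e
        coordinate-cong : ∀ {H H′} → proj₁ H ≈ᶠ proj₁ H′ → proj₁ (coordinate H) ≡ proj₁ (coordinate H′) × proj₂ (coordinate H) ≈ proj₂ (coordinate H′)
        coordinate-cong {H , p , _ , eq} {H′ , p′ , _ , eq′} H≈ with at-x p eq | at-x p′ eq′
        ... | e , ≡.refl , e∋x | e′ , ≡.refl , e′∋x with H≈
        ...   | edge q = side-cong q ≈-refl e∋x e′∋x , proj₁ q
        ≈-refl′ : ∀ s {y} → proj₁ (which s y) ≈ y
        ≈-refl′ 0F = ≈-refl
        ≈-refl′ 1F = ≈-refl
        side-which : ∀ s y (p : which s y ∋ x) → side p ≡ s
        side-which s y p = ≡.trans (side-cong ≈²-refl ≈-refl p (which-∋ s y)) (lemma s)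
          where
          lemma : ∀ s → side (which-∋ s y) ≡ s
          lemma 0F = ≡.refl
          lemma 1F = ≡.refl
        back : ∀ H → edge (which (proj₁ (coordinate H)) (proj₂ (coordinate H))) ≈ᶠ proj₁ H
        back (H , p , _ , eq) with at-x p eq
        ... | e , ≡.refl , at-tail q = edge (≈-refl , q)
        ... | e , ≡.refl , at-head q = edge (≈²-sym (arriving-unique x q))
      faces′ : SectionsArePolygons polytope 3 N
      faces′ {edge g} {top} _ _ _ = transport-size {S = ℤ/N} coordinate
        (λ z → face (L.outgoing g z) , ⋖⇒< (edge⋖face (∼-swap (L.outgoing-∼ g z))) , far⇒< ℕ.≤-refl , ≡.refl)
        (λ {H} {H′} → coordinate-cong {H} {H′}) (λ eq → face (L.outgoing-cong g eq)) (λ _ → ≈-refl) back ℤ/N-size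
        where
        coordinate : (∃[ H ] edge g < H × H < top × rank H ≡ 3) → ℤ
        coordinate (face h , _) = tail h
        coordinate-cong : ∀ {H H′} → proj₁ H ≈ᶠ proj₁ H′ → coordinate H ≈ coordinate H′
        coordinate-cong {face _ , _} {face _ , _} (face p) = proj₂ p
        back : ∀ H → face (L.outgoing g (coordinate H)) ≈ᶠ proj₁ H
        back (face h , p , _ , eq) with <⇒⋖ p eq
        ... | edge⋖face q = face (≈²-sym (L.outgoing-unique (∼-swap q)))

    -- A flag is its 2-face (w , z), the tail of its edge, and two bits telling which ends its
    -- vertex and its facet are. The factors are grouped as in the product 2 · p · q · r of the
    -- definition of tightness.
    flag-count : HasSize flagSetoid (2 ℕ.* N ℕ.* (2 ℕ.* N) ℕ.* N)
    flag-count = transport-size {S = ×-setoid (×-setoid (×-setoid Bit ℤ/N) (×-setoid Bit ℤ/N)) ℤ/N} coordinates build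
      (λ {Φ} {Ψ} → coordinates-cong {Φ} {Ψ}) build-cong coordinates-build build-coordinates
      (×-size (×-size (×-size Bit-size ℤ/N-size) (×-size Bit-size ℤ/N-size)) ℤ/N-size)
      where
      Code : Set
      Code = ((Fin 2 × ℤ) × (Fin 2 × ℤ)) × ℤ
      code : Tuple → Code
      code t = ((side (e∋v t) , tail (e t)) , (side (f∋c t) , proj₁ (f t))) , tail (f t)
      decode : Code → Tuple
      decode (((s , x) , (s′ , w)) , z) = tuple (end-∋ s (U.outgoing (w , z) x)) (U.outgoing-∼ (w , z) x) (end-∋ s′ (w , z))
      coordinates : Flag → Code
      coordinates Φ = code (proj₁ (flag-tuple Φ))
      build : Code → Flag
      build k = flag-of ⟨ decode k ⟩
      open Setoid (×-setoid (×-setoid (×-setoid Bit ℤ/N) (×-setoid Bit ℤ/N)) ℤ/N) using () renaming (_≈_ to _≈ᵏ_)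
      code-cong : ∀ t t′ → ⟨ t ⟩ ≈ᶜ ⟨ t′ ⟩ → code t ≈ᵏ code t′
      code-cong t t′ eq with eq on 1F | eq on 2F | eq on 3F | eq on 4F
      ... | vertex p | edge q | face r | facet s =
        ((side-cong q p (e∋v t) (e∋v t′) , proj₂ q) , (side-cong r s (f∋c t) (f∋c t′) , proj₁ r)) , proj₂ r
      of-flag : ∀ Φ → faces Φ ≋ list ⟨ proj₁ (flag-tuple Φ) ⟩
      of-flag Φ = proj₂ (flag-tuple Φ)
      module ≋ = Setoid ≋-setoid
      coordinates-cong : ∀ {Φ Ψ} → faces Φ ≋ faces Ψ → coordinates Φ ≈ᵏ coordinates Ψ
      coordinates-cong {Φ} {Ψ} eq = code-cong (proj₁ (flag-tuple Φ)) (proj₁ (flag-tuple Ψ))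
        (≋⇒≈ᶜ (≋.trans (≋.sym (of-flag Φ)) (≋.trans eq (of-flag Ψ))))
      decode-cong : ∀ {k k′} → k ≈ᵏ k′ → ⟨ decode k ⟩ ≈ᶜ ⟨ decode k′ ⟩
      decode-cong {((s , x) , (s′ , w)) , z} {((_ , x′) , (_ , w′)) , z′} (((≡.refl , p) , (≡.refl , q)) , r) =
        entries (end-cong s e≈) e≈ (q , r) (end-cong s′ (q , r))
        where
        e≈ : U.outgoing (w , z) x ≈² U.outgoing (w′ , z′) x′
        e≈ = ≈²-trans (U.outgoing-unique (U.∼-resp ≈²-refl (q , r) (U.outgoing-∼ (w , z) x))) (U.outgoing-cong (w′ , z′) p)
      build-cong : ∀ {k k′} → k ≈ᵏ k′ → faces (build k) ≋ faces (build k′)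
      build-cong eq = ≈ᶜ⇒≋ (decode-cong eq)
      code-decode : ∀ k → code (decode k) ≈ᵏ k
      code-decode (((s , x) , (s′ , w)) , z) = ((side-end s _ (end-∋ s (U.outgoing (w , z) x)) ≈-refl , ≈-refl) , (side-end s′ _ (end-∋ s′ (w , z)) ≈-refl , ≈-refl)) , ≈-refl
      decode-code : ∀ t → ⟨ decode (code t) ⟩ ≈ᶜ ⟨ t ⟩
      decode-code t = entries (≈-trans (end-cong (side (e∋v t)) e≈) (end-side (e∋v t))) e≈ ≈²-refl (end-side (f∋c t))
        where e≈ = ≈²-sym (U.outgoing-unique (e∼f t))
      coordinates-build : ∀ k → coordinates (build k) ≈ᵏ k
      coordinates-build k = Setoid.trans (×-setoid (×-setoid (×-setoid Bit ℤ/N) (×-setoid Bit ℤ/N)) ℤ/N)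
        {coordinates (build k)} {code (decode k)} {k}
        (code-cong (proj₁ (flag-tuple (build k))) (decode k) (≋⇒≈ᶜ (≋.sym (of-flag (build k))))) (code-decode k)
      build-coordinates : ∀ Φ → faces (build (coordinates Φ)) ≋ faces Φ
      build-coordinates Φ = ≋.trans (≈ᶜ⇒≋ (decode-code (proj₁ (flag-tuple Φ)))) (≋.sym (of-flag Φ))

-- Words of Γ₃ as automorphisms of the model.

module Action where

  open import Algebra.Bundles using (Group)
  open import Data.Fin as Fin using (Fin; zero; suc)
  open import Data.Fin.Patterns
  open import Data.Integer as ℤ using (ℤ; +_; -[1+_])
  import Data.Integer.Properties as ℤ
  open import Data.Nat as ℕ using (ℕ; zero; suc; NonZero)
  open import Data.Product using (Σ-syntax; ∃-syntax; _,_)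
  open import Data.Sign using (Sign)
  open import Data.Vec using (Vec; []; _∷_)
  open import Level using (0ℓ)
  open import Relation.Binary.Bundles using (Setoid)
  open import Relation.Binary.PropositionalEquality as ≡ using (_≡_; _≢_)
  open import Relation.Nullary using (no)
  open import Defs using (Word; gen; ε; _∙_; _⁻¹; Polytope; Automorphism; Equal)
  open GroupKit
  open Presentation
  open Universal
  open Modular
  open Half
  open HalfRelations
  open Facets
  open Incidence
  open Finite
  open Model
  open General
  open Flags
  open Tight

  half-unit : Sign → ℤ
  half-unit Sign.+ = + 0
  half-unit Sign.- = -[1+ 0 ]

  unit-half : ∀ s → + 1 ℤ.+ + 2 ℤ.* half-unit s ≡ unit s
  unit-half Sign.+ = ≡.refl
  unit-half Sign.- = ≡.refl

  module _ {S : Setoid 0ℓ 0ℓ} where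
    open Setoid S
    open Permutation

    fixed-^ : ∀ (g : Permutation S) {x} → to g x ≈ x → ∀ n → to (Powers._^_ (permutations S) g n) x ≈ x
    fixed-^ g {x} fix n = trans (reflexive (≡.cong (λ h → to h x) (Powers.^≡^ᶻ (permutations S) g n))) (go n)
      where
      open Powers (permutations S) using (_^ⁿ_; _^ᶻ_)
      natural : ∀ n → to (g ^ⁿ n) x ≈ x
      natural zero    = refl
      natural (suc n) = trans (to-cong (g ^ⁿ n) fix) (natural n)
      go : ∀ n → to (g ^ᶻ n) x ≈ x
      go (+ n)    = natural n
      go -[1+ n ] = trans (from-cong (g ^ⁿ suc n) (sym (natural (suc n)))) (from-to (g ^ⁿ suc n) x)

  module Acting (N : ℕ) (J : ℤ) .{{N≢0 : NonZero N}} (N-eq : + N ≡ + 16 ℤ.* J) (s₁ s₂ : Sign)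
    (q m : ℕ) (q-eq : + q ≡ + 32 ℤ.* J) (m-eq : + m ≡ + 8 ℤ.* J) where

    δ₁ δ₂ : ℤ
    δ₁ = half-unit s₁
    δ₂ = half-unit s₂

    open Semantics J
    open Congruence J
    open Ends J
    open TightPolytope N J N-eq δ₁ δ₂
    module Γₘ = Γ N q m s₁ s₂ J N-eq q-eq m-eq
    open U using (_∼_)
    open Setoid ℤ/N² using () renaming (_≈_ to _≈²_; trans to ≈²-trans; sym to ≈²-sym; refl to ≈²-refl)
    module P = Polytope polytope

    private
      W : Set
      W = Word (Fin 3)
      module Perm² = Group (permutations ℤ/N²)
      module Perm¹ = Group (permutations ℤ/N)
      module F₁₂ = Upper J δ₁ δ₂
      module F₂₁ = Upper J δ₂ δ₁
      module C₁₂ = FacetAction J δ₁ δ₂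
      module C₂₁ = FacetAction J δ₂ δ₁

      rename-units : ∀ {G a b c} → Relations G J (+ 1 ℤ.+ + 2 ℤ.* δ₁) (+ 1 ℤ.+ + 2 ℤ.* δ₂) a b c →
                     Relations G J (unit s₁) (unit s₂) a b c
      rename-units {G} {a} {b} {c} = ≡.subst₂ (λ x y → Relations G J x y a b c) (unit-half s₁) (unit-half s₂)

    -- On edges the dual generators are used: σ₁, σ₂, σ₃ act as the inverses of `up`, `turn`, `rot`
    -- with the signs exchanged. The relations then follow from those on 2-faces by `dual`.
    faceᵍ edgeᵍ : Vec (Permutation ℤ/N²) 3
    faceᵍ = F₁₂.rotₚ (+ 1) ∷ F₁₂.turnₚ ∷ F₁₂.upₚ (+ 1) ∷ []
    edgeᵍ = F₂₁.upₚ (+ 1) Perm².⁻¹ ∷ F₂₁.turnₚ Perm².⁻¹ ∷ F₂₁.rotₚ (+ 1) Perm².⁻¹ ∷ []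

    facetᵍ vertexᵍ : Vec (Permutation ℤ/N) 3
    facetᵍ = C₁₂.frotₚ (+ 1) ∷ C₁₂.fturnₚ ∷ C₁₂.fupₚ (+ 1) ∷ []
    vertexᵍ = C₂₁.fupₚ (+ 1) Perm¹.⁻¹ ∷ C₂₁.fturnₚ Perm¹.⁻¹ ∷ C₂₁.frotₚ (+ 1) Perm¹.⁻¹ ∷ []

    onFaces onEdges : W → Permutation ℤ/N²
    onFaces w = Powers.⟦_⟧ (permutations ℤ/N²) w faceᵍ
    onEdges w = Powers.⟦_⟧ (permutations ℤ/N²) w edgeᵍ

    onFacets onVertices : W → Permutation ℤ/N
    onFacets w = Powers.⟦_⟧ (permutations ℤ/N) w facetᵍ
    onVertices w = Powers.⟦_⟧ (permutations ℤ/N) w vertexᵍ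

    face-relations : Relations (permutations ℤ/N²) J (unit s₁) (unit s₂) (F₁₂.rotₚ (+ 1)) F₁₂.turnₚ (F₁₂.upₚ (+ 1))
    face-relations = rename-units (FaceRelations.relations J δ₁ δ₂)

    edge-relations : Relations (permutations ℤ/N²) J (unit s₁) (unit s₂)
                       (F₂₁.upₚ (+ 1) Perm².⁻¹) (F₂₁.turnₚ Perm².⁻¹) (F₂₁.rotₚ (+ 1) Perm².⁻¹)
    edge-relations = rename-units (Consequences.dual (FaceRelations.relations J δ₂ δ₁))

    facet-relations : Relations (permutations ℤ/N) J (unit s₁) (unit s₂) (C₁₂.frotₚ (+ 1)) C₁₂.fturnₚ (C₁₂.fupₚ (+ 1))
    facet-relations = rename-units C₁₂.facet-relations

    vertex-relations : Relations (permutations ℤ/N) J (unit s₁) (unit s₂)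
                         (C₂₁.fupₚ (+ 1) Perm¹.⁻¹) (C₂₁.fturnₚ Perm¹.⁻¹) (C₂₁.frotₚ (+ 1) Perm¹.⁻¹)
    vertex-relations = rename-units (Consequences.dual C₂₁.facet-relations)

    private
      word-induction : ∀ {A B : Setoid 0ℓ 0ℓ} {_~_ : Setoid.Carrier A → Setoid.Carrier B → Set}
        (resp : ∀ {x x′ y y′} → Setoid._≈_ A x x′ → Setoid._≈_ B y y′ → x ~ y → x′ ~ y′)
        (ρ : Vec (Permutation A) 3) (ρ′ : Vec (Permutation B) 3) →
        (∀ i → Preserves {A} {B} _~_ (Data.Vec.lookup ρ i) (Data.Vec.lookup ρ′ i)) →
        ∀ w → Preserves {A} {B} _~_ (Powers.⟦_⟧ (permutations A) w ρ) (Powers.⟦_⟧ (permutations B) w ρ′)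
      word-induction resp ρ ρ′ gens (gen i) = gens i
      word-induction {_~_ = _~_} resp ρ ρ′ gens ε = preserves-ε _~_
      word-induction {_~_ = _~_} resp ρ ρ′ gens (u ∙ v) =
        preserves-∙ _~_ (word-induction resp ρ ρ′ gens u) (word-induction resp ρ ρ′ gens v)
      word-induction {_~_ = _~_} resp ρ ρ′ gens (u ⁻¹) = preserves-⁻¹ _~_ resp (word-induction resp ρ ρ′ gens u)

    ∋-facets : ∀ w → Preserves {ℤ/N²} {ℤ/N} _∋_ (onFaces w) (onFacets w)
    ∋-facets = word-induction {ℤ/N²} {ℤ/N} {_∋_} ∋-resp faceᵍ facetᵍ λ { 0F → U.∋-rot ; 1F → U.∋-turn ; 2F → U.∋-up }

    ∋-vertices : ∀ w → Preserves {ℤ/N²} {ℤ/N} _∋_ (onEdges w) (onVertices w)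
    ∋-vertices = word-induction {ℤ/N²} {ℤ/N} {_∋_} ∋-resp edgeᵍ vertexᵍ λ
      { 0F → preserves-⁻¹ _∋_ ∋-resp L.∋-up ; 1F → preserves-⁻¹ _∋_ ∋-resp L.∋-turn ; 2F → preserves-⁻¹ _∋_ ∋-resp L.∋-rot }

    ∼-edges : ∀ w → Preserves {ℤ/N²} {ℤ/N²} _∼_ (onEdges w) (onFaces w)
    ∼-edges = word-induction {ℤ/N²} {ℤ/N²} {_∼_} U.∼-resp edgeᵍ faceᵍ λ { 0F → first ; 1F → second ; 2F → third }
      where
      open Permutation
      first : Preserves {ℤ/N²} {ℤ/N²} _∼_ (F₂₁.upₚ (+ 1) Perm².⁻¹) (F₁₂.rotₚ (+ 1))
      first = preserves
        (λ {e} p → ∼-swap (L.rot-up (∼-swap (U.∼-resp (≈²-sym (to-from (F₂₁.upₚ (+ 1)) e)) ≈²-refl p))))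
        (λ {e} p → U.∼-resp (to-from (F₂₁.upₚ (+ 1)) e) ≈²-refl (∼-swap (L.up-rot (∼-swap p))))
      second : Preserves {ℤ/N²} {ℤ/N²} _∼_ (F₂₁.turnₚ Perm².⁻¹) F₁₂.turnₚ
      second = preserves
        (λ {e} p → U.turn-turn⁻ (U.∼-resp (≈²-sym (to-from F₂₁.turnₚ e)) ≈²-refl p))
        (λ {e} p → U.∼-resp (to-from F₂₁.turnₚ e) ≈²-refl (U.turn-turn p))
      third : Preserves {ℤ/N²} {ℤ/N²} _∼_ (F₂₁.rotₚ (+ 1) Perm².⁻¹) (F₁₂.upₚ (+ 1))
      third = preserves
        (λ {e} p → U.up-rot (U.∼-resp (≈²-sym (to-from (F₂₁.rotₚ (+ 1)) e)) ≈²-refl p))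
        (λ {e} p → U.∼-resp (to-from (F₂₁.rotₚ (+ 1)) e) ≈²-refl (U.rot-up p))

    open Permutation using (to; from; to-cong; from-cong; to-from; from-to; to-injective)

    act act⁻ : W → Face → Face
    act w bottom     = bottom
    act w (vertex x) = vertex (to (onVertices w) x)
    act w (edge x)   = edge (to (onEdges w) x)
    act w (face x)   = face (to (onFaces w) x)
    act w (facet x)  = facet (to (onFacets w) x)
    act w top        = top
    act⁻ w bottom     = bottom
    act⁻ w (vertex x) = vertex (from (onVertices w) x)
    act⁻ w (edge x)   = edge (from (onEdges w) x)
    act⁻ w (face x)   = face (from (onFaces w) x)
    act⁻ w (facet x)  = facet (from (onFacets w) x)
    act⁻ w top        = top

    act-cong : ∀ w {F G} → F ≈ᶠ G → act w F ≈ᶠ act w G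
    act-cong w bottom     = bottom
    act-cong w (vertex p) = vertex (to-cong (onVertices w) p)
    act-cong w (edge p)   = edge (to-cong (onEdges w) p)
    act-cong w (face p)   = face (to-cong (onFaces w) p)
    act-cong w (facet p)  = facet (to-cong (onFacets w) p)
    act-cong w top        = top

    act-injective : ∀ w {F G} → act w F ≈ᶠ act w G → F ≈ᶠ G
    act-injective w {bottom}   {bottom}   bottom     = bottom
    act-injective w {vertex _} {vertex _} (vertex p) = vertex (to-injective (onVertices w) p)
    act-injective w {edge _}   {edge _}   (edge p)   = edge (to-injective (onEdges w) p)
    act-injective w {face _}   {face _}   (face p)   = face (to-injective (onFaces w) p)
    act-injective w {facet _}  {facet _}  (facet p)  = facet (to-injective (onFacets w) p)
    act-injective w {top}      {top}      top        = top

    act-act⁻ : ∀ w F → act w (act⁻ w F) ≈ᶠ F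
    act-act⁻ w bottom     = bottom
    act-act⁻ w (vertex x) = vertex (to-from (onVertices w) x)
    act-act⁻ w (edge x)   = edge (to-from (onEdges w) x)
    act-act⁻ w (face x)   = face (to-from (onFaces w) x)
    act-act⁻ w (facet x)  = facet (to-from (onFacets w) x)
    act-act⁻ w top        = top

    act-rank : ∀ w F → rank (act w F) ≡ rank F
    act-rank w bottom     = ≡.refl
    act-rank w (vertex _) = ≡.refl
    act-rank w (edge _)   = ≡.refl
    act-rank w (face _)   = ≡.refl
    act-rank w (facet _)  = ≡.refl
    act-rank w top        = ≡.refl

    act-⋖ : ∀ w {F G} → F ⋖ G → act w F ⋖ act w G
    act-⋖ w bottom⋖vertex   = bottom⋖vertex
    act-⋖ w (vertex⋖edge p) = vertex⋖edge (Preserves.forth (∋-vertices w) p)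
    act-⋖ w (edge⋖face p)   = edge⋖face (Preserves.forth (∼-edges w) p)
    act-⋖ w (face⋖facet p)  = face⋖facet (Preserves.forth (∋-facets w) p)
    act-⋖ w facet⋖top       = facet⋖top

    act-⋖⁻ : ∀ w F G → act w F ⋖ act w G → F ⋖ G
    act-⋖⁻ w bottom     (vertex _) bottom⋖vertex   = bottom⋖vertex
    act-⋖⁻ w (vertex _) (edge _)   (vertex⋖edge p) = vertex⋖edge (Preserves.back (∋-vertices w) p)
    act-⋖⁻ w (edge _)   (face _)   (edge⋖face p)   = edge⋖face (Preserves.back (∼-edges w) p)
    act-⋖⁻ w (face _)   (facet _)  (face⋖facet p)  = face⋖facet (Preserves.back (∋-facets w) p)
    act-⋖⁻ w (facet _)  top        facet⋖top       = facet⋖top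

    act-≤ : ∀ w {F G} → F ≤ᶠ G → act w F ≤ᶠ act w G
    act-≤ w (equal p) = equal (act-cong w p)
    act-≤ w (cover p) = cover (act-⋖ w p)
    act-≤ w {F} {G} (far p) = far (≡.subst₂ (λ m n → 2 ℕ.+ m ℕ.≤ n) (≡.sym (act-rank w F)) (≡.sym (act-rank w G)) p)

    act-≤⁻ : ∀ w {F G} → act w F ≤ᶠ act w G → F ≤ᶠ G
    act-≤⁻ w (equal p) = equal (act-injective w p)
    act-≤⁻ w (cover p) = cover (act-⋖⁻ w _ _ p)
    act-≤⁻ w {F} {G} (far p) = far (≡.subst₂ (λ m n → 2 ℕ.+ m ℕ.≤ n) (act-rank w F) (act-rank w G) p)

    automorphism : W → Automorphism polytope
    automorphism w = act w , record
      { isOrderMonomorphism = record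
        { isOrderHomomorphism = record { cong = act-cong w ; mono = act-≤ w }
        ; injective = act-injective w
        ; cancel = act-≤⁻ w
        }
      ; surjective = λ F → act⁻ w F , λ eq → ≈ᶠ-trans (act-cong w eq) (act-act⁻ w F)
      }

    act-sound : ∀ {u v} → Equal Γₘ.R u v → ∀ F → act u F ≈ᶠ act v F
    act-sound eq bottom     = bottom
    act-sound eq (vertex x) = vertex (Agree.at (Γₘ.universal vertex-relations eq) x)
    act-sound eq (edge x)   = edge (Agree.at (Γₘ.universal edge-relations eq) x)
    act-sound eq (face x)   = face (Agree.at (Γₘ.universal face-relations eq) x)
    act-sound eq (facet x)  = facet (Agree.at (Γₘ.universal facet-relations eq) x)
    act-sound eq top        = top

    act-∙ : ∀ u v F → act (u ∙ v) F ≡ act v (act u F)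
    act-∙ u v bottom     = ≡.refl
    act-∙ u v (vertex _) = ≡.refl
    act-∙ u v (edge _)   = ≡.refl
    act-∙ u v (face _)   = ≡.refl
    act-∙ u v (facet _)  = ≡.refl
    act-∙ u v top        = ≡.refl

    act-ε : ∀ F → act ε F ≡ F
    act-ε bottom     = ≡.refl
    act-ε (vertex _) = ≡.refl
    act-ε (edge _)   = ≡.refl
    act-ε (face _)   = ≡.refl
    act-ε (facet _)  = ≡.refl
    act-ε top        = ≡.refl

    act-⁻¹ : ∀ u F → act (u ⁻¹) F ≡ act⁻ u F
    act-⁻¹ u bottom     = ≡.refl
    act-⁻¹ u (vertex _) = ≡.refl
    act-⁻¹ u (edge _)   = ≡.refl
    act-⁻¹ u (face _)   = ≡.refl
    act-⁻¹ u (facet _)  = ≡.refl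
    act-⁻¹ u top        = ≡.refl

-- The two orbits of flags and the faithfulness of the action.

module Symmetry where

  open import Algebra.Bundles using (Group)
  open import Data.Empty using (⊥; ⊥-elim)
  open import Data.Fin as Fin using (Fin; zero; suc)
  open import Data.Fin.Patterns
  open import Data.Integer as ℤ using (ℤ; +_; -[1+_])
  import Data.Integer.Properties as ℤ
  open import Data.Integer.Solver using (module +-*-Solver)
  open import Data.Nat as ℕ using (ℕ; zero; suc; NonZero)
  import Data.Nat.Properties as ℕ
  open import Data.Product using (Σ-syntax; ∃; ∃-syntax; ∃₂; _,_; proj₁; proj₂)
  open import Data.Sign using (Sign)
  open import Data.Sum using (_⊎_; inj₁; inj₂)
  open import Data.Vec using (Vec; [])
  open import Level using (0ℓ)
  open import Relation.Binary.Bundles using (Setoid)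
  open import Relation.Binary.PropositionalEquality as ≡ using (_≡_; _≢_)
  open import Relation.Nullary using (¬_; Dec; no; contradiction)
  open import Defs using (Word; ε; _∙_; _⁻¹; σ₁; σ₂; σ₃; Polytope; Automorphism; Equal)
  open GroupKit
  open Collect using (Parity; even; odd; parity)
  open Presentation
  open Universal
  open Modular
  open Half
  open HalfRelations
  open Facets
  open Incidence
  open Finite
  open Model
  open General
  open Periods
  open Flags
  open Tight
  open Action

  2n≢1 : ∀ n → + 2 ℤ.* n ≢ + 1
  2n≢1 (+ zero)        ()
  2n≢1 (+ suc zero)    ()
  2n≢1 (+ suc (suc n)) ()
  2n≢1 -[1+ n ]        ()

  module Words (N : ℕ) (J : ℤ) .{{N≢0 : NonZero N}} (N-eq : + N ≡ + 16 ℤ.* J) (s₁ s₂ : Sign)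
    (q m : ℕ) (q-eq : + q ≡ + 32 ℤ.* J) (m-eq : + m ≡ + 8 ℤ.* J) where

    open Acting N J N-eq s₁ s₂ q m q-eq m-eq public
    open Semantics J
    open Congruence J
    open Ends J
    open TightPolytope N J N-eq δ₁ δ₂
    open U using (_∼_)
    open Setoid ℤ/N² using () renaming (_≈_ to _≈²_; trans to ≈²-trans; sym to ≈²-sym; refl to ≈²-refl)
    open Chains polytope
    open Automorphisms polytope
    open Γₘ using (R)
    module Γᴳ = Group Γₘ.group
    open Permutation using (to; from; to-cong; from-cong; to-injective)

    private
      W : Set
      W = Word (Fin 3)
      module F₁₂ = Upper J δ₁ δ₂
      module F₂₁ = Upper J δ₂ δ₁
      module C₁₂ = FacetAction J δ₁ δ₂
      module C₂₁ = FacetAction J δ₂ δ₁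

    odd≉0 : ∀ n → ¬ (+ 1 ℤ.+ + 2 ℤ.* n ≈ + 0)
    odd≉0 n (multiple k eq) = 2n≢1 (k ℤ.* (+ 8 ℤ.* J) ℤ.- n) (begin
      + 2 ℤ.* (k ℤ.* (+ 8 ℤ.* J) ℤ.- n)                   ≡⟨ solve 3 (λ k j n → :con (+ 2) :* (k :* (:con (+ 8) :* j) :- n)
                                                          := :con (+ 0) :+ k :* (:con (+ 16) :* j) :- :con (+ 2) :* n) ≡.refl k J n ⟩
      + 0 ℤ.+ k ℤ.* (+ 16 ℤ.* J) ℤ.- + 2 ℤ.* n            ≡⟨ ≡.cong (λ t → t ℤ.- + 2 ℤ.* n) eq ⟨
      + 1 ℤ.+ + 2 ℤ.* n ℤ.- + 2 ℤ.* n                     ≡⟨ solve 1 (λ n → :con (+ 1) :+ :con (+ 2) :* n :- :con (+ 2) :* n := :con (+ 1)) ≡.refl n ⟩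
      + 1                                                 ∎)
      where
      open ≡.≡-Reasoning
      open +-*-Solver using (solve; _:+_; _:*_; _:-_; :-_; _:=_) renaming (con to :con)

    0≉1 : ¬ (+ 0 ≈ + 1)
    0≉1 p = odd≉0 (+ 0) (≈-sym p)

    0≉-1 : ¬ (+ 0 ≈ -[1+ 0 ])
    0≉-1 p = odd≉0 -[1+ 0 ] (≈-sym p)

    Φ Φ¹ : Chain
    Φ = ⟨ tuple {+ 0} {+ 0 , + 0} {+ 0 , + 0} {+ 0} (at-tail ≈-refl) (U.base-∼ (+ 0)) (at-tail ≈-refl) ⟩
    Φ¹ = ⟨ tuple {+ 0} {+ 0 , -[1+ 0 ]} {+ 0 , + 0} {+ 0} (at-head (mod! {0} (con (+ 0)) (con -[1+ 0 ] ⊕ con (+ 1) ⊕ con (+ 8) ⊗ 𝕁 ⊗ con (+ 0)) ≡.refl []))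
           (U.base-∼ -[1+ 0 ]) (at-tail ≈-refl) ⟩

    words : W → FlagMap polytope polytope
    words w = moving (automorphism w)

    evenᶜ oddᶜ : W → Chain
    evenᶜ w = move (automorphism w) Φ
    oddᶜ w  = move (automorphism w) Φ¹

    -- The flag adjacent to the base flag in rank j is Φ¹ g j.
    g : Fin 4 → W
    g 0F = σ₁ ⁻¹
    g 1F = ε
    g 2F = σ₂
    g 3F = σ₂ ∙ σ₃

    Φ-adj : ∀ j → Adj j Φ (oddᶜ (g j))
    Φ-adj 0F = adj (λ { (vertex p) → 0≉1 p }) λ
      { 0F _ → bottom ; 1F ne → contradiction ≡.refl ne ; 2F _ → ≈ᶠ-refl ; 3F _ → face (≈²-sym (F₁₂.rot-base -[1+ 0 ]))
      ; 4F _ → facet (≈-sym (C₁₂.frot-base -[1+ 0 ])) ; 5F _ → top }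
    Φ-adj 1F = adj (λ { (edge p) → 0≉-1 (proj₂ p) }) λ
      { 0F _ → bottom ; 1F _ → ≈ᶠ-refl ; 2F ne → contradiction ≡.refl ne ; 3F _ → ≈ᶠ-refl ; 4F _ → ≈ᶠ-refl ; 5F _ → top }
    Φ-adj 2F = adj (λ { (face p) → 0≉-1 (≈-trans (proj₂ p) (proj₂ F₁₂.turn-base)) }) λ
      { 0F _ → bottom ; 1F _ → vertex (≈-sym (≈-trans (C₂₁.fsq-cong -[1+ 0 ] C₂₁.fturn-base) (C₂₁.fsq-base -[1+ 0 ])))
      ; 2F _ → edge (≈²-sym F₂₁.turn-back) ; 3F ne → contradiction ≡.refl ne
      ; 4F _ → facet (≈-sym C₁₂.fturn-base) ; 5F _ → top }
    Φ-adj 3F = adj (λ { (facet p) → 0≉1 (≈-trans p (C₁₂.fup-cong (+ 1) C₁₂.fturn-base)) }) λ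
      { 0F _ → bottom
      ; 1F _ → vertex (≈-sym (≈-trans (C₂₁.frot-cong -[1+ 0 ] (≈-trans (C₂₁.fsq-cong -[1+ 0 ] C₂₁.fturn-base) (C₂₁.fsq-base -[1+ 0 ]))) (C₂₁.frot-base -[1+ 0 ])))
      ; 2F _ → edge (≈²-sym (≈²-trans (F₂₁.rot-cong -[1+ 0 ] F₂₁.turn-back) (F₂₁.rot-base -[1+ 0 ])))
      ; 3F _ → face (≈²-sym (to-cong (F₁₂.upₚ (+ 1)) F₁₂.turn-base)) ; 4F ne → contradiction ≡.refl ne ; 5F _ → top }

    even-cong : ∀ {u v} → Equal R u v → evenᶜ u ≈ᶜ evenᶜ v
    even-cong eq = agree λ i → act-sound eq (at Φ i)

    odd-cong : ∀ {u v} → Equal R u v → oddᶜ u ≈ᶜ oddᶜ v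
    odd-cong eq = agree λ i → act-sound eq (at Φ¹ i)

    odd-∙ : ∀ u v → move (automorphism v) (oddᶜ u) ≈ᶜ oddᶜ (u ∙ v)
    odd-∙ u v = agree λ i → P.Eq.reflexive (≡.sym (act-∙ u v (at Φ¹ i)))

    even-adj : ∀ j w → Adj j (evenᶜ w) (oddᶜ (g j ∙ w))
    even-adj j w = adj-cong ≈ᶜ-refl (odd-∙ (g j) w) (FlagMap.on-adj (words w) (Φ-adj j))

    odd-adj : ∀ j w → Adj j (oddᶜ w) (evenᶜ (g j ⁻¹ ∙ w))
    odd-adj j w = adj-cong (odd-cong (Γᴳ.trans (Γᴳ.sym (Γᴳ.assoc (g j) (g j ⁻¹) w))
      (Γᴳ.trans (Γᴳ.∙-congʳ (Γᴳ.inverseʳ (g j))) (Γᴳ.identityˡ w)))) ≈ᶜ-refl (adj-sym (even-adj j (g j ⁻¹ ∙ w)))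

    open Decided _≟ᶠ_

    -- A path from Φ is followed; each adjacency passes from one kind of flag to the other and
    -- multiplies the word on the left by some `g j` or its inverse.
    orbit : ∀ y → ∃[ w ] (evenᶜ w ≈ᶜ y ⊎ oddᶜ w ≈ᶜ y)
    orbit y = go (path Φ y) ε (inj₁ (agree λ i → P.Eq.reflexive (act-ε (at Φ i))))
      where
      go : ∀ {a} → Path Φ y a → ∀ w → evenᶜ w ≈ᶜ a ⊎ oddᶜ w ≈ᶜ a → ∃[ w ] (evenᶜ w ≈ᶜ y ⊎ oddᶜ w ≈ᶜ y)
      go (done eq) w (inj₁ p) = w , inj₁ (≈ᶜ-trans p eq)
      go (done eq) w (inj₂ p) = w , inj₂ (≈ᶜ-trans p eq)
      go (step j s _ rest) w (inj₁ p) = go rest (g j ∙ w) (inj₂ (adj-unique (even-adj j w) (adj-cong (≈ᶜ-sym p) ≈ᶜ-refl s)))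
      go (step j s _ rest) w (inj₂ p) = go rest (g j ⁻¹ ∙ w) (inj₁ (adj-unique (odd-adj j w) (adj-cong (≈ᶜ-sym p) ≈ᶜ-refl s)))

    through-face : ∀ F → ∃₂ λ (x : Chain) (i : Fin 6) → at x i P.≈ F
    through-face bottom     = Φ , 0F , bottom
    through-face (vertex x) = ⟨ tuple {x} {+ 0 , x} (at-tail ≈-refl) (U.base-∼ x) (at-tail ≈-refl) ⟩ , 1F , ≈ᶠ-refl
    through-face (edge e)   = ⟨ tuple {e = e} (at-tail ≈-refl) (∼-swap (L.outgoing-∼ e (+ 0))) (at-tail ≈-refl) ⟩ , 2F , ≈ᶠ-refl
    through-face (face f)   = ⟨ tuple (at-tail ≈-refl) (U.outgoing-∼ f (+ 0)) (at-tail ≈-refl) ⟩ , 3F , ≈ᶠ-refl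
    through-face (facet c)  = ⟨ tuple {f = + 0 , c} (at-tail ≈-refl) (U.outgoing-∼ (+ 0 , c) (+ 0)) (at-tail ≈-refl) ⟩ , 4F , ≈ᶠ-refl
    through-face top        = Φ , 5F , top

    open Rigidity polytope _≟ᶠ_ through-face public using (determined)

    J≢0 : J ≢ + 0
    J≢0 J≡0 = ℕ.≢-nonZero⁻¹ N (ℤ.+-injective (≡.trans N-eq (≡.cong (+ 16 ℤ.*_) J≡0)))

    q≢0 : q ≢ 0
    q≢0 q≡0 = J≢0 (ℤ.*-cancelˡ-≡ (+ 32) J (+ 0) (≡.trans (≡.sym q-eq) (≡.cong +_ q≡0)))

    private
      module Kit = Powers Γₘ.group
      module Rel = Relations Γₘ.relations
      module NF = NormalForm Γₘ.relations (ℕ.pred N) (ℕ.pred q) (≡.trans (≡.cong +_ (ℕ.suc-pred N)) N-eq)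
        (≡.trans (≡.cong +_ (ℕ.suc-pred q {{ℕ.≢-nonZero q≢0}})) q-eq)

    open Kit using (_^_)

    private
      eval-power : ∀ {S : Setoid 0ℓ 0ℓ} (ρ : Vec (Permutation S) 3) w n →
        Powers.⟦_⟧ (permutations S) (w ^ n) ρ ≡ Powers._^_ (permutations S) (Powers.⟦_⟧ (permutations S) w ρ) n
      eval-power {S} ρ w n = ≡.trans (≡.cong (λ w → Powers.⟦_⟧ (permutations S) w ρ) (≡.sym (Γₘ.word-^ w n))) (eval-^ (permutations S) ρ w n)

    onFacet-power : ∀ w n x → to (onFacets (w ^ n)) x ≡ to (Powers._^_ (permutations ℤ/N) (onFacets w) n) x
    onFacet-power w n x = ≡.cong (λ h → to h x) (eval-power facetᵍ w n)

    onVertex-power : ∀ w n x → to (onVertices (w ^ n)) x ≡ to (Powers._^_ (permutations ℤ/N) (onVertices w) n) x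
    onVertex-power w n x = ≡.cong (λ h → to h x) (eval-power vertexᵍ w n)

    onFace-power : ∀ w n x → to (onFaces (w ^ n)) x ≡ to (Powers._^_ (permutations ℤ/N²) (onFaces w) n) x
    onFace-power w n x = ≡.cong (λ h → to h x) (eval-power faceᵍ w n)

    facet-up : ∀ l → to (onFacets (σ₃ ^ l)) (+ 0) ≈ l
    facet-up l = ≈-trans (≈-reflexive (onFacet-power σ₃ l (+ 0)))
      (≈-trans (≈-sym (Agree.at (C₁₂.up^ l) (+ 0))) (≈-reflexive (ℤ.+-identityˡ l)))

    facet-fixed₁ : ∀ i → to (onFacets (σ₁ ^ i)) (+ 0) ≈ + 0
    facet-fixed₁ i = ≈-trans (≈-reflexive (onFacet-power σ₁ i (+ 0))) (fixed-^ (C₁₂.frotₚ (+ 1)) (C₁₂.frot-base (+ 1)) i)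

    facet-fixed₂ : ∀ k → to (onFacets (σ₂ ^ k)) (+ 0) ≈ + 0
    facet-fixed₂ k = ≈-trans (≈-reflexive (onFacet-power σ₂ k (+ 0))) (fixed-^ C₁₂.fturnₚ C₁₂.fturn-base k)

    vertex-down : ∀ i → to (onVertices (σ₁ ^ i)) (+ 0) ≈ ℤ.- i
    vertex-down i = ≈-trans (≈-reflexive (onVertex-power σ₁ i (+ 0)))
      (≈-trans (Agree.at (Consequences.inv-^ C₂₁.facet-relations (C₂₁.fupₚ (+ 1)) i) (+ 0))
        (≈-trans (≈-sym (Agree.at (C₂₁.up^ (ℤ.- i)) (+ 0))) (≈-reflexive (ℤ.+-identityˡ (ℤ.- i)))))

    vertex-fixed₂ : ∀ k → to (onVertices (σ₂ ^ k)) (+ 0) ≈ + 0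
    vertex-fixed₂ k = ≈-trans (≈-reflexive (onVertex-power σ₂ k (+ 0))) (fixed-^ (Group._⁻¹ (permutations ℤ/N) C₂₁.fturnₚ)
      (≈-trans (C₂₁.fsq-cong -[1+ 0 ] C₂₁.fturn-base) (C₂₁.fsq-base -[1+ 0 ])) k)

    face-even : ∀ n → to (onFaces (σ₂ ^ (+ 2 ℤ.* n))) (+ 0 , + 0) ≈² (n , + 0)
    face-even n = ≈²-trans (Setoid.reflexive ℤ/N² (onFace-power σ₂ (+ 2 ℤ.* n) (+ 0 , + 0)))
      (≈²-trans (≈²-sym (Agree.at (F₁₂.turn-even n) (+ 0 , + 0))) (F₁₂.sq-base n))

    face-odd : ∀ n → proj₂ (to (onFaces (σ₂ ^ (+ 2 ℤ.* n ℤ.+ + 1))) (+ 0 , + 0)) ≈ -[1+ 0 ] ℤ.+ + 8 ℤ.* J ℤ.* n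
    face-odd n = ≈-trans (proj₂ (≈²-trans (Setoid.reflexive ℤ/N² (onFace-power σ₂ (+ 2 ℤ.* n ℤ.+ + 1) (+ 0 , + 0)))
      (≈²-sym (Agree.at (F₁₂.turn-odd n) (+ 0 , + 0))))) (F₁₂.turn-sq-base n)

    order-multiple : ∀ x {n} → Equal R (x ^ n) ε → ∀ k → Equal R (x ^ (k ℤ.* n)) ε
    order-multiple x {n} eq k = Γᴳ.trans (Γᴳ.reflexive (≡.cong (x ^_) (ℤ.*-comm k n)))
      (Γᴳ.trans (Γᴳ.sym (Kit.^-* x n k)) (Γᴳ.trans (Kit.^-cong k eq) (Kit.e^ k)))

    normal-form : ∀ w → ∃₂ λ i k → ∃[ l ] Equal R w (σ₁ ^ i ∙ σ₂ ^ k ∙ σ₃ ^ l)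
    normal-form w = ≡.subst NF.Normal (Γₘ.eval-self w) (NF.normal w)

    power-trivial : ∀ x {z} → Equal R (x ^ (+ 16 ℤ.* J)) ε → z ≈ + 0 → Equal R (x ^ z) ε
    power-trivial x eq (multiple k ≡.refl) = Γᴳ.trans (Γᴳ.reflexive (≡.cong (x ^_) (ℤ.+-identityˡ _))) (order-multiple x eq k)

    double-trivial : ∀ {n} → n ≈ + 0 → Equal R (σ₂ ^ (+ 2 ℤ.* n)) ε
    double-trivial (multiple t ≡.refl) = Γᴳ.trans (Γᴳ.reflexive (≡.cong (σ₂ ^_)
        (solve 2 (λ t j → :con (+ 2) :* (:con (+ 0) :+ t :* (:con (+ 16) :* j)) := t :* (:con (+ 32) :* j)) ≡.refl t J)))
        (order-multiple σ₂ Rel.b^q t)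
      where open +-*-Solver using (solve; _:+_; _:*_; _:=_) renaming (con to :con)

    neg-zero : ∀ {i} → ℤ.- i ≈ + 0 → i ≈ + 0
    neg-zero {i} (multiple t eq) = multiple (ℤ.- t) (≡.trans (≡.sym (ℤ.neg-involutive i)) (≡.trans (≡.cong ℤ.-_ (≡.trans eq (ℤ.+-identityˡ _)))
      (≡.trans (ℤ.neg-distribˡ-* t (+ 16 ℤ.* J)) (≡.sym (ℤ.+-identityˡ _)))))

    private
      -- The exponents are read off one after another. The facet 0 is fixed by σ₁ and σ₂ and moved
      -- to l by σ₃ˡ; the vertex 0 is fixed by σ₂ and moved to -i by σ₁ⁱ; the 2-face (0 , 0) is
      -- moved to (n , 0) by σ₂²ⁿ.
      faithful-normal : ∀ w i k l → Equal R w (σ₁ ^ i ∙ σ₂ ^ k ∙ σ₃ ^ l) → (∀ F → act w F ≈ᶠ F) → Equal R w ε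
      faithful-normal w i k l w≈ trivial-act = go k (parity k) w≈″ base-fixed
        where
        facet-entry : ∀ {x y} → facet x ≈ᶠ facet y → x ≈ y
        facet-entry (facet p) = p
        vertex-entry : ∀ {x y} → vertex x ≈ᶠ vertex y → x ≈ y
        vertex-entry (vertex p) = p
        face-entry : ∀ {x y} → face x ≈ᶠ face y → x ≈² y
        face-entry (face p) = p
        l≈0 : l ≈ + 0
        l≈0 = ≈-trans (≈-sym (≈-trans (to-cong (onFacets (σ₃ ^ l)) (≈-trans (to-cong (onFacets (σ₂ ^ k)) (facet-fixed₁ i)) (facet-fixed₂ k))) (facet-up l)))
          (facet-entry (≈ᶠ-trans (≈ᶠ-sym (act-sound w≈ (facet (+ 0)))) (trivial-act (facet (+ 0)))))
        w≈′ : Equal R w (σ₁ ^ i ∙ σ₂ ^ k)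
        w≈′ = Γᴳ.trans w≈ (Γᴳ.trans (Γᴳ.∙-congˡ (power-trivial σ₃ Rel.cᵖ l≈0)) (Γᴳ.identityʳ _))
        -i≈0 : ℤ.- i ≈ + 0
        -i≈0 = to-injective (onVertices (σ₂ ^ k)) (≈-trans (to-cong (onVertices (σ₂ ^ k)) (≈-sym (vertex-down i)))
          (≈-trans (vertex-entry (≈ᶠ-trans (≈ᶠ-sym (act-sound w≈′ (vertex (+ 0)))) (trivial-act (vertex (+ 0))))) (≈-sym (vertex-fixed₂ k))))
        i≈0 : i ≈ + 0
        i≈0 = neg-zero -i≈0
        w≈″ : Equal R w (σ₂ ^ k)
        w≈″ = Γᴳ.trans w≈′ (Γᴳ.trans (Γᴳ.∙-congʳ (power-trivial σ₁ Rel.aᵖ i≈0)) (Γᴳ.identityˡ _))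
        base-fixed : to (onFaces (σ₂ ^ k)) (+ 0 , + 0) ≈² (+ 0 , + 0)
        base-fixed = face-entry (≈ᶠ-trans (≈ᶠ-sym (act-sound w≈″ (face (+ 0 , + 0)))) (trivial-act (face (+ 0 , + 0))))
        open +-*-Solver using (solve; _:+_; _:*_; _:-_; :-_; _:=_) renaming (con to :con)
        go : ∀ k → Parity k → Equal R w (σ₂ ^ k) → to (onFaces (σ₂ ^ k)) (+ 0 , + 0) ≈² (+ 0 , + 0) → Equal R w ε
        go _ (even n) eq fixed = Γᴳ.trans eq (double-trivial (≈-trans (≈-sym (proj₁ (face-even n))) (proj₁ fixed)))
        -- An odd power of σ₂ sends (0 , 0) to a 2-face with second coordinate -1 + 8Jn, an odd
        -- number and so not 0 modulo 16J.
        go _ (odd n) eq fixed = ⊥-elim (odd≉0 (-[1+ 0 ] ℤ.+ + 4 ℤ.* J ℤ.* n) (≈-trans (≈-reflexive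
            (solve 2 (λ j n → :con (+ 1) :+ :con (+ 2) :* (:con -[1+ 0 ] :+ :con (+ 4) :* j :* n) := :con -[1+ 0 ] :+ :con (+ 8) :* j :* n) ≡.refl J n))
            (≈-trans (≈-sym (face-odd n)) (proj₂ fixed))))

    faithful : ∀ w → (∀ F → act w F ≈ᶠ F) → Equal R w ε
    faithful w = let i , k , l , w≈ = normal-form w in faithful-normal w i k l w≈

-- Finite counting arguments and orders that are powers of 2.

module Counting where

  open import Algebra.Bundles using (Group)
  open import Data.Fin as Fin using (Fin; zero; suc; toℕ; fromℕ<; punchOut; combine; remQuot)
  import Data.Fin.Properties as Fin
  open import Data.Integer as ℤ using (ℤ; +_)
  import Data.Integer.Properties as ℤ
  open import Data.Integer.DivMod using (_/ℕ_; _%ℕ_; a≡a%ℕn+[a/ℕn]*n; n%ℕd<d)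
  open import Data.Integer.Solver using (module +-*-Solver)
  open +-*-Solver using (solve; _:+_; _:*_; _:-_; :-_; con; _:=_)
  open import Data.Nat as ℕ using (ℕ; zero; suc)
  import Data.Nat.Properties as ℕ
  open import Data.Product using (Σ-syntax; ∃; ∃-syntax; _×_; _,_; proj₁; proj₂)
  open import Data.Sum using (_⊎_; inj₁; inj₂)
  open import Level using (0ℓ)
  open import Relation.Binary.PropositionalEquality as ≡ using (_≡_; _≢_)
  open import Relation.Nullary using (¬_; Dec; yes; no; contradiction)
  open GroupKit
  open Collect using (Parity; even; odd; parity)

  -- If f identified a with some other b, the section g could be redirected from a to b and would
  -- embed the set into itself minus a point.
  surjective⇒injective : ∀ {n} (f g : Fin n → Fin n) → (∀ i → f (g i) ≡ i) → ∀ {a b} → f a ≡ f b → a ≡ b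
  surjective⇒injective {suc n} f g fg {a} {b} fa≡fb with a Fin.≟ b
  ... | yes a≡b = a≡b
  ... | no a≢b = contradiction (Fin.injective⇒≤ {f = λ i → punchOut (avoid i)} λ {i} {j} eq →
        h-injective (Fin.punchOut-injective (avoid i) (avoid j) eq)) ℕ.1+n≰n
    where
    swap : ∀ c → Dec (c ≡ a) → Fin (suc n)
    swap c (yes _) = b
    swap c (no _)  = c
    h : Fin (suc n) → Fin (suc n)
    h i = swap (g i) (g i Fin.≟ a)
    avoid-swap : ∀ c d → a ≢ swap c d
    avoid-swap c (yes _)  = a≢b
    avoid-swap c (no c≢a) = λ eq → c≢a (≡.sym eq)
    avoid : ∀ i → a ≢ h i
    avoid i = avoid-swap (g i) (g i Fin.≟ a)
    f-swap : ∀ c d → f (swap c d) ≡ f c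
    f-swap c (yes ≡.refl) = ≡.sym fa≡fb
    f-swap c (no _)       = ≡.refl
    fh : ∀ i → f (h i) ≡ i
    fh i = ≡.trans (f-swap (g i) (g i Fin.≟ a)) (fg i)
    h-injective : ∀ {i j} → h i ≡ h j → i ≡ j
    h-injective {i} {j} eq = ≡.trans (≡.sym (fh i)) (≡.trans (≡.cong f eq) (fh j))

  Box : ℕ → ℕ → ℕ → Set
  Box p q r = Fin 2 × Fin p × Fin q × Fin r

  module _ {p q r : ℕ} where

    box-index : Box p q r → Fin (2 ℕ.* p ℕ.* q ℕ.* r)
    box-index (s , i , k , l) = combine (combine (combine s i) k) l

    private
      attach : Fin 2 × Fin p × Fin q → Fin r → Box p q r
      attach (s , i , k) l = s , i , k , l

      unbox₂ : Fin (2 ℕ.* p) → Fin 2 × Fin p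
      unbox₂ = remQuot p

      unbox₃ : Fin (2 ℕ.* p ℕ.* q) → Fin 2 × Fin p × Fin q
      unbox₃ c = let x , k = remQuot q c ; s , i = unbox₂ x in s , i , k

    unbox : Fin (2 ℕ.* p ℕ.* q ℕ.* r) → Box p q r
    unbox c = let x , l = remQuot {2 ℕ.* p ℕ.* q} r c in attach (unbox₃ x) l

    unbox-box : ∀ b → unbox (box-index b) ≡ b
    unbox-box (s , i , k , l) =
      ≡.trans (≡.cong (λ (x , l) → attach (unbox₃ x) l) (Fin.remQuot-combine (combine (combine s i) k) l))
      (≡.trans (≡.cong (λ (x , k) → attach (proj₁ (unbox₂ x) , proj₂ (unbox₂ x) , k) l) (Fin.remQuot-combine (combine s i) k))
        (≡.cong (λ (s , i) → s , i , k , l) (Fin.remQuot-combine s i)))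

  -- Double negation commutes with a finite conjunction. It supplies a finite table of decisions for
  -- a covered polytope.
  ¬¬-finite : ∀ {n} {P : Fin n → Set} → (∀ i → ¬ ¬ P i) → ¬ ¬ (∀ i → P i)
  ¬¬-finite {zero}  p k = k λ ()
  ¬¬-finite {suc n} p k = p zero λ p₀ → ¬¬-finite (λ i → p (suc i)) λ ps → k λ { zero → p₀ ; (suc i) → ps i }

  module _ (G : Group 0ℓ 0ℓ) where
    open Group G renaming (Carrier to C; _∙_ to _·_; ε to e; _⁻¹ to inv)
    open Powers G

    power-cong : ∀ x {m n} → m ≡ n → x ^ m ≈ x ^ n
    power-cong x eq = reflexive (≡.cong (x ^_) eq)

    power-multiple : ∀ {x d} → x ^ d ≈ e → ∀ k → x ^ (k ℤ.* d) ≈ e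
    power-multiple {x} {d} eq k = trans (power-cong x (ℤ.*-comm k d)) (trans (sym (^-* x d k)) (trans (^-cong k eq) (e^ k)))

    reduce-power : ∀ {x d p} → d ℕ.< p → x ^ (+ suc d) ≈ e → ∀ z → ∃[ n ] x ^ z ≈ x ^ (+ toℕ {p} n)
    reduce-power {x} {d} d<p eq z = fromℕ< r<p , trans (power-cong x (a≡a%ℕn+[a/ℕn]*n z (suc d)))
      (trans (^-+ x _ _) (trans (∙-congˡ (power-multiple eq (z /ℕ suc d))) (trans (identityʳ _)
        (power-cong x (≡.cong +_ (≡.sym (Fin.toℕ-fromℕ< r<p)))))))
      where r<p = ℕ.<-≤-trans (n%ℕd<d z (suc d)) d<p

    -- An odd power that is trivial makes x a power of x².
    order-2^ : ∀ n x a → x ^ ((+ 2) ℤ.^ suc n) ≈ e → x ^ a ≈ e → (∃[ c ] a ≡ c ℤ.* (+ 2) ℤ.^ suc n) ⊎ x ^ ((+ 2) ℤ.^ n) ≈ e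
    order-2^ n x a xⁿ xᵃ = go n (parity a) xⁿ xᵃ
      where
      square : ∀ x {z y} → y ≡ + 2 ℤ.* z → x ^ y ≈ e → (x ^ (+ 2)) ^ z ≈ e
      square x {z} eq p = trans (^-* x (+ 2) z) (trans (power-cong x (≡.sym eq)) p)
      go : ∀ n {a} → Parity a → x ^ ((+ 2) ℤ.^ suc n) ≈ e → x ^ a ≈ e → (∃[ c ] a ≡ c ℤ.* (+ 2) ℤ.^ suc n) ⊎ x ^ ((+ 2) ℤ.^ n) ≈ e
      go zero    (even b) _  _  = inj₁ (b , ℤ.*-comm (+ 2) b)
      go (suc n) (even b) xⁿ xᵃ with order-2^ n (x ^ (+ 2)) b (square x ≡.refl xⁿ) (square x ≡.refl xᵃ)
      ... | inj₁ (c , eq) = inj₁ (c , ≡.trans (≡.cong (+ 2 ℤ.*_) eq)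
              (solve 2 (λ c y → con (+ 2) :* (c :* y) := c :* (con (+ 2) :* y)) ≡.refl c ((+ 2) ℤ.^ suc n)))
      ... | inj₂ q = inj₂ (trans (sym (^-* x (+ 2) ((+ 2) ℤ.^ n))) q)
      go n (odd b) xⁿ xᵃ = inj₂ (trans
        (power-cong x (solve 2 (λ b y → y := (:- b) :* (con (+ 2) :* y) :+ y :* (con (+ 2) :* b :+ con (+ 1))) ≡.refl b ((+ 2) ℤ.^ n)))
        (trans (^-+ x _ _) (trans (∙-cong (power-multiple xⁿ (ℤ.- b)) (power-multiple xᵃ ((+ 2) ℤ.^ n))) (identityˡ e))))

-- Chirality of the model and its automorphism group.

module Chirality where

  open import Algebra.Bundles using (Group)
  open import Data.Empty using (⊥; ⊥-elim)
  open import Data.Fin as Fin using (Fin; suc; toℕ; inject₁)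
  open import Data.Fin.Patterns
  open import Data.Integer as ℤ using (ℤ; +_; -[1+_])
  import Data.Integer.Properties as ℤ
  open import Data.Integer.Solver using (module +-*-Solver)
  open import Data.Nat as ℕ using (ℕ; suc; NonZero)
  open import Data.Product using (Σ-syntax; ∃; ∃-syntax; _,_; proj₁; proj₂)
  open import Data.Sign using (Sign)
  open import Data.Sum using (_⊎_; inj₁; inj₂)
  open import Data.Vec using (Vec; []; _∷_)
  open import Relation.Binary.Bundles using (Setoid)
  open import Relation.Binary.Morphism.Structures using (IsOrderIsomorphism)
  open import Relation.Binary.PropositionalEquality as ≡ using (_≡_; _≢_)
  open import Relation.Nullary using (¬_; Dec; no)
  open import Defs using (Word; gen; ε; _∙_; _⁻¹; σ₁; σ₂; σ₃; Polytope; Automorphism; automorphismGroup; Equal; Chiral; SameOrbit; IsAutomorphismGroupOf; IsStandardRotation; Tight)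
  open GroupKit
  open Presentation
  open Universal
  open Modular
  open Half
  open Facets
  open Incidence
  open Finite
  open Model
  open General
  open Flags
  open Tight
  open Action
  open Symmetry

  module ChiralPolytope (N : ℕ) (J : ℤ) .{{N≢0 : NonZero N}} (N-eq : + N ≡ + 16 ℤ.* J) (s₁ s₂ : Sign)
    (q m : ℕ) (q-eq : + q ≡ + 32 ℤ.* J) (m-eq : + m ≡ + 8 ℤ.* J) where

    open Words N J N-eq s₁ s₂ q m q-eq m-eq public
    open Semantics J using (_≈_; multiple)
    open Congruence J
    open TightPolytope N J N-eq δ₁ δ₂ public
    open Chains polytope public hiding (rank≤5)
    open Automorphisms polytope public
    open Decided _≟ᶠ_ public
    open Γₘ public using (R)

    private
      W : Set
      W = Word (Fin 3)
      module Kit = Powers Γₘ.group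
      module Rel = Relations Γₘ.relations
      module Aut = Group (automorphismGroup polytope)

    open Kit using (_^_; Commute)

    x₀ x₁ x₂ : W
    x₀ = gen 0F
    x₁ = gen 1F
    x₂ = gen 2F

    free : ∀ (u v : W) → reduced u ≡ reduced v → Equal R u v
    free u v eq = ≡.subst₂ (Equal R) (Γₘ.eval-self u) (Γₘ.eval-self v) (Kit.group! u v eq (σ₁ ∷ σ₂ ∷ σ₃ ∷ []))

    act-equal : ∀ {u v} → (∀ F → act u F ≈ᶠ act v F) → Equal R u v
    act-equal {u} {v} eq = begin
      u              ≈⟨ Γᴳ.identityʳ u ⟨
      u ∙ ε          ≈⟨ Γᴳ.∙-congˡ (Γᴳ.inverseˡ v) ⟨
      u ∙ (v ⁻¹ ∙ v) ≈⟨ Γᴳ.assoc u (v ⁻¹) v ⟨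
      u ∙ v ⁻¹ ∙ v   ≈⟨ Γᴳ.∙-congʳ (faithful (u ∙ v ⁻¹) fixes) ⟩
      ε ∙ v          ≈⟨ Γᴳ.identityˡ v ⟩
      v              ∎
      where
      open import Relation.Binary.Reasoning.Setoid Γᴳ.setoid
      fixes : ∀ F → act (u ∙ v ⁻¹) F ≈ᶠ F
      fixes F = act-injective v (≈ᶠ-trans (P.Eq.reflexive (≡.sym (act-∙ (u ∙ v ⁻¹) v F)))
        (≈ᶠ-trans (act-sound (Γᴳ.trans (Γᴳ.assoc u (v ⁻¹) v) (Γᴳ.trans (Γᴳ.∙-congˡ (Γᴳ.inverseˡ v)) (Γᴳ.identityʳ u))) F) (eq F)))

    -- The mirror image of a word with respect to the 1-adjacent flag.
    ρᵍ : Vec W 3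
    ρᵍ = σ₁ ⁻¹ ∷ σ₂ ⁻¹ ∷ σ₂ ∙ σ₂ ∙ σ₃ ∷ []

    ρ : W → W
    ρ w = Kit.⟦ w ⟧ ρᵍ

    ρ-power : ∀ w n → ρ (w ^ n) ≡ ρ w ^ n
    ρ-power w n = ≡.trans (≡.cong ρ (≡.sym (Γₘ.word-^ w n))) (eval-^ Γₘ.group ρᵍ w n)

    σ₂σ₃-involution : Equal R ((σ₂ ∙ σ₃) ⁻¹) (σ₂ ∙ σ₃)
    σ₂σ₃-involution = Γᴳ.sym (inverseˡ-unique (σ₂ ∙ σ₃) (σ₂ ∙ σ₃) Rel.bc²)
      where open import Algebra.Properties.Group Γₘ.group using (inverseˡ-unique)

    ρ-g : ∀ j → Equal R (ρ (g j)) (g j ⁻¹)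
    ρ-g 0F = Γᴳ.refl
    ρ-g 1F = free ε (ε ⁻¹) ≡.refl
    ρ-g 2F = Γᴳ.refl
    ρ-g 3F = Γᴳ.trans (free (σ₂ ⁻¹ ∙ (σ₂ ∙ σ₂ ∙ σ₃)) (σ₂ ∙ σ₃) ≡.refl) (Γᴳ.sym σ₂σ₃-involution)

    -- σᵢ is the product of the reflections of ranks i and i − 1.
    σ-g : ∀ (k : Fin 3) → Equal R (gen k) (g (inject₁ k) ⁻¹ ∙ g (suc k))
    σ-g 0F = free σ₁ ((σ₁ ⁻¹) ⁻¹ ∙ ε) ≡.refl
    σ-g 1F = free σ₂ (ε ⁻¹ ∙ σ₂) ≡.refl
    σ-g 2F = free σ₃ (σ₂ ⁻¹ ∙ (σ₂ ∙ σ₃)) ≡.refl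

    ρσ-g : ∀ (k : Fin 3) → Equal R (ρ (gen k)) (g (inject₁ k) ∙ (g (suc k) ⁻¹ ∙ ε))
    ρσ-g 0F = free (σ₁ ⁻¹) (σ₁ ⁻¹ ∙ (ε ⁻¹ ∙ ε)) ≡.refl
    ρσ-g 1F = free (σ₂ ⁻¹) (ε ∙ (σ₂ ⁻¹ ∙ ε)) ≡.refl
    ρσ-g 2F = Γᴳ.trans (Γᴳ.assoc σ₂ σ₂ σ₃) (Γᴳ.∙-congˡ (Γᴳ.trans (Γᴳ.sym σ₂σ₃-involution) (Γᴳ.sym (Γᴳ.identityʳ _))))

    oddᶜ-ε : oddᶜ ε ≈ᶜ Φ¹
    oddᶜ-ε = agree λ i → P.Eq.reflexive (act-ε (at Φ¹ i))

    move-cong : ∀ α {x y} → x ≈ᶜ y → move α x ≈ᶜ move α y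
    move-cong α = FlagMap.on-cong (moving α)

    module NoMirror (α : Automorphism polytope) (mirror : move α Φ ≈ᶜ Φ¹) where
      open IsOrderIsomorphism (proj₂ α)

      -- A generator is a product of two adjacency moves starting from Φ. As α preserves adjacency
      -- and takes Φ to Φ¹, both sides send Φ to the same flag, and automorphisms are determined by
      -- one flag.
      intertwine-gen : ∀ k F → proj₁ α (act (gen k) F) ≈ᶠ act (ρ (gen k)) (proj₁ α F)
      intertwine-gen k = determined (automorphism (gen k) Aut.∙ α) (α Aut.∙ automorphism (ρ (gen k))) {Φ}
        (≈ᶜ-trans {move (automorphism (gen k) Aut.∙ α) Φ} {move α (evenᶜ (gen k))} (agree λ _ → ≈ᶠ-refl)
        (≈ᶜ-trans (move-cong α (even-cong (σ-g k)))
        (≈ᶜ-trans (adj-unique (adj-cong first ≈ᶜ-refl (FlagMap.on-adj (moving α) (odd-adj (inject₁ k) (g (suc k))))) (even-adj (inject₁ k) (g (suc k) ⁻¹ ∙ ε)))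
        (≈ᶜ-trans (odd-cong (Γᴳ.sym (ρσ-g k)))
        (≈ᶜ-trans {oddᶜ (ρ (gen k))} {move (automorphism (ρ (gen k))) (move α Φ)} (move-cong (automorphism (ρ (gen k))) (≈ᶜ-sym mirror)) (agree λ _ → ≈ᶠ-refl))))))
        where
        first : move α (oddᶜ (g (suc k))) ≈ᶜ evenᶜ (g (suc k) ⁻¹ ∙ ε)
        first = adj-unique (adj-cong mirror ≈ᶜ-refl (FlagMap.on-adj (moving α) (Φ-adj (suc k))))
          (adj-cong oddᶜ-ε ≈ᶜ-refl (odd-adj (suc k) ε))

      intertwine : ∀ w F → proj₁ α (act w F) ≈ᶠ act (ρ w) (proj₁ α F)
      intertwine (gen k) F = intertwine-gen k F
      intertwine ε F = ≈ᶠ-trans (cong (P.Eq.reflexive (act-ε F))) (P.Eq.reflexive (≡.sym (act-ε (proj₁ α F))))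
      intertwine (u ∙ v) F = ≈ᶠ-trans (cong (P.Eq.reflexive (act-∙ u v F))) (≈ᶠ-trans (intertwine v (act u F))
        (≈ᶠ-trans (act-cong (ρ v) (intertwine u F)) (P.Eq.reflexive (≡.sym (act-∙ (ρ u) (ρ v) (proj₁ α F))))))
      intertwine (u ⁻¹) F = act-injective (ρ u) (≈ᶠ-trans (≈ᶠ-sym (intertwine u (act (u ⁻¹) F)))
        (≈ᶠ-trans (cong (≈ᶠ-trans (act-cong u (P.Eq.reflexive (act-⁻¹ u F))) (act-act⁻ u F)))
          (≈ᶠ-sym (≈ᶠ-trans (act-cong (ρ u) (P.Eq.reflexive (act-⁻¹ (ρ u) (proj₁ α F)))) (act-act⁻ (ρ u) (proj₁ α F))))))

      -- Conjugation by α carries the action of a word to that of its mirror image, and equality of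
      -- actions implies equality in Γ₃.
      ρ-sound : ∀ {u v} → Equal R u v → Equal R (ρ u) (ρ v)
      ρ-sound {u} {v} eq = act-equal λ F → let G , αG = surjective F in
        ≈ᶠ-trans (act-cong (ρ u) (≈ᶠ-sym (αG ≈ᶠ-refl))) (≈ᶠ-trans (≈ᶠ-sym (intertwine u G))
          (≈ᶠ-trans (cong (act-sound eq G)) (≈ᶠ-trans (intertwine v G) (act-cong (ρ v) (αG ≈ᶠ-refl)))))

      private
        module C = Consequences Γₘ.relations
        open import Algebra.Properties.Group Γₘ.group using (∙-cancelˡ)
        open +-*-Solver using (solve; _:+_; _:*_; _:-_; :-_; _:=_) renaming (con to :con)
        s = unit s₁

      -- The mirror image of the second relation differs from the first
      -- relation by the central involution σ₂ to the 16J.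
      reflected : Equal R (σ₁ ^ (-[1+ 0 ] ℤ.+ + 8 ℤ.* J) ∙ σ₂ ^ (-[1+ 2 ] ℤ.+ s ℤ.* (+ 8 ℤ.* J)))
                          (σ₁ ^ (-[1+ 0 ] ℤ.+ + 8 ℤ.* J) ∙ σ₂ ^ (ℤ.- (+ 3 ℤ.+ s ℤ.* (+ 8 ℤ.* J))))
      reflected = begin
        σ₁ ^ (-[1+ 0 ] ℤ.+ + 8 ℤ.* J) ∙ σ₂ ^ (-[1+ 2 ] ℤ.+ s ℤ.* (+ 8 ℤ.* J)) ≈⟨ Rel.b⁻¹a ⟨
        σ₂ ⁻¹ ∙ σ₁                                     ≈⟨ free (σ₂ ⁻¹ ∙ σ₁) (σ₂ ⁻¹ ∙ (σ₁ ⁻¹) ⁻¹) ≡.refl ⟩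
        ρ (σ₂ ∙ σ₁ ⁻¹)                                 ≈⟨ ρ-sound Rel.ba⁻¹ ⟩
        ρ (σ₁ ^ (+ 1 ℤ.+ + 8 ℤ.* J)) ∙ ρ (σ₂ ^ (+ 3 ℤ.+ s ℤ.* (+ 8 ℤ.* J))) ≈⟨ Γᴳ.∙-cong (Γᴳ.reflexive (ρ-power σ₁ _)) (Γᴳ.reflexive (ρ-power σ₂ _)) ⟩
        (σ₁ ⁻¹) ^ (+ 1 ℤ.+ + 8 ℤ.* J) ∙ (σ₂ ⁻¹) ^ (+ 3 ℤ.+ s ℤ.* (+ 8 ℤ.* J)) ≈⟨ Γᴳ.∙-cong (C.inv-^ σ₁ _) (C.inv-^ σ₂ _) ⟩
        σ₁ ^ (ℤ.- (+ 1 ℤ.+ + 8 ℤ.* J)) ∙ σ₂ ^ (ℤ.- (+ 3 ℤ.+ s ℤ.* (+ 8 ℤ.* J))) ≈⟨ Γᴳ.∙-congʳ (C.shift σ₁ Rel.aᵖ (ℤ.- (+ 1 ℤ.+ + 8 ℤ.* J))) ⟨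
        σ₁ ^ (ℤ.- (+ 1 ℤ.+ + 8 ℤ.* J) ℤ.+ + 16 ℤ.* J) ∙ σ₂ ^ (ℤ.- (+ 3 ℤ.+ s ℤ.* (+ 8 ℤ.* J)))
          ≈⟨ Γᴳ.∙-congʳ (C.^-≡ σ₁ (solve 1 (λ j → :- (:con (+ 1) :+ :con (+ 8) :* j) :+ :con (+ 16) :* j := :con -[1+ 0 ] :+ :con (+ 8) :* j) ≡.refl J)) ⟩
        σ₁ ^ (-[1+ 0 ] ℤ.+ + 8 ℤ.* J) ∙ σ₂ ^ (ℤ.- (+ 3 ℤ.+ s ℤ.* (+ 8 ℤ.* J))) ∎
        where open import Relation.Binary.Reasoning.Setoid Γᴳ.setoid

      half-turn : Equal R (σ₂ ^ (+ 2 ℤ.* (s ℤ.* (+ 8 ℤ.* J)))) ε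
      half-turn = begin
        σ₂ ^ (+ 2 ℤ.* (s ℤ.* (+ 8 ℤ.* J)))
          ≈⟨ C.^-≡ σ₂ (solve 2 (λ j s → :con (+ 2) :* (s :* (:con (+ 8) :* j)) := (:con (+ 3) :+ s :* (:con (+ 8) :* j)) :+ (:con -[1+ 2 ] :+ s :* (:con (+ 8) :* j))) ≡.refl J s) ⟩
        σ₂ ^ ((+ 3 ℤ.+ s ℤ.* (+ 8 ℤ.* J)) ℤ.+ (-[1+ 2 ] ℤ.+ s ℤ.* (+ 8 ℤ.* J))) ≈⟨ Kit.^-+ σ₂ (+ 3 ℤ.+ s ℤ.* (+ 8 ℤ.* J)) (-[1+ 2 ] ℤ.+ s ℤ.* (+ 8 ℤ.* J)) ⟩
        σ₂ ^ (+ 3 ℤ.+ s ℤ.* (+ 8 ℤ.* J)) ∙ σ₂ ^ (-[1+ 2 ] ℤ.+ s ℤ.* (+ 8 ℤ.* J)) ≈⟨ Γᴳ.∙-congˡ (∙-cancelˡ _ _ _ reflected) ⟩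
        σ₂ ^ (+ 3 ℤ.+ s ℤ.* (+ 8 ℤ.* J)) ∙ σ₂ ^ (ℤ.- (+ 3 ℤ.+ s ℤ.* (+ 8 ℤ.* J))) ≈⟨ Γᴳ.∙-congˡ (Kit.^-neg σ₂ (+ 3 ℤ.+ s ℤ.* (+ 8 ℤ.* J))) ⟩
        σ₂ ^ (+ 3 ℤ.+ s ℤ.* (+ 8 ℤ.* J)) ∙ (σ₂ ^ (+ 3 ℤ.+ s ℤ.* (+ 8 ℤ.* J))) ⁻¹ ≈⟨ Γᴳ.inverseʳ _ ⟩
        ε ∎
        where open import Relation.Binary.Reasoning.Setoid Γᴳ.setoid

      impossible : ⊥
      -- The element σ₂^(16Jε) sends the 2-face (0 , 0) to (8Jε , 0), and 8Jε is no multiple of 16J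
      -- since ε is odd.
      impossible = half-odd s₁ (face-first (act-sound half-turn (face (+ 0 , + 0))))
        where
        face-first : ∀ {x} → face (Permutation.to (onFaces (σ₂ ^ (+ 2 ℤ.* x))) (+ 0 , + 0)) ≈ᶠ face (+ 0 , + 0) → x ≈ + 0
        face-first {x} (face p) = ≈-trans (≈-sym (proj₁ (face-even x))) (proj₁ p)
        half-odd : ∀ s → ¬ (unit s ℤ.* (+ 8 ℤ.* J) ≈ + 0)
        half-odd s (multiple t eq) = 2n≢1 (t ℤ.- half-unit s) (ℤ.*-cancelˡ-≡ (+ 8 ℤ.* J) _ _ {{8J≢0}} (begin
          + 8 ℤ.* J ℤ.* (+ 2 ℤ.* (t ℤ.- half-unit s))                              ≡⟨ solve 3 (λ j t d → :con (+ 8) :* j :* (:con (+ 2) :* (t :- d))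
                                                                                 := :con (+ 0) :+ t :* (:con (+ 16) :* j) :- :con (+ 2) :* d :* (:con (+ 8) :* j)) ≡.refl J t (half-unit s) ⟩
          + 0 ℤ.+ t ℤ.* (+ 16 ℤ.* J) ℤ.- + 2 ℤ.* half-unit s ℤ.* (+ 8 ℤ.* J)        ≡⟨ ≡.cong (λ x → x ℤ.- + 2 ℤ.* half-unit s ℤ.* (+ 8 ℤ.* J)) eq ⟨
          unit s ℤ.* (+ 8 ℤ.* J) ℤ.- + 2 ℤ.* half-unit s ℤ.* (+ 8 ℤ.* J)            ≡⟨ ≡.cong (λ u → u ℤ.* (+ 8 ℤ.* J) ℤ.- + 2 ℤ.* half-unit s ℤ.* (+ 8 ℤ.* J)) (unit-half s) ⟨
          (+ 1 ℤ.+ + 2 ℤ.* half-unit s) ℤ.* (+ 8 ℤ.* J) ℤ.- + 2 ℤ.* half-unit s ℤ.* (+ 8 ℤ.* J) ≡⟨ solve 2 (λ j d → (:con (+ 1) :+ :con (+ 2) :* d) :* (:con (+ 8) :* j) :- :con (+ 2) :* d :* (:con (+ 8) :* j)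
                                                                                 := :con (+ 8) :* j :* :con (+ 1)) ≡.refl J (half-unit s) ⟩
          + 8 ℤ.* J ℤ.* + 1                                                        ∎))
          where
          open ≡.≡-Reasoning
          8J≢0 : ℤ.NonZero (+ 8 ℤ.* J)
          8J≢0 = ℤ.≢-nonZero λ eq → J≢0 (ℤ.*-cancelˡ-≡ (+ 8) J (+ 0) eq)

    even≁odd : ∀ (α : Automorphism polytope) {u v} → ¬ (move α (evenᶜ u) ≈ᶜ oddᶜ v)
    even≁odd α {u} {v} p = NoMirror.impossible β
      (≈ᶜ-trans {move β Φ} {move (automorphism (v ⁻¹)) (move α (evenᶜ u))} (agree λ _ → ≈ᶠ-refl)
      (≈ᶜ-trans (move-cong (automorphism (v ⁻¹)) p) (≈ᶜ-trans (odd-∙ v (v ⁻¹)) (≈ᶜ-trans (odd-cong (Γᴳ.inverseʳ v)) oddᶜ-ε))))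
      where β = automorphism u Aut.∙ α Aut.∙ automorphism (v ⁻¹)

    odd≁even : ∀ (α : Automorphism polytope) {u v} → ¬ (move α (oddᶜ u) ≈ᶜ evenᶜ v)
    odd≁even α {u} {v} p = even≁odd (α Aut.⁻¹) {v} {u} (≈ᶜ-trans (move-cong (α Aut.⁻¹) (≈ᶜ-sym p))
      (agree λ i → Aut.inverseʳ α (at (oddᶜ u) i)))

    move-toFlag : ∀ α x → move α (toChain (toFlag x)) ≈ᶜ move α x
    move-toFlag α x = move-cong α (toChain-toFlag x)

    chiral : Chiral polytope
    chiral = record
      { two-orbits = toFlag Φ , toFlag Φ¹ , distinct , λ Λ → classify Λ (orbit (toChain Λ))
      ; adjacent-distinct = λ Ψ Λ n adjacent (α , sends) → let j , _ , s = toAdj (toChain Ψ) (toChain Λ)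
                                                                  (≡.subst₂ (P.Adjacent n) (toChain-list Ψ) (toChain-list Λ) adjacent)
                            in apart Ψ Λ j s α (sends⇒ {α} {Ψ} {Λ} sends) (orbit (toChain Ψ))
      }
      where
      distinct : ¬ SameOrbit polytope (toFlag Φ) (toFlag Φ¹)
      distinct (α , sends) = NoMirror.impossible α (≈ᶜ-trans (≈ᶜ-sym (move-toFlag α Φ))
        (≈ᶜ-trans (sends⇒ {α} {toFlag Φ} {toFlag Φ¹} sends) (toChain-toFlag Φ¹)))
      classify : ∀ Λ → ∃[ w ] (evenᶜ w ≈ᶜ toChain Λ ⊎ oddᶜ w ≈ᶜ toChain Λ) → SameOrbit polytope (toFlag Φ) Λ ⊎ SameOrbit polytope (toFlag Φ¹) Λ
      classify Λ (w , inj₁ p) = inj₁ (automorphism w , ⇒sends {automorphism w} {toFlag Φ} {Λ} (≈ᶜ-trans (move-toFlag (automorphism w) Φ) p))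
      classify Λ (w , inj₂ p) = inj₂ (automorphism w , ⇒sends {automorphism w} {toFlag Φ¹} {Λ} (≈ᶜ-trans (move-toFlag (automorphism w) Φ¹) p))
      apart : ∀ Ψ Λ j → Adj j (toChain Ψ) (toChain Λ) → ∀ α → move α (toChain Ψ) ≈ᶜ toChain Λ →
              ¬ (∃[ w ] (evenᶜ w ≈ᶜ toChain Ψ ⊎ oddᶜ w ≈ᶜ toChain Ψ))
      apart Ψ Λ j s α p (w , inj₁ r) = even≁odd α {w} {g j ∙ w} (≈ᶜ-trans (move-cong α r) (≈ᶜ-trans p
        (adj-unique s (adj-cong r ≈ᶜ-refl (even-adj j w)))))
      apart Ψ Λ j s α p (w , inj₂ r) = odd≁even α {w} {g j ⁻¹ ∙ w} (≈ᶜ-trans (move-cong α r) (≈ᶜ-trans p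
        (adj-unique s (adj-cong r ≈ᶜ-refl (odd-adj j w)))))

    -- Injectivity is faithfulness. For surjectivity, any automorphism takes Φ to an even flag by
    -- `even≁odd`, and the word of that flag agrees with it on Φ.
    isAutomorphismGroup : IsAutomorphismGroupOf Γₘ.group gen polytope
    isAutomorphismGroup = toFlag Φ , automorphism , record
        { isGroupMonomorphism = record
          { isGroupHomomorphism = record
            { isMonoidHomomorphism = record
              { isMagmaHomomorphism = record
                { isRelHomomorphism = record { cong = act-sound }
                ; homo = λ u v F → P.Eq.reflexive (act-∙ u v F)
                }
              ; ε-homo = λ F → P.Eq.reflexive (act-ε F)
              }
            ; ⁻¹-homo = λ u F → P.Eq.reflexive (act-⁻¹ u F)
            }
          ; injective = act-equal
          }
        ; surjective = λ α → realise α (orbit (move α Φ))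
        } , rotation
      where
      realise : ∀ α → ∃[ w ] (evenᶜ w ≈ᶜ move α Φ ⊎ oddᶜ w ≈ᶜ move α Φ) →
                ∃[ w ] (∀ {z} → Equal R z w → ∀ F → act z F ≈ᶠ proj₁ α F)
      realise α (w , inj₁ p) = w , λ eq F → ≈ᶠ-trans (act-sound eq F) (determined (automorphism w) α {Φ} p F)
      realise α (w , inj₂ p) = ⊥-elim (even≁odd α {ε} {w} (≈ᶜ-trans (move-cong α {evenᶜ ε} {Φ} (agree λ i → P.Eq.reflexive (act-ε (at Φ i)))) (≈ᶜ-sym p)))
      rotation : ∀ k → IsStandardRotation polytope (toFlag Φ) (suc (toℕ k)) (automorphism (gen k))
      rotation k = toFlag (oddᶜ (g (suc k))) , toFlag (evenᶜ (g (inject₁ k) ⁻¹ ∙ g (suc k)))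
        , fromAdj {suc k} {Φ} {oddᶜ (g (suc k))} (Φ-adj (suc k))
        , ≡.subst (λ n → P.Adjacent n (list (oddᶜ (g (suc k)))) (list (evenᶜ (g (inject₁ k) ⁻¹ ∙ g (suc k))))) (Fin.toℕ-inject₁ k)
            (fromAdj {inject₁ k} {oddᶜ (g (suc k))} {evenᶜ (g (inject₁ k) ⁻¹ ∙ g (suc k))} (odd-adj (inject₁ k) (g (suc k))))
        , ⇒sends {automorphism (gen k)} {toFlag Φ} {toFlag (evenᶜ (g (inject₁ k) ⁻¹ ∙ g (suc k)))}
            (≈ᶜ-trans (move-toFlag (automorphism (gen k)) Φ) (≈ᶜ-trans (even-cong (σ-g k)) (≈ᶜ-sym (toChain-toFlag (evenᶜ (g (inject₁ k) ⁻¹ ∙ g (suc k)))))))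
        where import Data.Fin.Properties as Fin

    tight : Tight polytope
    tight = N , 2 ℕ.* N , N , hasType , flag-count

-- The rotation group of a chiral polytope covered by the model.

module Quotient where

  open import Algebra.Bundles using (Group)
  open import Data.Empty using (⊥; ⊥-elim)
  open import Data.Fin as Fin using (Fin; suc; toℕ; inject₁)
  open import Data.Fin.Patterns
  import Data.Fin.Properties as Fin
  open import Data.Integer as ℤ using (ℤ; +_)
  import Data.Integer.Properties as ℤ
  open import Data.List.Properties using (map-tabulate)
  open import Data.Nat as ℕ using (ℕ; suc; NonZero)
  import Data.Nat.Properties as ℕ
  open import Data.Product using (Σ-syntax; ∃; ∃-syntax; _,_; proj₁; proj₂)
  open import Data.Sign using (Sign)
  open import Data.Sum using (_⊎_; inj₁; inj₂)
  open import Data.Vec using (Vec; []; _∷_)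
  open import Relation.Binary.Definitions using (Decidable)
  open import Relation.Binary.Morphism.Structures using (IsOrderHomomorphism; IsOrderIsomorphism)
  open import Relation.Binary.PropositionalEquality as ≡ using (_≡_; _≢_)
  open import Relation.Nullary using (¬_; Dec; no)
  open import Defs using (Word; gen; ε; _∙_; _⁻¹; σ₁; σ₂; σ₃; Polytope; Automorphism; automorphismGroup; Equal; Chiral; IsCovering)
  open GroupKit
  open Presentation
  open Universal
  open Finite
  open General
  open Periods
  open Counting
  open Chirality

  module Quotients (N : ℕ) (J : ℤ) .{{N≢0 : NonZero N}} (N-eq : + N ≡ + 16 ℤ.* J) (s₁ s₂ : Sign)
    (q m : ℕ) (q-eq : + q ≡ + 32 ℤ.* J) (m-eq : + m ≡ + 8 ℤ.* J) where

    open ChiralPolytope N J N-eq s₁ s₂ q m q-eq m-eq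

    private
      W : Set
      W = Word (Fin 3)
      module Kit = Powers Γₘ.group
      module Rel = Relations Γₘ.relations

    module Covered (Q : Polytope 4) (Q-chiral : Chiral Q) (γ : Face → Polytope.Face Q) (covering : IsCovering polytope Q γ)
      (_≟_ : Decidable (Polytope._≈_ Q)) where

      private
        module QC = Chains Q
        module Q where
          open Polytope Q public
          open QC public
          open QC.Decided _≟_ public
          open Automorphisms Q public
          open Rotations Q _≟_ Q-chiral public
      module A = Group (automorphismGroup Q)
      module AP = Powers (automorphismGroup Q)

      open IsCovering covering
      open IsOrderHomomorphism isOrderHomomorphism

      image : Chain → Q.Chain
      image x = record
        { at = λ i → γ (at x i)
        ; rank-at = λ i → ≡.trans (preserves-rank (at x i)) (rank-at x i)
        ; ascend = λ i → mono (ascend x i)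
        }

      projection : FlagMap polytope Q
      projection = record
        { on = image
        ; on-cong = λ p → Q.agree λ i → cong (p on i)
        ; on-adj = λ {j} {x} {y} a → let j′ , j′≡ , s = Q.toAdj (image x) (image y)
                                           (≡.subst₂ (Q.Adjacent (toℕ j)) (map-tabulate (at x) γ) (map-tabulate (at y) γ)
                                             (preserves-adjacency (toFlag x) (toFlag y) (toℕ j) (fromAdj {j} {x} {y} a)))
                                     in ≡.subst (λ j → Q.Adj j (image x) (image y)) (Fin.toℕ-injective j′≡) s
        }

      open FlagMap projection using () renaming (on-cong to image-cong; on-adj to image-adj)

      preimage : ∀ F → ∃[ G ] γ G Q.≈ F
      preimage F = let G , γG = surjective F in G , γG P.Eq.refl

      preimage-rank : ∀ F → P.rank+1 (proj₁ (preimage F)) ≡ Q.rank+1 F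
      preimage-rank F = ≡.trans (≡.sym (preserves-rank (proj₁ (preimage F)))) (Q.rank+1-cong (proj₂ (preimage F)))

      P-flat : Flat polytope
      P-flat = record { through = through-face ; far = far }

      Q-flat : Flat Q
      Q-flat = record
        { through = λ F → let G , γG = preimage F ; x , i , at≈ = through-face G in image x , i , Q.Eq.trans (cong at≈) γG
        ; far = λ {F} {G} le → Q.≤-trans (Q.≤-reflexive (Q.Eq.sym (proj₂ (preimage F)))) (Q.≤-trans
                  (mono (far (≡.subst₂ (λ m n → 2 ℕ.+ m ℕ.≤ n) (≡.sym (preimage-rank F)) (≡.sym (preimage-rank G)) le)))
                  (Q.≤-reflexive (proj₂ (preimage G))))
        }

      module Rigid = Rigidity Q _≟_ (Flat.through Q-flat)

      _then_ : ∀ {A B C : Polytope 4} → FlagMap A B → FlagMap B C → FlagMap A C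
      f then h = record
        { on = λ x → FlagMap.on h (FlagMap.on f x)
        ; on-cong = λ p → FlagMap.on-cong h (FlagMap.on-cong f p)
        ; on-adj = λ a → FlagMap.on-adj h (FlagMap.on-adj f a)
        }

      Ψ Ψ¹ : W → Q.Chain
      Ψ w  = image (evenᶜ w)
      Ψ¹ w = image (oddᶜ w)

      Ψ-adj : ∀ j w → Q.Adj j (Ψ w) (Ψ¹ (g j ∙ w))
      Ψ-adj j w = image-adj (even-adj j w)

      Ψ¹-adj : ∀ j w → Q.Adj j (Ψ¹ w) (Ψ (g j ⁻¹ ∙ w))
      Ψ¹-adj j w = image-adj (odd-adj j w)

      private
        opaque
          -- The rotations of Q come from the chirality of Q. That an automorphism of the covering
          -- polytope induces one on Q is not known beforehand; it follows for words once these
          -- rotations exist.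
          rotated : ∀ k → ∃[ α ] Q.move α (image Φ) Q.≈ᶜ Ψ (g (inject₁ k) ⁻¹ ∙ g (suc k))
          rotated k = Q.rotation (image-adj (Φ-adj (suc k))) (Ψ¹-adj (inject₁ k) (g (suc k)))

      α : Fin 3 → Automorphism Q
      α k = proj₁ (rotated k)

      α-base : ∀ k → Q.move (α k) (image Φ) Q.≈ᶜ Ψ (gen k)
      α-base k = Q.≈ᶜ-trans (proj₂ (rotated k)) (image-cong (even-cong (Γᴳ.sym (σ-g k))))

      α-fixed : ∀ k i → i ≢ position (inject₁ k) → i ≢ position (suc k) → proj₁ (α k) (Q.at (image Φ) i) Q.≈ Q.at (image Φ) i
      α-fixed k i ne ne′ = Q.Eq.trans (proj₂ (rotated k) Q.on i) (Q.Eq.sym (Q.Eq.trans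
        (Q.same (image-adj (Φ-adj (suc k))) i ne′) (Q.same (Ψ¹-adj (inject₁ k) (g (suc k))) i ne)))

      αs : Vec (Automorphism Q) 3
      αs = α 0F ∷ α 1F ∷ α 2F ∷ []

      τ : W → Automorphism Q
      τ w = AP.⟦ w ⟧ αs

      private
        -- Both composites are flag maps with the same value at Φ, so they agree everywhere.
        equivariant-gen : ∀ k y → Q.move (α k) (image y) Q.≈ᶜ image (move (automorphism (gen k)) y)
        equivariant-gen k = agreement _≟ᶠ_ (projection then Q.moving (α k)) (words (gen k) then projection) {Φ} (α-base k)

      equivariant : ∀ w y → Q.move (τ w) (image y) Q.≈ᶜ image (move (automorphism w) y)
      equivariant (gen 0F) y = equivariant-gen 0F y
      equivariant (gen 1F) y = equivariant-gen 1F y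
      equivariant (gen 2F) y = equivariant-gen 2F y
      equivariant ε y = Q.agree λ i → cong (P.Eq.reflexive (≡.sym (act-ε (at y i))))
      equivariant (u ∙ v) y = Q.agree λ i → Q.Eq.trans (IsOrderIsomorphism.cong (proj₂ (τ v)) (equivariant u y Q.on i))
        (Q.Eq.trans (equivariant v (move (automorphism u) y) Q.on i) (cong (P.Eq.reflexive (≡.sym (act-∙ u v (at y i))))))
      equivariant (u ⁻¹) y = Q.agree λ i → IsOrderIsomorphism.injective (proj₂ (τ u)) (Q.Eq.trans (A.inverseˡ (τ u) (γ (at y i)))
        (Q.Eq.sym (Q.Eq.trans (equivariant u (move (automorphism (u ⁻¹)) y) Q.on i)
          (cong (≈ᶠ-trans (act-cong u (P.Eq.reflexive (act-⁻¹ u (at y i)))) (act-act⁻ u (at y i)))))))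

      even-same : ∀ {u v} → Ψ u Q.≈ᶜ Ψ v → τ u A.≈ τ v
      even-same {u} {v} p = Rigid.determined (τ u) (τ v) {image Φ} (Q.≈ᶜ-trans (equivariant u Φ) (Q.≈ᶜ-trans p (Q.≈ᶜ-sym (equivariant v Φ))))

      odd-same : ∀ {u v} → Ψ¹ u Q.≈ᶜ Ψ¹ v → τ u A.≈ τ v
      odd-same {u} {v} p = Rigid.determined (τ u) (τ v) {image Φ¹} (Q.≈ᶜ-trans (equivariant u Φ¹) (Q.≈ᶜ-trans p (Q.≈ᶜ-sym (equivariant v Φ¹))))

      same-even : ∀ {u v} → τ u A.≈ τ v → Ψ u Q.≈ᶜ Ψ v
      same-even {u} {v} p = Q.≈ᶜ-trans (Q.≈ᶜ-sym (equivariant u Φ)) (Q.≈ᶜ-trans {y = Q.move (τ v) (image Φ)} (Q.agree λ i → p (γ (at Φ i))) (equivariant v Φ))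

      same-odd : ∀ {u v} → τ u A.≈ τ v → Ψ¹ u Q.≈ᶜ Ψ¹ v
      same-odd {u} {v} p = Q.≈ᶜ-trans (Q.≈ᶜ-sym (equivariant u Φ¹)) (Q.≈ᶜ-trans {y = Q.move (τ v) (image Φ¹)} (Q.agree λ i → p (γ (at Φ¹ i))) (equivariant v Φ¹))

      τ-sound : ∀ {u v} → Equal R u v → τ u A.≈ τ v
      τ-sound {u} {v} eq = even-same {u} {v} (image-cong (even-cong eq))

      τ-power : ∀ w n → τ (w Kit.^ n) ≡ τ w AP.^ n
      τ-power w n = ≡.trans (≡.cong τ (≡.sym (Γₘ.word-^ w n))) (eval-^ (automorphismGroup Q) αs w n)

      base-adj : Q.Adj 1F (image Φ) (image Φ¹)
      base-adj = image-adj (adj-cong ≈ᶜ-refl oddᶜ-ε (Φ-adj 1F))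

      -- Equality would give an automorphism of Q taking the image of Φ to that of Φ¹, an adjacent
      -- flag.
      parity : ∀ {u v} → ¬ (Ψ u Q.≈ᶜ Ψ¹ v)
      parity {u} {v} p = Q.apart base-adj (τ u A.∙ (τ v) A.⁻¹) (Q.agree λ i → Q.Eq.trans
        (IsOrderIsomorphism.cong (proj₂ ((τ v) A.⁻¹)) (Q.Eq.trans (equivariant u Φ Q.on i) (Q.Eq.trans (p Q.on i) (Q.Eq.sym (equivariant v Φ¹ Q.on i)))))
        (A.inverseʳ (τ v) (γ (at Φ¹ i))))

      relations : Relations (automorphismGroup Q) J (unit s₁) (unit s₂) (α 0F) (α 1F) (α 2F)
      relations = record
        { aᵖ = single σ₁ Rel.aᵖ ; b^q = single σ₂ Rel.b^q ; cᵖ = single σ₃ Rel.cᵖ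
        ; ab² = τ-sound Rel.ab² ; bc² = τ-sound Rel.bc² ; abc² = τ-sound Rel.abc²
        ; b⁻¹a = double σ₁ σ₂ Rel.b⁻¹a ; ba⁻¹ = double σ₁ σ₂ Rel.ba⁻¹ ; c⁻¹b = double σ₂ σ₃ Rel.c⁻¹b ; cb⁻¹ = double σ₂ σ₃ Rel.cb⁻¹
        }
        where
        single : ∀ w {n} → Equal R (w Kit.^ n) ε → τ w AP.^ n A.≈ A.ε
        single w {n} eq = ≡.subst (A._≈ A.ε) (τ-power w n) (τ-sound eq)
        double : ∀ u v {w m n} → Equal R w (u Kit.^ m ∙ v Kit.^ n) → τ w A.≈ τ u AP.^ m A.∙ τ v AP.^ n
        double u v {w} {m} {n} eq = ≡.subst₂ (λ α β → τ w A.≈ α A.∙ β) (τ-power u m) (τ-power v n) (τ-sound eq)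

      Lift : Q.Chain → Set
      Lift y = ∃[ w ] (Ψ w Q.≈ᶜ y ⊎ Ψ¹ w Q.≈ᶜ y)

      opaque
        lift : ∀ y → Lift y
        lift y = go (Q.path (image Φ) y) ε (inj₁ (image-cong (agree λ i → P.Eq.reflexive (act-ε (at Φ i)))))
          where
          go : ∀ {a} → Q.Path (image Φ) y a → ∀ w → Ψ w Q.≈ᶜ a ⊎ Ψ¹ w Q.≈ᶜ a → Lift y
          go (Q.done eq) w (inj₁ p) = w , inj₁ (Q.≈ᶜ-trans p eq)
          go (Q.done eq) w (inj₂ p) = w , inj₂ (Q.≈ᶜ-trans p eq)
          go (Q.step j s _ rest) w (inj₁ p) = go rest (g j ∙ w) (inj₂ (Q.adj-unique (Ψ-adj j w) (Q.adj-cong (Q.≈ᶜ-sym p) Q.≈ᶜ-refl s)))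
          go (Q.step j s _ rest) w (inj₂ p) = go rest (g j ⁻¹ ∙ w) (inj₁ (Q.adj-unique (Ψ¹-adj j w) (Q.adj-cong (Q.≈ᶜ-sym p) Q.≈ᶜ-refl s)))

      module _ (T : Polytope 4) where

        private module T = Chains T

        -- Flags of Q are images of even or odd flags, and `parity` keeps the two kinds apart, so
        -- functions of the word that factor through `τ` define a map on them. It is used for the
        -- inverse of the covering and for the mirror automorphism.
        module Descend (E O : W → T.Chain)
          (E-cong : ∀ {u v} → τ u A.≈ τ v → E u T.≈ᶜ E v) (O-cong : ∀ {u v} → τ u A.≈ τ v → O u T.≈ᶜ O v)
          (E-adj : ∀ j w → T.Adj j (E w) (O (g j ∙ w))) (O-adj : ∀ j w → T.Adj j (O w) (E (g j ⁻¹ ∙ w))) where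

          private
            pick : ∀ {y} → Lift y → T.Chain
            pick (w , inj₁ _) = E w
            pick (w , inj₂ _) = O w

            pick-cong : ∀ {y z} (p : Lift y) (q : Lift z) → y Q.≈ᶜ z → pick p T.≈ᶜ pick q
            pick-cong (u , inj₁ p) (v , inj₁ r) eq = E-cong (even-same {u} {v} (Q.≈ᶜ-trans p (Q.≈ᶜ-trans eq (Q.≈ᶜ-sym r))))
            pick-cong (u , inj₂ p) (v , inj₂ r) eq = O-cong (odd-same {u} {v} (Q.≈ᶜ-trans p (Q.≈ᶜ-trans eq (Q.≈ᶜ-sym r))))
            pick-cong (u , inj₁ p) (v , inj₂ r) eq = ⊥-elim (parity {u} {v} (Q.≈ᶜ-trans p (Q.≈ᶜ-trans eq (Q.≈ᶜ-sym r))))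
            pick-cong (u , inj₂ p) (v , inj₁ r) eq = ⊥-elim (parity {v} {u} (Q.≈ᶜ-sym (Q.≈ᶜ-trans p (Q.≈ᶜ-trans eq (Q.≈ᶜ-sym r)))))

            pick-adj : ∀ {j y z} → Q.Adj j y z → (p : Lift y) (q : Lift z) → T.Adj j (pick p) (pick q)
            pick-adj {j} {y} {z} s (u , inj₁ p) r = T.adj-cong T.≈ᶜ-refl (pick-cong {z} {z}
              (g j ∙ u , inj₂ (Q.adj-unique (Ψ-adj j u) (Q.adj-cong (Q.≈ᶜ-sym p) Q.≈ᶜ-refl s))) r Q.≈ᶜ-refl) (E-adj j u)
            pick-adj {j} {y} {z} s (u , inj₂ p) r = T.adj-cong T.≈ᶜ-refl (pick-cong {z} {z}
              (g j ⁻¹ ∙ u , inj₁ (Q.adj-unique (Ψ¹-adj j u) (Q.adj-cong (Q.≈ᶜ-sym p) Q.≈ᶜ-refl s))) r Q.≈ᶜ-refl) (O-adj j u)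

          descend : FlagMap Q T
          descend = record
            { on = λ y → pick (lift y)
            ; on-cong = λ {y} {z} → pick-cong (lift y) (lift z)
            ; on-adj = λ {j} {y} {z} s → pick-adj s (lift y) (lift z)
            }

          descend-even : ∀ {y} w → Ψ w Q.≈ᶜ y → FlagMap.on descend y T.≈ᶜ E w
          descend-even {y} w p = pick-cong {y} {y} (lift y) (w , inj₁ p) Q.≈ᶜ-refl

          descend-odd : ∀ {y} w → Ψ¹ w Q.≈ᶜ y → FlagMap.on descend y T.≈ᶜ O w
          descend-odd {y} w p = pick-cong {y} {y} (lift y) (w , inj₂ p) Q.≈ᶜ-refl

-- A tight chiral quotient is isomorphic to the model.

module Atomic where

  open import Algebra.Bundles using (Group)
  open import Data.Empty using (⊥; ⊥-elim)
  open import Data.Fin as Fin using (Fin; zero; suc; toℕ)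
  open import Data.Fin.Patterns
  import Data.Fin.Properties as Fin
  open import Data.Integer as ℤ using (ℤ; +_)
  import Data.Integer.Properties as ℤ
  open import Data.Integer.Solver using (module +-*-Solver)
  open import Data.Nat as ℕ using (ℕ; zero; suc; NonZero)
  import Data.Nat.Properties as ℕ
  open import Data.Product using (Σ-syntax; ∃; ∃-syntax; ∃₂; _×_; _,_; proj₁; proj₂)
  open import Data.Sign using (Sign)
  open import Data.Sum using (_⊎_; inj₁; inj₂)
  open import Data.Vec using (Vec; []; _∷_)
  open import Function.Bundles using (Inverse)
  open import Relation.Binary.Definitions using (Decidable)
  open import Relation.Binary.PropositionalEquality as ≡ using (_≡_; _≢_)
  open import Relation.Nullary using (¬_; Dec; no)
  open import Defs using (Word; gen; ε; _∙_; _⁻¹; σ₁; σ₂; σ₃; Polytope; Automorphism; automorphismGroup; Equal; Chiral; Tight; HasType; HasSize; SectionsArePolygons; IsCovering; Isomorphic)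
  open GroupKit
  open Presentation
  open Universal
  open Finite
  open General
  open Periods
  open Counting
  open Chirality
  open Quotient

  module Uncoverable (N : ℕ) (J : ℤ) .{{N≢0 : NonZero N}} (N-eq : + N ≡ + 16 ℤ.* J) (s₁ s₂ : Sign)
    (q m : ℕ) (q-eq : + q ≡ + 32 ℤ.* J) (m-eq : + m ≡ + 8 ℤ.* J) (t : ℕ) (J-eq : J ≡ (+ 2) ℤ.^ t) where

    open ChiralPolytope N J N-eq s₁ s₂ q m q-eq m-eq
    open Quotients N J N-eq s₁ s₂ q m q-eq m-eq

    private
      W : Set
      W = Word (Fin 3)
      module Kit = Powers Γₘ.group
      module Rel = Relations Γₘ.relations

    open Kit using (_^_)

    module TightQuotient (Q : Polytope 4) (Q-chiral : Chiral Q) (γ : Face → Polytope.Face Q) (covering : IsCovering polytope Q γ)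
      (_≟_ : Decidable (Polytope._≈_ Q)) {p₁ p₂ p₃ : ℕ} (hasType : HasType Q p₁ p₂ p₃)
      (count : HasSize (Polytope.flagSetoid Q) (2 ℕ.* p₁ ℕ.* p₂ ℕ.* p₃)) where

      private
        module QC = Chains Q
        module Q where
          open Polytope Q public
          open QC public
          open QC.Decided _≟_ public
          open Automorphisms Q public
          open Rotations Q _≟_ Q-chiral public
      open Covered Q Q-chiral γ covering _≟_

      opaque
        -- The order of each rotation of Q is at most the size of its polygon, so exponents may be
        -- taken below that size.
        reduce : ∀ k {p} → SectionsArePolygons Q (suc (toℕ k)) p → ∀ z → ∃[ n ] α k AP.^ z A.≈ α k AP.^ (+ toℕ {p} n)
        reduce k polygons = let _ , d<p , eq = Rigid.Period.period Q-chiral k (image Φ) (α k) (α-fixed k) polygons in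
          reduce-power (automorphismGroup Q) {α k} d<p eq

      half-orbit : Fin 2 → W → Q.Chain
      half-orbit 0F = Ψ
      half-orbit 1F = Ψ¹

      normal-word : Fin p₁ → Fin p₂ → Fin p₃ → W
      normal-word i k l = σ₁ ^ (+ toℕ i) ∙ σ₂ ^ (+ toℕ k) ∙ σ₃ ^ (+ toℕ l)

      boxed : Box p₁ p₂ p₃ → Q.Chain
      boxed (s , i , k , l) = half-orbit s (normal-word i k l)

      τ-triple : ∀ i k l → τ (σ₁ ^ i ∙ σ₂ ^ k ∙ σ₃ ^ l) ≡ α 0F AP.^ i A.∙ α 1F AP.^ k A.∙ α 2F AP.^ l
      τ-triple i k l = ≡.cong₂ A._∙_ (≡.cong₂ A._∙_ (τ-power σ₁ i) (τ-power σ₂ k)) (τ-power σ₃ l)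

      triple-cong : ∀ {i i′ k k′ l l′} → α 0F AP.^ i A.≈ α 0F AP.^ i′ → α 1F AP.^ k A.≈ α 1F AP.^ k′ → α 2F AP.^ l A.≈ α 2F AP.^ l′ →
                    τ (σ₁ ^ i ∙ σ₂ ^ k ∙ σ₃ ^ l) A.≈ τ (σ₁ ^ i′ ∙ σ₂ ^ k′ ∙ σ₃ ^ l′)
      triple-cong {i} {i′} {k} {k′} {l} {l′} p q r = ≡.subst₂ A._≈_ (≡.sym (τ-triple i k l)) (≡.sym (τ-triple i′ k′ l′))
        (A.∙-cong {α 0F AP.^ i A.∙ α 1F AP.^ k} {α 0F AP.^ i′ A.∙ α 1F AP.^ k′} {α 2F AP.^ l} {α 2F AP.^ l′}
          (A.∙-cong {α 0F AP.^ i} {α 0F AP.^ i′} {α 1F AP.^ k} {α 1F AP.^ k′} p q) r)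

      opaque
        -- Every flag lifts to a word, the word has a normal form, and its exponents are reduced in
        -- Q.
        boxed-onto : ∀ y → ∃[ b ] boxed b Q.≈ᶜ y
        boxed-onto y = from-lift (lift y)
          where
          in-box : ∀ w → ∃₂ λ i k → ∃[ l ] τ w A.≈ τ (normal-word i k l)
          in-box w =
            let i , k , l , eq = normal-form w
                i′ , p = reduce 0F (proj₁ hasType) i
                k′ , q = reduce 1F (proj₁ (proj₂ hasType)) k
                l′ , r = reduce 2F (proj₂ (proj₂ hasType)) l
            in i′ , k′ , l′ , A.trans {τ w} {τ (σ₁ ^ i ∙ σ₂ ^ k ∙ σ₃ ^ l)} {τ (normal-word i′ k′ l′)} (τ-sound {w} {σ₁ ^ i ∙ σ₂ ^ k ∙ σ₃ ^ l} eq) (triple-cong {i} {_} {k} {_} {l} p q r)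
          from-lift : Lift y → ∃[ b ] boxed b Q.≈ᶜ y
          from-lift (w , inj₁ p) = let i , k , l , eq = in-box w in
            (0F , i , k , l) , Q.≈ᶜ-trans (Q.≈ᶜ-sym (same-even {w} {normal-word i k l} eq)) p
          from-lift (w , inj₂ p) = let i , k , l , eq = in-box w in
            (1F , i , k , l) , Q.≈ᶜ-trans (Q.≈ᶜ-sym (same-odd {w} {normal-word i k l} eq)) p

      -- Tightness says that Q has exactly as many flags as there are boxes, and a surjection
      -- between finite sets of equal size is injective.
      boxed-injective : ∀ {b b′} → boxed b Q.≈ᶜ boxed b′ → b ≡ b′
      boxed-injective {b} {b′} p = ≡.trans (≡.sym (unbox-box b)) (≡.trans (≡.cong unbox
          (surjective⇒injective index section index-section {box-index b} {box-index b′} (to-cong (Q.≈ᶜ⇒≋ {boxed (unbox (box-index b))} {boxed (unbox (box-index b′))}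
            (≡.subst₂ (λ b b′ → boxed b Q.≈ᶜ boxed b′) (≡.sym (unbox-box b)) (≡.sym (unbox-box b′)) p)))))
          (unbox-box b′))
        where
        open Inverse count using (to; from; to-cong; strictlyInverseˡ)
        index section : Fin (2 ℕ.* p₁ ℕ.* p₂ ℕ.* p₃) → Fin (2 ℕ.* p₁ ℕ.* p₂ ℕ.* p₃)
        index c = to (Q.toFlag (boxed (unbox c)))
        section c = box-index (proj₁ (boxed-onto (Q.toChain (from c))))
        index-section : ∀ c → index (section c) ≡ c
        index-section c = let b , p = boxed-onto (Q.toChain (from c)) in
          ≡.trans (≡.cong (λ b → to (Q.toFlag (boxed b))) (unbox-box b))
          (≡.trans (to-cong (≡.subst (Q.list (boxed b) Q.≋_) (≡.sym (Q.toChain-list (from c))) (Q.≈ᶜ⇒≋ {boxed b} {Q.toChain (from c)} p)))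
            (strictlyInverseˡ c))

      -- As there are as many flags as exponent vectors, the rotations satisfy
      -- no relation between powers of different generators.
      independent : ∀ i k l → τ (σ₁ ^ i ∙ σ₂ ^ k ∙ σ₃ ^ l) A.≈ A.ε →
                    α 0F AP.^ i A.≈ A.ε × α 1F AP.^ k A.≈ A.ε × α 2F AP.^ l A.≈ A.ε
      independent i k l eq = vanish 0F (reduce 0F H₁ i) (reduce 0F H₁ (+ 0)) (≡.cong (λ b → proj₁ (proj₂ b)) corners)
        , vanish 1F (reduce 1F H₂ k) (reduce 1F H₂ (+ 0)) (≡.cong (λ b → proj₁ (proj₂ (proj₂ b))) corners)
        , vanish 2F (reduce 2F H₃ l) (reduce 2F H₃ (+ 0)) (≡.cong (λ b → proj₂ (proj₂ (proj₂ b))) corners)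
        where
        H₁ = proj₁ hasType
        H₂ = proj₁ (proj₂ hasType)
        H₃ = proj₂ (proj₂ hasType)
        corner : ℤ → ℤ → ℤ → Box p₁ p₂ p₃
        corner i k l = 0F , proj₁ (reduce 0F H₁ i) , proj₁ (reduce 1F H₂ k) , proj₁ (reduce 2F H₃ l)
        to-corner : ∀ i k l → τ (σ₁ ^ i ∙ σ₂ ^ k ∙ σ₃ ^ l) A.≈ τ (normal-word (proj₁ (reduce 0F H₁ i)) (proj₁ (reduce 1F H₂ k)) (proj₁ (reduce 2F H₃ l)))
        to-corner i k l = triple-cong {i} {_} {k} {_} {l} (proj₂ (reduce 0F H₁ i)) (proj₂ (reduce 1F H₂ k)) (proj₂ (reduce 2F H₃ l))
        zeros : τ (σ₁ ^ (+ 0) ∙ σ₂ ^ (+ 0) ∙ σ₃ ^ (+ 0)) A.≈ A.ε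
        zeros = τ-sound {σ₁ ^ (+ 0) ∙ σ₂ ^ (+ 0) ∙ σ₃ ^ (+ 0)} {ε} (Γᴳ.trans (Γᴳ.∙-cong (Γᴳ.trans (Γᴳ.∙-cong (Kit.^-0 σ₁) (Kit.^-0 σ₂)) (Γᴳ.identityˡ ε)) (Kit.^-0 σ₃)) (Γᴳ.identityˡ ε))
        corners : corner i k l ≡ corner (+ 0) (+ 0) (+ 0)
        corners = boxed-injective {corner i k l} {corner (+ 0) (+ 0) (+ 0)} (same-even
          {normal-word (proj₁ (reduce 0F H₁ i)) (proj₁ (reduce 1F H₂ k)) (proj₁ (reduce 2F H₃ l))}
          {normal-word (proj₁ (reduce 0F H₁ (+ 0))) (proj₁ (reduce 1F H₂ (+ 0))) (proj₁ (reduce 2F H₃ (+ 0)))}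
          λ F → Q.Eq.trans (Q.Eq.sym (to-corner i k l F)) (Q.Eq.trans (eq F) (Q.Eq.trans (Q.Eq.sym (zeros F)) (to-corner (+ 0) (+ 0) (+ 0) F))))
        vanish : ∀ k {p z} → (r : ∃[ n ] α k AP.^ z A.≈ α k AP.^ (+ toℕ {p} n)) (r₀ : ∃[ n ] α k AP.^ (+ 0) A.≈ α k AP.^ (+ toℕ {p} n)) →
                 proj₁ r ≡ proj₁ r₀ → α k AP.^ z A.≈ A.ε
        vanish k (n , p) (.n , p₀) ≡.refl F = Q.Eq.trans (p F) (Q.Eq.trans (Q.Eq.sym (p₀ F)) (AP.^-0 (α k) F))

      Central : Set
      Central = α 1F AP.^ (+ 16 ℤ.* J) A.≈ A.ε

      module Large (non-central : ¬ Central) where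

        open Degenerate relations

        private
          2^ : ℕ → ℤ
          2^ n = (+ 2) ℤ.^ n
          8J : + 8 ℤ.* J ≡ 2^ (3 ℕ.+ t)
          8J = ≡.trans (≡.cong (+ 8 ℤ.*_) J-eq) (solve 1 (λ j → con (+ 8) :* j := con (+ 2) :* (con (+ 2) :* (con (+ 2) :* j))) ≡.refl (2^ t))
            where open +-*-Solver
          16J : + 16 ℤ.* J ≡ 2^ (4 ℕ.+ t)
          16J = ≡.trans (solve 1 (λ j → con (+ 16) :* j := con (+ 2) :* (con (+ 8) :* j)) ≡.refl J) (≡.cong (+ 2 ℤ.*_) 8J)
            where open +-*-Solver
          32J : + 32 ℤ.* J ≡ 2^ (5 ℕ.+ t)
          32J = ≡.trans (solve 1 (λ j → con (+ 32) :* j := con (+ 2) :* (con (+ 16) :* j)) ≡.refl J) (≡.cong (+ 2 ℤ.*_) 16J)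
            where open +-*-Solver

          -- If the order did not divide d = 2^(n+1) exactly, that is, if some trivial power had an
          -- exponent not divisible by d, then α to the power d/2 would be trivial, which in each
          -- case makes z trivial. So relations between powers in Q already hold in Γ₃.
          multiple-of : ∀ k n {d} → d ≡ 2^ (suc n) → α k AP.^ d A.≈ A.ε → (α k AP.^ 2^ n A.≈ A.ε → Central) →
                        ∀ {w} → Equal R (w ^ d) ε → ∀ {z} → α k AP.^ z A.≈ A.ε → Equal R (w ^ z) ε
          multiple-of k n {d} ≡.refl αᵈ bad {w} wᵈ {z} αᶻ = decide (order-2^ (automorphismGroup Q) n (α k) z αᵈ αᶻ)
            where
            decide : (∃[ c ] z ≡ c ℤ.* d) ⊎ (α k AP.^ 2^ n A.≈ A.ε) → Equal R (w ^ z) ε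
            decide (inj₁ (c , ≡.refl)) = order-multiple w wᵈ c
            decide (inj₂ p)            = ⊥-elim (non-central (bad p))

          half : ∀ k {d d′} → d ≡ d′ → (α k AP.^ d A.≈ A.ε → Central) → α k AP.^ d′ A.≈ A.ε → Central
          half k ≡.refl f = f

        τ-faithful : ∀ w → τ w A.≈ A.ε → Equal R w ε
        τ-faithful w eq = let i , k , l , w≈ = normal-form w in go i k l w≈
          where
          go : ∀ i k l → Equal R w (σ₁ ^ i ∙ σ₂ ^ k ∙ σ₃ ^ l) → Equal R w ε
          go i k l w≈ =
            let p , r , u = independent i k l (λ F → Q.Eq.trans (Q.Eq.sym (τ-sound w≈ F)) (eq F)) in
            Γᴳ.trans w≈ (Γᴳ.trans (Γᴳ.∙-cong (Γᴳ.trans (Γᴳ.∙-cong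
              (multiple-of 0F (3 ℕ.+ t) 16J R.aᵖ (half 0F 8J first-degenerate) Rel.aᵖ p)
              (multiple-of 1F (4 ℕ.+ t) 32J R.b^q (half 1F 16J (λ z → z)) Rel.b^q r)) (Γᴳ.identityˡ ε))
              (multiple-of 2F (3 ℕ.+ t) 16J R.cᵖ (half 2F 8J third-degenerate) Rel.cᵖ u)) (Γᴳ.identityˡ ε))
            where module R = Relations relations

        τ-injective : ∀ {u v} → τ u A.≈ τ v → Equal R u v
        τ-injective {u} {v} eq = begin
          u              ≈⟨ Γᴳ.identityʳ u ⟨
          u ∙ ε          ≈⟨ Γᴳ.∙-congˡ (Γᴳ.inverseˡ v) ⟨
          u ∙ (v ⁻¹ ∙ v) ≈⟨ Γᴳ.assoc u (v ⁻¹) v ⟨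
          u ∙ v ⁻¹ ∙ v   ≈⟨ Γᴳ.∙-congʳ (τ-faithful (u ∙ v ⁻¹) (λ F → Q.Eq.trans (A.∙-congʳ {(τ v) A.⁻¹} {τ u} {τ v} eq F) (A.inverseʳ (τ v) F))) ⟩
          ε ∙ v          ≈⟨ Γᴳ.identityˡ v ⟩
          v              ∎
          where open import Relation.Binary.Reasoning.Setoid Γᴳ.setoid

        open Descend polytope evenᶜ oddᶜ (λ {u} {v} eq → even-cong (τ-injective {u} {v} eq)) (λ {u} {v} eq → odd-cong (τ-injective {u} {v} eq)) even-adj odd-adj

        isomorphic : Isomorphic polytope Q
        isomorphic = _ , InducedIsomorphism.isIsomorphism _≟ᶠ_ _≟_ P-flat Q-flat projection descend
            (λ x → back x (orbit x)) (λ y → forth y (lift y))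
          where
          back : ∀ x → ∃[ w ] (evenᶜ w ≈ᶜ x ⊎ oddᶜ w ≈ᶜ x) → FlagMap.on descend (image x) ≈ᶜ x
          back x (w , inj₁ p) = ≈ᶜ-trans (descend-even {image x} w (FlagMap.on-cong projection {evenᶜ w} {x} p)) p
          back x (w , inj₂ p) = ≈ᶜ-trans (descend-odd {image x} w (FlagMap.on-cong projection {oddᶜ w} {x} p)) p
          forth : ∀ y → Lift y → image (FlagMap.on descend y) Q.≈ᶜ y
          forth y (w , inj₁ p) = Q.≈ᶜ-trans (FlagMap.on-cong projection {FlagMap.on descend y} {evenᶜ w} (descend-even {y} w p)) p
          forth y (w , inj₂ p) = Q.≈ᶜ-trans (FlagMap.on-cong projection {FlagMap.on descend y} {oddᶜ w} (descend-odd {y} w p)) p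

      module Mirror (central : Central) where

        private
          module C = Consequences relations
          module GP where
            open import Algebra.Properties.Group (automorphismGroup Q) public
          mirrored : Vec (Automorphism Q) 3
          mirrored = α 0F A.⁻¹ ∷ α 1F A.⁻¹ ∷ α 1F A.∙ α 1F A.∙ α 2F ∷ []

        τ-ρ : ∀ w → τ (ρ w) ≡ AP.⟦ w ⟧ mirrored
        τ-ρ (gen 0F) = ≡.refl
        τ-ρ (gen 1F) = ≡.refl
        τ-ρ (gen 2F) = ≡.refl
        τ-ρ ε        = ≡.refl
        τ-ρ (u ∙ v)  = ≡.cong₂ A._∙_ (τ-ρ u) (τ-ρ v)
        τ-ρ (u ⁻¹)   = ≡.cong A._⁻¹ (τ-ρ u)

        mirror-sound : ∀ {u v} → Equal R u v → τ (ρ u) A.≈ τ (ρ v)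
        mirror-sound {u} {v} eq = ≡.subst₂ A._≈_ (≡.sym (τ-ρ u)) (≡.sym (τ-ρ v)) (Γₘ.universal (C.mirror central) eq)

        -- Respecting the relations of Γ₃ does not suffice, as Q may satisfy more. By `independent`,
        -- a word trivial in Q splits into powers of single generators that are trivial in Q; their
        -- mirror images are powers of σ₁⁻¹ and σ₂⁻¹ and a conjugate of a power of σ₃.
        mirror-trivial : ∀ w → τ w A.≈ A.ε → τ (ρ w) A.≈ A.ε
        mirror-trivial w eq = let i , k , l , w≈ = normal-form w in go i k l w≈
          where
          go : ∀ i k l → Equal R w (σ₁ ^ i ∙ σ₂ ^ k ∙ σ₃ ^ l) → τ (ρ w) A.≈ A.ε
          go i k l w≈ = A.trans {τ (ρ w)} {τ (ρ (σ₁ ^ i ∙ σ₂ ^ k ∙ σ₃ ^ l))} {A.ε} (mirror-sound {w} {σ₁ ^ i ∙ σ₂ ^ k ∙ σ₃ ^ l} w≈)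
            (≡.subst (A._≈ A.ε) (≡.sym (≡.cong₂ A._∙_ (≡.cong₂ A._∙_ (power σ₁ i) (power σ₂ k)) (power σ₃ l)))
              (A.trans {β} {A.ε A.∙ A.ε A.∙ A.ε} {A.ε} (A.∙-cong {(α 0F A.⁻¹) AP.^ i A.∙ (α 1F A.⁻¹) AP.^ k} {A.ε A.∙ A.ε} {(α 1F A.∙ α 1F A.∙ α 2F) AP.^ l} {A.ε}
                (A.∙-cong {(α 0F A.⁻¹) AP.^ i} {A.ε} {(α 1F A.⁻¹) AP.^ k} {A.ε} first second) third) (λ _ → Q.Eq.refl)))
            where
            β = (α 0F A.⁻¹) AP.^ i A.∙ (α 1F A.⁻¹) AP.^ k A.∙ (α 1F A.∙ α 1F A.∙ α 2F) AP.^ l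
            power : ∀ w n → τ (ρ (w ^ n)) ≡ τ (ρ w) AP.^ n
            power w n = ≡.trans (≡.cong τ (ρ-power w n)) (τ-power (ρ w) n)
            trivial = independent i k l (λ F → Q.Eq.trans (Q.Eq.sym (τ-sound w≈ F)) (eq F))
            inverted : ∀ k {n} → α k AP.^ n A.≈ A.ε → (α k A.⁻¹) AP.^ n A.≈ A.ε
            inverted k {n} p = A.trans {(α k A.⁻¹) AP.^ n} {α k AP.^ (ℤ.- n)} {A.ε} (C.inv-^ (α k) n) (C.order {α k} {n} p)
            first : (α 0F A.⁻¹) AP.^ i A.≈ A.ε
            first = inverted 0F {i} (proj₁ trivial)
            second : (α 1F A.⁻¹) AP.^ k A.≈ A.ε
            second = inverted 1F {k} (proj₁ (proj₂ trivial))
            third : (α 1F A.∙ α 1F A.∙ α 2F) AP.^ l A.≈ A.ε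
            third = A.trans {(α 1F A.∙ α 1F A.∙ α 2F) AP.^ l} {α 1F A.∙ (α 2F AP.^ (ℤ.- l) A.∙ α 1F A.⁻¹)} {A.ε} (C.mirror-power l)
              (A.trans {α 1F A.∙ (α 2F AP.^ (ℤ.- l) A.∙ α 1F A.⁻¹)} {α 1F A.∙ α 1F A.⁻¹} {A.ε} (A.∙-congˡ {α 1F} {α 2F AP.^ (ℤ.- l) A.∙ α 1F A.⁻¹} {α 1F A.⁻¹}
                (A.∙-congʳ {α 1F A.⁻¹} {α 2F AP.^ (ℤ.- l)} {A.ε} (C.order {α 2F} {l} (proj₂ (proj₂ trivial))))) (A.inverseʳ (α 1F)))

        mirror-cong : ∀ {u v} → τ u A.≈ τ v → τ (ρ u) A.≈ τ (ρ v)
        mirror-cong {u} {v} eq F = Q.Eq.trans (Q.Eq.sym (A.inverseˡ (τ (ρ v)) (proj₁ (τ (ρ u)) F)))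
          (cancelled (mirror-trivial (u ∙ v ⁻¹) (λ F → Q.Eq.trans (A.∙-congʳ {(τ v) A.⁻¹} {τ u} {τ v} eq F) (A.inverseʳ (τ v) F)) F))
          where
          cancelled : ∀ {F} → proj₁ ((τ (ρ v)) A.⁻¹) (proj₁ (τ (ρ u)) F) Q.≈ F → proj₁ (τ (ρ v)) (proj₁ ((τ (ρ v)) A.⁻¹) (proj₁ (τ (ρ u)) F)) Q.≈ proj₁ (τ (ρ v)) F
          cancelled = IsOrderIsomorphism.cong (proj₂ (τ (ρ v)))
            where open import Relation.Binary.Morphism.Structures using (IsOrderIsomorphism)

        ρ-involutive : ∀ w → Equal R (ρ (ρ w)) w
        ρ-involutive (gen 0F) = free ((σ₁ ⁻¹) ⁻¹) σ₁ ≡.refl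
        ρ-involutive (gen 1F) = free ((σ₂ ⁻¹) ⁻¹) σ₂ ≡.refl
        ρ-involutive (gen 2F) = free (σ₂ ⁻¹ ∙ σ₂ ⁻¹ ∙ (σ₂ ∙ σ₂ ∙ σ₃)) σ₃ ≡.refl
        ρ-involutive ε        = Γᴳ.refl
        ρ-involutive (u ∙ v)  = Γᴳ.∙-cong (ρ-involutive u) (ρ-involutive v)
        ρ-involutive (u ⁻¹)   = Γᴳ.⁻¹-cong (ρ-involutive u)

        -- The mirror exchanges the two orbits and applies ρ to words. Well-definedness is
        -- `mirror-cong`, and `ρ-g` gives compatibility with adjacency.
        E O : W → Q.Chain
        E w = Ψ¹ (ρ w)
        O w = Ψ (ρ w)

        private
          double-inverse : ∀ j → reduced (g j) ≡ reduced ((g j ⁻¹) ⁻¹)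
          double-inverse 0F = ≡.refl
          double-inverse 1F = ≡.refl
          double-inverse 2F = ≡.refl
          double-inverse 3F = ≡.refl

        open Descend Q E O (λ {u} {v} eq → same-odd {ρ u} {ρ v} (mirror-cong {u} {v} eq)) (λ {u} {v} eq → same-even {ρ u} {ρ v} (mirror-cong {u} {v} eq))
          (λ j w → Q.adj-cong Q.≈ᶜ-refl (FlagMap.on-cong projection (even-cong (Γᴳ.∙-congʳ (Γᴳ.sym (ρ-g j))))) (Ψ¹-adj j (ρ w)))
          (λ j w → Q.adj-cong Q.≈ᶜ-refl (FlagMap.on-cong projection (odd-cong (Γᴳ.∙-congʳ
            (Γᴳ.trans (free (g j) ((g j ⁻¹) ⁻¹) (double-inverse j)) (Γᴳ.sym (Γᴳ.⁻¹-cong (ρ-g j))))))) (Ψ-adj j (ρ w)))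

        impossible : ⊥
        -- The descended map is its own inverse because ρ is an involution. It is therefore an
        -- automorphism of Q, and it takes the image of Φ to the adjacent image of Φ¹.
        impossible = Q.apart base-adj μ (Q.agree λ i → Q.Eq.trans (Iso.induced-at (image Φ) i Q.Eq.refl)
            (Q.≈ᶜ-trans (descend-even {image Φ} ε even-ε) (FlagMap.on-cong projection oddᶜ-ε) Q.on i))
          where
          module Iso = Induced _≟_ Q-flat Q-flat descend
          even-ε : Ψ ε Q.≈ᶜ image Φ
          even-ε = FlagMap.on-cong projection (agree λ i → P.Eq.reflexive (act-ε (at Φ i)))
          involutive : ∀ y → Lift y → FlagMap.on descend (FlagMap.on descend y) Q.≈ᶜ y
          involutive y (w , inj₁ p) = Q.≈ᶜ-trans (descend-odd (ρ w) (Q.≈ᶜ-sym (descend-even {y} w p)))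
            (Q.≈ᶜ-trans (FlagMap.on-cong projection (even-cong (ρ-involutive w))) p)
          involutive y (w , inj₂ p) = Q.≈ᶜ-trans (descend-even (ρ w) (Q.≈ᶜ-sym (descend-odd {y} w p)))
            (Q.≈ᶜ-trans (FlagMap.on-cong projection (odd-cong (ρ-involutive w))) p)
          μ : Automorphism Q
          μ = Iso.induced , InducedIsomorphism.isIsomorphism _≟_ _≟_ Q-flat Q-flat descend descend
            (λ y → involutive y (lift y)) (λ y → involutive y (lift y))

      covers-isomorphically : ¬ ¬ Isomorphic polytope Q
      -- `Mirror.impossible` refutes `Central`, which is the hypothesis of `Large`; no decision of
      -- `Central` is involved.
      covers-isomorphically ¬iso = ¬iso (Large.isomorphic Mirror.impossible)


open import Data.Fin using (Fin; toℕ)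
open import Data.Fin.Patterns
open import Data.Integer as ℤ using (ℤ; +_)
import Data.Integer.Properties as ℤ
open import Data.Integer.Solver using (module +-*-Solver)
open import Data.Nat as ℕ using (ℕ; zero; suc; NonZero; _≤_; _^_; _∸_)
import Data.Nat.Properties as ℕ
open import Data.Product using (Σ-syntax; ∃; ∃-syntax; ∃₂; _×_; _,_)
open import Data.Sign using (Sign)
open import Relation.Binary.Definitions using (Decidable)
open import Relation.Binary.PropositionalEquality as ≡ using (_≡_)
open import Relation.Nullary using (¬_; Dec; yes; no; ¬¬-excluded-middle)
open import Defs hiding (_^_)
open Counting using (¬¬-finite)
open Finite using (module Residues)
open Chirality using (module ChiralPolytope)
open Quotient
open Atomic

-- Atomicity without decidable equality, and the theorem for each β.

module Theorem (N : ℕ) (J : ℤ) .{{N≢0 : NonZero N}} (N-eq : + N ≡ + 16 ℤ.* J) (s₁ s₂ : Sign)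
  (q m : ℕ) (q-eq : + q ≡ + 32 ℤ.* J) (m-eq : + m ≡ + 8 ℤ.* J) (t : ℕ) (J-eq : J ≡ (+ 2) ℤ.^ t) where

  open ChiralPolytope N J N-eq s₁ s₂ q m q-eq m-eq
  open Residues N J N-eq using (remainder; remainder-spec)

  representative : Fin 6 → Fin N → Fin N → Face
  representative 0F _ _ = bottom
  representative 1F i _ = vertex (+ toℕ i)
  representative 2F i k = edge (+ toℕ i , + toℕ k)
  representative 3F i k = face (+ toℕ i , + toℕ k)
  representative 4F i _ = facet (+ toℕ i)
  representative 5F _ _ = top

  represented : ∀ F → ∃[ s ] ∃₂ λ i k → representative s i k ≈ᶠ F
  represented bottom         = 0F , remainder (+ 0) , remainder (+ 0) , bottom
  represented (vertex x)     = 1F , remainder x , remainder (+ 0) , ≈ᶠ-sym (vertex (remainder-spec x))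
  represented (edge (y , x)) = 2F , remainder y , remainder x , ≈ᶠ-sym (edge (remainder-spec y , remainder-spec x))
  represented (face (w , z)) = 3F , remainder w , remainder z , ≈ᶠ-sym (face (remainder-spec w , remainder-spec z))
  represented (facet x)      = 4F , remainder x , remainder (+ 0) , ≈ᶠ-sym (facet (remainder-spec x))
  represented top            = 5F , remainder (+ 0) , remainder (+ 0) , top

  -- Only finitely many instances are needed, as the covered faces are the
  -- images of finitely many representatives.
  covered-decidable : ∀ {Q γ} → IsCovering polytope Q γ → ¬ ¬ Decidable (Polytope._≈_ Q)
  covered-decidable {Q} {γ} covering undecidable =
    ¬¬-finite (λ s → ¬¬-finite λ i → ¬¬-finite λ k → ¬¬-finite λ s′ → ¬¬-finite λ i′ → ¬¬-finite λ k′ →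
      ¬¬-excluded-middle {A = γ (representative s i k) Q.≈ γ (representative s′ i′ k′)})
    λ table → undecidable λ F G →
      let s , i , k , p = presented F ; s′ , i′ , k′ , p′ = presented G in transfer p p′ (table s i k s′ i′ k′)
    where
    module Q = Polytope Q
    open IsCovering covering
    open import Relation.Binary.Morphism.Structures using (IsOrderHomomorphism)
    presented : ∀ F → ∃[ s ] ∃₂ λ i k → γ (representative s i k) Q.≈ F
    presented F = let G , γG = surjective F ; s , i , k , eq = represented G in s , i , k , γG eq
    transfer : ∀ {F G F′ G′} → F Q.≈ F′ → G Q.≈ G′ → Dec (F Q.≈ G) → Dec (F′ Q.≈ G′)
    transfer p p′ (yes eq) = yes (Q.Eq.trans (Q.Eq.sym p) (Q.Eq.trans eq p′))
    transfer p p′ (no ne)  = no λ eq → ne (Q.Eq.trans p (Q.Eq.trans eq (Q.Eq.sym p′)))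

  atomicChiral : AtomicChiral polytope
  atomicChiral = record
    { tight = tight
    ; chiral = chiral
    -- The goal is empty, so the doubly negated decidability of equality in Q can be used as if it
    -- were given.
    ; atomic = λ { Q (_ , _ , _ , hasTypeQ , count) Q-chiral ((γ , covering) , ¬iso) →
        covered-decidable covering λ _≟_ → Uncoverable.TightQuotient.covers-isomorphically N J N-eq s₁ s₂ q m q-eq m-eq t J-eq
          Q Q-chiral γ covering _≟_ hasTypeQ count ¬iso }
    }

pos-2^ : ∀ n → + (2 ^ n) ≡ (+ 2) ℤ.^ n
pos-2^ zero    = ≡.refl
pos-2^ (suc n) = ≡.trans (ℤ.pos-* 2 (2 ^ n)) (≡.cong (+ 2 ℤ.*_) (pos-2^ n))

theorem4p9 : (β : ℕ) → 5 ≤ β → (ε₁ ε₂ : Sign) →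
  Σ[ P ∈ Polytope 4 ]
    AtomicChiral P
    × HasType P (2 ^ (β ∸ 1)) (2 ^ β) (2 ^ (β ∸ 1))
    × IsAutomorphismGroupOf (Γ₃ β ε₁ ε₂) gen P
theorem4p9 β 5≤β ε₁ ε₂ with ℕ.m≤n⇒∃[o]m+o≡n 5≤β
-- With β = 5 + t the powers of 2 in the statement compute to N, 2N and N for N = 2^(4 + t), and the
-- type needs no transport.
... | t , ≡.refl = polytope , T.atomicChiral , hasType , isAutomorphismGroup
  where
  open +-*-Solver
  instance
    nonZero : NonZero (2 ^ (4 ℕ.+ t))
    nonZero = ℕ.m^n≢0 2 (4 ℕ.+ t)
  j : ℤ
  j = (+ 2) ℤ.^ t
  m-eq : + (2 ^ (3 ℕ.+ t)) ≡ + 8 ℤ.* j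
  m-eq = ≡.trans (pos-2^ (3 ℕ.+ t)) (solve 1 (λ j → con (+ 2) :* (con (+ 2) :* (con (+ 2) :* j)) := con (+ 8) :* j) ≡.refl j)
  N-eq : + (2 ^ (4 ℕ.+ t)) ≡ + 16 ℤ.* j
  N-eq = ≡.trans (pos-2^ (4 ℕ.+ t)) (solve 1 (λ j → con (+ 2) :* (con (+ 2) :* (con (+ 2) :* (con (+ 2) :* j))) := con (+ 16) :* j) ≡.refl j)
  q-eq : + (2 ^ (5 ℕ.+ t)) ≡ + 32 ℤ.* j
  q-eq = ≡.trans (pos-2^ (5 ℕ.+ t)) (solve 1 (λ j → con (+ 2) :* (con (+ 2) :* (con (+ 2) :* (con (+ 2) :* (con (+ 2) :* j)))) := con (+ 32) :* j) ≡.refl j)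
  open ChiralPolytope (2 ^ (4 ℕ.+ t)) j N-eq ε₁ ε₂ (2 ^ (5 ℕ.+ t)) (2 ^ (3 ℕ.+ t)) q-eq m-eq
  module T = Theorem (2 ^ (4 ℕ.+ t)) j N-eq ε₁ ε₂ (2 ^ (5 ℕ.+ t)) (2 ^ (3 ℕ.+ t)) q-eq m-eq t ≡.refl
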